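{- Let $\Phi$ be an irreducible crystallographic root system spanning $V=\mathbb{R}^\ell$, with positive system $\Phi^+$, Weyl arrangement $\mathcal{A}$ and Coxeter number $\mathrm{h}$. Let $\beta_1,\beta_2\in\Phi^+$ be such that $X=H_{\beta_1}\cap H_{\beta_2}$ is of type $A_1^2$, with $\Phi\cap\mathrm{span}\{\beta_1,\beta_2\}=\{\pm\beta_1,\pm\beta_2\}$. Then for each $i\in\{1,2\}$, $$|\mathcal{A}^{H_{\beta_i}}|-|\mathcal{A}^X|=\mathrm{h}/2+\mathcal{K}_{\beta_{3-i}}(\beta_i),$$ where $$\mathcal{K}_{\beta_{3-i}}(\beta_i)=\sum_{\Lambda\in\mathcal{M}_{\beta_{3-i}}(\beta_i)}\ \sum_{\delta\in\Lambda^+\setminus\{\beta_i\}}\left(\widehat{\beta_i},\widehat{\delta}\right)^2 .$$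
   Context: $V=\mathbb{R}^\ell$ carries the standard inner product $(\cdot,\cdot)$; root systems are reduced. For $\alpha\in\Phi$ put $H_\alpha=\{x\in V:(\alpha,x)=0\}$; the Weyl arrangement is $\mathcal{A}=\{H_\alpha:\alpha\in\Phi^+\}$. For an intersection $X$ of hyperplanes of $\mathcal{A}$, $\mathcal{A}^X=\{K\cap X:K\in\mathcal{A},\ X\not\subseteq K\}$. $X$ is of type $A_1^2$ if $\Phi\cap X^\perp$ is a root system of type $A_1\times A_1$. A subset $\Gamma\subseteq\Phi$ is a subsystem if it is a root system in $\mathrm{span}(\Gamma)$; its rank is $\dim\mathrm{span}(\Gamma)$. For $\beta\in\Phi$, $\beta^\perp=\{\alpha\in\Phi:(\alpha,\beta)=0\}$. For $i\in\{1,2\}$, $\mathcal{M}_{\beta_{3-i}}(\beta_i)$ is the set of all $\Lambda\subseteq\beta_{3-i}^\perp$ such that $\Lambda$ is an irreducible subsystem of rank $2$ with $\beta_i\in\Lambda$, and $\Phi\cap\mathrm{span}(\{\beta_{3-i}\}\cup\Lambda)$ is a reducible subsystem of rank $3$. $\Lambda^+=\Phi^+\cap\Lambda$. For $x\in V\setminus\{0\}$, $\widehat{x}=x/\sqrt{(x,x)}$ is the normalized unit vector. -}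

module Defs where

open import Level using (0ℓ)
open import Algebra.Structures using (IsCommutativeRing)
open import Axiom.ExcludedMiddle using (ExcludedMiddle)
open import Data.Integer.Base using (ℤ; +_; -[1+_])
open import Data.List.Base as List using (List; []; _∷_; _++_; map; filter; deduplicate; foldr)
open import Data.List.Membership.Propositional using (_∈_; _∉_)
open import Data.List.Relation.Binary.Permutation.Propositional using (_↭_)
open import Data.List.Relation.Unary.Unique.Propositional using (Unique)
open import Data.Nat.Base as ℕ using (ℕ; zero; suc)
open import Data.Nat.GeneralisedArithmetic using (iterate)
open import Data.Product.Base using (∃; ∃₂; _×_)
open import Data.Sum.Base using (_⊎_)
open import Data.Vec.Base as Vec using (Vec; []; _∷_; replicate; zipWith; fromList)
open import Function.Bundles using (_⇔_)
open import Relation.Binary.PropositionalEquality.Core using (_≡_; _≢_)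
open import Relation.Binary.Structures using (IsTotalOrder)
open import Relation.Nullary.Negation.Core using (¬_)
open import Relation.Unary using (Pred; Satisfiable; _∩_; _⊆_; _⊈_; _≐_)

-- The real numbers, axiomatised as a complete ordered field (unique up to
-- unique isomorphism).  The inverse and the square root are determined by the
-- other fields, except for the irrelevant values of 0 ⁻¹ and of √ x for x < 0.
record RealNumbers : Set₁ where
  infix  8 _⁻¹
  infixl 7 _*_ _/_
  infixl 6 _+_ _-_
  infix  4 _≤_ _<_
  field
    Carrier           : Set
    _+_ _*_           : Carrier → Carrier → Carrier
    -_ _⁻¹ √_         : Carrier → Carrier
    0# 1#             : Carrier
    _≤_               : Carrier → Carrier → Set
    isCommutativeRing : IsCommutativeRing _≡_ _+_ _*_ -_ 0# 1#
    0≢1               : 0# ≢ 1#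
    *-inverse         : ∀ x → x ≢ 0# → x * x ⁻¹ ≡ 1#
    isTotalOrder      : IsTotalOrder _≡_ _≤_
    +-mono-≤          : ∀ x y z → x ≤ y → x + z ≤ y + z
    *-nonneg          : ∀ x y → 0# ≤ x → 0# ≤ y → 0# ≤ x * y
    √-nonneg          : ∀ x → 0# ≤ x → 0# ≤ √ x
    √-square          : ∀ x → 0# ≤ x → √ x * √ x ≡ x

  UpperBound : Pred Carrier 0ℓ → Pred Carrier 0ℓ
  UpperBound P b = ∀ x → P x → x ≤ b

  field
    complete : ∀ (P : Pred Carrier 0ℓ) → Satisfiable P → ∃ (UpperBound P) →
               ∃ λ s → UpperBound P s × (∀ b → UpperBound P b → s ≤ b)

  _<_ : Carrier → Carrier → Set
  x < y = x ≤ y × x ≢ y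

  _-_ : Carrier → Carrier → Carrier
  x - y = x + (- y)

  _/_ : Carrier → Carrier → Carrier
  x / y = x * y ⁻¹

  fromℕ : ℕ → Carrier
  fromℕ zero    = 0#
  fromℕ (suc n) = 1# + fromℕ n

  fromℤ : ℤ → Carrier
  fromℤ (+ n)    = fromℕ n
  fromℤ -[1+ n ] = - fromℕ (suc n)

  ∑ : ∀ {A : Set} → List A → (A → Carrier) → Carrier
  ∑ xs f = foldr (λ x s → f x + s) 0# xs

-- When xs has no repetitions, each subset of xs is listed exactly once.
sublists : ∀ {A : Set} → List A → List (List A)
sublists []       = [] ∷ []
sublists (x ∷ xs) = map (x ∷_) (sublists xs) ++ sublists xs

-- Finite sets of vectors are duplicate-free lists; arbitrary subsets of V are
-- predicates, compared extensionally by _≐_.  Excluded middle is what allows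
-- a finite set to be cut down by an arbitrary property.
module Geometry (em : ExcludedMiddle 0ℓ) (ℝ : RealNumbers) (ℓ : ℕ) where
  open RealNumbers ℝ

  V : Set
  V = Vec Carrier ℓ

  infixl 6 _⊕_
  infixr 7 _·_

  𝟎 : V
  𝟎 = replicate ℓ 0#

  _⊕_ : V → V → V
  _⊕_ = zipWith _+_

  _·_ : Carrier → V → V
  c · v = Vec.map (c *_) v

  neg : V → V
  neg = Vec.map (λ c → - c)

  ⟨_,_⟩ : V → V → Carrier
  ⟨ x , y ⟩ = Vec.foldr′ _+_ 0# (zipWith _*_ x y)

  normalize : V → V
  normalize x = (√ ⟨ x , x ⟩) ⁻¹ · x

  reflect : V → V → V
  reflect α v = v ⊕ neg ((fromℕ 2 * ⟨ α , v ⟩ / ⟨ α , α ⟩) · α)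

  infix 9 _ᗮ
  _ᗮ : Pred V 0ℓ → Pred V 0ℓ
  (X ᗮ) v = ∀ x → X x → ⟨ v , x ⟩ ≡ 0#

  lincomb : ∀ {n} → Vec Carrier n → Vec V n → V
  lincomb []       []       = 𝟎
  lincomb (c ∷ cs) (v ∷ vs) = c · v ⊕ lincomb cs vs

  SpanVec : ∀ {n} → Vec V n → Pred V 0ℓ
  SpanVec vs v = ∃ λ cs → v ≡ lincomb cs vs

  Span : List V → Pred V 0ℓ
  Span Γ = SpanVec (fromList Γ)

  LinearlyIndependent : ∀ {n} → Vec V n → Set
  LinearlyIndependent {n} vs = ∀ cs → lincomb cs vs ≡ 𝟎 → cs ≡ replicate n 0#

  HasDimension : Pred V 0ℓ → ℕ → Set
  HasDimension U r = ∃ λ (b : Vec V r) → LinearlyIndependent b × SpanVec b ≐ U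

  HasRank : List V → ℕ → Set
  HasRank Γ = HasDimension (Span Γ)

  infixl 7 _∣_
  _∣_ : List V → Pred V 0ℓ → List V
  Γ ∣ P = filter (λ v → em {P v}) Γ

  -- A reduced root system in Span Γ.
  record IsRootSystem (Γ : List V) : Set where
    field
      unique  : Unique Γ
      nonzero : 𝟎 ∉ Γ
      reduced : ∀ α c → α ∈ Γ → c · α ∈ Γ → c ≡ 1# ⊎ c ≡ - 1#
      closed  : ∀ α β → α ∈ Γ → β ∈ Γ → reflect α β ∈ Γ

  Crystallographic : List V → Set
  Crystallographic Γ = ∀ α β → α ∈ Γ → β ∈ Γ →
    ∃ λ (n : ℤ) → fromℕ 2 * ⟨ α , β ⟩ / ⟨ α , α ⟩ ≡ fromℤ n

  Spanning : List V → Set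
  Spanning Γ = ∀ v → Span Γ v

  Orthogonal : List V → List V → Set
  Orthogonal Γ₁ Γ₂ = ∀ α β → α ∈ Γ₁ → β ∈ Γ₂ → ⟨ α , β ⟩ ≡ 0#

  Reducible : List V → Set
  Reducible Γ = ∃₂ λ Γ₁ Γ₂ →
    Γ₁ ≢ [] × Γ₂ ≢ [] × Γ ↭ Γ₁ ++ Γ₂ × Orthogonal Γ₁ Γ₂

  Irreducible : List V → Set
  Irreducible Γ = Γ ≢ [] × ¬ Reducible Γ

  IsTypeA₁ : List V → Set
  IsTypeA₁ Γ = ∃ λ α → α ≢ 𝟎 × Γ ↭ α ∷ neg α ∷ []

  IsTypeA₁×A₁ : List V → Set
  IsTypeA₁×A₁ Γ = ∃₂ λ Γ₁ Γ₂ →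
    IsTypeA₁ Γ₁ × IsTypeA₁ Γ₂ × Γ ↭ Γ₁ ++ Γ₂ × Orthogonal Γ₁ Γ₂

  -- The roots that are positive on the chamber of a regular vector t.
  record IsPositiveSystem (Φ Φ⁺ : List V) : Set where
    field
      unique   : Unique Φ⁺
      t        : V
      regular  : ∀ α → α ∈ Φ → ⟨ t , α ⟩ ≢ 0#
      positive : ∀ α → α ∈ Φ⁺ ⇔ (α ∈ Φ × 0# < ⟨ t , α ⟩)

  simpleRoots : List V → List V
  simpleRoots Φ⁺ = Φ⁺ ∣ λ α → ¬ (∃₂ λ β γ → β ∈ Φ⁺ × γ ∈ Φ⁺ × α ≡ β ⊕ γ)

  IsOrder : (V → V) → ℕ → Set
  IsOrder f h = 0 ℕ.< h × IsPeriod h × (∀ k → 0 ℕ.< k → k ℕ.< h → ¬ IsPeriod k)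
    where
    IsPeriod : ℕ → Set
    IsPeriod k = ∀ v → iterate f v k ≡ v

  -- The order of a Coxeter element: the product of the simple reflections,
  -- taken in some order σ.
  IsCoxeterNumber : List V → ℕ → Set
  IsCoxeterNumber Φ⁺ h =
    ∃ λ σ → σ ↭ simpleRoots Φ⁺ × IsOrder (λ v → foldr reflect v σ) h

  H : V → Pred V 0ℓ
  H α x = ⟨ α , x ⟩ ≡ 0#

  weylArrangement : List V → List (Pred V 0ℓ)
  weylArrangement Φ⁺ = map H Φ⁺

  restriction : List (Pred V 0ℓ) → Pred V 0ℓ → List (Pred V 0ℓ)
  restriction 𝓐 X =
    deduplicate (λ K L → em {K ≐ L})
      (map (_∩ X) (filter (λ K → em {X ⊈ K}) 𝓐))

  perp : List V → V → List V
  perp Φ β = Φ ∣ λ α → ⟨ α , β ⟩ ≡ 0#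

  -- In 𝓜 and 𝓚 below, γ is the subscript β₃₋ᵢ and β is the argument βᵢ.
  record InM (Φ : List V) (γ β : V) (Λ : List V) : Set where
    field
      isRootSystem      : IsRootSystem Λ
      irreducible       : Irreducible Λ
      rank-two          : HasRank Λ 2
      contains          : β ∈ Λ
      span-isRootSystem : IsRootSystem (Φ ∣ Span (γ ∷ Λ))
      span-reducible    : Reducible (Φ ∣ Span (γ ∷ Λ))
      span-rank-three   : HasRank (Φ ∣ Span (γ ∷ Λ)) 3

  𝓜 : List V → V → V → List (List V)
  𝓜 Φ γ β = filter (λ Λ → em {InM Φ γ β Λ}) (sublists (perp Φ γ))

  𝓚 : (Φ Φ⁺ : List V) → V → V → Carrier
  𝓚 Φ Φ⁺ γ β =
    ∑ (𝓜 Φ γ β) λ Λ →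
    ∑ (Φ⁺ ∣ λ δ → δ ∈ Λ × δ ≢ β) λ δ →
    ⟨ normalize β , normalize δ ⟩ * ⟨ normalize β , normalize δ ⟩

-- For β ∈ Φ⁺ put c = Σ cos²(α,β), the sum taken over α ∈ Φ⁺.  The form
-- Σ ⟨α,·⟩²/⟨α,α⟩ over Φ is invariant under the reflections, so each root is an
-- eigenvector of it; by irreducibility the eigenvalue 2c is the same for all
-- roots, and the trace gives |Φ| = 2cℓ.
--
-- The same form on a rank two flat containing β, and its trace, show that the
-- roots of the flat other than β satisfy Σ (1 - 2cos²(α,β)) = 1; summing over
-- these flats, |𝓐^H| = |Φ⁺| + 1 - 2c for H = H β.  On a rank three flat
-- containing β and γ, the third eigenvalue agrees with that of γ unless ±γ is a
-- component of its own, in which case it agrees with that of β.  Summing the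
-- traces over these flats, |𝓐^H| - |𝓐^X| equals c plus the contributions of
-- the exceptional flats.  The latter correspond to the elements of 𝓜 because
-- no plane of an irreducible Φ of higher rank is of type G₂.
--
-- It remains to see that |Φ| = hℓ.  Each orbit of a Coxeter element sums to
-- zero, so it contains one of the ℓ positive roots made negative by it, whence
-- |Φ| ≤ hℓ.  Conversely, the Dynkin diagram is a forest, so all Coxeter elements
-- are conjugate to one that is a product of two involutions.  These act on the
-- plane spanned by the two halves of a Perron–Frobenius eigenvector, and the
-- product is a rotation of some order m.  Its m-th power fixes a vector of the
-- open chamber and is therefore trivial, so h ≤ m, while counting the roots by
-- their values on the plane gives mℓ ≤ |Φ|.

module Submission where

open import Defs
open import Level using (0ℓ)
open import Algebra.Bundles using (CommutativeRing)
import Algebra.Properties.Ring as RingProperties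
import Algebra.Solver.Ring as RingSolver
open import Algebra.Solver.Ring.AlmostCommutativeRing using (fromCommutativeRing; _-Raw-AlmostCommutative⟶_)
open import Axiom.ExcludedMiddle using (ExcludedMiddle)
open import Data.Empty using (⊥; ⊥-elim)
open import Data.Fin.Base as Fin using (Fin; opposite)
open import Data.Fin.Patterns using (0F; 1F)
open import Data.Integer.Base as ℤ using (ℤ; -[1+_]) renaming (+_ to pos)
import Data.Integer.Properties as ℤ
open import Data.List.Base as List using (List; []; _∷_; _++_; map; filter; length; deduplicate; foldr; concatMap; cartesianProductWith; upTo)
open import Data.List.Membership.Propositional using (_∈_; _∉_)
open import Data.List.Membership.Propositional.Properties
open import Data.List.Membership.Propositional.Properties.WithK using (unique∧set⇒bag)
open import Data.List.Properties using (length-++; length-map; length-upTo; map-∘; ++-assoc; ++-identityʳ; concatMap-++; ∷-injectiveʳ)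
open import Data.List.Relation.Binary.BagAndSetEquality using (∼bag⇒↭)
open import Data.List.Relation.Binary.Permutation.Propositional as ↭ using (_↭_; ↭-sym; ↭-trans; ↭-refl)
open import Data.List.Relation.Binary.Permutation.Propositional.Properties using (∈-resp-↭; ↭-length; shift; drop-∷; ++-comm; ++⁺ʳ)
open import Data.List.Relation.Unary.All as All using (All; []; _∷_)
open import Data.List.Relation.Unary.AllPairs using ([]; _∷_)
open import Data.List.Relation.Unary.Any using (here; there)
open import Data.List.Relation.Unary.Unique.Propositional using (Unique)
import Data.List.Relation.Unary.Unique.Propositional.Properties as Unique
open import Data.Maybe.Base using (Maybe; just; nothing)
open import Data.Nat.Base as ℕ using (ℕ; zero; suc)
open import Data.Nat.GeneralisedArithmetic using (iterate)
import Data.Nat.Properties as ℕ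
open import Data.Nat.Tactic.RingSolver using (solve-∀)
open import Data.Product.Base using (∃; ∃₂; _×_; _,_; proj₁; proj₂)
open import Data.Sum.Base using (_⊎_; inj₁; inj₂; [_,_]′)
open import Data.Vec.Base as Vec using (Vec; []; _∷_; replicate; zipWith; fromList)
open import Function.Base using (_∘_; id)
open import Function.Bundles using (_⇔_; mk⇔; Equivalence)
open import Relation.Binary.PropositionalEquality
open import Relation.Binary.Structures using (IsTotalOrder)
open import Relation.Nullary using (¬_; Dec; yes; no)
open import Relation.Nullary.Decidable using (¬?)
open import Relation.Unary using (Pred; _∩_; _⊈_; _≐_)

open ≡-Reasoning

-- The elements of `𝓜` are arbitrary irreducible subsystems of a plane, not full plane sections. A
-- plane of type G₂ also contains subsystems of type A₂, so a root could lie in several elements of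
-- `𝓜`. Once such planes are excluded, each `Λ` is everything its plane cuts out of the roots
-- orthogonal to `γ`, and the sum over `𝓜` turns into a sum over single roots. Analysis enters only
-- through the axioms of a complete ordered field: neither angles nor a spectral theorem appear. The
-- Perron-Frobenius eigenvalue is the supremum of the `μ` for which the Gram form minus `μ` times
-- the coordinate form is semidefinite; coercivity, proved by completing squares, replaces
-- compactness. Rotations of the plane are handled through the Chebyshev recursion `S` at
-- `k = 1 - μ`. That `S` ever stops being positive, and hence that the rotation has finite order,
-- follows from counting: as long as it is positive, each further level yields new positive roots,
-- of which there are finitely many.

module Reals (em : ExcludedMiddle 0ℓ) (ℝ : RealNumbers) where

  open RealNumbers ℝ public
    hiding (isCommutativeRing; isTotalOrder)

  private
    commutativeRing : CommutativeRing 0ℓ 0ℓ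
    commutativeRing = record { isCommutativeRing = RealNumbers.isCommutativeRing ℝ }

  open CommutativeRing commutativeRing public
    using (+-assoc; +-comm; *-assoc; *-comm; +-identityˡ; +-identityʳ; *-identityˡ; *-identityʳ; distribˡ; distribʳ; zeroˡ; zeroʳ; -‿inverseˡ; -‿inverseʳ; ring)
  open RingProperties ring using (-‿distribˡ-*; -‿distribʳ-*; -‿+-comm)
  open RingProperties ring public using (-0#≈0#; -‿involutive)
  open IsTotalOrder (RealNumbers.isTotalOrder ℝ) public
    using () renaming (refl to ≤-refl; trans to ≤-trans; antisym to ≤-antisym; total to ≤-total; reflexive to ≤-reflexive)

  -- The integers inside the field, and a ring solver with integer coefficients.

  fromℕ-+ : ∀ m n → fromℕ (m ℕ.+ n) ≡ fromℕ m + fromℕ n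
  fromℕ-+ zero    n = sym (+-identityˡ _)
  fromℕ-+ (suc m) n = trans (cong (1# +_) (fromℕ-+ m n)) (sym (+-assoc _ _ _))

  fromℕ-* : ∀ m n → fromℕ (m ℕ.* n) ≡ fromℕ m * fromℕ n
  fromℕ-* zero    n = sym (zeroˡ _)
  fromℕ-* (suc m) n = begin
    fromℕ (n ℕ.+ m ℕ.* n)                 ≡⟨ fromℕ-+ n (m ℕ.* n) ⟩
    fromℕ n + fromℕ (m ℕ.* n)             ≡⟨ cong₂ _+_ (sym (*-identityˡ _)) (fromℕ-* m n) ⟩
    1# * fromℕ n + fromℕ m * fromℕ n      ≡⟨ distribʳ _ _ _ ⟨
    (1# + fromℕ m) * fromℕ n              ∎

  fromℤ-⊖ : ∀ m n → fromℤ (m ℤ.⊖ n) ≡ fromℕ m - fromℕ n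
  fromℤ-⊖ zero    zero    = sym (-‿inverseʳ 0#)
  fromℤ-⊖ zero    (suc n) = sym (+-identityˡ _)
  fromℤ-⊖ (suc m) zero    = trans (sym (+-identityʳ _)) (cong (fromℕ (suc m) +_) (sym -0#≈0#))
  fromℤ-⊖ (suc m) (suc n) = begin
    fromℤ (suc m ℤ.⊖ suc n)                ≡⟨ cong fromℤ (ℤ.[1+m]⊖[1+n]≡m⊖n m n) ⟩
    fromℤ (m ℤ.⊖ n)                        ≡⟨ fromℤ-⊖ m n ⟩
    fromℕ m + - fromℕ n                    ≡⟨ cong (_+ - fromℕ n) (sym (+-identityˡ _)) ⟩
    0# + fromℕ m + - fromℕ n               ≡⟨ cong (λ z → z + fromℕ m + - fromℕ n) (sym (-‿inverseʳ 1#)) ⟩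
    1# + - 1# + fromℕ m + - fromℕ n        ≡⟨ cong (_+ - fromℕ n) (trans (+-assoc _ _ _) (cong (1# +_) (+-comm _ _))) ⟩
    1# + (fromℕ m + - 1#) + - fromℕ n      ≡⟨ cong (_+ - fromℕ n) (sym (+-assoc _ _ _)) ⟩
    1# + fromℕ m + - 1# + - fromℕ n        ≡⟨ +-assoc _ _ _ ⟩
    1# + fromℕ m + (- 1# + - fromℕ n)      ≡⟨ cong (1# + fromℕ m +_) (-‿+-comm _ _) ⟩
    1# + fromℕ m + - (1# + fromℕ n)        ∎

  fromℤ-+ : ∀ i j → fromℤ (i ℤ.+ j) ≡ fromℤ i + fromℤ j
  fromℤ-+ (pos m)    (pos n)    = fromℕ-+ m n
  fromℤ-+ (pos m)    -[1+ n ] = fromℤ-⊖ m (suc n)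
  fromℤ-+ -[1+ m ] (pos n)    = trans (fromℤ-⊖ n (suc m)) (+-comm _ _)
  fromℤ-+ -[1+ m ] -[1+ n ] = trans
    (cong (λ k → - fromℕ k) (sym (ℕ.+-suc (suc m) n)))
    (trans (cong -_ (fromℕ-+ (suc m) (suc n))) (sym (-‿+-comm _ _)))

  fromℤ-neg : ∀ i → fromℤ (ℤ.- i) ≡ - fromℤ i
  fromℤ-neg (pos zero)  = sym -0#≈0#
  fromℤ-neg (pos (suc n)) = refl
  fromℤ-neg -[1+ n ]  = sym (-‿involutive _)

  fromℤ-* : ∀ i j → fromℤ (i ℤ.* j) ≡ fromℤ i * fromℤ j
  fromℤ-* (pos m)    (pos n)    = trans (cong fromℤ (ℤ.+◃n≡+n (m ℕ.* n))) (fromℕ-* m n)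
  fromℤ-* (pos m)    -[1+ n ] = begin
    _                          ≡⟨ cong fromℤ (ℤ.-◃n≡-n (m ℕ.* suc n)) ⟩
    fromℤ (ℤ.- pos (m ℕ.* suc n)) ≡⟨ fromℤ-neg (pos (m ℕ.* suc n)) ⟩
    - fromℕ (m ℕ.* suc n)      ≡⟨ cong -_ (fromℕ-* m (suc n)) ⟩
    - (fromℕ m * fromℕ (suc n)) ≡⟨ -‿distribʳ-* _ _ ⟩
    _                          ∎
  fromℤ-* -[1+ m ] (pos n)    = begin
    _                          ≡⟨ cong fromℤ (ℤ.-◃n≡-n (suc m ℕ.* n)) ⟩
    fromℤ (ℤ.- pos (suc m ℕ.* n)) ≡⟨ fromℤ-neg (pos (suc m ℕ.* n)) ⟩
    - fromℕ (suc m ℕ.* n)      ≡⟨ cong -_ (fromℕ-* (suc m) n) ⟩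
    - (fromℕ (suc m) * fromℕ n) ≡⟨ -‿distribˡ-* _ _ ⟩
    _                          ∎
  fromℤ-* -[1+ m ] -[1+ n ] = begin
    _                          ≡⟨ cong fromℤ (ℤ.+◃n≡+n (suc m ℕ.* suc n)) ⟩
    fromℕ (suc m ℕ.* suc n)      ≡⟨ fromℕ-* (suc m) (suc n) ⟩
    fromℕ (suc m) * fromℕ (suc n) ≡⟨ -‿involutive _ ⟨
    - - (fromℕ (suc m) * fromℕ (suc n)) ≡⟨ cong -_ (-‿distribʳ-* _ _) ⟩
    - (fromℕ (suc m) * - fromℕ (suc n)) ≡⟨ -‿distribˡ-* _ _ ⟩
    _                          ∎

  -- Unlike fromℤ, this sends + 1 to 1# on the nose, so that constants of the
  -- solver match the literals 0# and 1#.
  private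
    embedℕ : ℕ → Carrier
    embedℕ zero          = 0#
    embedℕ (suc zero)    = 1#
    embedℕ (suc (suc n)) = 1# + embedℕ (suc n)

    embed : ℤ → Carrier
    embed (pos n)    = embedℕ n
    embed -[1+ n ] = - embedℕ (suc n)

    embedℕ≡ : ∀ n → embedℕ n ≡ fromℕ n
    embedℕ≡ zero          = refl
    embedℕ≡ (suc zero)    = sym (+-identityʳ 1#)
    embedℕ≡ (suc (suc n)) = cong (1# +_) (embedℕ≡ (suc n))

    embed≡ : ∀ i → embed i ≡ fromℤ i
    embed≡ (pos n)    = embedℕ≡ n
    embed≡ -[1+ n ] = cong -_ (embedℕ≡ (suc n))

    morphism : ℤ.+-*-rawRing -Raw-AlmostCommutative⟶ fromCommutativeRing commutativeRing
    morphism = record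
      { ⟦_⟧    = embed
      ; +-homo = λ i j → trans (embed≡ (i ℤ.+ j)) (trans (fromℤ-+ i j) (sym (cong₂ _+_ (embed≡ i) (embed≡ j))))
      ; *-homo = λ i j → trans (embed≡ (i ℤ.* j)) (trans (fromℤ-* i j) (sym (cong₂ _*_ (embed≡ i) (embed≡ j))))
      ; -‿homo = λ i → trans (embed≡ (ℤ.- i)) (trans (fromℤ-neg i) (cong -_ (sym (embed≡ i))))
      ; 0-homo = refl
      ; 1-homo = refl
      }

    _≟?_ : ∀ i j → Maybe (embed i ≡ embed j)
    i ≟? j with i ℤ.≟ j
    ... | yes i≡j = just (cong embed i≡j)
    ... | no _    = nothing

  open RingSolver ℤ.+-*-rawRing (fromCommutativeRing commutativeRing) morphism _≟?_ public
    using (solve; con; _:+_; _:*_; _:-_; :-_; _:=_; Polynomial)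

  infix 5 :0 :1 :2
  :0 :1 :2 : ∀ {n} → Polynomial n
  :0 = con (pos 0)
  :1 = con (pos 1)
  :2 = :1 :+ (:1 :+ :0)


  cancel-diff : ∀ {x y} → x - y ≡ 0# → x ≡ y
  cancel-diff {x} {y} e = trans (solve 2 (λ x y → x := (x :- y) :+ y) refl x y) (trans (cong (_+ y) e) (+-identityˡ y))

  diff≡0 : ∀ {x y} → x ≡ y → x - y ≡ 0#
  diff≡0 {x} refl = -‿inverseʳ x

  -- Proves an equation as a linear combination of given equations.
  combine₁ : ∀ {x y p q} k → p ≡ q → x - y ≡ k * (p - q) → x ≡ y
  combine₁ k e d = cancel-diff (trans d (trans (cong (k *_) (diff≡0 e)) (zeroʳ k)))

  combine₂ : ∀ {x y p q p′ q′} k k′ → p ≡ q → p′ ≡ q′ → x - y ≡ k * (p - q) + k′ * (p′ - q′) → x ≡ y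
  combine₂ k k′ e e′ d = cancel-diff (trans d (trans
    (cong₂ _+_ (trans (cong (k *_) (diff≡0 e)) (zeroʳ k)) (trans (cong (k′ *_) (diff≡0 e′)) (zeroʳ k′))) (+-identityˡ 0#)))

  combine₃ : ∀ {x y p q p′ q′ p″ q″} k k′ k″ → p ≡ q → p′ ≡ q′ → p″ ≡ q″ →
             x - y ≡ k * (p - q) + k′ * (p′ - q′) + k″ * (p″ - q″) → x ≡ y
  combine₃ k k′ k″ e e′ e″ d = cancel-diff (trans d (trans (cong₂ _+_
    (trans (cong₂ _+_ (trans (cong (k *_) (diff≡0 e)) (zeroʳ k)) (trans (cong (k′ *_) (diff≡0 e′)) (zeroʳ k′))) (+-identityˡ 0#))
    (trans (cong (k″ *_) (diff≡0 e″)) (zeroʳ k″))) (+-identityˡ 0#)))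

  -x≡0⇒x≡0 : ∀ {x} → - x ≡ 0# → x ≡ 0#
  -x≡0⇒x≡0 {x} e = trans (sym (-‿involutive x)) (trans (cong -_ e) -0#≈0#)

  -- Order, division and integrality in the ordered field.

  stable : ∀ {P : Set} → ¬ ¬ P → P
  stable {P} ¬¬p with em {P}
  ... | yes p = p
  ... | no ¬p = ⊥-elim (¬¬p ¬p)

  ≤⇒0≤ : ∀ {x y} → x ≤ y → 0# ≤ y - x
  ≤⇒0≤ {x} {y} x≤y = subst (_≤ y - x) (-‿inverseʳ x) (+-mono-≤ x y (- x) x≤y)

  0≤⇒≤ : ∀ {x y} → 0# ≤ y - x → x ≤ y
  0≤⇒≤ {x} {y} h = subst₂ _≤_ (+-identityˡ x) (solve 2 (λ x y → y :- x :+ x := y) refl x y) (+-mono-≤ 0# (y - x) x h)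

  0≤+ : ∀ {x y} → 0# ≤ x → 0# ≤ y → 0# ≤ x + y
  0≤+ {x} {y} 0≤x 0≤y = ≤-trans 0≤y (subst (_≤ x + y) (+-identityˡ y) (+-mono-≤ 0# x y 0≤x))

  0≤* : ∀ {x y} → 0# ≤ x → 0# ≤ y → 0# ≤ x * y
  0≤* {x} {y} = *-nonneg x y

  0≤-by : ∀ {x y} → 0# ≤ x → x ≡ y → 0# ≤ y
  0≤-by h refl = h

  ≤-by : ∀ {x y e} → 0# ≤ e → y - x ≡ e → x ≤ y
  ≤-by h eq = 0≤⇒≤ (0≤-by h (sym eq))

  0≤neg : ∀ {x} → x ≤ 0# → 0# ≤ - x
  0≤neg {x} h = 0≤-by (≤⇒0≤ h) (+-identityˡ (- x))

  ≤+≤ : ∀ {x y z w} → x ≤ y → z ≤ w → x + z ≤ y + w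
  ≤+≤ {x} {y} {z} {w} h k = ≤-by (0≤+ (≤⇒0≤ h) (≤⇒0≤ k))
    (solve 4 (λ x y z w → (y :+ w) :- (x :+ z) := (y :- x) :+ (w :- z)) refl x y z w)

  0≤sq : ∀ x → 0# ≤ x * x
  0≤sq x with ≤-total 0# x
  ... | inj₁ h = 0≤* h h
  ... | inj₂ h = 0≤-by (0≤* (0≤neg h) (0≤neg h)) (solve 1 (λ x → :- x :* :- x := x :* x) refl x)

  0≤1 : 0# ≤ 1#
  0≤1 = 0≤-by (0≤sq 1#) (*-identityˡ 1#)

  0<1 : 0# < 1#
  0<1 = 0≤1 , 0≢1

  0≤2 : 0# ≤ fromℕ 2
  0≤2 = 0≤+ 0≤1 (0≤+ 0≤1 ≤-refl)

  pos⇒≢0 : ∀ {x} → 0# < x → x ≢ 0#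
  pos⇒≢0 (_ , h) refl = h refl

  ≤0⇒¬pos : ∀ {x} → x ≤ 0# → ¬ 0# < x
  ≤0⇒¬pos h (k , l) = l (≤-antisym k h)

  pos-neg-⊥ : ∀ {x} → 0# < x → ¬ 0# ≤ - x
  pos-neg-⊥ {x} p h = ≤0⇒¬pos (≤-by h (+-identityˡ (- x))) p

  0<+ : ∀ {x y} → 0# < x → 0# ≤ y → 0# < x + y
  0<+ {x} {y} p q = 0≤+ (proj₁ p) q , λ e → pos-neg-⊥ p
    (0≤-by q (trans (solve 2 (λ x y → y := (x :+ y) :- x) refl x y) (trans (cong (_- x) (sym e)) (+-identityˡ _))))

  0≤+0< : ∀ {x y} → 0# ≤ x → 0# < y → 0# < x + y
  0≤+0< p q = subst (0# <_) (+-comm _ _) (0<+ q p)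

  0<2 : 0# < fromℕ 2
  0<2 = 0<+ 0<1 (0≤+ 0≤1 ≤-refl)

  sign : ∀ x → x ≡ 0# ⊎ 0# < x ⊎ 0# < - x
  sign x with em {x ≡ 0#}
  ... | yes e = inj₁ e
  ... | no ne with ≤-total 0# x
  ...   | inj₁ h = inj₂ (inj₁ (h , ne ∘ sym))
  ...   | inj₂ h = inj₂ (inj₂ (0≤neg h , λ e → ne (trans (sym (-‿involutive x)) (trans (cong -_ (sym e)) -0#≈0#))))

  *-cancelˡ : ∀ {x y z} → z ≢ 0# → z * x ≡ z * y → x ≡ y
  *-cancelˡ {x} {y} {z} z≢0 e = begin
    x              ≡⟨ inv x ⟩
    z ⁻¹ * (z * x) ≡⟨ cong (z ⁻¹ *_) e ⟩
    z ⁻¹ * (z * y) ≡⟨ inv y ⟨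
    y              ∎
    where
    inv : ∀ w → w ≡ z ⁻¹ * (z * w)
    inv w = combine₁ (- w) (*-inverse z z≢0)
      (solve 3 (λ w z i → w :- i :* (z :* w) := :- w :* (z :* i :- :1)) refl w z (z ⁻¹))

  x*y≡0 : ∀ {x y} → x * y ≡ 0# → x ≡ 0# ⊎ y ≡ 0#
  x*y≡0 {x} {y} e with em {x ≡ 0#}
  ... | yes x≡0 = inj₁ x≡0
  ... | no  x≢0 = inj₂ (*-cancelˡ x≢0 (trans e (sym (zeroʳ x))))

  *-≢0 : ∀ {x y} → x ≢ 0# → y ≢ 0# → x * y ≢ 0#
  *-≢0 p q e = [ p , q ]′ (x*y≡0 e)

  sq≡0 : ∀ {x} → x * x ≡ 0# → x ≡ 0#
  sq≡0 e = [ id , id ]′ (x*y≡0 e)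

  0<* : ∀ {x y} → 0# < x → 0# < y → 0# < x * y
  0<* p q = 0≤* (proj₁ p) (proj₁ q) , λ e → *-≢0 (pos⇒≢0 p) (pos⇒≢0 q) (sym e)

  0<sq : ∀ {x} → x ≢ 0# → 0# < x * x
  0<sq {x} h = 0≤sq x , λ e → h (sq≡0 (sym e))

  0<⁻¹ : ∀ {x} → 0# < x → 0# < x ⁻¹
  0<⁻¹ {x} p with sign (x ⁻¹)
  ... | inj₁ e = ⊥-elim (0≢1 (trans (sym (trans (cong (x *_) e) (zeroʳ x))) (*-inverse x (pos⇒≢0 p))))
  ... | inj₂ (inj₁ h) = h
  ... | inj₂ (inj₂ h) = ⊥-elim (pos-neg-⊥ 0<1 (0≤-by (0≤* (proj₁ p) (proj₁ h)) (combine₁ (- 1#) (*-inverse x (pos⇒≢0 p))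
          (solve 2 (λ x i → x :* :- i :- :- :1 := :- :1 :* (x :* i :- :1)) refl x (x ⁻¹)))))

  ⁻¹-inverseˡ : ∀ {x} → x ≢ 0# → x ⁻¹ * x ≡ 1#
  ⁻¹-inverseˡ {x} h = trans (*-comm _ _) (*-inverse x h)

  0≤-cancel : ∀ {x z} → 0# < z → 0# ≤ z * x → 0# ≤ x
  0≤-cancel {x} {z} p h = 0≤-by (0≤* (proj₁ (0<⁻¹ p)) h)
    (combine₁ x (⁻¹-inverseˡ (pos⇒≢0 p)) (solve 3 (λ x z i → i :* (z :* x) :- x := x :* (i :* z :- :1)) refl x z (z ⁻¹)))

  0<-cancel : ∀ {x z} → 0# ≤ z → 0# < z * x → 0# < x
  0<-cancel {x} {z} p h with sign x
  ... | inj₁ refl = ⊥-elim (pos⇒≢0 h (zeroʳ z))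
  ... | inj₂ (inj₁ q) = q
  ... | inj₂ (inj₂ q) = ⊥-elim (pos-neg-⊥ h (0≤-by (0≤* p (proj₁ q)) (solve 2 (λ z x → z :* :- x := :- (z :* x)) refl z x)))

  ¬pos⇒≤0 : ∀ {x} → ¬ 0# < x → x ≤ 0#
  ¬pos⇒≤0 {x} h with ≤-total x 0#
  ... | inj₁ x≤0 = x≤0
  ... | inj₂ 0≤x = ≤-reflexive (stable λ ne → h (0≤x , ne ∘ sym))

  <⇒0< : ∀ {x y} → x < y → 0# < y - x
  <⇒0< (h , n) = ≤⇒0≤ h , λ e → n (sym (cancel-diff (sym e)))

  0<⇒< : ∀ {x y} → 0# < y - x → x < y
  0<⇒< (h , n) = 0≤⇒≤ h , λ e → n (sym (diff≡0 (sym e)))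

  <-≤-⊥ : ∀ {x y} → x < y → y ≤ x → ⊥
  <-≤-⊥ (h , n) k = n (≤-antisym h k)

  ≰⇒> : ∀ {x y} → ¬ x ≤ y → y < x
  ≰⇒> {x} {y} h with ≤-total x y
  ... | inj₁ k = ⊥-elim (h k)
  ... | inj₂ k = k , λ { refl → h ≤-refl }

  <-≤-trans : ∀ {x y z} → x < y → y ≤ z → x < z
  <-≤-trans h k = ≤-trans (proj₁ h) k , λ { refl → <-≤-⊥ h k }

  0≤fromℕ : ∀ n → 0# ≤ fromℕ n
  0≤fromℕ zero    = ≤-refl
  0≤fromℕ (suc n) = 0≤+ 0≤1 (0≤fromℕ n)

  0<fromℕ : ∀ n → 0# < fromℕ (suc n)
  0<fromℕ n = 0<+ 0<1 (0≤fromℕ n)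

  fromℕ-mono : ∀ {m n} → m ℕ.≤ n → fromℕ m ≤ fromℕ n
  fromℕ-mono {n = n} ℕ.z≤n   = 0≤fromℕ n
  fromℕ-mono (ℕ.s≤s h) = ≤+≤ ≤-refl (fromℕ-mono h)

  fromℕ-cancel-≤ : ∀ {m n} → fromℕ m ≤ fromℕ n → m ℕ.≤ n
  fromℕ-cancel-≤ {zero}          h = ℕ.z≤n
  fromℕ-cancel-≤ {suc m} {zero}  h = ⊥-elim (≤0⇒¬pos h (0<fromℕ m))
  fromℕ-cancel-≤ {suc m} {suc n} h = ℕ.s≤s (fromℕ-cancel-≤ (≤-by (≤⇒0≤ h)
    (solve 2 (λ x y → y :- x := (:1 :+ y) :- (:1 :+ x)) refl (fromℕ m) (fromℕ n))))

  IsInteger : Carrier → Set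
  IsInteger x = ∃ λ n → x ≡ fromℤ n

  integer-+ : ∀ {x y} → IsInteger x → IsInteger y → IsInteger (x + y)
  integer-+ (m , refl) (n , refl) = m ℤ.+ n , sym (fromℤ-+ m n)

  integer-* : ∀ {x y} → IsInteger x → IsInteger y → IsInteger (x * y)
  integer-* (m , refl) (n , refl) = m ℤ.* n , sym (fromℤ-* m n)

  integer-neg : ∀ {x} → IsInteger x → IsInteger (- x)
  integer-neg (m , refl) = ℤ.- m , sym (fromℤ-neg m)

  integer-pos : ∀ {x} → IsInteger x → 0# < x → 1# ≤ x
  integer-pos (pos zero    , refl) h = ⊥-elim (proj₂ h refl)
  integer-pos (pos (suc n) , refl) h = ≤-by (0≤fromℕ n) (solve 1 (λ x → (:1 :+ x) :- :1 := x) refl (fromℕ n))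
  integer-pos (-[1+ n ]    , refl) h = ⊥-elim (pos-neg-⊥ h (0≤-by (0≤fromℕ (suc n)) (sym (-‿involutive _))))

  -- Indicators and finite sums.

  χ : Set → Carrier
  χ P with em {P}
  ... | yes _ = 1#
  ... | no _  = 0#

  χ-yes : ∀ {P} → P → χ P ≡ 1#
  χ-yes {P} p with em {P}
  ... | yes _ = refl
  ... | no ¬p = ⊥-elim (¬p p)

  χ-no : ∀ {P} → ¬ P → χ P ≡ 0#
  χ-no {P} ¬p with em {P}
  ... | yes p = ⊥-elim (¬p p)
  ... | no _  = refl

  χ-⇔ : ∀ {P Q} → (P → Q) → (Q → P) → χ P ≡ χ Q
  χ-⇔ {P} {Q} f g with em {P}
  ... | yes p = sym (χ-yes (f p))
  ... | no ¬p = sym (χ-no (¬p ∘ g))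

  private variable
    A B : Set
    xs ys : List A

  ∑-cong : ∀ {f g : A → Carrier} → (∀ {x} → x ∈ xs → f x ≡ g x) → ∑ xs f ≡ ∑ xs g
  ∑-cong {xs = []}     h = refl
  ∑-cong {xs = x ∷ xs} h = cong₂ _+_ (h (here refl)) (∑-cong {xs = xs} (h ∘ there))

  ∑-ext : ∀ {f g : A → Carrier} → (∀ x → f x ≡ g x) → ∑ xs f ≡ ∑ xs g
  ∑-ext {xs = xs} h = ∑-cong {xs = xs} (λ {x} _ → h x)

  ∑-0 : ∀ (xs : List A) → ∑ xs (λ _ → 0#) ≡ 0#
  ∑-0 []       = refl
  ∑-0 (x ∷ xs) = trans (+-identityˡ _) (∑-0 xs)

  ∑-zero : ∀ {f : A → Carrier} → (∀ {x} → x ∈ xs → f x ≡ 0#) → ∑ xs f ≡ 0#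
  ∑-zero {xs = xs} h = trans (∑-cong h) (∑-0 xs)

  ∑-+ : ∀ xs (f g : A → Carrier) → ∑ xs (λ x → f x + g x) ≡ ∑ xs f + ∑ xs g
  ∑-+ []       f g = sym (+-identityˡ 0#)
  ∑-+ (x ∷ xs) f g = trans (cong (f x + g x +_) (∑-+ xs f g))
    (solve 4 (λ a b c d → (a :+ b) :+ (c :+ d) := (a :+ c) :+ (b :+ d)) refl (f x) (g x) (∑ xs f) (∑ xs g))

  ∑-*ˡ : ∀ xs k (f : A → Carrier) → ∑ xs (λ x → k * f x) ≡ k * ∑ xs f
  ∑-*ˡ []       k f = sym (zeroʳ k)
  ∑-*ˡ (x ∷ xs) k f = trans (cong (k * f x +_) (∑-*ˡ xs k f)) (sym (distribˡ k _ _))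

  ∑-*ʳ : ∀ xs k (f : A → Carrier) → ∑ xs (λ x → f x * k) ≡ ∑ xs f * k
  ∑-*ʳ xs k f = trans (∑-ext {xs = xs} (λ x → *-comm (f x) k)) (trans (∑-*ˡ xs k f) (*-comm k _))

  ∑-neg : ∀ xs (f : A → Carrier) → ∑ xs (λ x → - f x) ≡ - ∑ xs f
  ∑-neg xs f = trans (∑-ext {xs = xs} (λ x → solve 1 (λ a → :- a := :- :1 :* a) refl (f x)))
    (trans (∑-*ˡ xs (- 1#) f) (solve 1 (λ a → :- :1 :* a := :- a) refl (∑ xs f)))

  ∑-minus : ∀ xs (f g : A → Carrier) → ∑ xs (λ x → f x - g x) ≡ ∑ xs f - ∑ xs g
  ∑-minus xs f g = trans (∑-+ xs f (λ x → - g x)) (cong (∑ xs f +_) (∑-neg xs g))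

  ∑-++ : ∀ xs {ys} (f : A → Carrier) → ∑ (xs ++ ys) f ≡ ∑ xs f + ∑ ys f
  ∑-++ []            f = sym (+-identityˡ _)
  ∑-++ (x ∷ xs) {ys} f = trans (cong (f x +_) (∑-++ xs f)) (sym (+-assoc (f x) (∑ xs f) (∑ ys f)))

  ∑-map : ∀ (g : A → B) xs (f : B → Carrier) → ∑ (map g xs) f ≡ ∑ xs (f ∘ g)
  ∑-map g []       f = refl
  ∑-map g (x ∷ xs) f = cong (f (g x) +_) (∑-map g xs f)

  ∑-↭ : ∀ {xs ys} → xs ↭ ys → (f : A → Carrier) → ∑ xs f ≡ ∑ ys f
  ∑-↭ ↭.refl        f = refl
  ∑-↭ (↭.prep x p)   f = cong (f x +_) (∑-↭ p f)
  ∑-↭ {xs = .x ∷ .y ∷ xs} {ys = _ ∷ _ ∷ ys} (↭.swap x y p) f = trans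
    (solve 3 (λ a b c → a :+ (b :+ c) := b :+ (a :+ c)) refl (f x) (f y) (∑ xs f))
    (cong (λ s → f y + (f x + s)) (∑-↭ p f))
  ∑-↭ (↭.trans p q)  f = trans (∑-↭ p f) (∑-↭ q f)

  ∑-swap : ∀ (xs : List A) (ys : List B) (f : A → B → Carrier) →
           ∑ xs (λ x → ∑ ys (f x)) ≡ ∑ ys (λ y → ∑ xs (λ x → f x y))
  ∑-swap []       ys f = sym (∑-0 ys)
  ∑-swap (x ∷ xs) ys f = trans (cong (∑ ys (f x) +_) (∑-swap xs ys f)) (sym (∑-+ ys _ _))

  ∑-const : ∀ (xs : List A) k → ∑ xs (λ _ → k) ≡ fromℕ (length xs) * k
  ∑-const []       k = sym (zeroˡ k)
  ∑-const (x ∷ xs) k = trans (cong (k +_) (∑-const xs k))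
    (solve 2 (λ k n → k :+ n :* k := (:1 :+ n) :* k) refl k (fromℕ (length xs)))

  ∑-length : ∀ (xs : List A) → ∑ xs (λ _ → 1#) ≡ fromℕ (length xs)
  ∑-length xs = trans (∑-const xs 1#) (*-identityʳ _)

  ∑-nonneg : ∀ {f : A → Carrier} → (∀ {x} → x ∈ xs → 0# ≤ f x) → 0# ≤ ∑ xs f
  ∑-nonneg {xs = []}     h = ≤-refl
  ∑-nonneg {xs = x ∷ xs} h = 0≤+ (h (here refl)) (∑-nonneg {xs = xs} (h ∘ there))

  ∑-pos : ∀ {f : A → Carrier} {x} → (∀ {x} → x ∈ xs → 0# ≤ f x) → x ∈ xs → 0# < f x → 0# < ∑ xs f
  ∑-pos {xs = x ∷ xs} h (here refl) p = 0<+ p (∑-nonneg {xs = xs} (h ∘ there))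
  ∑-pos {xs = x ∷ xs} h (there q)   p = 0≤+0< (h (here refl)) (∑-pos {xs = xs} (h ∘ there) q p)

  ∑-nonneg-zero : ∀ {f : A → Carrier} {x} → (∀ {x} → x ∈ xs → 0# ≤ f x) → ∑ xs f ≡ 0# → x ∈ xs → f x ≡ 0#
  ∑-nonneg-zero {f = f} {x} h e p with em {f x ≡ 0#}
  ... | yes q = q
  ... | no  q = ⊥-elim (proj₂ (∑-pos h p (h p , q ∘ sym)) (sym e))

  ∑-pos⁻ : ∀ xs {f : A → Carrier} → 0# < ∑ xs f → ∃ λ x → x ∈ xs × 0# < f x
  ∑-pos⁻ []       p = ⊥-elim (proj₂ p refl)
  ∑-pos⁻ (x ∷ xs) {f} p with em {0# < f x}
  ... | yes q = x , here refl , q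
  ... | no ¬q with ∑-pos⁻ xs {f} (0<rest (≤-total (f x) 0#))
    where
    0<rest : f x ≤ 0# ⊎ 0# ≤ f x → 0# < ∑ xs f
    0<rest (inj₁ h) = subst (0# <_) (solve 2 (λ a b → a :+ b :- a := b) refl (f x) (∑ xs f))
                        (0<+ p (0≤neg h))
    0<rest (inj₂ h) with em {f x ≡ 0#}
    ... | yes e = subst (0# <_) (trans (cong (_+ ∑ xs f) e) (+-identityˡ _)) p
    ... | no ne = ⊥-elim (¬q (h , ne ∘ sym))
  ...   | y , y∈ , q = y , there y∈ , q

  ∑-filter : ∀ (P : Pred A 0ℓ) xs (f : A → Carrier) →
             ∑ (filter (λ x → em {P x}) xs) f ≡ ∑ xs (λ x → χ (P x) * f x)
  ∑-filter P []       f = refl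
  ∑-filter P (x ∷ xs) f with em {P x}
  ... | yes _ = cong₂ _+_ (sym (*-identityˡ _)) (∑-filter P xs f)
  ... | no _  = trans (∑-filter P xs f) (trans (sym (+-identityˡ _)) (cong₂ _+_ (sym (zeroˡ (f x))) refl))

  ∑-single : ∀ {f : A → Carrier} {x} → Unique xs → x ∈ xs → (∀ {y} → y ∈ xs → y ≢ x → f y ≡ 0#) → ∑ xs f ≡ f x
  ∑-single {xs = x ∷ xs} {f} (x∉ ∷ _) (here refl) h = trans
    (cong (f x +_) (∑-zero {xs = xs} (λ y∈ → h (there y∈) (λ { refl → All.lookup x∉ y∈ refl })))) (+-identityʳ _)
  ∑-single {xs = y ∷ xs} {f} {x} (y∉ ∷ u) (there x∈) h = trans
    (cong₂ _+_ (h (here refl) (λ { refl → All.lookup y∉ x∈ refl })) (∑-single {xs = xs} u x∈ (h ∘ there)))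
    (+-identityˡ _)


  -- Duplicate-free lists as finite sets.

  ∈-split : ∀ {x : A} {xs} → x ∈ xs → ∃ λ ys → xs ↭ x ∷ ys
  ∈-split {x = x} x∈ with ∈-∃++ x∈
  ... | as , bs , refl = as ++ bs , shift x as bs

  Unique-↭ : xs ↭ ys → Unique xs → Unique ys
  Unique-↭ ↭.refl        u = u
  Unique-↭ (↭.prep x p)   (x∉ ∷ u) = All.tabulate (λ y∈ → All.lookup x∉ (∈-resp-↭ (↭-sym p) y∈)) ∷ Unique-↭ p u
  Unique-↭ (↭.swap x y p) ((x≢y ∷ x∉) ∷ y∉ ∷ u) =
    ((x≢y ∘ sym) ∷ All.tabulate (λ z∈ → All.lookup y∉ (∈-resp-↭ (↭-sym p) z∈))) ∷
    All.tabulate (λ z∈ → All.lookup x∉ (∈-resp-↭ (↭-sym p) z∈)) ∷ Unique-↭ p u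
  Unique-↭ (↭.trans p q)  u = Unique-↭ q (Unique-↭ p u)

  same-set⇒↭ : Unique xs → Unique ys → (∀ {x : A} → x ∈ xs → x ∈ ys) → (∀ {x} → x ∈ ys → x ∈ xs) → xs ↭ ys
  same-set⇒↭ u v f g = ∼bag⇒↭ (unique∧set⇒bag u v (mk⇔ f g))

  ⊆⇒length≤ : Unique xs → (∀ {x : A} → x ∈ xs → x ∈ ys) → length xs ℕ.≤ length ys
  ⊆⇒length≤ {xs = []}     u h = ℕ.z≤n
  ⊆⇒length≤ {xs = x ∷ xs} {ys} (x∉ ∷ u) h with ∈-split (h (here refl))
  ... | zs , p = ℕ.≤-trans (ℕ.s≤s (⊆⇒length≤ {ys = zs} u sub)) (ℕ.≤-reflexive (sym (↭-length p)))
    where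
    sub : ∀ {y} → y ∈ xs → y ∈ zs
    sub y∈ with ∈-resp-↭ p (h (there y∈))
    ... | here refl = ⊥-elim (All.lookup x∉ y∈ refl)
    ... | there q   = q

  -- The order of the reals is not well founded, but on a finite list the number of entries of
  -- smaller value drops strictly, and the induction runs on that number.
  finite-induction : ∀ {xs : List A} (f : A → Carrier) (P : A → Set) →
    (∀ {x} → x ∈ xs → (∀ {y} → y ∈ xs → f y < f x → P y) → P x) → ∀ {x} → x ∈ xs → P x
  finite-induction {A} {xs} f P step {x} x∈ = go (length (below x)) ℕ.≤-refl x∈
    where
    below : A → List A
    below x = filter (λ y → em {f y < f x}) xs
    smaller : ∀ {x y} → y ∈ xs → f y < f x → length (below y) ℕ.< length (below x)
    smaller {x} {y} y∈ h = go′ xs y∈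
      where
      le : ∀ zs → length (filter (λ z → em {f z < f y}) zs) ℕ.≤ length (filter (λ z → em {f z < f x}) zs)
      le []       = ℕ.z≤n
      le (z ∷ zs) with em {f z < f y} | em {f z < f x}
      ... | yes p | yes q = ℕ.s≤s (le zs)
      ... | yes p | no ¬q = ⊥-elim (¬q (<-≤-trans p (proj₁ h)))
      ... | no ¬p | yes q = ℕ.m≤n⇒m≤1+n (le zs)
      ... | no ¬p | no ¬q = le zs
      go′ : ∀ zs → y ∈ zs → length (filter (λ z → em {f z < f y}) zs) ℕ.< length (filter (λ z → em {f z < f x}) zs)
      go′ (z ∷ zs) (here refl) with em {f z < f y} | em {f z < f x}
      ... | yes p | _     = ⊥-elim (proj₂ p refl)
      ... | no ¬p | yes q = ℕ.s≤s (le zs)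
      ... | no ¬p | no ¬q = ⊥-elim (¬q h)
      go′ (z ∷ zs) (there q) with em {f z < f y} | em {f z < f x}
      ... | yes p | yes q′ = ℕ.s≤s (go′ zs q)
      ... | yes p | no ¬q = ⊥-elim (¬q (<-≤-trans p (proj₁ h)))
      ... | no ¬p | yes q′ = ℕ.m≤n⇒m≤1+n (go′ zs q)
      ... | no ¬p | no ¬q = go′ zs q
    go : ∀ n {x} → length (below x) ℕ.≤ n → x ∈ xs → P x
    go zero    le x∈ = step x∈ λ y∈ h → ⊥-elim (ℕ.n≮0 (ℕ.<-≤-trans (smaller y∈ h) le))
    go (suc n) le x∈ = step x∈ λ y∈ h → go n (ℕ.≤-pred (ℕ.<-≤-trans (smaller y∈ h) le)) y∈

-- Euclidean space and its reflections.

module Vectors (em : ExcludedMiddle 0ℓ) (ℝ : RealNumbers) (ℓ : ℕ) where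

  open Reals em ℝ
  open Geometry em ℝ ℓ public

  private
    -- The geometry is fixed in dimension `ℓ`, whereas these facts need induction on the number of
    -- coordinates; they are therefore stated for every `n` first.
    module Coordinates where
      open module G n = Geometry em ℝ n using () renaming (⟨_,_⟩ to ip; _⊕_ to add; _·_ to scale; 𝟎 to zer; neg to ng)

      sym′ : ∀ n (x y : Vec Carrier n) → ip n x y ≡ ip n y x
      sym′ zero    []       []       = refl
      sym′ (suc n) (a ∷ x) (b ∷ y) = cong₂ _+_ (*-comm a b) (sym′ n x y)

      add′ : ∀ n (x y z : Vec Carrier n) → ip n (add n x y) z ≡ ip n x z + ip n y z
      add′ zero    []       []       []      = sym (+-identityˡ 0#)
      add′ (suc n) (a ∷ x) (b ∷ y) (c ∷ z) = trans (cong ((a + b) * c +_) (add′ n x y z))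
        (solve 5 (λ a b c p q → (a :+ b) :* c :+ (p :+ q) := (a :* c :+ p) :+ (b :* c :+ q)) refl a b c (ip n x z) (ip n y z))

      scale′ : ∀ n k (x z : Vec Carrier n) → ip n (scale n k x) z ≡ k * ip n x z
      scale′ zero    k []       []      = sym (zeroʳ k)
      scale′ (suc n) k (a ∷ x) (c ∷ z) = trans (cong (k * a * c +_) (scale′ n k x z))
        (solve 4 (λ k a c p → k :* a :* c :+ k :* p := k :* (a :* c :+ p)) refl k a c (ip n x z))

      neg′ : ∀ n (x z : Vec Carrier n) → ip n (ng n x) z ≡ - ip n x z
      neg′ zero    []       []      = solve 0 (:0 := :- :0) refl
      neg′ (suc n) (a ∷ x) (c ∷ z) = trans (cong (- a * c +_) (neg′ n x z))
        (solve 3 (λ a c p → :- a :* c :+ :- p := :- (a :* c :+ p)) refl a c (ip n x z))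

      zero′ : ∀ n (z : Vec Carrier n) → ip n (zer n) z ≡ 0#
      zero′ zero    []      = refl
      zero′ (suc n) (c ∷ z) = trans (cong₂ _+_ (zeroˡ c) (zero′ n z)) (+-identityˡ 0#)

      nonneg′ : ∀ n (x : Vec Carrier n) → 0# ≤ ip n x x
      nonneg′ zero    []      = ≤-refl
      nonneg′ (suc n) (a ∷ x) = 0≤+ (0≤sq a) (nonneg′ n x)

      definite′ : ∀ n (x : Vec Carrier n) → ip n x x ≡ 0# → x ≡ zer n
      definite′ zero    []      e = refl
      definite′ (suc n) (a ∷ x) e with em {a ≡ 0#}
      ... | yes refl = cong (0# ∷_) (definite′ n x (trans (sym (trans (cong (_+ ip n x x) (zeroˡ 0#)) (+-identityˡ _))) e))
      ... | no  a≢0  = ⊥-elim (proj₂ (0<+ (0<sq a≢0) (nonneg′ n x)) (sym e))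

      minus′ : ∀ n (x y : Vec Carrier n) → add n x (ng n y) ≡ zer n → x ≡ y
      minus′ zero    []      []      e = refl
      minus′ (suc n) (a ∷ x) (b ∷ y) e =
        cong₂ _∷_ (cancel-diff (cong Vec.head e)) (minus′ n x y (cong Vec.tail e))

      basis′ : ∀ n → List (Vec Carrier n)
      basis′ zero    = []
      basis′ (suc n) = (1# ∷ zer n) ∷ map (0# ∷_) (basis′ n)

      basis-length′ : ∀ n → length (basis′ n) ≡ n
      basis-length′ zero    = refl
      basis-length′ (suc n) = cong suc (trans (length-map (0# ∷_) (basis′ n)) (basis-length′ n))

      basis-unit′ : ∀ n {e} → e ∈ basis′ n → ip n e e ≡ 1#
      basis-unit′ (suc n) (here refl) = trans (cong (1# * 1# +_) (zero′ n _)) (solve 0 (:1 :* :1 :+ :0 := :1) refl)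
      basis-unit′ (suc n) (there e∈) with ∈-map⁻ (0# ∷_) e∈
      ... | e , e∈′ , refl = trans (cong (0# * 0# +_) (basis-unit′ n e∈′)) (solve 0 (:0 :* :0 :+ :1 := :1) refl)

      parseval′ : ∀ n (x y : Vec Carrier n) → ∑ (basis′ n) (λ e → ip n x e * ip n y e) ≡ ip n x y
      parseval′ zero    []      []      = refl
      parseval′ (suc n) (a ∷ x) (b ∷ y) = cong₂ _+_
        (trans (cong₂ _*_ (first a x) (first b y)) refl)
        (trans (∑-map (0# ∷_) (basis′ n) _) (trans (∑-ext {xs = basis′ n} λ e → cong₂ _*_ (rest a x e) (rest b y e)) (parseval′ n x y)))
        where
        first : ∀ a x → ip (suc n) (a ∷ x) (1# ∷ zer n) ≡ a
        first a x = trans (cong (a * 1# +_) (trans (sym′ n x (zer n)) (zero′ n x))) (solve 1 (λ a → a :* :1 :+ :0 := a) refl a)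
        rest : ∀ a x e → ip (suc n) (a ∷ x) (0# ∷ e) ≡ ip n x e
        rest a x e = solve 2 (λ a p → a :* :0 :+ p := p) refl a (ip n x e)

  ⟨⟩-sym : ∀ x y → ⟨ x , y ⟩ ≡ ⟨ y , x ⟩
  ⟨⟩-sym = Coordinates.sym′ ℓ

  ⟨⟩-⊕ˡ : ∀ x y z → ⟨ x ⊕ y , z ⟩ ≡ ⟨ x , z ⟩ + ⟨ y , z ⟩
  ⟨⟩-⊕ˡ = Coordinates.add′ ℓ

  ⟨⟩-·ˡ : ∀ k x z → ⟨ k · x , z ⟩ ≡ k * ⟨ x , z ⟩
  ⟨⟩-·ˡ = Coordinates.scale′ ℓ

  ⟨⟩-negˡ : ∀ x z → ⟨ neg x , z ⟩ ≡ - ⟨ x , z ⟩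
  ⟨⟩-negˡ = Coordinates.neg′ ℓ

  ⟨⟩-𝟎ˡ : ∀ z → ⟨ 𝟎 , z ⟩ ≡ 0#
  ⟨⟩-𝟎ˡ = Coordinates.zero′ ℓ

  ⟨⟩-⊕ʳ : ∀ x y z → ⟨ x , y ⊕ z ⟩ ≡ ⟨ x , y ⟩ + ⟨ x , z ⟩
  ⟨⟩-⊕ʳ x y z = trans (⟨⟩-sym x _) (trans (⟨⟩-⊕ˡ y z x) (cong₂ _+_ (⟨⟩-sym y x) (⟨⟩-sym z x)))

  ⟨⟩-·ʳ : ∀ k x z → ⟨ x , k · z ⟩ ≡ k * ⟨ x , z ⟩
  ⟨⟩-·ʳ k x z = trans (⟨⟩-sym x _) (trans (⟨⟩-·ˡ k z x) (cong (k *_) (⟨⟩-sym z x)))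

  ⟨⟩-negʳ : ∀ x z → ⟨ x , neg z ⟩ ≡ - ⟨ x , z ⟩
  ⟨⟩-negʳ x z = trans (⟨⟩-sym x _) (trans (⟨⟩-negˡ z x) (cong -_ (⟨⟩-sym z x)))

  ⟨⟩-𝟎ʳ : ∀ z → ⟨ z , 𝟎 ⟩ ≡ 0#
  ⟨⟩-𝟎ʳ z = trans (⟨⟩-sym z _) (⟨⟩-𝟎ˡ z)

  ⟨⟩-nonneg : ∀ x → 0# ≤ ⟨ x , x ⟩
  ⟨⟩-nonneg = Coordinates.nonneg′ ℓ

  ⟨⟩-definite : ∀ {x} → ⟨ x , x ⟩ ≡ 0# → x ≡ 𝟎
  ⟨⟩-definite {x} = Coordinates.definite′ ℓ x

  ⟨⟩-pos : ∀ {x} → x ≢ 𝟎 → 0# < ⟨ x , x ⟩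
  ⟨⟩-pos {x} h = ⟨⟩-nonneg x , λ e → h (⟨⟩-definite (sym e))

  -- Pairing the difference with itself and using definiteness. This is the standard way below to
  -- turn an identity of vectors into one of scalars, where the ring solver applies.
  ⟨⟩-ext : ∀ {x y} → (∀ z → ⟨ x , z ⟩ ≡ ⟨ y , z ⟩) → x ≡ y
  ⟨⟩-ext {x} {y} h = Coordinates.minus′ ℓ x y (⟨⟩-definite (begin
    ⟨ x ⊕ neg y , x ⊕ neg y ⟩                    ≡⟨ ⟨⟩-⊕ˡ x (neg y) _ ⟩
    ⟨ x , x ⊕ neg y ⟩ + ⟨ neg y , x ⊕ neg y ⟩    ≡⟨ cong₂ _+_ (h _) (⟨⟩-negˡ y _) ⟩
    ⟨ y , x ⊕ neg y ⟩ - ⟨ y , x ⊕ neg y ⟩        ≡⟨ -‿inverseʳ _ ⟩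
    0#                                           ∎))

  basis : List V
  basis = Coordinates.basis′ ℓ

  basis-length : length basis ≡ ℓ
  basis-length = Coordinates.basis-length′ ℓ

  basis-unit : ∀ {e} → e ∈ basis → ⟨ e , e ⟩ ≡ 1#
  basis-unit = Coordinates.basis-unit′ ℓ

  parseval : ∀ x y → ∑ basis (λ e → ⟨ x , e ⟩ * ⟨ y , e ⟩) ≡ ⟨ x , y ⟩
  parseval = Coordinates.parseval′ ℓ

  ⟨⟩-⊕·ˡ : ∀ x k y z → ⟨ x ⊕ k · y , z ⟩ ≡ ⟨ x , z ⟩ + k * ⟨ y , z ⟩
  ⟨⟩-⊕·ˡ x k y z = trans (⟨⟩-⊕ˡ x _ z) (cong (⟨ x , z ⟩ +_) (⟨⟩-·ˡ k y z))

  ⟨⟩-⊕·ʳ : ∀ z x k y → ⟨ z , x ⊕ k · y ⟩ ≡ ⟨ z , x ⟩ + k * ⟨ z , y ⟩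
  ⟨⟩-⊕·ʳ z x k y = trans (⟨⟩-⊕ʳ z x _) (cong (⟨ z , x ⟩ +_) (⟨⟩-·ʳ k z y))

  ⊕-comm : ∀ x y → x ⊕ y ≡ y ⊕ x
  ⊕-comm x y = ⟨⟩-ext λ z → trans (⟨⟩-⊕ˡ x y z) (trans (+-comm _ _) (sym (⟨⟩-⊕ˡ y x z)))

  ⊕-identityʳ : ∀ x → x ⊕ 𝟎 ≡ x
  ⊕-identityʳ x = ⟨⟩-ext λ z → trans (⟨⟩-⊕ˡ x 𝟎 z) (trans (cong (⟨ x , z ⟩ +_) (⟨⟩-𝟎ˡ z)) (+-identityʳ _))

  ⊕-identityˡ : ∀ x → 𝟎 ⊕ x ≡ x
  ⊕-identityˡ x = trans (⊕-comm 𝟎 x) (⊕-identityʳ x)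

  1·_ : ∀ x → 1# · x ≡ x
  1· x = ⟨⟩-ext λ z → trans (⟨⟩-·ˡ 1# x z) (*-identityˡ _)

  0·_ : ∀ x → 0# · x ≡ 𝟎
  0· x = ⟨⟩-ext λ z → trans (⟨⟩-·ˡ 0# x z) (trans (zeroˡ _) (sym (⟨⟩-𝟎ˡ z)))

  ·-assoc : ∀ k l x → k · (l · x) ≡ (k * l) · x
  ·-assoc k l x = ⟨⟩-ext λ z → trans (⟨⟩-·ˡ k (l · x) z) (trans (cong (k *_) (⟨⟩-·ˡ l x z)) (trans (sym (*-assoc k l _)) (sym (⟨⟩-·ˡ (k * l) x z))))

  neg≡ : ∀ x → neg x ≡ (- 1#) · x
  neg≡ x = ⟨⟩-ext λ z → trans (⟨⟩-negˡ x z) (trans (solve 1 (λ a → :- a := :- :1 :* a) refl ⟨ x , z ⟩) (sym (⟨⟩-·ˡ (- 1#) x z)))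

  neg-involutive : ∀ x → neg (neg x) ≡ x
  neg-involutive x = ⟨⟩-ext λ z → trans (⟨⟩-negˡ (neg x) z) (trans (cong -_ (⟨⟩-negˡ x z)) (-‿involutive ⟨ x , z ⟩))

  neg-injective : ∀ {x y} → neg x ≡ neg y → x ≡ y
  neg-injective {x} {y} e = trans (sym (neg-involutive x)) (trans (cong neg e) (neg-involutive y))

  ⟨neg,neg⟩ : ∀ x y → ⟨ neg x , neg y ⟩ ≡ ⟨ x , y ⟩
  ⟨neg,neg⟩ x y = trans (⟨⟩-negˡ x _) (trans (cong -_ (⟨⟩-negʳ x y)) (-‿involutive ⟨ x , y ⟩))


  vsum : List V → (V → Carrier) → V
  vsum []       c = 𝟎
  vsum (v ∷ vs) c = c v · v ⊕ vsum vs c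

  ⟨vsum,⟩ : ∀ vs c z → ⟨ vsum vs c , z ⟩ ≡ ∑ vs (λ v → c v * ⟨ v , z ⟩)
  ⟨vsum,⟩ []       c z = ⟨⟩-𝟎ˡ z
  ⟨vsum,⟩ (v ∷ vs) c z = trans (⟨⟩-⊕ˡ (c v · v) (vsum vs c) z) (cong₂ _+_ (⟨⟩-·ˡ (c v) v z) (⟨vsum,⟩ vs c z))

  ⟨,vsum⟩ : ∀ vs c z → ⟨ z , vsum vs c ⟩ ≡ ∑ vs (λ v → c v * ⟨ z , v ⟩)
  ⟨,vsum⟩ vs c z = trans (⟨⟩-sym z _) (trans (⟨vsum,⟩ vs c z) (∑-ext {xs = vs} λ v → cong (c v *_) (⟨⟩-sym v z)))


  cartan : V → V → Carrier
  cartan α v = fromℕ 2 * ⟨ α , v ⟩ / ⟨ α , α ⟩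

  cartan-spec : ∀ {α} v → α ≢ 𝟎 → cartan α v * ⟨ α , α ⟩ ≡ fromℕ 2 * ⟨ α , v ⟩
  cartan-spec {α} v h = combine₁ (fromℕ 2 * ⟨ α , v ⟩) (⁻¹-inverseˡ (pos⇒≢0 (⟨⟩-pos h)))
    (solve 4 (λ t p i q → t :* p :* i :* q :- t :* p := t :* p :* (i :* q :- :1)) refl (fromℕ 2) ⟨ α , v ⟩ (⟨ α , α ⟩ ⁻¹) ⟨ α , α ⟩)

  ⟨reflect,⟩ : ∀ α v w → ⟨ reflect α v , w ⟩ ≡ ⟨ v , w ⟩ - cartan α v * ⟨ α , w ⟩
  ⟨reflect,⟩ α v w = trans (⟨⟩-⊕ˡ v _ w) (cong (⟨ v , w ⟩ +_) (trans (⟨⟩-negˡ (cartan α v · α) w) (cong -_ (⟨⟩-·ˡ (cartan α v) α w))))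

  ⟨,reflect⟩ : ∀ α v w → ⟨ w , reflect α v ⟩ ≡ ⟨ w , v ⟩ - cartan α v * ⟨ w , α ⟩
  ⟨,reflect⟩ α v w = trans (⟨⟩-sym w _) (trans (⟨reflect,⟩ α v w) (cong₂ (λ a b → a - cartan α v * b) (⟨⟩-sym v w) (⟨⟩-sym α w)))

  reflect-adjoint : ∀ {α} v w → α ≢ 𝟎 → ⟨ reflect α v , w ⟩ ≡ ⟨ v , reflect α w ⟩
  reflect-adjoint {α} v w h = trans (⟨reflect,⟩ α v w) (trans
    (cong (λ p → ⟨ v , w ⟩ - p) (*-cancelˡ (pos⇒≢0 (⟨⟩-pos h)) (combine₂ ⟨ α , w ⟩ (- ⟨ α , v ⟩) (cartan-spec v h) (cartan-spec w h)
      (solve 6 (λ a c d p q t → a :* (c :* q) :- a :* (d :* p) := q :* (c :* a :- t :* p) :+ :- p :* (d :* a :- t :* q)) refl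
        ⟨ α , α ⟩ (cartan α v) (cartan α w) ⟨ α , v ⟩ ⟨ α , w ⟩ (fromℕ 2)))))
    (sym (trans (⟨,reflect⟩ α w v) (cong (λ p → ⟨ v , w ⟩ - cartan α w * p) (⟨⟩-sym v α)))))

  reflect-self : ∀ {α} → α ≢ 𝟎 → reflect α α ≡ neg α
  reflect-self {α} h = ⟨⟩-ext λ z → trans (⟨reflect,⟩ α α z) (trans
    (combine₁ (- ⟨ α , z ⟩) cartan≡2 (solve 2 (λ a c → a :- c :* a :- :- a := :- a :* (c :- :2)) refl ⟨ α , z ⟩ (cartan α α)))
    (sym (⟨⟩-negˡ α z)))
    where
    cartan≡2 : cartan α α ≡ fromℕ 2
    cartan≡2 = *-cancelˡ (pos⇒≢0 (⟨⟩-pos h)) (trans (*-comm _ _) (trans (cartan-spec α h) (*-comm _ _)))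

  reflect-⊥ : ∀ {α v} → ⟨ α , v ⟩ ≡ 0# → reflect α v ≡ v
  reflect-⊥ {α} {v} e = ⟨⟩-ext λ z → trans (⟨reflect,⟩ α v z) (combine₁ (- (fromℕ 2 * ⟨ α , α ⟩ ⁻¹ * ⟨ α , z ⟩)) e
    (solve 5 (λ v t p i a → v :- t :* p :* i :* a :- v := :- (t :* i :* a) :* (p :- :0)) refl ⟨ v , z ⟩ (fromℕ 2) ⟨ α , v ⟩ (⟨ α , α ⟩ ⁻¹) ⟨ α , z ⟩))

  cartan-⊕· : ∀ α v k w → cartan α (v ⊕ k · w) ≡ cartan α v + k * cartan α w
  cartan-⊕· α v k w = trans (cong (λ p → fromℕ 2 * p / ⟨ α , α ⟩) (⟨⟩-⊕·ʳ α v k w))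
    (solve 5 (λ t p k q i → t :* (p :+ k :* q) :* i := t :* p :* i :+ k :* (t :* q :* i)) refl (fromℕ 2) ⟨ α , v ⟩ k ⟨ α , w ⟩ (⟨ α , α ⟩ ⁻¹))

  reflect-⊕· : ∀ α v k w → reflect α (v ⊕ k · w) ≡ reflect α v ⊕ k · reflect α w
  reflect-⊕· α v k w = ⟨⟩-ext λ z → begin
    ⟨ reflect α (v ⊕ k · w) , z ⟩
      ≡⟨ ⟨reflect,⟩ α _ z ⟩
    ⟨ v ⊕ k · w , z ⟩ - cartan α (v ⊕ k · w) * ⟨ α , z ⟩
      ≡⟨ cong₂ (λ a b → a - b * ⟨ α , z ⟩) (⟨⟩-⊕·ˡ v k w z) (cartan-⊕· α v k w) ⟩
    ⟨ v , z ⟩ + k * ⟨ w , z ⟩ - (cartan α v + k * cartan α w) * ⟨ α , z ⟩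
      ≡⟨ solve 6 (λ v k w c d a → v :+ k :* w :- (c :+ k :* d) :* a := (v :- c :* a) :+ k :* (w :- d :* a)) refl ⟨ v , z ⟩ k ⟨ w , z ⟩ (cartan α v) (cartan α w) ⟨ α , z ⟩ ⟩
    (⟨ v , z ⟩ - cartan α v * ⟨ α , z ⟩) + k * (⟨ w , z ⟩ - cartan α w * ⟨ α , z ⟩)
      ≡⟨ cong₂ (λ a b → a + k * b) (⟨reflect,⟩ α v z) (⟨reflect,⟩ α w z) ⟨
    ⟨ reflect α v , z ⟩ + k * ⟨ reflect α w , z ⟩
      ≡⟨ ⟨⟩-⊕·ˡ (reflect α v) k (reflect α w) z ⟨
    ⟨ reflect α v ⊕ k · reflect α w , z ⟩ ∎

  reflect-𝟎 : ∀ α → reflect α 𝟎 ≡ 𝟎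
  reflect-𝟎 α = reflect-⊥ (⟨⟩-𝟎ʳ α)

  reflect-· : ∀ α k w → reflect α (k · w) ≡ k · reflect α w
  reflect-· α k w = trans (cong (reflect α) (sym (⊕-identityˡ _))) (trans (reflect-⊕· α 𝟎 k w) (trans (cong (_⊕ k · reflect α w) (reflect-𝟎 α)) (⊕-identityˡ _)))

  reflect-neg : ∀ α v → reflect α (neg v) ≡ neg (reflect α v)
  reflect-neg α v = trans (cong (reflect α) (neg≡ v)) (trans (reflect-· α (- 1#) v) (sym (neg≡ _)))

  reflect-⊕ : ∀ α v w → reflect α (v ⊕ w) ≡ reflect α v ⊕ reflect α w
  reflect-⊕ α v w = trans (cong (λ w → reflect α (v ⊕ w)) (sym (1· w))) (trans (reflect-⊕· α v 1# w) (cong (reflect α v ⊕_) (1· _)))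

  ⟨⟩-reflect-self : ∀ {α} v → α ≢ 𝟎 → ⟨ α , reflect α v ⟩ ≡ - ⟨ α , v ⟩
  ⟨⟩-reflect-self {α} v h = trans (sym (reflect-adjoint α v h)) (trans (cong ⟨_, v ⟩ (reflect-self h)) (⟨⟩-negˡ α v))

  reflect-involutive : ∀ {α} v → α ≢ 𝟎 → reflect α (reflect α v) ≡ v
  reflect-involutive {α} v h = ⟨⟩-ext λ z → trans (⟨reflect,⟩ α _ z) (trans (cong₂ (λ a b → a - b * ⟨ α , z ⟩) (⟨reflect,⟩ α v z)
      (trans (cong (λ p → fromℕ 2 * p / ⟨ α , α ⟩) (⟨⟩-reflect-self v h))
        (solve 3 (λ t p i → t :* :- p :* i := :- (t :* p :* i)) refl (fromℕ 2) ⟨ α , v ⟩ (⟨ α , α ⟩ ⁻¹))))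
    (solve 3 (λ v c a → v :- c :* a :- :- c :* a := v) refl ⟨ v , z ⟩ (cartan α v) ⟨ α , z ⟩))

  reflect-isometry : ∀ {α} v w → α ≢ 𝟎 → ⟨ reflect α v , reflect α w ⟩ ≡ ⟨ v , w ⟩
  reflect-isometry {α} v w h = trans (reflect-adjoint v _ h) (cong ⟨ v ,_⟩ (reflect-involutive w h))

  reflect-injective : ∀ {α v w} → α ≢ 𝟎 → reflect α v ≡ reflect α w → v ≡ w
  reflect-injective {α} {v} {w} h e = trans (sym (reflect-involutive v h)) (trans (cong (reflect α) e) (reflect-involutive w h))

  ⟨lin₂,⟩ : ∀ k x l y z → ⟨ k · x ⊕ l · y , z ⟩ ≡ k * ⟨ x , z ⟩ + l * ⟨ y , z ⟩
  ⟨lin₂,⟩ k x l y z = trans (⟨⟩-⊕·ˡ (k · x) l y z) (cong (_+ l * ⟨ y , z ⟩) (⟨⟩-·ˡ k x z))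

  ⟨,lin₂⟩ : ∀ k x l y z → ⟨ z , k · x ⊕ l · y ⟩ ≡ k * ⟨ z , x ⟩ + l * ⟨ z , y ⟩
  ⟨,lin₂⟩ k x l y z = trans (⟨⟩-⊕·ʳ z (k · x) l y) (cong (_+ l * ⟨ z , y ⟩) (⟨⟩-·ʳ k z x))

  ⟨lin₂,lin₂⟩ : ∀ k x l y → ⟨ k · x ⊕ l · y , k · x ⊕ l · y ⟩ ≡ k * k * ⟨ x , x ⟩ + fromℕ 2 * (k * l * ⟨ x , y ⟩) + l * l * ⟨ y , y ⟩
  ⟨lin₂,lin₂⟩ k x l y = trans (⟨lin₂,⟩ k x l y (k · x ⊕ l · y)) (trans
    (cong₂ (λ a b → k * a + l * b) (⟨,lin₂⟩ k x l y x) (trans (⟨,lin₂⟩ k x l y y) (cong (λ a → k * a + l * ⟨ y , y ⟩) (⟨⟩-sym y x))))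
    (solve 5 (λ k l p q r → k :* (k :* p :+ l :* q) :+ l :* (k :* q :+ l :* r) := k :* k :* p :+ :2 :* (k :* l :* q) :+ l :* l :* r) refl
      k l ⟨ x , x ⟩ ⟨ x , y ⟩ ⟨ y , y ⟩))

  private
    -- The component of `x` orthogonal to `y`, scaled by `⟨ y , y ⟩` to avoid an inverse. Its
    -- squared length is `⟨ y , y ⟩` times the Gram determinant, which yields both the
    -- Cauchy-Schwarz inequality and its equality case.
    residue : V → V → V
    residue x y = ⟨ y , y ⟩ · x ⊕ (- ⟨ x , y ⟩) · y

    ⟨residue,residue⟩ : ∀ x y → ⟨ residue x y , residue x y ⟩ ≡ ⟨ y , y ⟩ * (⟨ x , x ⟩ * ⟨ y , y ⟩ - ⟨ x , y ⟩ * ⟨ x , y ⟩)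
    ⟨residue,residue⟩ x y = trans (⟨lin₂,lin₂⟩ ⟨ y , y ⟩ x (- ⟨ x , y ⟩) y)
      (solve 3 (λ p q r → r :* r :* p :+ :2 :* (r :* :- q :* q) :+ :- q :* :- q :* r := r :* (p :* r :- q :* q)) refl ⟨ x , x ⟩ ⟨ x , y ⟩ ⟨ y , y ⟩)

  cauchy-schwarz : ∀ x y → ⟨ x , y ⟩ * ⟨ x , y ⟩ ≤ ⟨ x , x ⟩ * ⟨ y , y ⟩
  cauchy-schwarz x y with em {y ≡ 𝟎}
  ... | yes refl = ≤-by (0≤sq 0#) (trans (cong₂ (λ a b → ⟨ x , x ⟩ * a - b * b) (⟨⟩-𝟎ˡ 𝟎) (⟨⟩-𝟎ʳ x))
                     (solve 1 (λ a → a :* :0 :- :0 :* :0 := :0 :* :0) refl ⟨ x , x ⟩))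
  ... | no y≢𝟎 = 0≤⇒≤ (0≤-cancel (⟨⟩-pos y≢𝟎) (0≤-by (⟨⟩-nonneg (residue x y)) (⟨residue,residue⟩ x y)))

  parallel : ∀ {x y} → y ≢ 𝟎 → ⟨ x , y ⟩ * ⟨ x , y ⟩ ≡ ⟨ x , x ⟩ * ⟨ y , y ⟩ → x ≡ (⟨ x , y ⟩ * ⟨ y , y ⟩ ⁻¹) · y
  parallel {x} {y} y≢𝟎 e = ⟨⟩-ext λ z → trans (*-cancelˡ (pos⇒≢0 (⟨⟩-pos y≢𝟎))
    (combine₂ 1# (- ⟨ x , y ⟩ * ⟨ y , z ⟩) (residue⊥ z) (⁻¹-inverseˡ (pos⇒≢0 (⟨⟩-pos y≢𝟎)))
      (solve 5 (λ r q i s p → r :* p :- r :* (q :* i :* s) := :1 :* (r :* p :+ :- q :* s :- :0) :+ :- q :* s :* (i :* r :- :1)) refl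
        ⟨ y , y ⟩ ⟨ x , y ⟩ (⟨ y , y ⟩ ⁻¹) ⟨ y , z ⟩ ⟨ x , z ⟩)))
    (sym (⟨⟩-·ˡ (⟨ x , y ⟩ * ⟨ y , y ⟩ ⁻¹) y z))
    where
    residue⊥ : ∀ z → ⟨ y , y ⟩ * ⟨ x , z ⟩ + - ⟨ x , y ⟩ * ⟨ y , z ⟩ ≡ 0#
    residue⊥ z = trans (sym (⟨lin₂,⟩ ⟨ y , y ⟩ x (- ⟨ x , y ⟩) y z)) (trans
      (cong ⟨_, z ⟩ (⟨⟩-definite {residue x y} (trans (⟨residue,residue⟩ x y)
        (trans (cong (⟨ y , y ⟩ *_) (diff≡0 (sym e))) (zeroʳ ⟨ y , y ⟩))))) (⟨⟩-𝟎ˡ z))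

-- Symmetric forms: radical, completion of squares, coercivity.

module Forms (em : ExcludedMiddle 0ℓ) (ℝ : RealNumbers) where

  open Reals em ℝ
  private module Space (n : ℕ) = Vectors em ℝ n

  module _ {n : ℕ} where
    open Space n

    record IsForm (B : V → V → Carrier) : Set where
      field
        symmetric : ∀ x y → B x y ≡ B y x
        linear    : ∀ x k y z → B (x ⊕ k · y) z ≡ B x z + k * B y z

      linearʳ : ∀ z x k y → B z (x ⊕ k · y) ≡ B z x + k * B z y
      linearʳ z x k y = trans (symmetric z _) (trans (linear x k y z) (cong₂ (λ a b → a + k * b) (symmetric x z) (symmetric y z)))

      zero-left : ∀ z → B 𝟎 z ≡ 0#
      zero-left z = combine₁ (- 1#) (trans (cong (λ u → B u z) (sym (trans (cong (𝟎 ⊕_) (1· 𝟎)) (⊕-identityʳ 𝟎)))) (linear 𝟎 1# 𝟎 z))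
        (solve 1 (λ a → a :- :0 := :- :1 :* (a :- (a :+ :1 :* a))) refl (B 𝟎 z))

      nonneg : (∀ x → x ≢ 𝟎 → 0# < B x x) → ∀ x → 0# ≤ B x x
      nonneg definite x with em {x ≡ 𝟎}
      ... | yes refl = ≤-reflexive (sym (zero-left 𝟎))
      ... | no x≢𝟎   = proj₁ (definite x x≢𝟎)

      expand : ∀ x k y → B (x ⊕ k · y) (x ⊕ k · y) ≡ B x x + fromℕ 2 * (k * B x y) + k * k * B y y
      expand x k y = trans (linear x k y (x ⊕ k · y)) (trans (cong₂ (λ a b → a + k * b) (linearʳ x x k y) (trans (linearʳ y x k y) (cong (_+ k * B y y) (symmetric y x))))
        (solve 4 (λ k p q r → (p :+ k :* q) :+ k :* (q :+ k :* r) := p :+ :2 :* (k :* q) :+ k :* k :* r) refl k (B x x) (B x y) (B y y)))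

      -- With `q = B x y`, `r = B y y` and `s = 1 / (r + 1)`, nonnegativity at `x - q s y` becomes
      -- `- (r + 2) q² ≥ 0` after clearing denominators. The summand 1 keeps the denominator nonzero
      -- even if `r` vanishes.
      null-vector : (∀ x → 0# ≤ B x x) → ∀ {x} → B x x ≡ 0# → ∀ y → B x y ≡ 0#
      null-vector nonneg {x} e y = sq≡0 (≤-antisym
        (≤-by (0≤-cancel (0<+ 0<1 (0≤+ 0≤1 (nonneg y))) (0≤-by (0≤* (0≤sq (r + 1#)) (nonneg (x ⊕ (- q * s) · y)))
          (trans (cong ((r + 1#) * (r + 1#) *_) (expand x (- q * s) y)) (combine₂ ((r + 1#) * (r + 1#)) (q * q * (r * s * (r + 1#) + r - fromℕ 2 * (r + 1#))) e inv
            (solve 4 (λ p q r s → (r :+ :1) :* (r :+ :1) :* (p :+ :2 :* (:- q :* s :* q) :+ :- q :* s :* (:- q :* s) :* r) :- (:1 :+ (:1 :+ r)) :* :- (q :* q)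
              := (r :+ :1) :* (r :+ :1) :* (p :- :0) :+ q :* q :* (r :* s :* (r :+ :1) :+ r :- :2 :* (r :+ :1)) :* (s :* (r :+ :1) :- :1)) refl (B x x) q r s)))))
          (+-identityˡ _))
        (0≤sq q))
        where
        q = B x y
        r = B y y
        s = (r + 1#) ⁻¹
        inv : s * (r + 1#) ≡ 1#
        inv = ⁻¹-inverseˡ (pos⇒≢0 (0≤+0< (nonneg y) 0<1))

    -- The functional is the pairing with the vector `w = Σ f(e) e` over the standard basis, so
    -- Cauchy-Schwarz bounds it.
    functional-bound : ∀ (f : V → Carrier) → (∀ x k y → f (x ⊕ k · y) ≡ f x + k * f y) → ∃ λ M → 0# ≤ M × ∀ x → f x * f x ≤ M * ⟨ x , x ⟩
    functional-bound f linear = ⟨ w , w ⟩ , ⟨⟩-nonneg w , λ x → subst (λ p → p * p ≤ ⟨ w , w ⟩ * ⟨ x , x ⟩) (sym (riesz x)) (cauchy-schwarz w x)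
      where
      w : V
      w = vsum basis f
      f𝟎 : f 𝟎 ≡ 0#
      f𝟎 = combine₁ (- 1#) (trans (cong f (sym (trans (cong (𝟎 ⊕_) (1· 𝟎)) (⊕-identityʳ 𝟎)))) (linear 𝟎 1# 𝟎))
        (solve 1 (λ a → a :- :0 := :- :1 :* (a :- (a :+ :1 :* a))) refl (f 𝟎))
      f-vsum : ∀ vs c → f (vsum vs c) ≡ ∑ vs (λ v → c v * f v)
      f-vsum []       c = f𝟎
      f-vsum (v ∷ vs) c = trans (cong f (⊕-comm (c v · v) (vsum vs c))) (trans (linear (vsum vs c) (c v) v) (trans (+-comm _ _) (cong (c v * f v +_) (f-vsum vs c))))
      riesz : ∀ x → f x ≡ ⟨ w , x ⟩
      riesz x = begin
        f x                                    ≡⟨ cong f (⟨⟩-ext λ z → trans (sym (parseval x z)) (trans (∑-ext {xs = basis} λ e → cong (⟨ x , e ⟩ *_) (⟨⟩-sym z e)) (sym (⟨vsum,⟩ basis (λ e → ⟨ x , e ⟩) z)))) ⟩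
        f (vsum basis (λ e → ⟨ x , e ⟩))       ≡⟨ f-vsum basis (λ e → ⟨ x , e ⟩) ⟩
        ∑ basis (λ e → ⟨ x , e ⟩ * f e)        ≡⟨ ∑-ext {xs = basis} (λ e → trans (*-comm _ _) (cong (f e *_) (⟨⟩-sym x e))) ⟩
        ∑ basis (λ e → f e * ⟨ e , x ⟩)        ≡⟨ ⟨vsum,⟩ basis f x ⟨
        ⟨ w , x ⟩                              ∎

  module _ {n : ℕ} where
    private
      module N = Space n
      module N⁺ = Space (suc n)

    -- Completing the square with respect to the first basis vector.
    module Square {B : N⁺.V → N⁺.V → Carrier} (form : IsForm B) (definite : ∀ x → x ≢ N⁺.𝟎 → 0# < B x x) where
      open IsForm form

      e₀ : N⁺.V
      e₀ = 1# ∷ N.𝟎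

      a : Carrier
      a = B e₀ e₀

      a-pos : 0# < a
      a-pos = definite e₀ (λ e → 0≢1 (sym (cong Vec.head e)))

      ι-linear : ∀ x k y → 0# ∷ (x N.⊕ k N.· y) ≡ (0# ∷ x) N⁺.⊕ k N⁺.· (0# ∷ y)
      ι-linear x k y = cong (_∷ (x N.⊕ k N.· y)) (sym (trans (+-identityˡ _) (zeroʳ k)))

      b : N.V → Carrier
      b x = B e₀ (0# ∷ x)

      b-linear : ∀ x k y → b (x N.⊕ k N.· y) ≡ b x + k * b y
      b-linear x k y = trans (cong (B e₀) (ι-linear x k y)) (linearʳ e₀ (0# ∷ x) k (0# ∷ y))

      -- The Schur complement of the entry `a`, multiplied by `a` so that no division occurs.
      B′ : N.V → N.V → Carrier
      B′ x y = a * B (0# ∷ x) (0# ∷ y) - b x * b y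

      form′ : IsForm B′
      form′ = record
        { symmetric = λ x y → cong₂ (λ p q → a * p - q) (symmetric _ _) (*-comm _ _)
        ; linear    = λ x k y z → trans (cong₂ (λ p q → a * p - q * b z) (trans (cong (λ u → B u (0# ∷ z)) (ι-linear x k y)) (linear (0# ∷ x) k (0# ∷ y) (0# ∷ z))) (b-linear x k y))
            (solve 7 (λ a p k q bx by bz → a :* (p :+ k :* q) :- (bx :+ k :* by) :* bz := (a :* p :- bx :* bz) :+ k :* (a :* q :- by :* bz)) refl
              a (B (0# ∷ x) (0# ∷ z)) k (B (0# ∷ y) (0# ∷ z)) (b x) (b y) (b z))
        }

      split : ∀ x₀ x → x₀ ∷ x ≡ (0# ∷ x) N⁺.⊕ x₀ N⁺.· e₀
      split x₀ x = cong₂ _∷_ (solve 1 (λ x → x := :0 :+ x :* :1) refl x₀) (N.⟨⟩-ext λ z → sym (trans (N.⟨⟩-⊕·ˡ x x₀ N.𝟎 z)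
        (trans (cong (λ p → N.⟨ x , z ⟩ + x₀ * p) (N.⟨⟩-𝟎ˡ z)) (solve 2 (λ p k → p :+ k :* :0 := p) refl N.⟨ x , z ⟩ x₀))))

      square : ∀ x₀ x → a * B (x₀ ∷ x) (x₀ ∷ x) ≡ (a * x₀ + b x) * (a * x₀ + b x) + B′ x x
      square x₀ x = trans (cong (a *_) (trans (cong (λ u → B u u) (split x₀ x)) (trans (expand (0# ∷ x) x₀ e₀) (cong (λ p → B (0# ∷ x) (0# ∷ x) + fromℕ 2 * (x₀ * p) + x₀ * x₀ * a) (symmetric (0# ∷ x) e₀)))))
        (solve 4 (λ a x b r → a :* (r :+ :2 :* (x :* b) :+ x :* x :* a) := (a :* x :+ b) :* (a :* x :+ b) :+ (a :* r :- b :* b)) refl a x₀ (b x) (B (0# ∷ x) (0# ∷ x)))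

      -- The first coordinate `- b x / a` makes the square in `square` vanish, so `B′ x x` is `a`
      -- times the value of `B` at a nonzero vector.
      definite′ : ∀ x → x ≢ N.𝟎 → 0# < B′ x x
      definite′ x x≢ = subst (0# <_) (trans (square (- b x * a ⁻¹) x) (combine₁ (- b x * (a * (- b x * a ⁻¹) + b x)) (⁻¹-inverseˡ (pos⇒≢0 a-pos))
          (solve 4 (λ a b i r → (a :* (:- b :* i) :+ b) :* (a :* (:- b :* i) :+ b) :+ r :- r := :- b :* (a :* (:- b :* i) :+ b) :* (i :* a :- :1)) refl a (b x) (a ⁻¹) (B′ x x))))
        (0<* a-pos (definite ((- b x * a ⁻¹) ∷ x) (x≢ ∘ cong Vec.tail)))

  -- The substitute for compactness of the unit sphere: a definite form dominates a multiple of the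
  -- squared length. Induction on the dimension, splitting off one completed square at a time.
  coercive : ∀ n {B} → IsForm {n} B → (∀ x → x ≢ Space.𝟎 n → 0# < B x x) → ∃ λ K → 0# ≤ K × ∀ x → Space.⟨_,_⟩ n x x ≤ K * B x x
  coercive zero    {B} form definite = 0# , ≤-refl , λ { [] → ≤-reflexive (sym (zeroˡ (B [] []))) }
  coercive (suc n) {B} form definite =
    let (K , 0≤K , h) = coercive n form′ definite′
        (M , 0≤M , h′) = functional-bound b b-linear
    in bound K 0≤K h M 0≤M h′
    where
    open Square form definite
    module N = Space n
    bound : ∀ K → 0# ≤ K → (∀ x → N.⟨ x , x ⟩ ≤ K * B′ x x) → ∀ M → 0# ≤ M → (∀ x → b x * b x ≤ M * N.⟨ x , x ⟩) →
            ∃ λ K → 0# ≤ K × ∀ x → Space.⟨_,_⟩ (suc n) x x ≤ K * B x x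
    bound K 0≤K h M 0≤M h′ = a ⁻¹ * L , 0≤* (proj₁ (0<⁻¹ a-pos)) 0≤L , estimate
      where
      -- Write `q = ⟨ x , x ⟩`, `β = B′ x x` and `s = a x₀ + b x`. Then
      -- `(s - b x)² ≤ 2 s² + 2 (b x)²`, `(b x)² ≤ M q` and `q ≤ K β` give `a² (x₀² + q) ≤ 2 s² + (2
      -- M + a²) K β ≤ L (s² + β)`, and `s² + β` is `a` times the value of `B`.
      L = fromℕ 2 + (fromℕ 2 * M + a * a) * K
      0≤T : 0# ≤ fromℕ 2 * M + a * a
      0≤T = 0≤+ (0≤* 0≤2 0≤M) (0≤sq a)
      0≤L : 0# ≤ L
      0≤L = 0≤+ 0≤2 (0≤* 0≤T 0≤K)
      estimate : ∀ x → Space.⟨_,_⟩ (suc n) x x ≤ a ⁻¹ * L * B x x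
      estimate (x₀ ∷ x) = 0≤⇒≤ (0≤-cancel (0<* a-pos a-pos) (0≤-by
        (0≤+ (0≤+ (0≤+ (0≤+ (0≤* (0≤* 0≤T 0≤K) (0≤sq s)) (0≤sq (s + b x))) (0≤* 0≤2 (IsForm.nonneg form′ definite′ x)))
                  (0≤* 0≤T (≤⇒0≤ (h x)))) (0≤* 0≤2 (≤⇒0≤ (h′ x))))
        (sym (combine₂ (a * L * Q) L (⁻¹-inverseˡ (pos⇒≢0 a-pos)) (square x₀ x)
          (solve 9 (λ a i K M b x q Q β →
              let T = :2 :* M :+ a :* a
                  L = :2 :+ T :* K
                  s = a :* x :+ b
              in a :* a :* (i :* L :* Q :- (x :* x :+ q)) :- (T :* K :* (s :* s) :+ (s :+ b) :* (s :+ b) :+ :2 :* β :+ T :* (K :* β :- q) :+ :2 :* (M :* q :- b :* b))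
                 := a :* L :* Q :* (i :* a :- :1) :+ L :* (a :* Q :- (s :* s :+ β))) refl
            a (a ⁻¹) K M (b x) x₀ N.⟨ x , x ⟩ Q (B′ x x))))))
        where
        s = a * x₀ + b x
        Q = B (x₀ ∷ x) (x₀ ∷ x)

module Theory (em : ExcludedMiddle 0ℓ) (ℝ : RealNumbers) (ℓ : ℕ) where

  open Reals em ℝ
  open Vectors em ℝ ℓ public
  open Forms em ℝ

  -- Linear combinations, spans and subspaces.

  lincomb-+ : ∀ {n} (cs ds : Vec Carrier n) vs → lincomb (zipWith _+_ cs ds) vs ≡ lincomb cs vs ⊕ lincomb ds vs
  lincomb-+ []       []       []       = sym (⊕-identityˡ 𝟎)
  lincomb-+ (c ∷ cs) (d ∷ ds) (v ∷ vs) = ⟨⟩-ext λ z → begin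
    ⟨ (c + d) · v ⊕ lincomb (zipWith _+_ cs ds) vs , z ⟩       ≡⟨ cong (λ u → ⟨ (c + d) · v ⊕ u , z ⟩) (lincomb-+ cs ds vs) ⟩
    ⟨ (c + d) · v ⊕ (x ⊕ y) , z ⟩                              ≡⟨ ⟨⟩-⊕ˡ ((c + d) · v) (x ⊕ y) z ⟩
    ⟨ (c + d) · v , z ⟩ + ⟨ x ⊕ y , z ⟩                        ≡⟨ cong₂ _+_ (⟨⟩-·ˡ (c + d) v z) (⟨⟩-⊕ˡ x y z) ⟩
    (c + d) * ⟨ v , z ⟩ + (⟨ x , z ⟩ + ⟨ y , z ⟩)              ≡⟨ solve 5 (λ c d p q r → (c :+ d) :* p :+ (q :+ r) := (c :* p :+ q) :+ (d :* p :+ r)) refl c d ⟨ v , z ⟩ ⟨ x , z ⟩ ⟨ y , z ⟩ ⟩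
    (c * ⟨ v , z ⟩ + ⟨ x , z ⟩) + (d * ⟨ v , z ⟩ + ⟨ y , z ⟩)  ≡⟨ cong₂ _+_ (part c x z) (part d y z) ⟨
    ⟨ c · v ⊕ x , z ⟩ + ⟨ d · v ⊕ y , z ⟩                      ≡⟨ ⟨⟩-⊕ˡ (c · v ⊕ x) (d · v ⊕ y) z ⟨
    ⟨ (c · v ⊕ x) ⊕ (d · v ⊕ y) , z ⟩                          ∎
    where
    x = lincomb cs vs
    y = lincomb ds vs
    part : ∀ c x z → ⟨ c · v ⊕ x , z ⟩ ≡ c * ⟨ v , z ⟩ + ⟨ x , z ⟩
    part c x z = trans (⟨⟩-⊕ˡ (c · v) x z) (cong (_+ ⟨ x , z ⟩) (⟨⟩-·ˡ c v z))

  lincomb-* : ∀ {n} k (cs : Vec Carrier n) vs → lincomb (Vec.map (k *_) cs) vs ≡ k · lincomb cs vs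
  lincomb-* k []       []       = ⟨⟩-ext λ z → trans (⟨⟩-𝟎ˡ z) (sym (trans (⟨⟩-·ˡ k 𝟎 z) (trans (cong (k *_) (⟨⟩-𝟎ˡ z)) (zeroʳ k))))
  lincomb-* k (c ∷ cs) (v ∷ vs) = ⟨⟩-ext λ z → begin
    ⟨ (k * c) · v ⊕ lincomb (Vec.map (k *_) cs) vs , z ⟩ ≡⟨ cong (λ u → ⟨ (k * c) · v ⊕ u , z ⟩) (lincomb-* k cs vs) ⟩
    ⟨ (k * c) · v ⊕ k · x , z ⟩                          ≡⟨ ⟨lin₂,⟩ (k * c) v k x z ⟩
    k * c * ⟨ v , z ⟩ + k * ⟨ x , z ⟩                    ≡⟨ solve 4 (λ k c p q → k :* c :* p :+ k :* q := k :* (c :* p :+ q)) refl k c ⟨ v , z ⟩ ⟨ x , z ⟩ ⟩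
    k * (c * ⟨ v , z ⟩ + ⟨ x , z ⟩)                      ≡⟨ cong (k *_) (trans (⟨⟩-⊕ˡ (c · v) x z) (cong (_+ ⟨ x , z ⟩) (⟨⟩-·ˡ c v z))) ⟨
    k * ⟨ c · v ⊕ x , z ⟩                                ≡⟨ ⟨⟩-·ˡ k (c · v ⊕ x) z ⟨
    ⟨ k · (c · v ⊕ x) , z ⟩                              ∎
    where x = lincomb cs vs

  record Subspace (P : Pred V 0ℓ) : Set where
    field
      has-𝟎  : P 𝟎
      has-⊕· : ∀ x k y → P x → P y → P (x ⊕ k · y)

    has-· : ∀ k y → P y → P (k · y)
    has-· k y p = subst P (⊕-identityˡ (k · y)) (has-⊕· 𝟎 k y has-𝟎 p)

    has-⊕ : ∀ x y → P x → P y → P (x ⊕ y)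
    has-⊕ x y p q = subst (λ y → P (x ⊕ y)) (1· y) (has-⊕· x 1# y p q)

    has-neg : ∀ y → P y → P (neg y)
    has-neg y p = subst P (sym (neg≡ y)) (has-· (- 1#) y p)

    has-reflect : ∀ α v → P α → P v → P (reflect α v)
    has-reflect α v p q = has-⊕ v (neg (cartan α v · α)) q (has-neg (cartan α v · α) (has-· (cartan α v) α p))

  spanVec-subspace : ∀ {n} (vs : Vec V n) → Subspace (SpanVec vs)
  spanVec-subspace {n} vs = record
    { has-𝟎  = replicate n 0# , sym (zero-comb vs)
    ; has-⊕· = λ { x k y (cs , refl) (ds , refl) →
        zipWith _+_ cs (Vec.map (k *_) ds) ,
        sym (trans (lincomb-+ cs (Vec.map (k *_) ds) vs) (cong (lincomb cs vs ⊕_) (lincomb-* k ds vs))) }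
    }
    where
    zero-comb : ∀ {n} (vs : Vec V n) → lincomb (replicate n 0#) vs ≡ 𝟎
    zero-comb []       = refl
    zero-comb (v ∷ vs) = trans (cong₂ _⊕_ (0· v) (zero-comb vs)) (⊕-identityˡ 𝟎)

  span-subspace : ∀ Γ → Subspace (Span Γ)
  span-subspace Γ = spanVec-subspace (fromList Γ)

  spanVec-here : ∀ {n} v (vs : Vec V n) → SpanVec (v ∷ vs) v
  spanVec-here v vs with Subspace.has-𝟎 (spanVec-subspace vs)
  ... | cs , e = 1# ∷ cs , sym (trans (cong₂ _⊕_ (1· v) (sym e)) (⊕-identityʳ v))

  spanVec-there : ∀ {n} v (vs : Vec V n) {w} → SpanVec vs w → SpanVec (v ∷ vs) w
  spanVec-there v vs (cs , refl) = 0# ∷ cs , sym (trans (cong (_⊕ lincomb cs vs) (0· v)) (⊕-identityˡ _))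

  ∈⇒Span : ∀ {Γ v} → v ∈ Γ → Span Γ v
  ∈⇒Span {v ∷ Γ} (here refl) = spanVec-here v (fromList Γ)
  ∈⇒Span {u ∷ Γ} (there h)   = spanVec-there u (fromList Γ) (∈⇒Span h)

  Span-least : ∀ {Γ P} → Subspace P → (∀ {v} → v ∈ Γ → P v) → ∀ {v} → Span Γ v → P v
  Span-least {[]}    S h ([] , refl) = Subspace.has-𝟎 S
  Span-least {u ∷ Γ} S h (c ∷ cs , refl) =
    Subspace.has-⊕ S (c · u) (lincomb cs (fromList Γ)) (Subspace.has-· S c u (h (here refl))) (Span-least {Γ} S (h ∘ there) (cs , refl))

  linear-subspace : ∀ {f : V → Carrier} → (∀ x k y → f (x ⊕ k · y) ≡ f x + k * f y) → f 𝟎 ≡ 0# → Subspace (λ v → f v ≡ 0#)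
  linear-subspace f-linear f𝟎 = record
    { has-𝟎  = f𝟎
    ; has-⊕· = λ x k y p q → trans (f-linear x k y) (trans (cong₂ (λ a b → a + k * b) p q) (trans (+-identityˡ _) (zeroʳ k)))
    }

  ⊥-subspace : ∀ u → Subspace (λ v → ⟨ u , v ⟩ ≡ 0#)
  ⊥-subspace u = linear-subspace (⟨⟩-⊕·ʳ u) (⟨⟩-𝟎ʳ u)

  Span-⊥⇒𝟎 : ∀ {Γ v} → Span Γ v → (∀ {u} → u ∈ Γ → ⟨ v , u ⟩ ≡ 0#) → v ≡ 𝟎
  Span-⊥⇒𝟎 {v = v} s h = ⟨⟩-definite (Span-least (⊥-subspace v) h s)


  -- Sections of a set of vectors, and irreducibility as connectedness.

  ∈-∣⁺ : ∀ (P : Pred V 0ℓ) {Γ v} → v ∈ Γ → P v → v ∈ Γ ∣ P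
  ∈-∣⁺ P = ∈-filter⁺ (λ v → em {P v})

  ∈-∣⁻ : ∀ Γ (P : Pred V 0ℓ) {v} → v ∈ Γ ∣ P → v ∈ Γ × P v
  ∈-∣⁻ Γ P = ∈-filter⁻ (λ v → em {P v}) {xs = Γ}

  ∣-unique : ∀ {P : Pred V 0ℓ} {Γ} → Unique Γ → Unique (Γ ∣ P)
  ∣-unique {P} = Unique.filter⁺ (λ v → em {P v})

  ∣-partition : ∀ Γ (P : Pred V 0ℓ) → Γ ↭ (Γ ∣ P) ++ (Γ ∣ (λ v → ¬ P v))
  ∣-partition []      P = ↭-refl
  ∣-partition (v ∷ Γ) P with em {P v} | em {¬ P v}
  ... | yes p | yes q = ⊥-elim (q p)
  ... | yes p | no ¬q = ↭.prep v (∣-partition Γ P)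
  ... | no ¬p | yes q = ↭-trans (↭.prep v (∣-partition Γ P)) (↭-sym (shift v (Γ ∣ P) _))
  ... | no ¬p | no ¬q = ⊥-elim (¬q ¬p)

  nonempty : ∀ {A : Set} {xs : List A} {x} → x ∈ xs → xs ≢ []
  nonempty () refl

  -- If `P` failed somewhere, the vectors with and without `P` would form an orthogonal
  -- decomposition. This turns irreducibility into an induction along pairs of vectors that are not
  -- orthogonal.
  irreducible-connected : ∀ {Γ α} (P : Pred V 0ℓ) → Irreducible Γ → α ∈ Γ → P α →
    (∀ {β γ} → β ∈ Γ → γ ∈ Γ → P β → ¬ P γ → ⟨ β , γ ⟩ ≡ 0#) → ∀ {β} → β ∈ Γ → P β
  irreducible-connected {Γ} P (_ , irr) α∈ Pα orth {β} β∈ with em {P β}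
  ... | yes p = p
  ... | no ¬p = ⊥-elim (irr (Γ ∣ P , Γ ∣ (λ v → ¬ P v) , nonempty (∈-∣⁺ P α∈ Pα) , nonempty (∈-∣⁺ (λ v → ¬ P v) β∈ ¬p) , ∣-partition Γ P ,
      λ β γ β∈ γ∈ → orth (proj₁ (∈-∣⁻ Γ P β∈)) (proj₁ (∈-∣⁻ Γ (λ v → ¬ P v) γ∈)) (proj₂ (∈-∣⁻ Γ P β∈)) (proj₂ (∈-∣⁻ Γ (λ v → ¬ P v) γ∈))))

  -- The squared cosine of the angle, kept free of square roots.
  κ : V → V → Carrier
  κ α β = ⟨ α , β ⟩ * ⟨ α , β ⟩ * (⟨ α , α ⟩ ⁻¹ * ⟨ β , β ⟩ ⁻¹)

  κ-sym : ∀ α β → κ α β ≡ κ β α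
  κ-sym α β = cong₂ _*_ (cong₂ _*_ (⟨⟩-sym α β) (⟨⟩-sym α β)) (*-comm _ _)

  κ-⊥ : ∀ {α β} → ⟨ α , β ⟩ ≡ 0# → κ α β ≡ 0#
  κ-⊥ {α} {β} e = trans (cong (λ p → p * p * (⟨ α , α ⟩ ⁻¹ * ⟨ β , β ⟩ ⁻¹)) e) (solve 1 (λ i → :0 :* :0 :* i := :0) refl (⟨ α , α ⟩ ⁻¹ * ⟨ β , β ⟩ ⁻¹))

  κ-spec : ∀ {α β} → α ≢ 𝟎 → β ≢ 𝟎 → κ α β * (⟨ α , α ⟩ * ⟨ β , β ⟩) ≡ ⟨ α , β ⟩ * ⟨ α , β ⟩
  κ-spec {α} {β} α≢𝟎 β≢𝟎 = combine₂ (pp * (⟨ β , β ⟩ ⁻¹ * ⟨ β , β ⟩)) pp (⁻¹-inverseˡ (pos⇒≢0 (⟨⟩-pos α≢𝟎))) (⁻¹-inverseˡ (pos⇒≢0 (⟨⟩-pos β≢𝟎)))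
    (solve 5 (λ p a b i j → p :* (i :* j) :* (a :* b) :- p := p :* (j :* b) :* (i :* a :- :1) :+ p :* (j :* b :- :1)) refl
      pp ⟨ α , α ⟩ ⟨ β , β ⟩ (⟨ α , α ⟩ ⁻¹) (⟨ β , β ⟩ ⁻¹))
    where pp = ⟨ α , β ⟩ * ⟨ α , β ⟩

  κ-self : ∀ {α} → α ≢ 𝟎 → κ α α ≡ 1#
  κ-self {α} h = *-cancelˡ (pos⇒≢0 (0<* (⟨⟩-pos h) (⟨⟩-pos h))) (trans (*-comm _ _) (trans (κ-spec h h) (sym (*-identityʳ _))))

  κ-negˡ : ∀ α β → κ (neg α) β ≡ κ α β
  κ-negˡ α β = cong₂ (λ p a → p * (a ⁻¹ * ⟨ β , β ⟩ ⁻¹)) (trans (cong (λ p → p * p) (⟨⟩-negˡ α β)) (solve 1 (λ p → :- p :* :- p := p :* p) refl ⟨ α , β ⟩)) (⟨neg,neg⟩ α α)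

  cartan-product : ∀ {α β} → α ≢ 𝟎 → β ≢ 𝟎 → cartan α β * cartan β α ≡ fromℕ 2 * fromℕ 2 * κ α β
  cartan-product {α} {β} α≢𝟎 β≢𝟎 = trans (cong (λ p → cartan α β * (fromℕ 2 * p / ⟨ β , β ⟩)) (⟨⟩-sym β α))
    (solve 4 (λ t p a b → (t :* p :* a) :* (t :* p :* b) := t :* t :* (p :* p :* (a :* b))) refl (fromℕ 2) ⟨ α , β ⟩ (⟨ α , α ⟩ ⁻¹) (⟨ β , β ⟩ ⁻¹))

  -- The weights give every root of `Γ` the same share of the trace, whatever its length, so the
  -- trace counts roots.
  form : List V → V → V → Carrier
  form Γ v w = ∑ Γ λ α → ⟨ α , v ⟩ * ⟨ α , w ⟩ * ⟨ α , α ⟩ ⁻¹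

  form-sym : ∀ Γ v w → form Γ v w ≡ form Γ w v
  form-sym Γ v w = ∑-ext {xs = Γ} λ α → cong (_* ⟨ α , α ⟩ ⁻¹) (*-comm _ _)

  form-⊕·ˡ : ∀ Γ x k y w → form Γ (x ⊕ k · y) w ≡ form Γ x w + k * form Γ y w
  form-⊕·ˡ Γ x k y w = trans (∑-ext {xs = Γ} λ α → trans (cong (λ p → p * ⟨ α , w ⟩ * ⟨ α , α ⟩ ⁻¹) (⟨⟩-⊕·ʳ α x k y))
      (solve 5 (λ p k q w i → (p :+ k :* q) :* w :* i := p :* w :* i :+ k :* (q :* w :* i)) refl ⟨ α , x ⟩ k ⟨ α , y ⟩ ⟨ α , w ⟩ (⟨ α , α ⟩ ⁻¹)))
    (trans (∑-+ Γ (λ α → ⟨ α , x ⟩ * ⟨ α , w ⟩ * ⟨ α , α ⟩ ⁻¹) (λ α → k * (⟨ α , y ⟩ * ⟨ α , w ⟩ * ⟨ α , α ⟩ ⁻¹)))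
      (cong (form Γ x w +_) (∑-*ˡ Γ k λ α → ⟨ α , y ⟩ * ⟨ α , w ⟩ * ⟨ α , α ⟩ ⁻¹)))

  form-𝟎ˡ : ∀ Γ w → form Γ 𝟎 w ≡ 0#
  form-𝟎ˡ Γ w = ∑-zero {xs = Γ} λ {α} _ → trans (cong (λ p → p * ⟨ α , w ⟩ * ⟨ α , α ⟩ ⁻¹) (⟨⟩-𝟎ʳ α)) (solve 2 (λ p i → :0 :* p :* i := :0) refl ⟨ α , w ⟩ (⟨ α , α ⟩ ⁻¹))

  ∑-κ : ∀ Γ β → ∑ Γ (λ α → κ α β) ≡ form Γ β β * ⟨ β , β ⟩ ⁻¹
  ∑-κ Γ β = trans (∑-ext {xs = Γ} λ α → sym (*-assoc _ _ _)) (∑-*ʳ Γ (⟨ β , β ⟩ ⁻¹) λ α → ⟨ α , β ⟩ * ⟨ α , β ⟩ * ⟨ α , α ⟩ ⁻¹)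

  -- Eigenvalues of the invariant form of a root system.

  module RootSystem {Γ : List V} (rs : IsRootSystem Γ) where
    open IsRootSystem rs public

    root-≢𝟎 : ∀ {α} → α ∈ Γ → α ≢ 𝟎
    root-≢𝟎 h refl = nonzero h

    neg-root : ∀ {α} → α ∈ Γ → neg α ∈ Γ
    neg-root {α} h = subst (_∈ Γ) (reflect-self (root-≢𝟎 h)) (closed α α h h)

    restrict : ∀ P → (∀ α β → P α → P β → P (reflect α β)) → IsRootSystem (Γ ∣ P)
    restrict P h = record
      { unique  = ∣-unique unique
      ; nonzero = λ p → nonzero (proj₁ (∈-∣⁻ Γ P p))
      ; reduced = λ α c p q → reduced α c (proj₁ (∈-∣⁻ Γ P p)) (proj₁ (∈-∣⁻ Γ P q))
      ; closed  = λ α β p q → ∈-∣⁺ P (closed α β (proj₁ (∈-∣⁻ Γ P p)) (proj₁ (∈-∣⁻ Γ P q))) (h α β (proj₂ (∈-∣⁻ Γ P p)) (proj₂ (∈-∣⁻ Γ P q)))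
      }

    ∑-reflect : ∀ {ρ} → ρ ∈ Γ → (f : V → Carrier) → ∑ Γ (f ∘ reflect ρ) ≡ ∑ Γ f
    ∑-reflect {ρ} ρ∈ f = trans (sym (∑-map (reflect ρ) Γ f)) (∑-↭ (same-set⇒↭
      (Unique.map⁺ (reflect-injective (root-≢𝟎 ρ∈)) unique) unique
      (λ h → let (v , v∈ , e) = ∈-map⁻ (reflect ρ) h in subst (_∈ Γ) (sym e) (closed ρ v ρ∈ v∈))
      (λ {v} h → subst (_∈ map (reflect ρ) Γ) (reflect-involutive v (root-≢𝟎 ρ∈)) (∈-map⁺ (reflect ρ) (closed ρ v ρ∈ h)))) f)

    form-reflect : ∀ {ρ} → ρ ∈ Γ → ∀ v w → form Γ (reflect ρ v) (reflect ρ w) ≡ form Γ v w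
    form-reflect {ρ} ρ∈ v w = trans
      (sym (∑-reflect ρ∈ λ α → ⟨ α , reflect ρ v ⟩ * ⟨ α , reflect ρ w ⟩ * ⟨ α , α ⟩ ⁻¹))
      (∑-ext {xs = Γ} λ α → cong₂ _*_ (cong₂ _*_ (reflect-isometry α v ρ≢) (reflect-isometry α w ρ≢)) (cong _⁻¹ (reflect-isometry α α ρ≢)))
      where ρ≢ = root-≢𝟎 ρ∈

    -- Comparing form Γ ρ w with its image under the reflection in ρ shows that
    -- ρ is an eigenvector of the form.
    eigenvalue : V → Carrier
    eigenvalue ρ = form Γ ρ ρ * ⟨ ρ , ρ ⟩ ⁻¹

    eigen : ∀ {ρ} → ρ ∈ Γ → ∀ w → form Γ ρ w ≡ eigenvalue ρ * ⟨ ρ , w ⟩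
    eigen {ρ} ρ∈ w = *-cancelˡ (pos⇒≢0 (0<* 0<2 (⟨⟩-pos ρ≢)))
      (combine₃ ⟨ ρ , ρ ⟩ (form Γ ρ ρ) (- (fromℕ 2 * form Γ ρ ρ * ⟨ ρ , w ⟩)) twice (cartan-spec w ρ≢) (⁻¹-inverseˡ (pos⇒≢0 (⟨⟩-pos ρ≢)))
        (solve 7 (λ t r f c g i p → t :* r :* f :- t :* r :* (g :* i :* p) :=
            r :* (t :* f :- c :* g) :+ g :* (c :* r :- t :* p) :+ :- (t :* g :* p) :* (i :* r :- :1)) refl
          (fromℕ 2) ⟨ ρ , ρ ⟩ (form Γ ρ w) (cartan ρ w) (form Γ ρ ρ) (⟨ ρ , ρ ⟩ ⁻¹) ⟨ ρ , w ⟩))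
      where
      ρ≢ = root-≢𝟎 ρ∈
      image : form Γ (reflect ρ ρ) (reflect ρ w) ≡ - 1# * (form Γ ρ w + - cartan ρ w * form Γ ρ ρ)
      image = begin
        form Γ (reflect ρ ρ) (reflect ρ w)  ≡⟨ cong₂ (form Γ) (trans (reflect-self ρ≢) (trans (neg≡ ρ) (sym (⊕-identityˡ _)))) (cong (w ⊕_) (trans (neg≡ _) (·-assoc _ _ ρ))) ⟩
        form Γ (𝟎 ⊕ (- 1#) · ρ) w′          ≡⟨ form-⊕·ˡ Γ 𝟎 (- 1#) ρ w′ ⟩
        form Γ 𝟎 w′ + - 1# * form Γ ρ w′    ≡⟨ trans (cong (_+ - 1# * form Γ ρ w′) (form-𝟎ˡ Γ w′)) (+-identityˡ _) ⟩
        - 1# * form Γ ρ w′                  ≡⟨ cong (- 1# *_) (trans (form-sym Γ ρ w′) (form-⊕·ˡ Γ w (- 1# * cartan ρ w) ρ ρ)) ⟩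
        - 1# * (form Γ w ρ + - 1# * cartan ρ w * form Γ ρ ρ) ≡⟨ cong₂ (λ a b → - 1# * (a + b * form Γ ρ ρ)) (form-sym Γ w ρ) (solve 1 (λ c → :- :1 :* c := :- c) refl (cartan ρ w)) ⟩
        - 1# * (form Γ ρ w + - cartan ρ w * form Γ ρ ρ) ∎
        where w′ = w ⊕ (- 1# * cartan ρ w) · ρ
      twice : fromℕ 2 * form Γ ρ w ≡ cartan ρ w * form Γ ρ ρ
      twice = combine₁ 1# (trans (sym (form-reflect ρ∈ ρ w)) image)
        (solve 3 (λ f c g → :2 :* f :- c :* g := :1 :* (f :- :- :1 :* (f :+ :- c :* g))) refl (form Γ ρ w) (cartan ρ w) (form Γ ρ ρ))

    -- Eigenvectors of a symmetric form with distinct eigenvalues are orthogonal: the value at `ρ`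
    -- and `σ` is computed from either side.
    eigenvalue-unique : ∀ {σ} → σ ∈ Γ → ∀ {b} ρ → (∀ w → form Γ ρ w ≡ b * ⟨ ρ , w ⟩) → ⟨ ρ , σ ⟩ ≢ 0# → b ≡ eigenvalue σ
    eigenvalue-unique {σ} σ∈ {b} ρ eig h = *-cancelˡ h (begin
      ⟨ ρ , σ ⟩ * b              ≡⟨ *-comm _ _ ⟩
      b * ⟨ ρ , σ ⟩              ≡⟨ eig σ ⟨
      form Γ ρ σ                 ≡⟨ form-sym Γ ρ σ ⟩
      form Γ σ ρ                 ≡⟨ eigen σ∈ ρ ⟩
      eigenvalue σ * ⟨ σ , ρ ⟩   ≡⟨ trans (*-comm _ _) (cong (_* eigenvalue σ) (⟨⟩-sym σ ρ)) ⟩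
      ⟨ ρ , σ ⟩ * eigenvalue σ   ∎)

    eigenvalue-cong : ∀ {ρ σ} → ρ ∈ Γ → σ ∈ Γ → ⟨ ρ , σ ⟩ ≢ 0# → eigenvalue ρ ≡ eigenvalue σ
    eigenvalue-cong {ρ} ρ∈ σ∈ = eigenvalue-unique σ∈ ρ (eigen ρ∈)

    eigenvalue≡∑κ : ∀ ρ → eigenvalue ρ ≡ ∑ Γ (λ α → κ α ρ)
    eigenvalue≡∑κ ρ = sym (∑-κ Γ ρ)

    module _ (irr : Irreducible Γ) where
      eigenvalue-const : ∀ {ρ σ} → ρ ∈ Γ → σ ∈ Γ → eigenvalue ρ ≡ eigenvalue σ
      eigenvalue-const {ρ} ρ∈ σ∈ = sym (irreducible-connected (λ σ → eigenvalue σ ≡ eigenvalue ρ) irr ρ∈ refl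
        (λ β∈ γ∈ p ¬q → stable λ ne → ¬q (trans (sym (eigenvalue-cong β∈ γ∈ ne)) p)) σ∈)

      -- The trace of the form, computed in an orthonormal basis.
      length≡eigenvalue*ℓ : Spanning Γ → ∀ {ρ} → ρ ∈ Γ → fromℕ (length Γ) ≡ eigenvalue ρ * fromℕ ℓ
      length≡eigenvalue*ℓ spanning {ρ} ρ∈ = begin
        fromℕ (length Γ)
          ≡⟨ ∑-length Γ ⟨
        ∑ Γ (λ _ → 1#)
          ≡⟨ ∑-cong {xs = Γ} (λ {α} α∈ → trans (sym (*-inverse _ (pos⇒≢0 (⟨⟩-pos (root-≢𝟎 α∈))))) (trans (cong (_* ⟨ α , α ⟩ ⁻¹) (sym (parseval α α))) (sym (∑-*ʳ basis (⟨ α , α ⟩ ⁻¹) λ e → ⟨ α , e ⟩ * ⟨ α , e ⟩)))) ⟩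
        ∑ Γ (λ α → ∑ basis λ e → ⟨ α , e ⟩ * ⟨ α , e ⟩ * ⟨ α , α ⟩ ⁻¹)
          ≡⟨ ∑-swap Γ basis _ ⟩
        ∑ basis (λ e → form Γ e e)
          ≡⟨ ∑-cong {xs = basis} (λ {e} e∈ → trans (all-eigen e e) (trans (cong (eigenvalue ρ *_) (basis-unit e∈)) (*-identityʳ _))) ⟩
        ∑ basis (λ _ → eigenvalue ρ)
          ≡⟨ ∑-const basis _ ⟩
        fromℕ (length basis) * eigenvalue ρ
          ≡⟨ trans (*-comm _ _) (cong (λ n → eigenvalue ρ * fromℕ n) basis-length) ⟩
        eigenvalue ρ * fromℕ ℓ ∎
        where
        all-eigen : ∀ v w → form Γ v w ≡ eigenvalue ρ * ⟨ v , w ⟩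
        all-eigen v w = cancel-diff (Span-least {Γ} {λ v → form Γ v w - eigenvalue ρ * ⟨ v , w ⟩ ≡ 0#}
          (linear-subspace
            (λ x k y → trans (cong₂ (λ a b → a - eigenvalue ρ * b) (form-⊕·ˡ Γ x k y w) (⟨⟩-⊕·ˡ x k y w))
              (solve 6 (λ a k b e p q → (a :+ k :* b) :- e :* (p :+ k :* q) := (a :- e :* p) :+ k :* (b :- e :* q)) refl
                (form Γ x w) k (form Γ y w) (eigenvalue ρ) ⟨ x , w ⟩ ⟨ y , w ⟩))
            (trans (cong₂ (λ a b → a - eigenvalue ρ * b) (form-𝟎ˡ Γ w) (⟨⟩-𝟎ˡ w)) (solve 1 (λ e → :0 :- e :* :0 := :0) refl (eigenvalue ρ))))
          (λ {α} α∈ → diff≡0 (trans (eigen α∈ w) (cong (_* ⟨ α , w ⟩) (eigenvalue-const α∈ ρ∈)))) (spanning v))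

  -- Integrality of Cartan numbers and differences of roots.

  integer≡1⊎≥2 : ∀ {x} → IsInteger x → 0# < x → x ≡ 1# ⊎ fromℕ 2 ≤ x
  integer≡1⊎≥2 {x} i p with em {x ≡ 1#}
  ... | yes e = inj₁ e
  ... | no ne = inj₂ (≤-by (≤⇒0≤ (integer-pos (integer-+ i (integer-neg (pos 1 , sym (+-identityʳ 1#))))
                  (≤⇒0≤ (integer-pos i p) , λ e → ne (cancel-diff (sym e)))))
                (solve 1 (λ x → x :- :2 := x :- :1 :- :1) refl x))

  module Crystal {Φ : List V} (rs : IsRootSystem Φ) (crystallographic : Crystallographic Φ) where
    open RootSystem rs

    cartan-integer : ∀ {α β} → α ∈ Φ → β ∈ Φ → IsInteger (cartan α β)
    cartan-integer {α} {β} α∈ β∈ = crystallographic α β α∈ β∈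

    cartan-pos : ∀ {α β} → α ∈ Φ → 0# < ⟨ α , β ⟩ → 0# < cartan α β
    cartan-pos α∈ p = 0<* (0<* 0<2 p) (0<⁻¹ (⟨⟩-pos (root-≢𝟎 α∈)))

    parallel-roots : ∀ {α β} → α ∈ Φ → β ∈ Φ → ⟨ α , β ⟩ * ⟨ α , β ⟩ ≡ ⟨ α , α ⟩ * ⟨ β , β ⟩ → α ≡ β ⊎ α ≡ neg β
    parallel-roots {α} {β} α∈ β∈ e =
      [ (λ c≡1 → inj₁ (trans α≡ (trans (cong (_· β) c≡1) (1· β)))) , (λ c≡-1 → inj₂ (trans α≡ (trans (cong (_· β) c≡-1) (sym (neg≡ β))))) ]′
        (reduced β c β∈ (subst (_∈ Φ) α≡ α∈))
      where
      c = ⟨ α , β ⟩ * ⟨ β , β ⟩ ⁻¹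
      α≡ : α ≡ c · β
      α≡ = parallel (root-≢𝟎 β∈) e

    -- The two Cartan integers are positive with product `4 cos²`, which is less than 4 unless the
    -- roots are parallel. So one of them is 1, and the reflection belonging to it produces the
    -- difference up to sign.
    minus-root : ∀ {α β} → α ∈ Φ → β ∈ Φ → α ≢ β → 0# < ⟨ α , β ⟩ → α ⊕ neg β ∈ Φ
    minus-root {α} {β} α∈ β∈ α≢β p
      with integer≡1⊎≥2 (cartan-integer α∈ β∈) (cartan-pos α∈ p)
         | integer≡1⊎≥2 (cartan-integer β∈ α∈) (cartan-pos β∈ (subst (0# <_) (⟨⟩-sym α β) p))
    ... | inj₁ m≡1 | _ = subst (_∈ Φ) eq (neg-root (closed α β α∈ β∈))
      where
      eq : neg (reflect α β) ≡ α ⊕ neg β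
      eq = ⟨⟩-ext λ z → begin
        ⟨ neg (reflect α β) , z ⟩                    ≡⟨ ⟨⟩-negˡ (reflect α β) z ⟩
        - ⟨ reflect α β , z ⟩                        ≡⟨ cong -_ (⟨reflect,⟩ α β z) ⟩
        - (⟨ β , z ⟩ - cartan α β * ⟨ α , z ⟩)       ≡⟨ cong (λ m → - (⟨ β , z ⟩ - m * ⟨ α , z ⟩)) m≡1 ⟩
        - (⟨ β , z ⟩ - 1# * ⟨ α , z ⟩)               ≡⟨ solve 2 (λ a b → :- (b :- :1 :* a) := a :+ :- b) refl ⟨ α , z ⟩ ⟨ β , z ⟩ ⟩
        ⟨ α , z ⟩ + - ⟨ β , z ⟩                      ≡⟨ trans (⟨⟩-⊕ˡ α (neg β) z) (cong (⟨ α , z ⟩ +_) (⟨⟩-negˡ β z)) ⟨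
        ⟨ α ⊕ neg β , z ⟩                            ∎
    ... | inj₂ _ | inj₁ n≡1 = subst (_∈ Φ) (cong (λ v → α ⊕ neg v) (trans (cong (_· β) n≡1) (1· β))) (closed β α β∈ α∈)
    ... | inj₂ 2≤m | inj₂ 2≤n = ⊥-elim ([ α≢β , α≢-β ]′ (parallel-roots α∈ β∈ (≤-antisym (cauchy-schwarz α β) reverse)))
      where
      m = cartan α β
      n = cartan β α
      -- With both Cartan integers at least 2, `m n - 4 = (m - 2) (n - 2) + 2 (m - 2) + 2 (n - 2)`
      -- is nonnegative, which is the converse of Cauchy-Schwarz.
      reverse : ⟨ α , α ⟩ * ⟨ β , β ⟩ ≤ ⟨ α , β ⟩ * ⟨ α , β ⟩
      reverse = 0≤⇒≤ (0≤-cancel (0<* 0<2 0<2) (0≤-by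
        (0≤* (0≤+ (0≤* (≤⇒0≤ 2≤m) (≤⇒0≤ 2≤n)) (0≤+ (0≤* 0≤2 (≤⇒0≤ 2≤m)) (0≤* 0≤2 (≤⇒0≤ 2≤n))))
             (proj₁ (0<* (⟨⟩-pos (root-≢𝟎 α∈)) (⟨⟩-pos (root-≢𝟎 β∈)))))
        (combine₂ (fromℕ 2 * ⟨ α , β ⟩) (cartan α β * ⟨ α , α ⟩)
          (cartan-spec β (root-≢𝟎 α∈)) (trans (cartan-spec α (root-≢𝟎 β∈)) (cong (fromℕ 2 *_) (⟨⟩-sym β α)))
          (solve 5 (λ m n a b p →
              ((m :- :2) :* (n :- :2) :+ (:2 :* (m :- :2) :+ :2 :* (n :- :2))) :* (a :* b) :- :2 :* :2 :* (p :* p :- a :* b)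
                := :2 :* p :* (m :* a :- :2 :* p) :+ m :* a :* (n :* b :- :2 :* p)) refl
            m n ⟨ α , α ⟩ ⟨ β , β ⟩ ⟨ α , β ⟩))))
      α≢-β : α ≢ neg β
      α≢-β e = pos-neg-⊥ p (0≤-by (⟨⟩-nonneg β) (trans (sym (trans (cong -_ (⟨⟩-negˡ β β)) (-‿involutive ⟨ β , β ⟩))) (cong (λ v → - ⟨ v , β ⟩) (sym e))))

  -- Words in reflections, their orbits and inversions.

  act : List V → V → V
  act σ v = foldr reflect v σ

  act-++ : ∀ σ τ v → act (σ ++ τ) v ≡ act σ (act τ v)
  act-++ []      τ v = refl
  act-++ (δ ∷ σ) τ v = cong (reflect δ) (act-++ σ τ v)

  act-⊕· : ∀ σ v k w → act σ (v ⊕ k · w) ≡ act σ v ⊕ k · act σ w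
  act-⊕· []      v k w = refl
  act-⊕· (δ ∷ σ) v k w = trans (cong (reflect δ) (act-⊕· σ v k w)) (reflect-⊕· δ (act σ v) k (act σ w))

  act-⊕ : ∀ σ v w → act σ (v ⊕ w) ≡ act σ v ⊕ act σ w
  act-⊕ []      v w = refl
  act-⊕ (δ ∷ σ) v w = trans (cong (reflect δ) (act-⊕ σ v w)) (reflect-⊕ δ (act σ v) (act σ w))

  act-neg : ∀ σ v → act σ (neg v) ≡ neg (act σ v)
  act-neg []      v = refl
  act-neg (δ ∷ σ) v = trans (cong (reflect δ) (act-neg σ v)) (reflect-neg δ (act σ v))

  act-𝟎 : ∀ σ → act σ 𝟎 ≡ 𝟎
  act-𝟎 []      = refl
  act-𝟎 (δ ∷ σ) = trans (cong (reflect δ) (act-𝟎 σ)) (reflect-𝟎 δ)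

  act-isometry : ∀ {σ} → All (_≢ 𝟎) σ → ∀ v w → ⟨ act σ v , act σ w ⟩ ≡ ⟨ v , w ⟩
  act-isometry []      v w = refl
  act-isometry {δ ∷ σ} (h ∷ hs) v w = trans (reflect-isometry (act σ v) (act σ w) h) (act-isometry hs v w)

  unact : List V → V → V
  unact []      v = v
  unact (δ ∷ σ) v = unact σ (reflect δ v)

  unact-act : ∀ {σ} → All (_≢ 𝟎) σ → ∀ v → unact σ (act σ v) ≡ v
  unact-act []            v = refl
  unact-act {δ ∷ σ} (h ∷ hs) v = trans (cong (unact σ) (reflect-involutive (act σ v) h)) (unact-act hs v)

  act-injective : ∀ {σ} → All (_≢ 𝟎) σ → ∀ {v w} → act σ v ≡ act σ w → v ≡ w
  act-injective {σ} h {v} {w} e = trans (sym (unact-act h v)) (trans (cong (unact σ) e) (unact-act h w))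

  iterate-suc : ∀ {A : Set} (f : A → A) x n → iterate f x (suc n) ≡ f (iterate f x n)
  iterate-suc f x zero    = refl
  iterate-suc f x (suc n) = iterate-suc f (f x) n

  positive-part : ∀ x → ∃₂ λ p q → 0# ≤ p × 0# ≤ q × x ≡ p - q × p * q ≡ 0#
  positive-part x with ≤-total 0# x
  ... | inj₁ h = x , 0# , h , ≤-refl , solve 1 (λ x → x := x :- :0) refl x , zeroʳ x
  ... | inj₂ h = 0# , - x , ≤-refl , 0≤neg h , solve 1 (λ x → x := :0 :- :- x) refl x , zeroˡ (- x)

  Period : List V → ℕ → Set
  Period σ n = ∀ v → iterate (act σ) v n ≡ v

  orbit-sum : List V → ℕ → V → V
  orbit-sum σ zero    v = 𝟎
  orbit-sum σ (suc n) v = v ⊕ orbit-sum σ n (act σ v)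

  act-orbit-sum : ∀ σ n v → act σ (orbit-sum σ n v) ≡ orbit-sum σ n (act σ v)
  act-orbit-sum σ zero    v = act-𝟎 σ
  act-orbit-sum σ (suc n) v = trans (act-⊕ σ v (orbit-sum σ n (act σ v))) (cong (act σ v ⊕_) (act-orbit-sum σ n (act σ v)))

  ⊕-assoc : ∀ x y z → (x ⊕ y) ⊕ z ≡ x ⊕ (y ⊕ z)
  ⊕-assoc x y z = ⟨⟩-ext λ w → trans (trans (⟨⟩-⊕ˡ (x ⊕ y) z w) (cong (_+ ⟨ z , w ⟩) (⟨⟩-⊕ˡ x y w)))
    (trans (+-assoc ⟨ x , w ⟩ ⟨ y , w ⟩ ⟨ z , w ⟩) (sym (trans (⟨⟩-⊕ˡ x (y ⊕ z) w) (cong (⟨ x , w ⟩ +_) (⟨⟩-⊕ˡ y z w)))))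

  ⊕-cancelʳ : ∀ {x y} z → x ⊕ z ≡ y ⊕ z → x ≡ y
  ⊕-cancelʳ {x} {y} z e = ⟨⟩-ext λ w → combine₁ 1# (trans (sym (⟨⟩-⊕ˡ x z w)) (trans (cong ⟨_, w ⟩ e) (⟨⟩-⊕ˡ y z w)))
    (solve 3 (λ x y z → x :- y := :1 :* ((x :+ z) :- (y :+ z))) refl ⟨ x , w ⟩ ⟨ y , w ⟩ ⟨ z , w ⟩)

  orbit-sum-last : ∀ σ n v → orbit-sum σ (suc n) v ≡ orbit-sum σ n v ⊕ iterate (act σ) v n
  orbit-sum-last σ zero    v = ⊕-comm v 𝟎
  orbit-sum-last σ (suc n) v = trans (cong (v ⊕_) (orbit-sum-last σ n (act σ v))) (sym (⊕-assoc v (orbit-sum σ n (act σ v)) _))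

  -- Applying the word shifts the summation range by one; the term entering is the `n`-th iterate,
  -- which equals the term leaving.
  orbit-sum-fixed : ∀ σ n → Period σ n → ∀ v → act σ (orbit-sum σ n v) ≡ orbit-sum σ n v
  orbit-sum-fixed σ n p v = ⊕-cancelʳ v (begin
    act σ (orbit-sum σ n v) ⊕ v             ≡⟨ cong (_⊕ v) (act-orbit-sum σ n v) ⟩
    orbit-sum σ n (act σ v) ⊕ v             ≡⟨ ⊕-comm (orbit-sum σ n (act σ v)) v ⟩
    orbit-sum σ (suc n) v                   ≡⟨ orbit-sum-last σ n v ⟩
    orbit-sum σ n v ⊕ iterate (act σ) v n   ≡⟨ cong (orbit-sum σ n v ⊕_) (p v) ⟩
    orbit-sum σ n v ⊕ v                     ∎)

  length-product : ∀ {A B C : Set} (f : A → B → C) xs ys → length (cartesianProductWith f xs ys) ≡ length xs ℕ.* length ys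
  length-product f []       ys = refl
  length-product f (x ∷ xs) ys = trans (length-++ (map (f x) ys)) (cong₂ ℕ._+_ (length-map (f x) ys) (length-product f xs ys))

  -- The positive roots that a word makes negative.
  flipped : List V → List V
  flipped []      = []
  flipped (δ ∷ σ) = unact σ δ ∷ flipped σ

  length-flipped : ∀ σ → length (flipped σ) ≡ length σ
  length-flipped []      = refl
  length-flipped (δ ∷ σ) = cong suc (length-flipped σ)

  reflect-conjugate : ∀ {σ δ} → All (_≢ 𝟎) σ → δ ≢ 𝟎 → ∀ v → act σ (reflect δ v) ≡ reflect (act σ δ) (act σ v)
  reflect-conjugate {σ} {δ} h δ≢ v = trans (act-⊕ σ v (neg (cartan δ v · δ))) (cong (act σ v ⊕_) (trans (act-neg σ (cartan δ v · δ)) (cong neg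
    (trans (cong (act σ) (sym (⊕-identityˡ (cartan δ v · δ)))) (trans (act-⊕· σ 𝟎 (cartan δ v) δ) (trans (cong (_⊕ cartan δ v · act σ δ) (act-𝟎 σ)) (trans (⊕-identityˡ _)
      (cong (_· act σ δ) (cong₂ (λ a b → fromℕ 2 * a / b) (sym (act-isometry h δ v)) (sym (act-isometry h δ δ)))))))))))

  -- Conjugacy of words, and the words of a forest.

  infix 4 _~_
  -- Words related by cyclic shifts and by exchanges of commuting reflections;
  -- the corresponding products are conjugate.
  data _~_ : List V → List V → Set where
    ~-refl  : ∀ {σ} → σ ~ σ
    ~-sym   : ∀ {σ τ} → σ ~ τ → τ ~ σ
    ~-trans : ∀ {σ τ υ} → σ ~ τ → τ ~ υ → σ ~ υ
    ~-swap  : ∀ σ {a b} τ → ⟨ a , b ⟩ ≡ 0# → σ ++ a ∷ b ∷ τ ~ σ ++ b ∷ a ∷ τ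
    ~-shift : ∀ {a} σ → a ≢ 𝟎 → a ∷ σ ~ σ ++ a ∷ []

  ≡⇒~ : ∀ {σ τ} → σ ≡ τ → σ ~ τ
  ≡⇒~ refl = ~-refl

  reflect-commute : ∀ {a b} → ⟨ a , b ⟩ ≡ 0# → ∀ v → reflect a (reflect b v) ≡ reflect b (reflect a v)
  reflect-commute {a} {b} e v = ⟨⟩-ext λ z → begin
    ⟨ reflect a (reflect b v) , z ⟩                                         ≡⟨ half a b e z ⟩
    ⟨ v , z ⟩ - cartan b v * ⟨ b , z ⟩ - cartan a v * ⟨ a , z ⟩             ≡⟨ solve 3 (λ v b a → v :- b :- a := v :- a :- b) refl ⟨ v , z ⟩ (cartan b v * ⟨ b , z ⟩) (cartan a v * ⟨ a , z ⟩) ⟩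
    ⟨ v , z ⟩ - cartan a v * ⟨ a , z ⟩ - cartan b v * ⟨ b , z ⟩             ≡⟨ half b a (trans (⟨⟩-sym b a) e) z ⟨
    ⟨ reflect b (reflect a v) , z ⟩                                         ∎
    where
    half : ∀ a b → ⟨ a , b ⟩ ≡ 0# → ∀ z → ⟨ reflect a (reflect b v) , z ⟩ ≡ ⟨ v , z ⟩ - cartan b v * ⟨ b , z ⟩ - cartan a v * ⟨ a , z ⟩
    half a b e z = trans (⟨reflect,⟩ a (reflect b v) z) (cong₂ (λ p q → p - q * ⟨ a , z ⟩) (⟨reflect,⟩ b v z)
      (cong (λ p → fromℕ 2 * p / ⟨ a , a ⟩) (trans (⟨,reflect⟩ b v a) (trans (cong (λ p → ⟨ a , v ⟩ - cartan b v * p) e) (solve 2 (λ p c → p :- c :* :0 := p) refl ⟨ a , v ⟩ (cartan b v))))))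

  iterate-cong : ∀ {A : Set} {f g : A → A} → (∀ x → f x ≡ g x) → ∀ x n → iterate f x n ≡ iterate g x n
  iterate-cong h x zero    = refl
  iterate-cong {f = f} h x (suc n) = trans (iterate-cong h (f x) n) (cong (λ y → iterate _ y n) (h x))

  -- A swap leaves the product unchanged, and a cyclic shift conjugates it by the reflection in the
  -- shifted letter.
  ~-period : ∀ {σ τ} n → σ ~ τ → (Period σ n → Period τ n) × (Period τ n → Period σ n)
  ~-period n ~-refl = id , id
  ~-period n (~-sym r) = proj₂ (~-period n r) , proj₁ (~-period n r)
  ~-period n (~-trans r s) = proj₁ (~-period n s) ∘ proj₁ (~-period n r) , proj₂ (~-period n r) ∘ proj₂ (~-period n s)
  ~-period n (~-swap σ {a} {b} τ e) = (λ p v → trans (iterate-cong (sym ∘ same) v n) (p v)) , (λ p v → trans (iterate-cong same v n) (p v))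
    where
    same : ∀ v → act (σ ++ a ∷ b ∷ τ) v ≡ act (σ ++ b ∷ a ∷ τ) v
    same v = trans (act-++ σ (a ∷ b ∷ τ) v) (trans (cong (act σ) (reflect-commute e (act τ v))) (sym (act-++ σ (b ∷ a ∷ τ) v)))
  ~-period n (~-shift {a} σ a≢) = (λ p v → reflect-injective a≢ (trans (sym (twist v n)) (p (reflect a v)))) , back
    where
    twist : ∀ v n → iterate (act (a ∷ σ)) (reflect a v) n ≡ reflect a (iterate (act (σ ++ a ∷ [])) v n)
    twist v zero    = refl
    twist v (suc n) = trans (cong (λ w → iterate (act (a ∷ σ)) (reflect a w) n) (sym (act-++ σ (a ∷ []) v))) (twist (act (σ ++ a ∷ []) v) n)
    back : Period (σ ++ a ∷ []) n → Period (a ∷ σ) n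
    back p v = begin
      iterate (act (a ∷ σ)) v n                           ≡⟨ cong (λ w → iterate (act (a ∷ σ)) w n) (reflect-involutive v a≢) ⟨
      iterate (act (a ∷ σ)) (reflect a (reflect a v)) n   ≡⟨ twist (reflect a v) n ⟩
      reflect a (iterate (act (σ ++ a ∷ [])) (reflect a v) n) ≡⟨ cong (reflect a) (p (reflect a v)) ⟩
      reflect a (reflect a v)                             ≡⟨ reflect-involutive v a≢ ⟩
      v                                                   ∎

  ~⇒↭ : ∀ {σ τ} → σ ~ τ → σ ↭ τ
  ~⇒↭ ~-refl = ↭-refl
  ~⇒↭ (~-sym r) = ↭-sym (~⇒↭ r)
  ~⇒↭ (~-trans r s) = ↭-trans (~⇒↭ r) (~⇒↭ s)
  ~⇒↭ (~-swap σ {a} {b} τ e) = ↭-trans (shift a σ (b ∷ τ)) (↭-trans (↭.prep a (shift b σ τ)) (↭-trans (↭.swap a b ↭-refl) (↭-trans (↭.prep b (↭-sym (shift a σ τ))) (↭-sym (shift b σ (a ∷ τ))))))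
  ~⇒↭ (~-shift {a} σ _) = ++-comm (a ∷ []) σ

  ~-rotate : ∀ σ τ → (∀ {a} → a ∈ σ → a ≢ 𝟎) → σ ++ τ ~ τ ++ σ
  ~-rotate []      τ h = ≡⇒~ (sym (++-identityʳ τ))
  ~-rotate (a ∷ σ) τ h = ~-trans (~-shift (σ ++ τ) (h (here refl))) (~-trans (≡⇒~ (++-assoc σ τ (a ∷ [])))
    (~-trans (~-rotate σ (τ ++ a ∷ []) (h ∘ there)) (≡⇒~ (++-assoc τ (a ∷ []) σ))))

  ~-past : ∀ σ {a} τ υ → (∀ {b} → b ∈ τ → ⟨ a , b ⟩ ≡ 0#) → σ ++ a ∷ τ ++ υ ~ σ ++ τ ++ a ∷ υ
  ~-past σ         []      υ h = ~-refl
  ~-past σ {a} (b ∷ τ) υ h = ~-trans (~-swap σ (τ ++ υ) (h (here refl))) (~-trans (≡⇒~ (sym (++-assoc σ (b ∷ []) (a ∷ τ ++ υ))))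
    (~-trans (~-past (σ ++ b ∷ []) τ υ (h ∘ there)) (≡⇒~ (++-assoc σ (b ∷ []) (τ ++ a ∷ υ)))))

  ~-blocks : ∀ σ π ρ υ → (∀ {a b} → a ∈ π → b ∈ ρ → ⟨ a , b ⟩ ≡ 0#) → σ ++ π ++ ρ ++ υ ~ σ ++ ρ ++ π ++ υ
  ~-blocks σ []      ρ υ h = ~-refl
  ~-blocks σ (a ∷ π) ρ υ h = ~-trans (≡⇒~ (sym (++-assoc σ (a ∷ []) (π ++ ρ ++ υ))))
    (~-trans (~-blocks (σ ++ a ∷ []) π ρ υ (h ∘ there)) (~-trans (≡⇒~ (++-assoc σ (a ∷ []) (ρ ++ π ++ υ))) (~-past σ ρ (π ++ υ) (h (here refl)))))

  -- A forest is built by successively attaching leaves: x is joined to no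
  -- vector of S except possibly y.
  data Forest : List V → Set where
    empty : Forest []
    root  : ∀ x → Forest (x ∷ [])
    leaf  : ∀ {S x y T} → Forest S → y ∈ S → (∀ {a} → a ∈ S → a ≡ y ⊎ ⟨ x , a ⟩ ≡ 0#) → T ↭ x ∷ S → Forest T

  -- Inserting x after y turns an equivalence of words on S into an
  -- equivalence of words on x ∷ S.
  module Insertion {S : List V} {x y : V} (S≢𝟎 : ∀ {a} → a ∈ S → a ≢ 𝟎) (x≢𝟎 : x ≢ 𝟎) (S-unique : Unique S) (y∈S : y ∈ S)
                   (joined : ∀ {a} → a ∈ S → a ≡ y ⊎ ⟨ x , a ⟩ ≡ 0#) where

    double : V → List V
    double a with em {a ≡ y}
    ... | yes _ = a ∷ x ∷ []
    ... | no _  = a ∷ []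

    double-∈ : ∀ {a b} → b ∈ double a → b ≡ a ⊎ (b ≡ x × a ≡ y)
    double-∈ {a} b∈ with em {a ≡ y}
    double-∈ (here e)         | yes _ = inj₁ e
    double-∈ (there (here e)) | yes a≡y = inj₂ (e , a≡y)
    double-∈ (here e)         | no _ = inj₁ e

    double-y : double y ≡ y ∷ x ∷ []
    double-y with em {y ≡ y}
    ... | yes _ = refl
    ... | no ne = ⊥-elim (ne refl)

    double-other : ∀ {a} → a ≢ y → double a ≡ a ∷ []
    double-other {a} ne with em {a ≡ y}
    ... | yes e = ⊥-elim (ne e)
    ... | no _  = refl

    insert : List V → List V
    insert = concatMap double

    insert-other : ∀ σ → (∀ {a} → a ∈ σ → a ≢ y) → insert σ ≡ σ
    insert-other []      h = refl
    insert-other (a ∷ σ) h = cong₂ _++_ (double-other (h (here refl))) (insert-other σ (h ∘ there))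

    -- The pair made of `y` and `x` moves as one block. A letter of `S` that may be exchanged with
    -- `y` differs from `y`, since `y` is nonzero, and is therefore orthogonal to `x` as well.
    insert-~ : ∀ {σ τ} → (∀ {a} → a ∈ σ → a ∈ S) → σ ~ τ → insert σ ~ insert τ
    insert-~ h ~-refl = ~-refl
    insert-~ h (~-sym r) = ~-sym (insert-~ (h ∘ ∈-resp-↭ (~⇒↭ r)) r)
    insert-~ h (~-trans r s) = ~-trans (insert-~ h r) (insert-~ (h ∘ ∈-resp-↭ (↭-sym (~⇒↭ r))) s)
    insert-~ h (~-swap σ {a} {b} τ e) = ~-trans (≡⇒~ (concatMap-++ double σ (a ∷ b ∷ τ)))
      (~-trans (~-blocks (insert σ) (double a) (double b) (insert τ) orth) (≡⇒~ (sym (concatMap-++ double σ (b ∷ a ∷ τ)))))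
      where
      a∈ = h (∈-++⁺ʳ σ (here refl))
      b∈ = h (∈-++⁺ʳ σ (there (here refl)))
      ¬both : a ≡ y → b ≢ y
      ¬both refl refl = S≢𝟎 a∈ (⟨⟩-definite e)
      orth : ∀ {c d} → c ∈ double a → d ∈ double b → ⟨ c , d ⟩ ≡ 0#
      orth c∈ d∈ with double-∈ c∈ | double-∈ d∈
      ... | inj₁ refl          | inj₁ refl          = e
      ... | inj₁ refl          | inj₂ (refl , b≡y)  = [ (λ a≡y → ⊥-elim (¬both a≡y b≡y)) , trans (⟨⟩-sym a x) ]′ (joined a∈)
      ... | inj₂ (refl , a≡y)  | inj₁ refl          = [ (λ b≡y → ⊥-elim (¬both a≡y b≡y)) , id ]′ (joined b∈)
      ... | inj₂ (refl , a≡y)  | inj₂ (refl , b≡y)  = ⊥-elim (¬both a≡y b≡y)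
    insert-~ h (~-shift {a} σ a≢) = ~-trans (~-rotate (double a) (insert σ) ≢𝟎) (≡⇒~ (sym (trans (concatMap-++ double σ (a ∷ [])) (cong (insert σ ++_) (++-identityʳ (double a))))))
      where
      ≢𝟎 : ∀ {b} → b ∈ double a → b ≢ 𝟎
      ≢𝟎 b∈ with double-∈ b∈
      ... | inj₁ refl       = a≢
      ... | inj₂ (refl , _) = x≢𝟎

    -- Cyclic shifts bring `x` to the end of the word. From there it moves left past the letters
    -- following `y`, all orthogonal to it, until it stands next to `y`.
    absorb : ∀ {σ} → σ ↭ x ∷ S → ∃ λ τ → τ ↭ S × σ ~ insert τ
    absorb {σ} p with ∈-∃++ (∈-resp-↭ (↭-sym p) (here refl))
    ... | u , v , refl = v ++ u , perm , ~-trans (~-rotate u (x ∷ v) u≢𝟎) (~-trans (~-shift (v ++ u) x≢𝟎) end)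
      where
      perm : v ++ u ↭ S
      perm = ↭-trans (++-comm v u) (drop-∷ (↭-trans (↭-sym (shift x u v)) p))
      u≢𝟎 : ∀ {a} → a ∈ u → a ≢ 𝟎
      u≢𝟎 a∈ = S≢𝟎 (∈-resp-↭ perm (∈-++⁺ʳ v a∈))
      end : (v ++ u) ++ x ∷ [] ~ insert (v ++ u)
      end with v ++ u | perm
      ... | τ | q with ∈-∃++ (∈-resp-↭ (↭-sym q) y∈S)
      ...   | w₁ , w₂ , refl = ~-trans (≡⇒~ (trans (++-assoc w₁ (y ∷ w₂) (x ∷ [])) (sym (++-assoc w₁ (y ∷ []) (w₂ ++ x ∷ [])))))
                (~-trans (~-sym (~-past (w₁ ++ y ∷ []) w₂ [] orth))
                (≡⇒~ (trans (++-assoc w₁ (y ∷ []) (x ∷ w₂ ++ [])) (sym (trans (concatMap-++ double w₁ (y ∷ w₂)) (cong₂ _++_ (insert-other w₁ left)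
                  (cong₂ _++_ double-y (trans (insert-other w₂ right) (sym (++-identityʳ w₂))))))))))
        where
        u′ : Unique (y ∷ w₁ ++ w₂)
        u′ = Unique-↭ (↭-trans (↭-sym q) (shift y w₁ w₂)) S-unique
        y∉ : ∀ {a} → a ∈ w₁ ++ w₂ → a ≢ y
        y∉ a∈ refl = Unique.Unique[x∷xs]⇒x∉xs u′ a∈
        left : ∀ {a} → a ∈ w₁ → a ≢ y
        left = y∉ ∘ ∈-++⁺ˡ
        right : ∀ {a} → a ∈ w₂ → a ≢ y
        right = y∉ ∘ ∈-++⁺ʳ w₁
        orth : ∀ {b} → b ∈ w₂ → ⟨ x , b ⟩ ≡ 0#
        orth b∈ = [ ⊥-elim ∘ right b∈ , id ]′ (joined (∈-resp-↭ q (∈-++⁺ʳ w₁ (there b∈))))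

  singleton-↭ : ∀ {A : Set} {xs : List A} {x} → xs ↭ x ∷ [] → xs ≡ x ∷ []
  singleton-↭ {xs = []} p with ↭-length p
  ... | ()
  singleton-↭ {xs = y ∷ []} p with ∈-resp-↭ p (here refl)
  ... | here refl = refl
  singleton-↭ {xs = y ∷ z ∷ xs} p with ↭-length p
  ... | ()

  empty-↭ : ∀ {A : Set} {xs : List A} → xs ↭ [] → xs ≡ []
  empty-↭ {xs = []} p = refl
  empty-↭ {xs = y ∷ xs} p with ↭-length p
  ... | ()

  -- Conjugacy of all Coxeter elements of a forest, by removing a leaf: both words become words on
  -- the smaller forest with the leaf inserted behind its neighbour.
  forest-words : ∀ {S} → Forest S → (∀ {a} → a ∈ S → a ≢ 𝟎) → Unique S → ∀ {σ τ} → σ ↭ S → τ ↭ S → σ ~ τ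
  forest-words empty    h u p q = ≡⇒~ (trans (empty-↭ p) (sym (empty-↭ q)))
  forest-words (root x) h u p q = ≡⇒~ (trans (singleton-↭ p) (sym (singleton-↭ q)))
  forest-words (leaf {S} {x} F y∈ joined r) h u p q with Unique-↭ r u
  ... | _ ∷ uS = let (_ , p′ , s) = absorb (↭-trans p r)
                     (_ , q′ , s′) = absorb (↭-trans q r)
                 in ~-trans s (~-trans (insert-~ (∈-resp-↭ p′) (forest-words F hS uS p′ q′)) (~-sym s′))
    where
    hS : ∀ {a} → a ∈ S → a ≢ 𝟎
    hS a∈ = h (∈-resp-↭ (↭-sym r) (there a∈))
    open Insertion hS (h (∈-resp-↭ (↭-sym r) (here refl))) uS y∈ joined

  Independent : List V → Set
  Independent I = ∀ {a b} → a ∈ I → b ∈ I → a ≢ b → ⟨ a , b ⟩ ≡ 0#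

  -- A new leaf goes to the side not containing its neighbour.
  forest-bipartite : ∀ {S} → Forest S → Unique S → ∃₂ λ I J → I ++ J ↭ S × Independent I × Independent J
  forest-bipartite empty    u = [] , [] , ↭-refl , (λ ()) , λ ()
  forest-bipartite (root x) u = x ∷ [] , [] , ↭-refl , (λ { (here refl) (here refl) ne → ⊥-elim (ne refl) }) , λ ()
  forest-bipartite {S′} (leaf {S} {x} {y} F y∈ joined r) u with Unique-↭ r u
  ... | _ ∷ uS with forest-bipartite F uS
  ...   | I , J , p , hI , hJ = [ case₁ , case₂ ]′ (∈-++⁻ I (∈-resp-↭ (↭-sym p) y∈))
    where
    extend : ∀ {K} → (∀ {a} → a ∈ K → a ∈ S) → y ∉ K → Independent K → Independent (x ∷ K)
    extend sub y∉ hK (here refl) (here refl) ne = ⊥-elim (ne refl)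
    extend sub y∉ hK (here refl) (there b∈) ne = [ (λ { refl → ⊥-elim (y∉ b∈) }) , id ]′ (joined (sub b∈))
    extend sub y∉ hK {a} (there a∈) (here refl) ne = [ (λ { refl → ⊥-elim (y∉ a∈) }) , trans (⟨⟩-sym a x) ]′ (joined (sub a∈))
    extend sub y∉ hK (there a∈) (there b∈) ne = hK a∈ b∈ ne
    disjoint : ∀ {a} → a ∈ I → a ∉ J
    disjoint {a} a∈I a∈J with ∈-split a∈I
    ... | I′ , q = Unique.Unique[x∷xs]⇒x∉xs (Unique-↭ (++⁺ʳ J q) (Unique-↭ (↭-sym p) uS)) (∈-++⁺ʳ I′ a∈J)
    Goal : Set
    Goal = ∃₂ λ I J → I ++ J ↭ S′ × Independent I × Independent J
    case₁ : y ∈ I → Goal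
    case₁ y∈I = I , x ∷ J , ↭-trans (shift x I J) (↭-trans (↭.prep x p) (↭-sym r)) , hI ,
      (λ {a} {b} → extend (∈-resp-↭ p ∘ ∈-++⁺ʳ I) (disjoint y∈I) hJ {a} {b})
    case₂ : y ∈ J → Goal
    case₂ y∈J = x ∷ I , J , ↭-trans (↭.prep x p) (↭-sym r) ,
      (λ {a} {b} → extend (∈-resp-↭ p ∘ ∈-++⁺ˡ) (λ y∈I → disjoint y∈I y∈J) hI {a} {b}) , hJ

  -- Normalized vectors, and products of commuting reflections.

  unit : V → Carrier
  unit v = (√ ⟨ v , v ⟩) ⁻¹

  unit-pos : ∀ {v} → v ≢ 𝟎 → 0# < unit v
  unit-pos {v} h = 0<⁻¹ (√-nonneg _ (⟨⟩-nonneg v) , λ e → pos⇒≢0 (⟨⟩-pos h) (trans (sym (√-square _ (⟨⟩-nonneg v))) (trans (cong (λ s → s * s) (sym e)) (zeroˡ 0#))))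

  unit-spec : ∀ {v} → v ≢ 𝟎 → unit v * unit v * ⟨ v , v ⟩ ≡ 1#
  unit-spec {v} h = combine₃ (unit v * √v + 1#) 0# (unit v * unit v) inv inv (sym (√-square _ (⟨⟩-nonneg v)))
    (solve 3 (λ i s q → i :* i :* q :- :1 := (i :* s :+ :1) :* (i :* s :- :1) :+ :0 :* (i :* s :- :1) :+ i :* i :* (q :- s :* s)) refl (unit v) √v ⟨ v , v ⟩)
    where
    √v = √ ⟨ v , v ⟩
    inv : unit v * √v ≡ 1#
    inv = ⁻¹-inverseˡ λ e → pos⇒≢0 (⟨⟩-pos h) (trans (sym (√-square _ (⟨⟩-nonneg v))) (trans (cong (λ s → s * s) e) (zeroˡ 0#)))

  ⟨normalize,normalize⟩ : ∀ v w → ⟨ normalize v , normalize w ⟩ ≡ unit v * unit w * ⟨ v , w ⟩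
  ⟨normalize,normalize⟩ v w = trans (⟨⟩-·ˡ (unit v) v (normalize w)) (trans (cong (unit v *_) (⟨⟩-·ʳ (unit w) v w)) (sym (*-assoc _ _ _)))

  unit² : ∀ {v} → v ≢ 𝟎 → unit v * unit v ≡ ⟨ v , v ⟩ ⁻¹
  unit² {v} h = *-cancelˡ (pos⇒≢0 (⟨⟩-pos h)) (trans (*-comm _ _) (trans (unit-spec h) (sym (*-inverse _ (pos⇒≢0 (⟨⟩-pos h))))))

  ⟨normalize,normalize⟩²≡κ : ∀ {v w} → v ≢ 𝟎 → w ≢ 𝟎 →
    ⟨ normalize v , normalize w ⟩ * ⟨ normalize v , normalize w ⟩ ≡ κ v w
  ⟨normalize,normalize⟩²≡κ {v} {w} hv hw = trans (cong (λ p → p * p) (⟨normalize,normalize⟩ v w))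
    (trans (solve 3 (λ a b p → a :* b :* p :* (a :* b :* p) := p :* p :* (a :* a :* (b :* b))) refl (unit v) (unit w) ⟨ v , w ⟩)
      (cong₂ (λ a b → ⟨ v , w ⟩ * ⟨ v , w ⟩ * (a * b)) (unit² hv) (unit² hw)))

  -- A reflection in one of the orthogonal vectors does not change the pairings with the others, so
  -- all Cartan numbers may be taken at the original `v`.
  act-independent : ∀ {I} → Independent I → Unique I → ∀ v z → ⟨ act I v , z ⟩ ≡ ⟨ v , z ⟩ - ∑ I (λ δ → cartan δ v * ⟨ δ , z ⟩)
  act-independent {[]}    ind u v z = solve 1 (λ a → a := a :- :0) refl ⟨ v , z ⟩
  act-independent {δ ∷ I} ind (δ∉ ∷ u) v z = begin
    ⟨ reflect δ (act I v) , z ⟩                              ≡⟨ ⟨reflect,⟩ δ (act I v) z ⟩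
    ⟨ act I v , z ⟩ - cartan δ (act I v) * ⟨ δ , z ⟩         ≡⟨ cong₂ (λ p q → p - q * ⟨ δ , z ⟩) (ih z) (cong (λ p → fromℕ 2 * p / ⟨ δ , δ ⟩) same) ⟩
    ⟨ v , z ⟩ - ∑ I (λ δ → cartan δ v * ⟨ δ , z ⟩) - cartan δ v * ⟨ δ , z ⟩
      ≡⟨ solve 3 (λ p s q → p :- s :- q := p :- (q :+ s)) refl ⟨ v , z ⟩ (∑ I (λ δ → cartan δ v * ⟨ δ , z ⟩)) (cartan δ v * ⟨ δ , z ⟩) ⟩
    ⟨ v , z ⟩ - (cartan δ v * ⟨ δ , z ⟩ + ∑ I (λ δ → cartan δ v * ⟨ δ , z ⟩)) ∎
    where
    ih : ∀ z → ⟨ act I v , z ⟩ ≡ ⟨ v , z ⟩ - ∑ I (λ δ → cartan δ v * ⟨ δ , z ⟩)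
    ih = act-independent {I} (λ a∈ b∈ → ind (there a∈) (there b∈)) u v
    same : ⟨ δ , act I v ⟩ ≡ ⟨ δ , v ⟩
    same = trans (⟨⟩-sym δ (act I v)) (trans (ih δ) (trans (cong₂ _-_ (⟨⟩-sym v δ) (∑-zero {xs = I} λ {ε} ε∈ →
      trans (cong (cartan ε v *_) (ind (there ε∈) (here refl) (λ e → All.lookup δ∉ ε∈ (sym e)))) (zeroʳ _))) (solve 1 (λ a → a :- :0 := a) refl ⟨ δ , v ⟩)))

  act-adjoint : ∀ {I} → Independent I → Unique I → ∀ v w → ⟨ act I v , w ⟩ ≡ ⟨ v , act I w ⟩
  act-adjoint {I} ind u v w = trans (act-independent {I} ind u v w) (trans (cong₂ _-_ (⟨⟩-sym v w) (∑-ext {xs = I} λ δ →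
      solve 4 (λ t p q i → t :* p :* i :* q := t :* q :* i :* p) refl (fromℕ 2) ⟨ δ , v ⟩ ⟨ δ , w ⟩ (⟨ δ , δ ⟩ ⁻¹)))
    (trans (sym (act-independent {I} ind u w v)) (⟨⟩-sym (act I w) v)))

  act-member : ∀ {I} → Independent I → Unique I → ∀ {α} → α ∈ I → α ≢ 𝟎 → act I α ≡ neg α
  act-member {I} ind u {α} α∈ α≢ = ⟨⟩-ext λ z → trans (act-independent {I} ind u α z) (trans
    (cong (λ s → ⟨ α , z ⟩ - s) (∑-single u α∈ (λ {δ} δ∈ ne → trans (cong (λ p → fromℕ 2 * p / ⟨ δ , δ ⟩ * ⟨ δ , z ⟩) (ind δ∈ α∈ ne))
      (solve 3 (λ t i q → t :* :0 :* i :* q := :0) refl (fromℕ 2) (⟨ δ , δ ⟩ ⁻¹) ⟨ δ , z ⟩))))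
    (trans (combine₁ (- (fromℕ 2 * ⟨ α , z ⟩)) (*-inverse ⟨ α , α ⟩ (pos⇒≢0 (⟨⟩-pos α≢)))
      (solve 3 (λ a q i → q :- :2 :* a :* i :* q :- :- q := :- (:2 :* q) :* (a :* i :- :1)) refl ⟨ α , α ⟩ ⟨ α , z ⟩ (⟨ α , α ⟩ ⁻¹))) (sym (⟨⟩-negˡ α z))))

  -- Equivalence classes, projections, sublists and planes.

  χ-¬ : ∀ P → χ (¬ P) ≡ 1# - χ P
  χ-¬ P with em {P}
  ... | yes p = trans (χ-no (λ ¬p → ¬p p)) (sym (-‿inverseʳ 1#))
  ... | no ¬p = trans (χ-yes ¬p) (solve 0 (:1 := :1 :- :0) refl)

  χ-× : ∀ P Q → χ (P × Q) ≡ χ P * χ Q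
  χ-× P Q with em {P}
  ... | no ¬p = trans (χ-no (¬p ∘ proj₁)) (sym (zeroˡ (χ Q)))
  ... | yes p = trans (χ-⇔ proj₂ (p ,_)) (sym (*-identityˡ (χ Q)))

  module _ {A : Set} (R : A → A → Set) (R-refl : ∀ x → R x x) (R-sym : ∀ {x y} → R x y → R y x) (R-trans : ∀ {x y z} → R x y → R y z → R x z) where
    representatives : List A → List A
    representatives = deduplicate (λ x y → em {R x y})

    private
      ∑-reject : ∀ ys x (f : A → Carrier) → ∑ (filter (λ y → ¬? (em {R x y})) ys) f ≡ ∑ ys (λ y → χ (¬ R x y) * f y)
      ∑-reject []       x f = refl
      ∑-reject (y ∷ ys) x f with em {R x y}
      ... | yes r = trans (∑-reject ys x f) (trans (sym (+-identityˡ _)) (cong (_+ ∑ ys (λ y → χ (¬ R x y) * f y)) (sym (trans (cong (_* f y) (χ-no (λ ¬r → ¬r r))) (zeroˡ (f y))))))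
      ... | no ¬r = cong₂ _+_ (sym (trans (cong (_* f y) (χ-yes ¬r)) (*-identityˡ (f y)))) (∑-reject ys x f)

    representative-unique : ∀ {xs x} → x ∈ xs → ∑ (representatives xs) (λ d → χ (R x d)) ≡ 1#
    representative-unique {y ∷ xs} {x} x∈ = trans (cong (χ (R x y) +_) (∑-reject (representatives xs) y (λ d → χ (R x d)))) (by em)
      where
      by : Dec (R x y) → χ (R x y) + ∑ (representatives xs) (λ d → χ (¬ R y d) * χ (R x d)) ≡ 1#
      by (yes r) = trans (cong₂ _+_ (χ-yes r) (∑-zero {xs = representatives xs} λ {d} _ → trans (sym (χ-× (¬ R y d) (R x d))) (χ-no λ (¬s , s) → ¬s (R-trans (R-sym r) s)))) (+-identityʳ 1#)
      by (no ¬r) = trans (cong₂ _+_ (χ-no ¬r) (∑-ext {xs = representatives xs} λ d → trans (sym (χ-× (¬ R y d) (R x d))) (χ-⇔ proj₂ λ s → (λ s′ → ¬r (R-trans s (R-sym s′))) , s)))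
        (trans (+-identityˡ _) (representative-unique (other x∈)))
        where
        other : x ∈ y ∷ xs → x ∈ xs
        other (here refl) = ⊥-elim (¬r (R-refl x))
        other (there h)   = h

    ∑-classes : ∀ xs (f : A → Carrier) → ∑ xs f ≡ ∑ (representatives xs) (λ d → ∑ xs (λ x → χ (R x d) * f x))
    ∑-classes xs f = trans (∑-cong {xs = xs} λ {x} x∈ → trans (sym (*-identityˡ (f x))) (trans (cong (_* f x) (sym (representative-unique x∈))) (sym (∑-*ʳ (representatives xs) (f x) λ d → χ (R x d)))))
      (∑-swap xs (representatives xs) λ x d → χ (R x d) * f x)

  module _ {A : Set} {B : Set₁} (f : A → B) (R : B → B → Set) where
    filter-reject-map : ∀ x ys → filter (λ y → ¬? (em {R (f x) y})) (map f ys) ≡ map f (filter (λ y → ¬? (em {R (f x) (f y)})) ys)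
    filter-reject-map x []       = refl
    filter-reject-map x (y ∷ ys) with em {R (f x) (f y)}
    ... | yes _ = filter-reject-map x ys
    ... | no _  = cong (f y ∷_) (filter-reject-map x ys)

    -- Hyperplanes are predicates and live in `Set₁`. Pulling the relation back along `f` allows
    -- them to be counted through the roots that define them.
    deduplicate-map : ∀ xs → deduplicate (λ x y → em {R x y}) (map f xs) ≡ map f (deduplicate (λ x y → em {R (f x) (f y)}) xs)
    deduplicate-map []       = refl
    deduplicate-map (x ∷ xs) = cong (f x ∷_) (trans (cong (filter (λ y → ¬? (em {R (f x) y}))) (deduplicate-map xs)) (filter-reject-map x (deduplicate (λ x y → em {R (f x) (f y)}) xs)))

    filter-map : ∀ (P : B → Set) xs → filter (λ y → em {P y}) (map f xs) ≡ map f (filter (λ x → em {P (f x)}) xs)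
    filter-map P []       = refl
    filter-map P (x ∷ xs) with em {P (f x)}
    ... | yes _ = cong (f x ∷_) (filter-map P xs)
    ... | no _  = filter-map P xs

  *-≡0ʳ : ∀ k x → k * x ≡ 0# → k ≢ 0# → x ≡ 0#
  *-≡0ʳ k x e k≢0 = [ ⊥-elim ∘ k≢0 , id ]′ (x*y≡0 e)

  -- The part of v orthogonal to the pairwise orthogonal vectors of B.
  residual : List V → V → V
  residual []      v = v
  residual (b ∷ B) v = residual B v ⊕ (- (⟨ v , b ⟩ * ⟨ b , b ⟩ ⁻¹)) · b

  -- Stated for any linear `g` because two are needed: the pairing with a vector, which describes
  -- the projection, and the invariant form in one argument.
  residual-linear : ∀ B (g : V → Carrier) → (∀ x k y → g (x ⊕ k · y) ≡ g x + k * g y) →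
                    ∀ v → g (residual B v) ≡ g v - ∑ B (λ b → ⟨ v , b ⟩ * ⟨ b , b ⟩ ⁻¹ * g b)
  residual-linear []      g linear v = solve 1 (λ a → a := a :- :0) refl (g v)
  residual-linear (b ∷ B) g linear v = trans (linear (residual B v) (- (⟨ v , b ⟩ * ⟨ b , b ⟩ ⁻¹)) b) (trans (cong (_+ - (⟨ v , b ⟩ * ⟨ b , b ⟩ ⁻¹) * g b) (residual-linear B g linear v))
    (solve 4 (λ v s c b → v :- s :+ :- c :* b := v :- (c :* b :+ s)) refl (g v) (∑ B λ b → ⟨ v , b ⟩ * ⟨ b , b ⟩ ⁻¹ * g b) (⟨ v , b ⟩ * ⟨ b , b ⟩ ⁻¹) (g b)))

  module _ {P : Pred V 0ℓ} (S : Subspace P) where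
    open Subspace S

    residual-⇒ : ∀ B → (∀ {b} → b ∈ B → P b) → ∀ {v} → P v → P (residual B v)
    residual-⇒ []      h {v} q = q
    residual-⇒ (b ∷ B) h {v} q = has-⊕· (residual B v) (- (⟨ v , b ⟩ * ⟨ b , b ⟩ ⁻¹)) b (residual-⇒ B (h ∘ there) q) (h (here refl))

    residual-⇐ : ∀ B → (∀ {b} → b ∈ B → P b) → ∀ {v} → P (residual B v) → P v
    residual-⇐ []      h {v} q = q
    residual-⇐ (b ∷ B) h {v} q = residual-⇐ B (h ∘ there) (subst P back (has-⊕· (residual (b ∷ B) v) c b q (h (here refl))))
      where
      c = ⟨ v , b ⟩ * ⟨ b , b ⟩ ⁻¹
      back : residual (b ∷ B) v ⊕ c · b ≡ residual B v
      back = ⟨⟩-ext λ z → trans (⟨⟩-⊕·ˡ (residual (b ∷ B) v) c b z) (trans (cong (_+ c * ⟨ b , z ⟩) (⟨⟩-⊕·ˡ (residual B v) (- c) b z))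
        (solve 3 (λ r c b → r :+ :- c :* b :+ c :* b := r) refl ⟨ residual B v , z ⟩ c ⟨ b , z ⟩))

  module _ {A : Set} where
    ∈-sublist : ∀ {xs Λ} {x : A} → Λ ∈ sublists xs → x ∈ Λ → x ∈ xs
    ∈-sublist {[]} (here refl) ()
    ∈-sublist {y ∷ xs} Λ∈ x∈ with ∈-++⁻ (map (y ∷_) (sublists xs)) Λ∈
    ... | inj₂ h = there (∈-sublist h x∈)
    ... | inj₁ h with ∈-map⁻ (y ∷_) h
    ∈-sublist Λ∈ (here refl) | inj₁ h | Λ′ , Λ′∈ , refl = here refl
    ∈-sublist Λ∈ (there x∈)  | inj₁ h | Λ′ , Λ′∈ , refl = there (∈-sublist Λ′∈ x∈)

    module _ (P : Pred A 0ℓ) where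
      private
        select : List A → List A
        select = filter (λ x → em {P x})

        select-yes : ∀ {x xs} → P x → select (x ∷ xs) ≡ x ∷ select xs
        select-yes {x} px with em {P x}
        ... | yes _ = refl
        ... | no ¬p = ⊥-elim (¬p px)

        select-no : ∀ {x xs} → ¬ P x → select (x ∷ xs) ≡ select xs
        select-no {x} ¬px with em {P x}
        ... | yes p = ⊥-elim (¬px p)
        ... | no _  = refl

      -- A sublist keeps the order of `xs`, so for duplicate-free `xs` it is determined, as a list,
      -- by its set of entries.
      sublist-select : ∀ {xs Λ} → Unique xs → Λ ∈ sublists xs → (∀ {x} → x ∈ xs → x ∈ Λ → P x) → (∀ {x} → x ∈ xs → P x → x ∈ Λ) → Λ ≡ select xs
      sublist-select {[]} u (here refl) to from = refl
      sublist-select {y ∷ xs} u Λ∈ to from with ∈-++⁻ (map (y ∷_) (sublists xs)) Λ∈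
      sublist-select {y ∷ xs} (y∉ ∷ u) Λ∈ to from | inj₂ h =
        trans (sublist-select u h (to ∘ there) (from ∘ there)) (sym (select-no λ py → All.lookup y∉ (∈-sublist h (from (here refl) py)) refl))
      sublist-select {y ∷ xs} (y∉ ∷ u) Λ∈ to from | inj₁ h with ∈-map⁻ (y ∷_) h
      ... | Λ′ , Λ′∈ , refl = trans (cong (y ∷_) (sublist-select u Λ′∈ (λ x∈ x∈Λ → to (there x∈) (there x∈Λ)) (λ x∈ px → tail x∈ (from (there x∈) px)))) (sym (select-yes (to (here refl) (here refl))))
        where
        tail : ∀ {x} → x ∈ xs → x ∈ y ∷ Λ′ → x ∈ Λ′
        tail x∈ (here refl) = ⊥-elim (All.lookup y∉ x∈ refl)
        tail x∈ (there h)   = h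

      select-sublist : ∀ xs → select xs ∈ sublists xs
      select-sublist []       = here refl
      select-sublist (x ∷ xs) with em {P x}
      ... | yes _ = ∈-++⁺ˡ (∈-map⁺ (x ∷_) (select-sublist xs))
      ... | no _  = ∈-++⁺ʳ (map (x ∷_) (sublists xs)) (select-sublist xs)

      -- For duplicate-free `xs` the list `select xs` occurs exactly once among the sublists, so a
      -- function supported on it contributes one term.
      ∑-sublists : ∀ {xs} (f : List A → Carrier) → Unique xs → (∀ {Λ} → Λ ∈ sublists xs → Λ ≢ select xs → f Λ ≡ 0#) → ∑ (sublists xs) f ≡ f (select xs)
      ∑-sublists {[]}     f u h = +-identityʳ (f [])
      ∑-sublists {x ∷ xs} f (x∉ ∷ u) h = trans (∑-++ (map (x ∷_) (sublists xs)) f) (trans (cong (_+ ∑ (sublists xs) f) (∑-map (x ∷_) (sublists xs) f)) (by em))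
        where
        with-x : ∀ {Λ} → Λ ∈ sublists xs → x ∷ Λ ∈ sublists (x ∷ xs)
        with-x h = ∈-++⁺ˡ (∈-map⁺ (x ∷_) h)
        without-x : ∀ {Λ} → Λ ∈ sublists xs → Λ ∈ sublists (x ∷ xs)
        without-x = ∈-++⁺ʳ (map (x ∷_) (sublists xs))
        absent : ∀ {ys : List A} {Λ} → (∀ {y} → y ∈ ys → y ∈ xs) → ys ≢ x ∷ Λ
        absent sub refl = All.lookup x∉ (sub (here refl)) refl
        by : Dec (P x) → ∑ (sublists xs) (f ∘ (x ∷_)) + ∑ (sublists xs) f ≡ f (select (x ∷ xs))
        by (yes px) = trans (cong₂ _+_
            (∑-sublists (f ∘ (x ∷_)) u (λ Λ∈ ne → h (with-x Λ∈) (λ e → ne (∷-injectiveʳ (trans e (select-yes px))))))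
            (∑-zero {xs = sublists xs} λ Λ∈ → h (without-x Λ∈) (λ e → absent (∈-sublist Λ∈) (trans e (select-yes px)))))
          (trans (+-identityʳ _) (cong f (sym (select-yes px))))
        by (no ¬px) = trans (cong₂ _+_
            (∑-zero {xs = sublists xs} λ Λ∈ → h (with-x Λ∈) (λ e → absent (λ y∈ → proj₁ (∈-filter⁻ (λ x → em {P x}) {xs = xs} y∈)) (sym (trans e (select-no ¬px)))))
            (∑-sublists f u (λ Λ∈ ne → h (without-x Λ∈) (λ e → ne (trans e (select-no ¬px))))))
          (trans (+-identityˡ _) (cong f (sym (select-no ¬px))))


  plane-elim : ∀ {u w v} → Span (u ∷ w ∷ []) v → ∃₂ λ x y → v ≡ x · u ⊕ y · w
  plane-elim {u} {w} (x ∷ y ∷ [] , e) = x , y , trans e (cong (x · u ⊕_) (⊕-identityʳ (y · w)))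

  plane-intro : ∀ u w x y → Span (u ∷ w ∷ []) (x · u ⊕ y · w)
  plane-intro u w x y = Subspace.has-⊕· (span-subspace (u ∷ w ∷ [])) (x · u) y w (Subspace.has-· (span-subspace (u ∷ w ∷ [])) x u (∈⇒Span (here refl))) (∈⇒Span (there (here refl)))

  -- Cramer's rule. The Gram determinant of `a` and `b` is `D²` times that of `u` and `w`, so it can
  -- only be nonzero if `D` is.
  exchange : ∀ {u w a b} → Span (u ∷ w ∷ []) a → Span (u ∷ w ∷ []) b → ⟨ a , b ⟩ * ⟨ a , b ⟩ ≢ ⟨ a , a ⟩ * ⟨ b , b ⟩ →
             ∀ {v} → Span (u ∷ w ∷ []) v → Span (a ∷ b ∷ []) v
  exchange {u} {w} {a} {b} sa sb ne = let (x , y , ea) = plane-elim sa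
                                          (x′ , y′ , eb) = plane-elim sb
                                      in go x y ea x′ y′ eb
    where
    T = span-subspace (a ∷ b ∷ [])
    go : ∀ x y → a ≡ x · u ⊕ y · w → ∀ x′ y′ → b ≡ x′ · u ⊕ y′ · w → ∀ {v} → Span (u ∷ w ∷ []) v → Span (a ∷ b ∷ []) v
    go x y ea x′ y′ eb = Span-least T λ
      { (here refl)         → divide u y′ (- y) λ z → combine₂ y′ (- y) (expandˡ z) (expandʳ z)
          (solve 8 (λ x y x′ y′ u w a b → y′ :* a :+ :- y :* b :- (x :* y′ :- x′ :* y) :* u := y′ :* (a :- (x :* u :+ y :* w)) :+ :- y :* (b :- (x′ :* u :+ y′ :* w))) refl x y x′ y′ ⟨ u , z ⟩ ⟨ w , z ⟩ ⟨ a , z ⟩ ⟨ b , z ⟩)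
      ; (there (here refl)) → divide w (- x′) x λ z → combine₂ (- x′) x (expandˡ z) (expandʳ z)
          (solve 8 (λ x y x′ y′ u w a b → :- x′ :* a :+ x :* b :- (x :* y′ :- x′ :* y) :* w := :- x′ :* (a :- (x :* u :+ y :* w)) :+ x :* (b :- (x′ :* u :+ y′ :* w))) refl x y x′ y′ ⟨ u , z ⟩ ⟨ w , z ⟩ ⟨ a , z ⟩ ⟨ b , z ⟩)
      }
      where
      D = x * y′ - x′ * y
      expandˡ : ∀ z → ⟨ a , z ⟩ ≡ x * ⟨ u , z ⟩ + y * ⟨ w , z ⟩
      expandˡ z = trans (cong ⟨_, z ⟩ ea) (⟨lin₂,⟩ x u y w z)
      expandʳ : ∀ z → ⟨ b , z ⟩ ≡ x′ * ⟨ u , z ⟩ + y′ * ⟨ w , z ⟩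
      expandʳ z = trans (cong ⟨_, z ⟩ eb) (⟨lin₂,⟩ x′ u y′ w z)
      U = ⟨ u , u ⟩
      M = ⟨ u , w ⟩
      W = ⟨ w , w ⟩
      pair : ∀ s t s′ t′ {c d} → c ≡ s · u ⊕ t · w → d ≡ s′ · u ⊕ t′ · w → ⟨ c , d ⟩ ≡ s * (s′ * U + t′ * M) + t * (s′ * M + t′ * W)
      pair s t s′ t′ refl refl = trans (⟨lin₂,⟩ s u t w (s′ · u ⊕ t′ · w)) (cong₂ (λ p q → s * p + t * q) (⟨,lin₂⟩ s′ u t′ w u) (trans (⟨,lin₂⟩ s′ u t′ w w) (cong (λ m → s′ * m + t′ * W) (⟨⟩-sym w u))))
      D≢0 : D ≢ 0#
      D≢0 D≡0 = ne (trans (cong₂ _*_ (pair x y x′ y′ ea eb) (pair x y x′ y′ ea eb)) (trans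
        (combine₁ (- (D * (U * W - M * M))) D≡0
          (solve 7 (λ x y x′ y′ u m w →
              (x :* (x′ :* u :+ y′ :* m) :+ y :* (x′ :* m :+ y′ :* w)) :* (x :* (x′ :* u :+ y′ :* m) :+ y :* (x′ :* m :+ y′ :* w))
                :- (x :* (x :* u :+ y :* m) :+ y :* (x :* m :+ y :* w)) :* (x′ :* (x′ :* u :+ y′ :* m) :+ y′ :* (x′ :* m :+ y′ :* w))
              := :- ((x :* y′ :- x′ :* y) :* (u :* w :- m :* m)) :* (x :* y′ :- x′ :* y :- :0)) refl x y x′ y′ U M W))
        (sym (cong₂ _*_ (pair x y x y ea ea) (pair x′ y′ x′ y′ eb eb)))))
      divide : ∀ c s t → (∀ z → s * ⟨ a , z ⟩ + t * ⟨ b , z ⟩ ≡ D * ⟨ c , z ⟩) → Span (a ∷ b ∷ []) c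
      divide c s t h = subst (Span (a ∷ b ∷ [])) (⟨⟩-ext λ z → trans (⟨⟩-·ˡ (D ⁻¹) (s · a ⊕ t · b) z) (trans (cong (D ⁻¹ *_) (trans (⟨lin₂,⟩ s a t b z) (h z)))
          (combine₁ ⟨ c , z ⟩ (⁻¹-inverseˡ D≢0) (solve 3 (λ i d c → i :* (d :* c) :- c := c :* (i :* d :- :1)) refl (D ⁻¹) D ⟨ c , z ⟩))))
        (Subspace.has-· T (D ⁻¹) (s · a ⊕ t · b) (plane-intro a b s t))

  integer-4 : ∀ {m} → IsInteger m → m < fromℕ 4 → m ≢ fromℕ 3 → m ≤ fromℕ 2
  integer-4 {m} i m<4 m≢3 = ≤-by (≤⇒0≤ (integer-pos (integer-+ three (integer-neg i)) (3-m≥0 , λ e → m≢3 (sym (cancel-diff (sym e))))))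
    (solve 1 (λ m → :2 :- m := :1 :+ :2 :- m :- :1) refl m)
    where
    three : IsInteger (fromℕ 3)
    three = pos 3 , refl
    four : IsInteger (fromℕ 4)
    four = pos 4 , refl
    3-m≥0 : 0# ≤ fromℕ 3 - m
    3-m≥0 = 0≤-by (≤⇒0≤ (integer-pos (integer-+ four (integer-neg i)) (<⇒0< m<4))) (solve 1 (λ m → :1 :+ (:1 :+ :2) :- m :- :1 := :1 :+ :2 :- m) refl m)

  inhabitant : ∀ {A : Set} {xs : List A} → xs ≢ [] → ∃ (_∈ xs)
  inhabitant {xs = []}    ne = ⊥-elim (ne refl)
  inhabitant {xs = x ∷ _} ne = x , here refl

  module Main {Φ Φ⁺ : List V} (rs : IsRootSystem Φ) (crystallographic : Crystallographic Φ)
              (spanning : Spanning Φ) (ps : IsPositiveSystem Φ Φ⁺) (irr : Irreducible Φ) where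

    -- Simple roots, their dual basis, and connectedness of the Dynkin diagram.

    module SimpleRoots where
      open RootSystem rs public
      open Crystal rs crystallographic public
      open IsPositiveSystem ps public using (t; regular; positive) renaming (unique to unique⁺)

      Δ : List V
      Δ = simpleRoots Φ⁺

      ⁺⇒root : ∀ {α} → α ∈ Φ⁺ → α ∈ Φ
      ⁺⇒root {α} h = proj₁ (Equivalence.to (positive α) h)

      ⁺⇒t-pos : ∀ {α} → α ∈ Φ⁺ → 0# < ⟨ t , α ⟩
      ⁺⇒t-pos {α} h = proj₂ (Equivalence.to (positive α) h)

      t-pos⇒⁺ : ∀ {α} → α ∈ Φ → 0# < ⟨ t , α ⟩ → α ∈ Φ⁺
      t-pos⇒⁺ {α} h p = Equivalence.from (positive α) (h , p)

      root-sign : ∀ {α} → α ∈ Φ → α ∈ Φ⁺ ⊎ neg α ∈ Φ⁺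
      root-sign {α} h with sign ⟨ t , α ⟩
      ... | inj₁ e        = ⊥-elim (regular α h e)
      ... | inj₂ (inj₁ p) = inj₁ (t-pos⇒⁺ h p)
      ... | inj₂ (inj₂ p) = inj₂ (t-pos⇒⁺ (neg-root h) (subst (0# <_) (sym (⟨⟩-negʳ t α)) p))

      ⁺-neg-⊥ : ∀ {α} → α ∈ Φ⁺ → neg α ∉ Φ⁺
      ⁺-neg-⊥ {α} p q = pos-neg-⊥ (⁺⇒t-pos p) (0≤-by (proj₁ (⁺⇒t-pos q)) (⟨⟩-negʳ t α))

      ∉⁺⇒neg : ∀ {α} → α ∈ Φ → α ∉ Φ⁺ → neg α ∈ Φ⁺
      ∉⁺⇒neg h n = [ ⊥-elim ∘ n , id ]′ (root-sign h)

      private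
        Simple : Pred V 0ℓ
        Simple α = ¬ (∃₂ λ β γ → β ∈ Φ⁺ × γ ∈ Φ⁺ × α ≡ β ⊕ γ)

      Δ⇒⁺ : ∀ {δ} → δ ∈ Δ → δ ∈ Φ⁺
      Δ⇒⁺ h = proj₁ (∈-∣⁻ Φ⁺ Simple h)

      Δ⇒root : ∀ {δ} → δ ∈ Δ → δ ∈ Φ
      Δ⇒root h = ⁺⇒root (Δ⇒⁺ h)

      Δ-≢𝟎 : ∀ {δ} → δ ∈ Δ → δ ≢ 𝟎
      Δ-≢𝟎 h = root-≢𝟎 (Δ⇒root h)

      Δ-unique : Unique Δ
      Δ-unique = ∣-unique unique⁺

      -- At an acute angle the difference would be a root. Whichever of the two differences is
      -- positive then decomposes one of the simple roots into positive roots.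
      Δ-obtuse : ∀ {α β} → α ∈ Δ → β ∈ Δ → α ≢ β → ⟨ α , β ⟩ ≤ 0#
      Δ-obtuse {α} {β} α∈ β∈ α≢β with em {0# < ⟨ α , β ⟩}
      ... | no ¬p = ¬pos⇒≤0 ¬p
      ... | yes p with root-sign (minus-root (Δ⇒root α∈) (Δ⇒root β∈) α≢β p)
      ...   | inj₁ q = ⊥-elim (proj₂ (∈-∣⁻ Φ⁺ Simple α∈) (α ⊕ neg β , β , q , Δ⇒⁺ β∈ , cancel α β))
        where
        cancel : ∀ α β → α ≡ (α ⊕ neg β) ⊕ β
        cancel α β = ⟨⟩-ext λ z → sym (trans (⟨⟩-⊕ˡ (α ⊕ neg β) β z) (trans (cong (_+ ⟨ β , z ⟩) (trans (⟨⟩-⊕ˡ α (neg β) z) (cong (⟨ α , z ⟩ +_) (⟨⟩-negˡ β z))))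
          (solve 2 (λ a b → (a :+ :- b) :+ b := a) refl ⟨ α , z ⟩ ⟨ β , z ⟩)))
      ...   | inj₂ q = ⊥-elim (proj₂ (∈-∣⁻ Φ⁺ Simple β∈) (neg (α ⊕ neg β) , α , q , Δ⇒⁺ α∈ , cancel α β))
        where
        cancel : ∀ α β → β ≡ neg (α ⊕ neg β) ⊕ α
        cancel α β = ⟨⟩-ext λ z → sym (trans (⟨⟩-⊕ˡ (neg (α ⊕ neg β)) α z) (trans (cong (_+ ⟨ α , z ⟩) (trans (⟨⟩-negˡ (α ⊕ neg β) z) (cong -_ (trans (⟨⟩-⊕ˡ α (neg β) z) (cong (⟨ α , z ⟩ +_) (⟨⟩-negˡ β z))))))
          (solve 2 (λ a b → :- (a :+ :- b) :+ a := b) refl ⟨ α , z ⟩ ⟨ β , z ⟩)))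

      -- Induction on the height `⟨ t , α ⟩`: a root that is not simple is a sum of two positive
      -- roots, both of smaller height.
      cone : ∀ {α} → α ∈ Φ⁺ → ∃ λ c → (∀ δ → 0# ≤ c δ) × α ≡ vsum Δ c
      cone = finite-induction (λ α → ⟨ t , α ⟩) (λ α → ∃ λ c → (∀ δ → 0# ≤ c δ) × α ≡ vsum Δ c) step
        where
        step : ∀ {α} → α ∈ Φ⁺ → (∀ {β} → β ∈ Φ⁺ → ⟨ t , β ⟩ < ⟨ t , α ⟩ → ∃ λ c → (∀ δ → 0# ≤ c δ) × β ≡ vsum Δ c) →
               ∃ λ c → (∀ δ → 0# ≤ c δ) × α ≡ vsum Δ c
        step {α} α∈ ih with em {∃₂ λ β γ → β ∈ Φ⁺ × γ ∈ Φ⁺ × α ≡ β ⊕ γ}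
        ... | no ¬dec = (λ δ → χ (δ ≡ α)) , χ≥0 , ⟨⟩-ext λ z → sym (trans (⟨vsum,⟩ Δ _ z)
              (trans (∑-single Δ-unique (∈-∣⁺ Simple α∈ ¬dec) (λ {δ} _ ne → trans (cong (_* ⟨ δ , z ⟩) (χ-no ne)) (zeroˡ _)))
                (trans (cong (_* ⟨ α , z ⟩) (χ-yes refl)) (*-identityˡ _))))
          where
          χ≥0 : ∀ δ → 0# ≤ χ (δ ≡ α)
          χ≥0 δ with em {δ ≡ α}
          ... | yes _ = 0≤1
          ... | no _  = ≤-refl
        ... | yes (β , γ , β∈ , γ∈ , refl) = add (ih β∈ (0<⇒< (subst (0# <_) γ-part (⁺⇒t-pos γ∈)))) (ih γ∈ (0<⇒< (subst (0# <_) β-part (⁺⇒t-pos β∈))))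
          where
          γ-part : ⟨ t , γ ⟩ ≡ ⟨ t , β ⊕ γ ⟩ - ⟨ t , β ⟩
          γ-part = trans (solve 2 (λ a b → b := (a :+ b) :- a) refl ⟨ t , β ⟩ ⟨ t , γ ⟩) (cong (_- ⟨ t , β ⟩) (sym (⟨⟩-⊕ʳ t β γ)))
          β-part : ⟨ t , β ⟩ ≡ ⟨ t , β ⊕ γ ⟩ - ⟨ t , γ ⟩
          β-part = trans (solve 2 (λ a b → a := (a :+ b) :- b) refl ⟨ t , β ⟩ ⟨ t , γ ⟩) (cong (_- ⟨ t , γ ⟩) (sym (⟨⟩-⊕ʳ t β γ)))
          add : (∃ λ c → (∀ δ → 0# ≤ c δ) × β ≡ vsum Δ c) → (∃ λ c → (∀ δ → 0# ≤ c δ) × γ ≡ vsum Δ c) →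
                ∃ λ c → (∀ δ → 0# ≤ c δ) × β ⊕ γ ≡ vsum Δ c
          add (c , c≥0 , e) (d , d≥0 , e′) = (λ δ → c δ + d δ) , (λ δ → 0≤+ (c≥0 δ) (d≥0 δ)) , ⟨⟩-ext λ z → trans (⟨⟩-⊕ˡ β γ z)
            (trans (cong₂ _+_ (trans (cong ⟨_, z ⟩ e) (⟨vsum,⟩ Δ c z)) (trans (cong ⟨_, z ⟩ e′) (⟨vsum,⟩ Δ d z)))
            (trans (sym (∑-+ Δ (λ δ → c δ * ⟨ δ , z ⟩) (λ δ → d δ * ⟨ δ , z ⟩)))
            (trans (∑-ext {xs = Δ} λ δ → sym (distribʳ ⟨ δ , z ⟩ (c δ) (d δ))) (sym (⟨vsum,⟩ Δ (λ δ → c δ + d δ) z)))))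

      -- The positive and the negative part of a relation are equal, and their
      -- common value u satisfies ⟨ u , u ⟩ ≤ 0 because the simple roots are obtuse.
      Δ-independent : ∀ c → vsum Δ c ≡ 𝟎 → ∀ {δ} → δ ∈ Δ → c δ ≡ 0#
      Δ-independent c rel {δ} δ∈ = trans (c≡ δ) (trans (cong₂ _-_ (vanish p p≥0 u≡𝟎 δ∈) (vanish q q≥0 (trans (sym u≡) u≡𝟎) δ∈)) (-‿inverseʳ 0#))
        where
        p q : V → Carrier
        p δ = proj₁ (positive-part (c δ))
        q δ = proj₁ (proj₂ (positive-part (c δ)))
        p≥0 : ∀ δ → 0# ≤ p δ
        p≥0 δ = proj₁ (proj₂ (proj₂ (positive-part (c δ))))
        q≥0 : ∀ δ → 0# ≤ q δ
        q≥0 δ = proj₁ (proj₂ (proj₂ (proj₂ (positive-part (c δ)))))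
        c≡ : ∀ δ → c δ ≡ p δ - q δ
        c≡ δ = proj₁ (proj₂ (proj₂ (proj₂ (proj₂ (positive-part (c δ))))))
        pq≡0 : ∀ δ → p δ * q δ ≡ 0#
        pq≡0 δ = proj₂ (proj₂ (proj₂ (proj₂ (proj₂ (positive-part (c δ))))))
        u = vsum Δ p
        u≡ : u ≡ vsum Δ q
        u≡ = ⟨⟩-ext λ z → cancel-diff (begin
          ⟨ u , z ⟩ - ⟨ vsum Δ q , z ⟩                              ≡⟨ cong₂ _-_ (⟨vsum,⟩ Δ p z) (⟨vsum,⟩ Δ q z) ⟩
          ∑ Δ (λ δ → p δ * ⟨ δ , z ⟩) - ∑ Δ (λ δ → q δ * ⟨ δ , z ⟩)  ≡⟨ ∑-minus Δ (λ δ → p δ * ⟨ δ , z ⟩) (λ δ → q δ * ⟨ δ , z ⟩) ⟨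
          ∑ Δ (λ δ → p δ * ⟨ δ , z ⟩ - q δ * ⟨ δ , z ⟩)              ≡⟨ ∑-ext {xs = Δ} (λ δ → trans (solve 3 (λ a b d → a :* d :- b :* d := (a :- b) :* d) refl (p δ) (q δ) ⟨ δ , z ⟩) (cong (_* ⟨ δ , z ⟩) (sym (c≡ δ)))) ⟩
          ∑ Δ (λ δ → c δ * ⟨ δ , z ⟩)                                ≡⟨ ⟨vsum,⟩ Δ c z ⟨
          ⟨ vsum Δ c , z ⟩                                           ≡⟨ trans (cong ⟨_, z ⟩ rel) (⟨⟩-𝟎ˡ z) ⟩
          0#                                                         ∎)
        term : ∀ {α β} → α ∈ Δ → β ∈ Δ → 0# ≤ - (p α * (q β * ⟨ α , β ⟩))
        term {α} {β} α∈ β∈ with em {α ≡ β}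
        ... | yes refl = 0≤-by ≤-refl (sym (trans (cong -_ (trans (sym (*-assoc _ _ _)) (trans (cong (_* ⟨ α , α ⟩) (pq≡0 α)) (zeroˡ _)))) -0#≈0#))
        ... | no α≢β = 0≤-by (0≤* (0≤* (p≥0 α) (q≥0 β)) (0≤neg (Δ-obtuse α∈ β∈ α≢β))) (solve 3 (λ a b d → a :* b :* :- d := :- (a :* (b :* d))) refl (p α) (q β) ⟨ α , β ⟩)
        ⟨u,u⟩ : ⟨ u , u ⟩ ≡ ∑ Δ λ α → ∑ Δ λ β → p α * (q β * ⟨ α , β ⟩)
        ⟨u,u⟩ = trans (cong ⟨ u ,_⟩ u≡) (trans (⟨vsum,⟩ Δ p _) (∑-ext {xs = Δ} λ α → trans (cong (p α *_) (⟨,vsum⟩ Δ q α)) (sym (∑-*ˡ Δ (p α) λ β → q β * ⟨ α , β ⟩))))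
        u≡𝟎 : u ≡ 𝟎
        u≡𝟎 = ⟨⟩-definite (≤-antisym
          (≤-by (∑-nonneg {xs = Δ} λ {α} α∈ → ∑-nonneg {xs = Δ} (term α∈))
            (trans (+-identityˡ _) (trans (cong -_ ⟨u,u⟩) (sym (trans (∑-ext {xs = Δ} λ α → ∑-neg Δ λ β → p α * (q β * ⟨ α , β ⟩)) (∑-neg Δ λ α → ∑ Δ λ β → p α * (q β * ⟨ α , β ⟩)))))))
          (⟨⟩-nonneg u))
        vanish : ∀ p → (∀ δ → 0# ≤ p δ) → vsum Δ p ≡ 𝟎 → ∀ {δ} → δ ∈ Δ → p δ ≡ 0#
        vanish p p≥0 e {δ} δ∈ = [ id , (λ h → ⊥-elim (pos⇒≢0 (⁺⇒t-pos (Δ⇒⁺ δ∈)) h)) ]′ (x*y≡0 (∑-nonneg-zero {xs = Δ}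
          (λ {α} α∈ → 0≤* (p≥0 α) (proj₁ (⁺⇒t-pos (Δ⇒⁺ α∈)))) (trans (sym (⟨,vsum⟩ Δ p t)) (trans (cong ⟨ t ,_⟩ e) (⟨⟩-𝟎ʳ t))) δ∈))

      Combination : Pred V 0ℓ
      Combination v = ∃ λ c → v ≡ vsum Δ c

      combination-subspace : Subspace Combination
      combination-subspace = record
        { has-𝟎  = (λ _ → 0#) , ⟨⟩-ext λ z → trans (⟨⟩-𝟎ˡ z) (sym (trans (⟨vsum,⟩ Δ _ z) (∑-zero {xs = Δ} λ _ → zeroˡ _)))
        ; has-⊕· = λ { x k y (c , refl) (d , refl) → (λ δ → c δ + k * d δ) , ⟨⟩-ext λ z → trans (⟨⟩-⊕·ˡ (vsum Δ c) k (vsum Δ d) z)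
            (trans (cong₂ (λ a b → a + k * b) (⟨vsum,⟩ Δ c z) (⟨vsum,⟩ Δ d z))
            (trans (cong (∑ Δ (λ δ → c δ * ⟨ δ , z ⟩) +_) (sym (∑-*ˡ Δ k λ δ → d δ * ⟨ δ , z ⟩)))
            (trans (sym (∑-+ Δ (λ δ → c δ * ⟨ δ , z ⟩) (λ δ → k * (d δ * ⟨ δ , z ⟩))))
            (trans (∑-ext {xs = Δ} λ δ → solve 4 (λ c k d p → c :* p :+ k :* (d :* p) := (c :+ k :* d) :* p) refl (c δ) k (d δ) ⟨ δ , z ⟩)
              (sym (⟨vsum,⟩ Δ (λ δ → c δ + k * d δ) z)))))) }
        }

      abstract
        combination : ∀ v → Combination v
        combination v = Span-least combination-subspace
          (λ α∈ → [ (λ p → proj₁ (cone p) , proj₂ (proj₂ (cone p)))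
                  , (λ p → subst Combination (neg-involutive _) (Subspace.has-neg combination-subspace _ (proj₁ (cone p) , proj₂ (proj₂ (cone p))))) ]′ (root-sign α∈))
          (spanning v)

        -- The basis dual to the simple roots.
        ω : V → V
        ω δ = vsum basis λ e → proj₁ (combination e) δ

        expansion : ∀ v → v ≡ vsum Δ (λ δ → ⟨ ω δ , v ⟩)
        expansion v = ⟨⟩-ext λ z → begin
          ⟨ v , z ⟩
            ≡⟨ parseval v z ⟨
          ∑ basis (λ e → ⟨ v , e ⟩ * ⟨ z , e ⟩)
            ≡⟨ ∑-ext {xs = basis} (λ e → trans (cong (⟨ v , e ⟩ *_) (trans (cong ⟨ z ,_⟩ (proj₂ (combination e))) (⟨,vsum⟩ Δ (proj₁ (combination e)) z))) (sym (∑-*ˡ Δ ⟨ v , e ⟩ λ δ → proj₁ (combination e) δ * ⟨ z , δ ⟩))) ⟩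
          ∑ basis (λ e → ∑ Δ λ δ → ⟨ v , e ⟩ * (proj₁ (combination e) δ * ⟨ z , δ ⟩))
            ≡⟨ ∑-swap basis Δ (λ e δ → ⟨ v , e ⟩ * (proj₁ (combination e) δ * ⟨ z , δ ⟩)) ⟩
          ∑ Δ (λ δ → ∑ basis λ e → ⟨ v , e ⟩ * (proj₁ (combination e) δ * ⟨ z , δ ⟩))
            ≡⟨ ∑-ext {xs = Δ} (λ δ → trans (∑-ext {xs = basis} λ e → trans (solve 3 (λ a c b → a :* (c :* b) := c :* a :* b) refl ⟨ v , e ⟩ (proj₁ (combination e) δ) ⟨ z , δ ⟩) (cong (λ a → proj₁ (combination e) δ * a * ⟨ z , δ ⟩) (⟨⟩-sym v e)))
                 (trans (∑-*ʳ basis ⟨ z , δ ⟩ λ e → proj₁ (combination e) δ * ⟨ e , v ⟩) (cong₂ _*_ (sym (⟨vsum,⟩ basis (λ e → proj₁ (combination e) δ) v)) (⟨⟩-sym z δ)))) ⟩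
          ∑ Δ (λ δ → ⟨ ω δ , v ⟩ * ⟨ δ , z ⟩)
            ≡⟨ ⟨vsum,⟩ Δ (λ δ → ⟨ ω δ , v ⟩) z ⟨
          ⟨ vsum Δ (λ δ → ⟨ ω δ , v ⟩) , z ⟩ ∎

        expansion-unique : ∀ {v c} → v ≡ vsum Δ c → ∀ {δ} → δ ∈ Δ → ⟨ ω δ , v ⟩ ≡ c δ
        expansion-unique {v} {c} e δ∈ = cancel-diff (Δ-independent (λ δ → ⟨ ω δ , v ⟩ - c δ) (⟨⟩-ext λ z → begin
          ⟨ vsum Δ (λ δ → ⟨ ω δ , v ⟩ - c δ) , z ⟩                  ≡⟨ ⟨vsum,⟩ Δ (λ δ → ⟨ ω δ , v ⟩ - c δ) z ⟩
          ∑ Δ (λ δ → (⟨ ω δ , v ⟩ - c δ) * ⟨ δ , z ⟩)               ≡⟨ ∑-ext {xs = Δ} (λ δ → solve 3 (λ a b d → (a :- b) :* d := a :* d :- b :* d) refl ⟨ ω δ , v ⟩ (c δ) ⟨ δ , z ⟩) ⟩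
          ∑ Δ (λ δ → ⟨ ω δ , v ⟩ * ⟨ δ , z ⟩ - c δ * ⟨ δ , z ⟩)     ≡⟨ ∑-minus Δ (λ δ → ⟨ ω δ , v ⟩ * ⟨ δ , z ⟩) (λ δ → c δ * ⟨ δ , z ⟩) ⟩
          _                                                         ≡⟨ cong₂ _-_ (⟨vsum,⟩ Δ (λ δ → ⟨ ω δ , v ⟩) z) (⟨vsum,⟩ Δ c z) ⟨
          ⟨ vsum Δ (λ δ → ⟨ ω δ , v ⟩) , z ⟩ - ⟨ vsum Δ c , z ⟩     ≡⟨ diff≡0 (cong ⟨_, z ⟩ (trans (sym (expansion v)) e)) ⟩
          0#                                                        ≡⟨ ⟨⟩-𝟎ˡ z ⟨
          ⟨ 𝟎 , z ⟩                                                 ∎) δ∈)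

        ⟨ω,⟩ : ∀ δ v → ⟨ ω δ , v ⟩ ≡ ∑ basis (λ e → proj₁ (combination e) δ * ⟨ e , v ⟩)
        ⟨ω,⟩ δ v = ⟨vsum,⟩ basis (λ e → proj₁ (combination e) δ) v

      ω-nonneg : ∀ {δ α} → δ ∈ Δ → α ∈ Φ⁺ → 0# ≤ ⟨ ω δ , α ⟩
      ω-nonneg {δ} δ∈ α∈ = let c , c≥0 , e = cone α∈ in 0≤-by (c≥0 δ) (sym (expansion-unique {c = c} e δ∈))

      private
        single : ∀ {ε} → ε ∈ Δ → ε ≡ vsum Δ (λ δ → χ (δ ≡ ε))
        single {ε} ε∈ = ⟨⟩-ext λ z → sym (trans (⟨vsum,⟩ Δ _ z) (trans
          (∑-single Δ-unique ε∈ (λ {δ} _ ne → trans (cong (_* ⟨ δ , z ⟩) (χ-no ne)) (zeroˡ _)))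
          (trans (cong (_* ⟨ ε , z ⟩) (χ-yes refl)) (*-identityˡ _))))

      ω-self : ∀ {δ} → δ ∈ Δ → ⟨ ω δ , δ ⟩ ≡ 1#
      ω-self δ∈ = trans (expansion-unique (single δ∈) δ∈) (χ-yes refl)

      ω-other : ∀ {δ ε} → δ ∈ Δ → ε ∈ Δ → δ ≢ ε → ⟨ ω δ , ε ⟩ ≡ 0#
      ω-other δ∈ ε∈ ne = trans (expansion-unique (single ε∈) δ∈) (χ-no ne)

      ω-reflect : ∀ {δ ε} v → δ ∈ Δ → ε ∈ Δ → δ ≢ ε → ⟨ ω δ , reflect ε v ⟩ ≡ ⟨ ω δ , v ⟩
      ω-reflect {δ} {ε} v δ∈ ε∈ ne = trans (⟨,reflect⟩ ε v (ω δ)) (trans (cong (λ a → ⟨ ω δ , v ⟩ - cartan ε v * a) (ω-other δ∈ ε∈ ne))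
        (solve 2 (λ a c → a :- c :* :0 := a) refl ⟨ ω δ , v ⟩ (cartan ε v)))

      -- Both sides are the trace of the identity.
      length-Δ : length Δ ≡ ℓ
      length-Δ = fromℕ-injective (begin
        fromℕ (length Δ)                                                    ≡⟨ ∑-length Δ ⟨
        ∑ Δ (λ _ → 1#)                                                      ≡⟨ ∑-cong {xs = Δ} (λ δ∈ → sym (ω-self δ∈)) ⟩
        ∑ Δ (λ δ → ⟨ ω δ , δ ⟩)                                             ≡⟨ ∑-ext {xs = Δ} (λ δ → ⟨ω,⟩ δ δ) ⟩
        ∑ Δ (λ δ → ∑ basis λ e → proj₁ (combination e) δ * ⟨ e , δ ⟩)       ≡⟨ ∑-swap Δ basis _ ⟩
        ∑ basis (λ e → ∑ Δ λ δ → proj₁ (combination e) δ * ⟨ e , δ ⟩)       ≡⟨ ∑-cong {xs = basis} (λ {e} e∈ → trans (sym (⟨,vsum⟩ Δ (proj₁ (combination e)) e)) (trans (cong ⟨ e ,_⟩ (sym (proj₂ (combination e)))) (basis-unit e∈))) ⟩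
        ∑ basis (λ _ → 1#)                                                  ≡⟨ trans (∑-length basis) (cong fromℕ basis-length) ⟩
        fromℕ ℓ                                                             ∎)
        where
        fromℕ-injective : ∀ {m n} → fromℕ m ≡ fromℕ n → m ≡ n
        fromℕ-injective e = ℕ.≤-antisym (fromℕ-cancel-≤ (≤-reflexive e)) (fromℕ-cancel-≤ (≤-reflexive (sym e)))

      Δ⊥⇒𝟎 : ∀ {v} → (∀ {δ} → δ ∈ Δ → ⟨ δ , v ⟩ ≡ 0#) → v ≡ 𝟎
      Δ⊥⇒𝟎 {v} h = ⟨⟩-definite (trans (cong ⟨_, v ⟩ (expansion v)) (trans (⟨vsum,⟩ Δ _ v) (∑-zero {xs = Δ} λ {δ} δ∈ → trans (cong (⟨ ω δ , v ⟩ *_) (h δ∈)) (zeroʳ _))))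

      -- The reflection changes only the coefficient of `δ`. If the image were negative, all other
      -- coefficients of `α` would vanish, and `α` would be a positive multiple of `δ`.
      simple-reflection : ∀ {δ α} → δ ∈ Δ → α ∈ Φ⁺ → α ≢ δ → reflect δ α ∈ Φ⁺
      simple-reflection {δ} {α} δ∈ α∈ α≢δ with root-sign (closed δ α (Δ⇒root δ∈) (⁺⇒root α∈))
      ... | inj₁ h = h
      ... | inj₂ h = ⊥-elim ([ α≢δ ∘ (λ e → trans α≡ (trans (cong (_· δ) e) (1· δ))) , negative ]′ (reduced δ c (Δ⇒root δ∈) (subst (_∈ Φ) α≡ (⁺⇒root α∈))))
        where
        c = ⟨ ω δ , α ⟩
        coefficient : ∀ {ε} → ε ∈ Δ → ε ≢ δ → ⟨ ω ε , α ⟩ ≡ 0#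
        coefficient {ε} ε∈ ε≢δ = ≤-antisym
          (≤-by (0≤-by (ω-nonneg ε∈ h) (trans (⟨⟩-negʳ (ω ε) _) (cong -_ (ω-reflect α ε∈ δ∈ ε≢δ)))) (+-identityˡ _))
          (ω-nonneg ε∈ α∈)
        α≡ : α ≡ c · δ
        α≡ = ⟨⟩-ext λ z → trans (cong ⟨_, z ⟩ (expansion α)) (trans (⟨vsum,⟩ Δ _ z) (trans
          (∑-single Δ-unique δ∈ (λ {ε} ε∈ ne → trans (cong (_* ⟨ ε , z ⟩) (coefficient ε∈ ne)) (zeroˡ _))) (sym (⟨⟩-·ˡ c δ z))))
        negative : c ≢ - 1#
        negative e = pos-neg-⊥ 0<1 (0≤-by (ω-nonneg δ∈ α∈) e)

      chamber-pos : ∀ {z} → (∀ {δ} → δ ∈ Δ → 0# < ⟨ z , δ ⟩) → ∀ {α} → α ∈ Φ⁺ → 0# < ⟨ z , α ⟩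
      chamber-pos {z} h {α} α∈ with cone α∈
      ... | c , c≥0 , e = 0≤-by (∑-nonneg {xs = Δ} nn) (sym ⟨z,α⟩) , λ 0≡ → root-≢𝟎 (⁺⇒root α∈) (trans e (⟨⟩-ext λ w → trans (⟨vsum,⟩ Δ c w)
            (trans (∑-zero {xs = Δ} λ {δ} δ∈ → trans (cong (_* ⟨ δ , w ⟩) ([ id , (λ q → ⊥-elim (pos⇒≢0 (h δ∈) q)) ]′ (x*y≡0 (∑-nonneg-zero {xs = Δ} nn (sym (trans 0≡ ⟨z,α⟩)) δ∈)))) (zeroˡ _)) (sym (⟨⟩-𝟎ˡ w)))))
        where
        nn : ∀ {δ} → δ ∈ Δ → 0# ≤ c δ * ⟨ z , δ ⟩
        nn {δ} δ∈ = 0≤* (c≥0 δ) (proj₁ (h δ∈))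
        ⟨z,α⟩ : ⟨ z , α ⟩ ≡ ∑ Δ λ δ → c δ * ⟨ z , δ ⟩
        ⟨z,α⟩ = trans (cong ⟨ z ,_⟩ e) (⟨,vsum⟩ Δ c z)

      act-root : ∀ {σ} → (∀ {δ} → δ ∈ σ → δ ∈ Δ) → ∀ {α} → α ∈ Φ → act σ α ∈ Φ
      act-root {[]}    h α∈ = α∈
      act-root {δ ∷ σ} h α∈ = closed δ _ (Δ⇒root (h (here refl))) (act-root (h ∘ there) α∈)

      word-≢𝟎 : ∀ {σ} → (∀ {δ} → δ ∈ σ → δ ∈ Δ) → All (_≢ 𝟎) σ
      word-≢𝟎 h = All.tabulate (λ δ∈ → Δ-≢𝟎 (h δ∈))

      module _ (irr : Irreducible Φ) where
        -- If `Z` and its complement were orthogonal, every root would be supported on simple roots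
        -- of one side only (`In` or `Out`), and the roots themselves would split. A simple root
        -- outside `Z` cannot be `In`, its own coefficient being 1.
        Δ-connected : ∀ (Z : Pred V 0ℓ) {δ₀} → δ₀ ∈ Δ → Z δ₀ →
          (∀ {δ ε} → δ ∈ Δ → ε ∈ Δ → Z δ → ¬ Z ε → ⟨ δ , ε ⟩ ≡ 0#) → ∀ {δ} → δ ∈ Δ → Z δ
        Δ-connected Z {δ₀} δ₀∈ Zδ₀ orth {δ} δ∈ with em {Z δ}
        ... | yes z = z
        ... | no ¬z = ⊥-elim (0≢1 (trans (sym (irreducible-connected In irr (Δ⇒root δ₀∈) In-δ₀ In-orth (Δ⇒root δ∈) δ δ∈ ¬z)) (ω-self δ∈)))
          where
          In Out : Pred V 0ℓ
          In α = ∀ ε → ε ∈ Δ → ¬ Z ε → ⟨ ω ε , α ⟩ ≡ 0#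
          Out α = ∀ ε → ε ∈ Δ → Z ε → ⟨ ω ε , α ⟩ ≡ 0#
          In-δ₀ : In δ₀
          In-δ₀ ε ε∈ ¬zε = ω-other ε∈ δ₀∈ λ { refl → ¬zε Zδ₀ }
          In-Out-⊥ : ∀ {α β} → In α → Out β → ⟨ α , β ⟩ ≡ 0#
          In-Out-⊥ {α} {β} i o = trans (cong ⟨_, β ⟩ (expansion α)) (trans (⟨vsum,⟩ Δ (λ δ → ⟨ ω δ , α ⟩) β) (∑-zero {xs = Δ} outer))
            where
            inner : ∀ {ε} → ε ∈ Δ → Z ε → ⟨ ε , β ⟩ ≡ 0#
            inner {ε} ε∈ zε = trans (cong ⟨ ε ,_⟩ (expansion β)) (trans (⟨,vsum⟩ Δ (λ δ → ⟨ ω δ , β ⟩) ε) (∑-zero {xs = Δ} λ {ζ} ζ∈ → summand ζ∈ em))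
              where
              summand : ∀ {ζ} → ζ ∈ Δ → Dec (Z ζ) → ⟨ ω ζ , β ⟩ * ⟨ ε , ζ ⟩ ≡ 0#
              summand {ζ} ζ∈ (yes zζ) = trans (cong (_* ⟨ ε , ζ ⟩) (o ζ ζ∈ zζ)) (zeroˡ ⟨ ε , ζ ⟩)
              summand {ζ} ζ∈ (no ¬zζ) = trans (cong (⟨ ω ζ , β ⟩ *_) (orth ε∈ ζ∈ zε ¬zζ)) (zeroʳ ⟨ ω ζ , β ⟩)
            outer′ : ∀ {ε} → ε ∈ Δ → Dec (Z ε) → ⟨ ω ε , α ⟩ * ⟨ ε , β ⟩ ≡ 0#
            outer′ {ε} ε∈ (yes zε) = trans (cong (⟨ ω ε , α ⟩ *_) (inner ε∈ zε)) (zeroʳ ⟨ ω ε , α ⟩)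
            outer′ {ε} ε∈ (no ¬zε) = trans (cong (_* ⟨ ε , β ⟩) (i ε ε∈ ¬zε)) (zeroˡ ⟨ ε , β ⟩)
            outer : ∀ {ε} → ε ∈ Δ → ⟨ ω ε , α ⟩ * ⟨ ε , β ⟩ ≡ 0#
            outer ε∈ = outer′ ε∈ em
          In-reflect : ∀ {ε α} → ε ∈ Δ → Z ε → In α → In (reflect ε α)
          In-reflect {ε} {α} ε∈ zε i ζ ζ∈ ¬zζ = trans (ω-reflect α ζ∈ ε∈ λ { refl → ¬zζ zε }) (i ζ ζ∈ ¬zζ)
          Out-reflect : ∀ {ε α} → ε ∈ Δ → ¬ Z ε → Out α → Out (reflect ε α)
          Out-reflect {ε} {α} ε∈ ¬zε o ζ ζ∈ zζ = trans (ω-reflect α ζ∈ ε∈ λ { refl → ¬zε zζ }) (o ζ ζ∈ zζ)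
          In-simple : ∀ {ε} → ε ∈ Δ → Z ε → In ε
          In-simple ε∈ zε ζ ζ∈ ¬zζ = ω-other ζ∈ ε∈ λ { refl → ¬zζ zε }
          Out-simple : ∀ {ε} → ε ∈ Δ → ¬ Z ε → Out ε
          Out-simple ε∈ ¬zε ζ ζ∈ zζ = ω-other ζ∈ ε∈ λ { refl → ¬zε zζ }
          -- Every positive root is reached from a simple root by simple
          -- reflections that increase the value of t.
          dichotomy : ∀ {α} → α ∈ Φ⁺ → In α ⊎ Out α
          dichotomy = finite-induction (λ α → ⟨ t , α ⟩) (λ α → In α ⊎ Out α) step
            where
            step : ∀ {α} → α ∈ Φ⁺ → (∀ {β} → β ∈ Φ⁺ → ⟨ t , β ⟩ < ⟨ t , α ⟩ → In β ⊎ Out β) → In α ⊎ Out α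
            -- Since `⟨ α , α ⟩` is the sum of the `f δ`, some `f ε` is positive. The coefficient
            -- being nonnegative, `⟨ ε , α ⟩` is positive too, so the reflection in `ε` lowers the
            -- value of `t`.
            step {α} α∈ ih = descend (∑-pos⁻ Δ {f} (subst (0# <_) (trans (cong ⟨_, α ⟩ (expansion α)) (⟨vsum,⟩ Δ (λ δ → ⟨ ω δ , α ⟩) α)) (⟨⟩-pos (root-≢𝟎 (⁺⇒root α∈)))))
              where
              f : V → Carrier
              f δ = ⟨ ω δ , α ⟩ * ⟨ δ , α ⟩
              simple : ∀ {ε} → ε ∈ Δ → Dec (Z ε) → In ε ⊎ Out ε
              simple ε∈ (yes z) = inj₁ (In-simple ε∈ z)
              simple ε∈ (no ¬z) = inj₂ (Out-simple ε∈ ¬z)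
              finish : ∀ {ε β} → ε ∈ Δ → reflect ε β ≡ α → In β ⊎ Out β → Dec (Z ε) → In α ⊎ Out α
              finish {ε} {β} ε∈ back (inj₁ i) (yes z) = inj₁ (subst In back (In-reflect ε∈ z i))
              finish {ε} {β} ε∈ back (inj₁ i) (no ¬z) = inj₁ (subst In (trans (sym (reflect-⊥ (trans (⟨⟩-sym ε β) (In-Out-⊥ {β} {ε} i (Out-simple ε∈ ¬z))))) back) i)
              finish {ε} {β} ε∈ back (inj₂ o) (yes z) = inj₂ (subst Out (trans (sym (reflect-⊥ (In-Out-⊥ {ε} {β} (In-simple ε∈ z) o))) back) o)
              finish {ε} {β} ε∈ back (inj₂ o) (no ¬z) = inj₂ (subst Out back (Out-reflect ε∈ ¬z o))
              decreases : ∀ {ε} → ε ∈ Δ → 0# < ⟨ ε , α ⟩ → ⟨ t , reflect ε α ⟩ < ⟨ t , α ⟩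
              decreases {ε} ε∈ p = 0<⇒< (subst (0# <_) (trans (solve 2 (λ a c → c := a :- (a :- c)) refl ⟨ t , α ⟩ (cartan ε α * ⟨ t , ε ⟩)) (cong (λ a → ⟨ t , α ⟩ - a) (sym (⟨,reflect⟩ ε α t))))
                (0<* (cartan-pos (Δ⇒root ε∈) p) (⁺⇒t-pos (Δ⇒⁺ ε∈))))
              descend : (∃ λ ε → ε ∈ Δ × 0# < f ε) → In α ⊎ Out α
              descend (ε , ε∈ , p) with em {α ≡ ε}
              ... | yes α≡ε = subst (λ α → In α ⊎ Out α) (sym α≡ε) (simple ε∈ em)
              ... | no α≢ε = finish ε∈ (reflect-involutive α (Δ-≢𝟎 ε∈))
                               (ih (simple-reflection ε∈ α∈ α≢ε) (decreases ε∈ (0<-cancel (ω-nonneg ε∈ α∈) p))) em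
          Out-neg : ∀ {α} → Out (neg α) → Out α
          Out-neg {α} o ε ε∈ z = -x≡0⇒x≡0 {⟨ ω ε , α ⟩} (trans (sym (⟨⟩-negʳ (ω ε) α)) (o ε ε∈ z))
          In-neg : ∀ {α} → In (neg α) → In α
          In-neg {α} o ε ε∈ z = -x≡0⇒x≡0 {⟨ ω ε , α ⟩} (trans (sym (⟨⟩-negʳ (ω ε) α)) (o ε ε∈ z))
          In-orth : ∀ {α β} → α ∈ Φ → β ∈ Φ → In α → ¬ In β → ⟨ α , β ⟩ ≡ 0#
          In-orth {α} {β} α∈ β∈ i ¬i with root-sign β∈
          ... | inj₁ p = [ (λ j → ⊥-elim (¬i j)) , In-Out-⊥ {α} {β} i ]′ (dichotomy p)
          ... | inj₂ p = [ (λ j → ⊥-elim (¬i (In-neg {β} j))) , (λ o → In-Out-⊥ {α} {β} i (Out-neg {β} o)) ]′ (dichotomy p)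

    -- Coxeter elements: few inversions, no fixed vectors, trivial stabilizers.

    module CoxeterElements where
      open SimpleRoots public

      Word : List V → Set
      Word σ = ∀ {δ} → δ ∈ σ → δ ∈ Δ

      -- At the letter where the moving root turns negative it must equal that letter, since a
      -- simple reflection keeps all other positive roots positive. Hence a word has at most one
      -- such root per letter.
      flipped-complete : ∀ {σ} → Word σ → ∀ {θ} → θ ∈ Φ⁺ → act σ θ ∉ Φ⁺ → θ ∈ flipped σ
      flipped-complete {[]}    w θ∈ n = ⊥-elim (n θ∈)
      flipped-complete {δ ∷ σ} w {θ} θ∈ n with em {act σ θ ∈ Φ⁺}
      ... | no ¬p = there (flipped-complete (w ∘ there) θ∈ ¬p)
      ... | yes p with em {act σ θ ≡ δ}
      ...   | yes e = here (trans (sym (unact-act (word-≢𝟎 (w ∘ there)) θ)) (cong (unact σ) e))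
      ...   | no ne = ⊥-elim (n (simple-reflection (w (here refl)) p ne))

      -- The letters being distinct, only the first letter `δ` changes the coordinate `ω δ`. A fixed
      -- vector therefore enters that last reflection with Cartan number 0, is fixed by the
      -- remaining word, and the argument repeats.
      fixed-⊥ : ∀ {σ} → Word σ → Unique σ → ∀ {v} → act σ v ≡ v → ∀ {δ} → δ ∈ σ → ⟨ δ , v ⟩ ≡ 0#
      fixed-⊥ {δ ∷ σ} w (δ∉ ∷ u) {v} e = λ { (here refl) → trans (cong ⟨ δ ,_⟩ (sym fixed)) δ⊥ ; (there h) → fixed-⊥ (w ∘ there) u fixed h }
        where
        x = act σ v
        δ∈ = w (here refl)
        δ≢ = Δ-≢𝟎 δ∈
        ω-act : ∀ {τ} → Word τ → All (δ ≢_) τ → ⟨ ω δ , act τ v ⟩ ≡ ⟨ ω δ , v ⟩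
        ω-act {[]}    w′ []       = refl
        ω-act {ε ∷ τ} w′ (h ∷ hs) = trans (ω-reflect (act τ v) δ∈ (w′ (here refl)) h) (ω-act (w′ ∘ there) hs)
        coefficient : cartan δ x ≡ 0#
        coefficient = combine₃ (- 1#) (- 1#) (- cartan δ x)
          (trans (sym (⟨,reflect⟩ δ x (ω δ))) (cong ⟨ ω δ ,_⟩ e)) (sym (ω-act (w ∘ there) δ∉)) (ω-self δ∈)
          (solve 4 (λ c a b o → c :- :0 := :- :1 :* ((a :- c :* o) :- b) :+ :- :1 :* (b :- a) :+ :- c :* (o :- :1)) refl (cartan δ x) ⟨ ω δ , x ⟩ ⟨ ω δ , v ⟩ ⟨ ω δ , δ ⟩)
        δ⊥ : ⟨ δ , x ⟩ ≡ 0#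
        δ⊥ = *-cancelˡ (pos⇒≢0 0<2) (trans (sym (cartan-spec x δ≢)) (trans (cong (_* ⟨ δ , δ ⟩) coefficient) (trans (zeroˡ ⟨ δ , δ ⟩) (sym (zeroʳ (fromℕ 2))))))
        fixed : x ≡ v
        fixed = trans (sym (reflect-⊥ δ⊥)) e

      module _ {σ} (σ↭Δ : σ ↭ Δ) {h} (h>0 : 0 ℕ.< h) (period : Period σ h) where
        private
          C : V → V
          C = act σ

          word : Word σ
          word = ∈-resp-↭ σ↭Δ

          C-root : ∀ {α} n → α ∈ Φ → iterate C α n ∈ Φ
          C-root zero    α∈ = α∈
          C-root (suc n) α∈ = C-root n (act-root word α∈)

          orbit-sum≡𝟎 : ∀ v → orbit-sum σ h v ≡ 𝟎
          orbit-sum≡𝟎 v = Δ⊥⇒𝟎 (λ δ∈ → fixed-⊥ word (Unique-↭ (↭-sym σ↭Δ) Δ-unique) (orbit-sum-fixed σ h period v) (∈-resp-↭ (↭-sym σ↭Δ) δ∈))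

          orbit-sum-pos : ∀ n {v} z → (∀ k → 0# < ⟨ z , iterate C v k ⟩) → 0# ≤ ⟨ z , orbit-sum σ n v ⟩
          orbit-sum-pos zero    z p = ≤-reflexive (sym (⟨⟩-𝟎ʳ z))
          orbit-sum-pos (suc n) {v} z p = 0≤-by (0≤+ (proj₁ (p 0)) (orbit-sum-pos n z (p ∘ suc))) (sym (⟨⟩-⊕ʳ z v (orbit-sum σ n (C v))))

          not-always : ∀ n v z → 0 ℕ.< n → orbit-sum σ n v ≡ 𝟎 → ¬ (∀ k → 0# < ⟨ z , iterate C v k ⟩)
          not-always (suc n) v z _ e p = pos⇒≢0 (0<+ (p 0) (orbit-sum-pos n z (p ∘ suc)))
            (trans (sym (⟨⟩-⊕ʳ z v (orbit-sum σ n (C v)))) (trans (cong ⟨ z ,_⟩ e) (⟨⟩-𝟎ʳ z)))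

          -- The sum over an orbit vanishes, so no `z` can be positive along all of it. Taking `t`
          -- for `z` makes an orbit meet the negative roots, taking `neg t` the positive ones.
          sometimes : ∀ {α} (P : Pred V 0ℓ) z → (∀ {v} → v ∈ Φ → ¬ P v → 0# < ⟨ z , v ⟩) → α ∈ Φ → ∃ λ k → P (iterate C α k)
          sometimes {α} P z h′ α∈ with em {∃ λ k → P (iterate C α k)}
          ... | yes p = p
          ... | no ¬p = ⊥-elim (not-always h α z h>0 (orbit-sum≡𝟎 α) (λ k → h′ (C-root k α∈) (λ q → ¬p (k , q))))

          first-change : ∀ {α} → α ∈ Φ⁺ → ∀ k → iterate C α k ∉ Φ⁺ → ∃ λ j → iterate C α j ∈ Φ⁺ × C (iterate C α j) ∉ Φ⁺
          first-change α∈ zero    n = ⊥-elim (n α∈)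
          first-change {α} α∈ (suc k) n with em {iterate C α k ∈ Φ⁺}
          ... | yes p = k , p , subst (_∉ Φ⁺) (iterate-suc C α k) n
          ... | no ¬p = first-change α∈ k ¬p

          orbits : List V
          orbits = cartesianProductWith (iterate C) (flipped σ) (upTo h)

          orbits-closed : ∀ {v} → C v ∈ orbits → v ∈ orbits
          orbits-closed {v} Cv∈ = let (θ , j , θ∈ , j∈ , e) = ∈-cartesianProductWith⁻ (iterate C) (flipped σ) (upTo h) Cv∈
                                  in pull θ j θ∈ (∈-upTo⁻ j∈) e
            where
            inject : ∀ {w} → C v ≡ C w → v ≡ w
            inject = act-injective (word-≢𝟎 word)
            pull : ∀ θ j → θ ∈ flipped σ → j ℕ.< h → C v ≡ iterate C θ j → v ∈ orbits
            pull θ (suc j) θ∈ j<h e = subst (_∈ orbits) (sym (inject (trans e (iterate-suc C θ j))))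
              (∈-cartesianProductWith⁺ (iterate C) θ∈ (∈-upTo⁺ (ℕ.<-trans (ℕ.n<1+n j) j<h)))
            -- Exponent 0 wraps around: `θ` is its own image under the `h`-th power, so its
            -- predecessor has exponent `h - 1`.
            pull θ zero    θ∈ j<h e = subst (_∈ orbits) (sym (inject (trans e (trans (sym (period θ)) (trans (cong (iterate C θ) (sym h≡)) (iterate-suc C θ (ℕ.pred h)))))))
              (∈-cartesianProductWith⁺ (iterate C) θ∈ (∈-upTo⁺ (ℕ.≤-reflexive h≡)))
              where
              h≡ : suc (ℕ.pred h) ≡ h
              h≡ = ℕ.suc-pred h {{ℕ.>-nonZero h>0}}

          orbits-closed* : ∀ k {v} → iterate C v k ∈ orbits → v ∈ orbits
          orbits-closed* zero    v∈ = v∈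
          orbits-closed* (suc k) v∈ = orbits-closed (orbits-closed* k v∈)

          θ∈orbits : ∀ {θ} → θ ∈ Φ⁺ → C θ ∉ Φ⁺ → θ ∈ orbits
          θ∈orbits θ∈ n = ∈-cartesianProductWith⁺ (iterate C) (flipped-complete word θ∈ n) (∈-upTo⁺ h>0)

          ⁺∈orbits : ∀ {α} → α ∈ Φ⁺ → α ∈ orbits
          ⁺∈orbits {α} α∈ = let (k , n) = sometimes (_∉ Φ⁺) t (λ {v} v∈ ¬n → ⁺⇒t-pos (stable ¬n)) (⁺⇒root α∈)
                                (j , p , q) = first-change α∈ k n
                            in orbits-closed* j (θ∈orbits p q)

          root∈orbits : ∀ {α} → α ∈ Φ → α ∈ orbits
          root∈orbits {α} α∈ = let (k , p) = sometimes (_∈ Φ⁺) (neg t) (λ {v} v∈ n → subst (0# <_) (trans (⟨⟩-negʳ t v) (sym (⟨⟩-negˡ t v))) (⁺⇒t-pos (∉⁺⇒neg v∈ n))) α∈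
                               in orbits-closed* k (⁺∈orbits p)

        length-Φ≤ : length Φ ℕ.≤ length Δ ℕ.* h
        length-Φ≤ = ℕ.≤-trans (⊆⇒length≤ {ys = orbits} unique root∈orbits) (ℕ.≤-reflexive (trans (length-product (iterate C) (flipped σ) (upTo h))
          (cong₂ ℕ._*_ (trans (length-flipped σ) (↭-length σ↭Δ)) (length-upTo h))))

      -- The exchange property: the word is cut at the letter where the root turns negative, and
      -- just before that letter the root equals it.
      deletion-split : ∀ {σ} → Word σ → ∀ {θ} → θ ∈ Φ⁺ → act σ θ ∉ Φ⁺ →
                       ∃₂ λ τ ε → ∃ λ τ′ → σ ≡ τ ++ ε ∷ τ′ × act τ′ θ ≡ ε
      deletion-split {[]}    w θ∈ n = ⊥-elim (n θ∈)
      deletion-split {δ ∷ σ} w {θ} θ∈ n with em {act σ θ ∈ Φ⁺}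
      ... | no ¬p = let (τ , ε , τ′ , e , e′) = deletion-split (w ∘ there) θ∈ ¬p in δ ∷ τ , ε , τ′ , cong (δ ∷_) e , e′
      ... | yes p with em {act σ θ ≡ δ}
      ...   | yes e = [] , δ , σ , refl , e
      ...   | no ne = ⊥-elim (n (simple-reflection (w (here refl)) p ne))

      -- A word stabilizing a vector of the open chamber can be shortened by two
      -- letters without changing its action.
      stabilizer-trivial : ∀ {z} → (∀ {α} → α ∈ Φ⁺ → 0# < ⟨ z , α ⟩) → ∀ {σ} → Word σ → act σ z ≡ z → ∀ v → act σ v ≡ v
      stabilizer-trivial {z} z-pos {σ} w e = go (length σ) ℕ.≤-refl w e
        where
        preserves : ∀ {σ} → Word σ → act σ z ≡ z → ∀ {α} → α ∈ Φ⁺ → act σ α ∈ Φ⁺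
        preserves {σ} w e {α} α∈ with root-sign (act-root w (⁺⇒root α∈))
        ... | inj₁ p = p
        ... | inj₂ p = ⊥-elim (pos-neg-⊥ (z-pos α∈) (0≤-by (proj₁ (z-pos p)) (trans (⟨⟩-negʳ z (act σ α)) (cong -_ (trans (cong ⟨_, act σ α ⟩ (sym e)) (act-isometry (word-≢𝟎 w) z α))))))
        snoc : ∀ σ → σ ≡ [] ⊎ ∃₂ λ τ δ → σ ≡ τ ++ δ ∷ []
        snoc []      = inj₁ refl
        snoc (δ ∷ σ) with snoc σ
        ... | inj₁ refl           = inj₂ ([] , δ , refl)
        ... | inj₂ (τ , ε , refl) = inj₂ (δ ∷ τ , ε , refl)
        go : ∀ n {σ} → length σ ℕ.≤ n → Word σ → act σ z ≡ z → ∀ v → act σ v ≡ v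
        go n {σ} le w e with snoc σ
        ... | inj₁ refl = λ v → refl
        go zero    le w e | inj₂ (τ , δ , refl) = ⊥-elim (ℕ.n≮0 (ℕ.≤-trans (ℕ.≤-reflexive (sym (trans (length-++ τ) (ℕ.+-comm _ 1)))) le))
        go (suc n) le w e | inj₂ (τ , δ , refl) = shorten (deletion-split wτ (Δ⇒⁺ δ∈) τδ∉)
          where
          δ∈ : δ ∈ Δ
          δ∈ = w (∈-++⁺ʳ τ (here refl))
          wτ : Word τ
          wτ = w ∘ ∈-++⁺ˡ
          -- A word fixing `z` preserves pairings with `z` and hence positivity. It sends `δ` to the
          -- negative of `act τ δ`, so the latter is not positive.
          τδ∉ : act τ δ ∉ Φ⁺
          τδ∉ p = ⁺-neg-⊥ p (subst (_∈ Φ⁺) (trans (act-++ τ (δ ∷ []) δ) (trans (cong (act τ) (reflect-self (Δ-≢𝟎 δ∈))) (act-neg τ δ))) (preserves w e (Δ⇒⁺ δ∈)))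
          shorten : (∃₂ λ μ ε → ∃ λ ν → τ ≡ μ ++ ε ∷ ν × act ν δ ≡ ε) → ∀ v → act (τ ++ δ ∷ []) v ≡ v
          shorten (μ , ε , ν , refl , refl) v = trans (same v) (go n le′ w′ (trans (sym (same z)) e) v)
            where
            wν : Word ν
            wν = wτ ∘ ∈-++⁺ʳ μ ∘ there
            w′ : Word (μ ++ ν)
            w′ h = [ wτ ∘ ∈-++⁺ˡ , wν ]′ (∈-++⁻ μ h)
            le′ : length (μ ++ ν) ℕ.≤ n
            le′ = ℕ.≤-pred (ℕ.≤-trans (ℕ.s≤s (ℕ.≤-trans (ℕ.≤-reflexive (length-++ μ)) (ℕ.≤-trans (ℕ.+-monoʳ-≤ (length μ) (ℕ.n≤1+n (length ν)))
                    (ℕ.≤-reflexive (sym (length-++ μ {act ν δ ∷ ν})))))) (ℕ.≤-trans (ℕ.≤-reflexive (sym (trans (length-++ (μ ++ act ν δ ∷ ν)) (ℕ.+-comm _ 1)))) le))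
            -- The reflection in `act ν δ` followed on the right by `ν` equals `ν` followed on the
            -- right by the reflection in `δ`, which cancels the final letter.
            same : ∀ v → act ((μ ++ act ν δ ∷ ν) ++ δ ∷ []) v ≡ act (μ ++ ν) v
            same v = begin
              act ((μ ++ act ν δ ∷ ν) ++ δ ∷ []) v                  ≡⟨ act-++ (μ ++ act ν δ ∷ ν) (δ ∷ []) v ⟩
              act (μ ++ act ν δ ∷ ν) (reflect δ v)                  ≡⟨ act-++ μ (act ν δ ∷ ν) (reflect δ v) ⟩
              act μ (reflect (act ν δ) (act ν (reflect δ v)))       ≡⟨ cong (act μ) (reflect-conjugate (word-≢𝟎 wν) (Δ-≢𝟎 δ∈) (reflect δ v)) ⟨
              act μ (act ν (reflect δ (reflect δ v)))               ≡⟨ cong (λ u → act μ (act ν u)) (reflect-involutive v (Δ-≢𝟎 δ∈)) ⟩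
              act μ (act ν v)                                       ≡⟨ act-++ μ ν v ⟨
              act (μ ++ ν) v                                        ∎

    -- The Dynkin diagram is a forest.

    module SimpleForest where
      open CoxeterElements public

      cosine : V → V → Carrier
      cosine a b = unit a * unit b * ⟨ a , b ⟩

      cosine-nonpos : ∀ {a b} → a ∈ Δ → b ∈ Δ → a ≢ b → 0# ≤ - cosine a b
      cosine-nonpos {a} {b} a∈ b∈ ne = 0≤-by (0≤* (0≤* (proj₁ (unit-pos (Δ-≢𝟎 a∈))) (proj₁ (unit-pos (Δ-≢𝟎 b∈)))) (0≤neg (Δ-obtuse a∈ b∈ ne)))
        (solve 3 (λ a b p → a :* b :* :- p := :- (a :* b :* p)) refl (unit a) (unit b) ⟨ a , b ⟩)

      -- For an edge `4 cos²` is a positive integer, so `4 cos² - 1 = (1 - 2 cos) (- 2 cos - 1)` is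
      -- nonnegative, and the first factor is positive because the cosine is not.
      cosine-edge : ∀ {a b} → a ∈ Δ → b ∈ Δ → a ≢ b → ⟨ a , b ⟩ ≢ 0# → 0# ≤ - (cosine a b + cosine a b) - 1#
      cosine-edge {a} {b} a∈ b∈ ne e = 0≤-cancel (0≤+0< (0≤+ (cosine-nonpos a∈ b∈ ne) (cosine-nonpos a∈ b∈ ne)) 0<1) (0≤-by
        (≤⇒0≤ (integer-pos (integer-* (cartan-integer (Δ⇒root a∈) (Δ⇒root b∈)) (cartan-integer (Δ⇒root b∈) (Δ⇒root a∈)))
          (subst (0# <_) (sym product) (0<* (0<* 0<2 0<2) (0<sq (*-≢0 (*-≢0 (pos⇒≢0 (unit-pos a≢)) (pos⇒≢0 (unit-pos b≢))) e))))))
        (trans (cong (_- 1#) product) (solve 1 (λ g → :2 :* :2 :* (g :* g) :- :1 := (:- g :+ :- g :+ :1) :* (:- (g :+ g) :- :1)) refl (cosine a b))))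
        where
        a≢ = Δ-≢𝟎 a∈
        b≢ = Δ-≢𝟎 b∈
        product : cartan a b * cartan b a ≡ fromℕ 2 * fromℕ 2 * (cosine a b * cosine a b)
        product = trans (cartan-product a≢ b≢) (cong (fromℕ 2 * fromℕ 2 *_)
          (trans (sym (⟨normalize,normalize⟩²≡κ a≢ b≢)) (cong (λ p → p * p) (⟨normalize,normalize⟩ a b))))

      -- The sum of the squared length of Σ â over a ∈ S is positive, so some
      -- x ∈ S satisfies 1 + Σ cos(x,a) > 0.  An edge contributes at most -1/2.
      simple-forest : ∀ n {S} → length S ≡ n → Word S → Unique S → Forest S
      simple-forest zero    {[]} e w u = empty
      simple-forest (suc n) {S} e w u = pick (∑-pos⁻ S {λ x → unit x * ⟨ x , W ⟩} (subst (0# <_) (⟨vsum,⟩ S unit W) (⟨⟩-pos W≢𝟎)))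
        where
        W : V
        W = vsum S unit
        t-pos : ∀ {x} → x ∈ S → 0# < unit x * ⟨ t , x ⟩
        t-pos x∈ = 0<* (unit-pos (Δ-≢𝟎 (w x∈))) (⁺⇒t-pos (Δ⇒⁺ (w x∈)))
        some : ∀ {S : List V} → length S ≡ suc n → ∃ (_∈ S)
        some {x ∷ _} _ = x , here refl
        W≢𝟎 : W ≢ 𝟎
        W≢𝟎 W≡𝟎 = pos⇒≢0 (∑-pos {xs = S} (λ x∈ → proj₁ (t-pos x∈)) (proj₂ (some e)) (t-pos (proj₂ (some e))))
          (trans (sym (⟨,vsum⟩ S unit t)) (trans (cong ⟨ t ,_⟩ W≡𝟎) (⟨⟩-𝟎ʳ t)))
        pick : (∃ λ x → x ∈ S × 0# < unit x * ⟨ x , W ⟩) → Forest S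
        pick (x , x∈ , p) with ∈-split x∈
        ... | S′ , q = branch S′ refl
          where
          u′ : Unique (x ∷ S′)
          u′ = Unique-↭ q u
          wS′ : Word S′
          wS′ h = w (∈-resp-↭ (↭-sym q) (there h))
          x≢ : ∀ {a} → a ∈ S′ → x ≢ a
          x≢ a∈ refl = Unique.Unique[x∷xs]⇒x∉xs u′ a∈
          F : Forest S′
          F = simple-forest n (ℕ.suc-injective (trans (sym (↭-length q)) e)) wS′ (tail u′)
            where
            tail : ∀ {x : V} {S} → Unique (x ∷ S) → Unique S
            tail (_ ∷ u) = u
          total : 0# < 1# + ∑ S′ (cosine x)
          total = subst (0# <_) (trans (cong (unit x *_) (trans (⟨,vsum⟩ S unit x) (∑-↭ q λ a → unit a * ⟨ x , a ⟩)))
            (trans (distribˡ (unit x) (unit x * ⟨ x , x ⟩) _) (cong₂ _+_ (trans (sym (*-assoc _ _ _)) (unit-spec (Δ-≢𝟎 (w x∈))))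
              (trans (sym (∑-*ˡ S′ (unit x) λ a → unit a * ⟨ x , a ⟩)) (∑-ext {xs = S′} λ a → sym (*-assoc _ _ _)))))) p
          branch : ∀ T → T ≡ S′ → Forest S
          branch []      refl = subst Forest (sym (singleton-↭ q)) (root x)
          branch (b ∷ T) refl with em {∃ λ y → y ∈ S′ × ⟨ x , y ⟩ ≢ 0#}
          -- A vertex without edges is attached as a leaf to an arbitrary vertex.
          ... | no ¬y = leaf F (here refl) (λ {a} a∈ → inj₂ (stable λ ne → ¬y (a , a∈ , ne))) q
          ... | yes (y , y∈ , edge) with ∈-split y∈
          ...   | S″ , q″ = leaf F y∈ (λ {a} a∈ → join (∈-resp-↭ q″ a∈)) q
            where
            S″⊆ : ∀ {a} → a ∈ S″ → a ∈ S′
            S″⊆ a∈ = ∈-resp-↭ (↭-sym q″) (there a∈)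
            second : ∀ {a} → a ∈ S″ → ¬ (⟨ x , a ⟩ ≢ 0#)
            second {a} a∈ edge′ with ∈-split a∈
            ... | S‴ , q‴ = pos-neg-⊥ (0<* 0<2 total)
              (0≤-by (0≤+ (0≤+ (cosine-edge (w x∈) (wS′ y∈) (x≢ y∈) edge) (cosine-edge (w x∈) (wS′ (S″⊆ a∈)) (x≢ (S″⊆ a∈)) edge′))
                          (0≤* 0≤2 (0≤-by (∑-nonneg {xs = S‴} λ b∈ → cosine-nonpos (w x∈) (wS′ (S‴⊆ b∈)) (x≢ (S‴⊆ b∈))) (∑-neg S‴ (cosine x)))))
                (trans (solve 3 (λ g g′ s → :- (g :+ g) :- :1 :+ (:- (g′ :+ g′) :- :1) :+ :2 :* :- s := :- (:2 :* (:1 :+ (g :+ (g′ :+ s))))) refl (cosine x y) (cosine x a) (∑ S‴ (cosine x)))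
                  (cong (λ s → - (fromℕ 2 * (1# + s))) (sym (trans (∑-↭ q″ (cosine x)) (cong (cosine x y +_) (∑-↭ q‴ (cosine x))))))))
              where
              S‴⊆ : ∀ {b} → b ∈ S‴ → b ∈ S′
              S‴⊆ b∈ = S″⊆ (∈-resp-↭ (↭-sym q‴) (there b∈))
            join : ∀ {a} → a ∈ y ∷ S″ → a ≡ y ⊎ ⟨ x , a ⟩ ≡ 0#
            join (here e)   = inj₁ e
            join (there a∈) = inj₂ (stable (second a∈))

      Δ-forest : Forest Δ
      Δ-forest = simple-forest (length Δ) refl id Δ-unique

    -- Perron–Frobenius for the Gram matrix of the normalized simple roots.  The
    -- eigenvalue μ is the minimum of the Rayleigh quotient ⟨v,v⟩/Σ c(δ,v)².
    module PerronFrobenius where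
      open SimpleForest

      length-of : V → Carrier
      length-of δ = √ ⟨ δ , δ ⟩

      unit-length : ∀ {v} → v ≢ 𝟎 → unit v * length-of v ≡ 1#
      unit-length {v} h = ⁻¹-inverseˡ λ e → pos⇒≢0 (⟨⟩-pos h) (trans (sym (√-square _ (⟨⟩-nonneg v))) (trans (cong (λ s → s * s) e) (zeroˡ 0#)))

      -- The coordinate of `v` with respect to the normalized simple root of `δ`.
      c : V → V → Carrier
      c δ v = length-of δ * ⟨ ω δ , v ⟩

      c-linear : ∀ δ x k y → c δ (x ⊕ k · y) ≡ c δ x + k * c δ y
      c-linear δ x k y = trans (cong (length-of δ *_) (⟨⟩-⊕·ʳ (ω δ) x k y)) (solve 4 (λ l p k q → l :* (p :+ k :* q) := l :* p :+ k :* (l :* q)) refl (length-of δ) ⟨ ω δ , x ⟩ k ⟨ ω δ , y ⟩)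

      c-expansion : ∀ v w → ⟨ v , w ⟩ ≡ ∑ Δ λ δ → c δ v * (unit δ * ⟨ δ , w ⟩)
      c-expansion v w = trans (cong ⟨_, w ⟩ (expansion v)) (trans (⟨vsum,⟩ Δ (λ δ → ⟨ ω δ , v ⟩) w) (∑-cong {xs = Δ} λ {δ} δ∈ →
        combine₁ (- (⟨ ω δ , v ⟩ * ⟨ δ , w ⟩)) (unit-length (Δ-≢𝟎 δ∈)) (solve 4 (λ o d l u → o :* d :- l :* o :* (u :* d) := :- (o :* d) :* (u :* l :- :1)) refl ⟨ ω δ , v ⟩ ⟨ δ , w ⟩ (length-of δ) (unit δ))))

      G : V → V → Carrier
      G v w = ∑ Δ λ δ → c δ v * c δ w

      G-nonneg : ∀ v → 0# ≤ G v v
      G-nonneg v = ∑-nonneg {xs = Δ} λ {δ} _ → 0≤sq (c δ v)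

      -- In the coordinates `c`: the Gram matrix of the normalized simple roots minus `μ` times the
      -- identity.
      F : Carrier → V → V → Carrier
      F μ v w = ⟨ v , w ⟩ - μ * G v w

      G-linear : ∀ x k y z → G (x ⊕ k · y) z ≡ G x z + k * G y z
      G-linear x k y z = trans (∑-ext {xs = Δ} λ δ → trans (cong (_* c δ z) (c-linear δ x k y)) (solve 4 (λ p k q r → (p :+ k :* q) :* r := p :* r :+ k :* (q :* r)) refl (c δ x) k (c δ y) (c δ z)))
        (trans (∑-+ Δ (λ δ → c δ x * c δ z) (λ δ → k * (c δ y * c δ z))) (cong (G x z +_) (∑-*ˡ Δ k λ δ → c δ y * c δ z)))

      F-form : ∀ μ → IsForm (F μ)
      F-form μ = record
        { symmetric = λ x y → cong₂ (λ p q → p - μ * q) (⟨⟩-sym x y) (∑-ext {xs = Δ} λ δ → *-comm (c δ x) (c δ y))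
        ; linear    = λ x k y z → trans (cong₂ (λ p q → p - μ * q) (⟨⟩-⊕·ˡ x k y z) (G-linear x k y z))
            (solve 6 (λ p k q m g h → (p :+ k :* q) :- m :* (g :+ k :* h) := (p :- m :* g) :+ k :* (q :- m :* h)) refl ⟨ x , z ⟩ k ⟨ y , z ⟩ μ (G x z) (G y z))
        }

      c-normal : ∀ {δ} → δ ∈ Δ → c δ (unit δ · δ) ≡ 1#
      c-normal {δ} δ∈ = trans (cong (length-of δ *_) (trans (⟨⟩-·ʳ (unit δ) (ω δ) δ) (trans (cong (unit δ *_) (ω-self δ∈)) (*-identityʳ _)))) (trans (*-comm _ _) (unit-length (Δ-≢𝟎 δ∈)))

      c-other : ∀ {δ ε} → δ ∈ Δ → ε ∈ Δ → δ ≢ ε → c δ (unit ε · ε) ≡ 0#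
      c-other {δ} {ε} δ∈ ε∈ ne = trans (cong (length-of δ *_) (trans (⟨⟩-·ʳ (unit ε) (ω δ) ε) (trans (cong (unit ε *_) (ω-other δ∈ ε∈ ne)) (zeroʳ _)))) (zeroʳ _)

      G-normal : ∀ v {δ} → δ ∈ Δ → G v (unit δ · δ) ≡ c δ v
      G-normal v {δ} δ∈ = trans (∑-single Δ-unique δ∈ (λ {ε} ε∈ ne → trans (cong (c ε v *_) (c-other ε∈ δ∈ ne)) (zeroʳ _))) (trans (cong (c δ v *_) (c-normal δ∈)) (*-identityʳ _))

      ⟨,normal⟩ : ∀ v δ → ⟨ v , unit δ · δ ⟩ ≡ unit δ * ⟨ v , δ ⟩
      ⟨,normal⟩ v δ = ⟨⟩-·ʳ (unit δ) v δ

      G-bound : ∃ λ M → 0# ≤ M × ∀ v → G v v ≤ M * ⟨ v , v ⟩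
      G-bound = ∑ Δ m , ∑-nonneg {xs = Δ} (λ {δ} _ → 0≤* (0≤sq (length-of δ)) (⟨⟩-nonneg (ω δ))) , λ v → ≤-by
        (∑-nonneg {xs = Δ} λ {δ} _ → 0≤* (0≤sq (length-of δ)) (≤⇒0≤ (cauchy-schwarz (ω δ) v)))
        (trans (cong (λ p → p - G v v) (sym (∑-*ʳ Δ ⟨ v , v ⟩ m))) (trans (sym (∑-minus Δ (λ δ → m δ * ⟨ v , v ⟩) (λ δ → c δ v * c δ v)))
          (∑-ext {xs = Δ} λ δ → solve 4 (λ l o q p → l :* l :* o :* q :- l :* p :* (l :* p) := l :* l :* (o :* q :- p :* p)) refl (length-of δ) ⟨ ω δ , ω δ ⟩ ⟨ v , v ⟩ ⟨ ω δ , v ⟩)))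
        where
        m : V → Carrier
        m δ = length-of δ * length-of δ * ⟨ ω δ , ω δ ⟩

      -- The lower bounds of the Rayleigh quotient, phrased without a quotient. Their supremum is
      -- the least eigenvalue.
      Below : Pred Carrier 0ℓ
      Below μ = ∀ v → 0# ≤ F μ v v

      F-normal : ∀ μ {δ} → δ ∈ Δ → F μ (unit δ · δ) (unit δ · δ) ≡ 1# - μ
      F-normal μ {δ} δ∈ = trans (cong₂ (λ p q → p - μ * q)
          (trans (⟨⟩-·ˡ (unit δ) δ (unit δ · δ)) (trans (cong (unit δ *_) (⟨⟩-·ʳ (unit δ) δ δ)) (trans (sym (*-assoc _ _ _)) (unit-spec (Δ-≢𝟎 δ∈)))))
          (trans (G-normal (unit δ · δ) δ∈) (c-normal δ∈)))
        (solve 1 (λ m → :1 :- m :* :1 := :1 :- m) refl μ)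

      abs : Carrier → Carrier
      abs x = proj₁ (positive-part x) + proj₁ (proj₂ (positive-part x))

      abs-nonneg : ∀ x → 0# ≤ abs x
      abs-nonneg x = let (_ , _ , p , q , _) = positive-part x in 0≤+ p q

      abs-≥ : ∀ x y → 0# ≤ abs x * abs y - x * y
      abs-≥ x y = let (p , q , p≥0 , q≥0 , e , _) = positive-part x
                      (p′ , q′ , p′≥0 , q′≥0 , e′ , _) = positive-part y
                  in 0≤-by (0≤* 0≤2 (0≤+ (0≤* p≥0 q′≥0) (0≤* q≥0 p′≥0)))
                     (trans (solve 4 (λ p q p′ q′ → :2 :* (p :* q′ :+ q :* p′) := (p :+ q) :* (p′ :+ q′) :- (p :- q) :* (p′ :- q′)) refl p q p′ q′)
                       (cong₂ (λ a b → (p + q) * (p′ + q′) - a * b) (sym e) (sym e′)))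

      abs-sq : ∀ x → abs x * abs x ≡ x * x
      abs-sq x = let (p , q , _ , _ , e , pq) = positive-part x in
        trans (combine₁ (fromℕ 2 * fromℕ 2) pq (solve 2 (λ p q → (p :+ q) :* (p :+ q) :- (p :- q) :* (p :- q) := :2 :* :2 :* (p :* q :- :0)) refl p q)) (cong (λ a → a * a) (sym e))

      Δ-inhabited : ∃ (_∈ Δ)
      Δ-inhabited with em {∃ (_∈ Δ)}
      ... | yes p = p
      ... | no ¬p = ⊥-elim (contra Φ refl)
        where
        contra : ∀ Γ → Γ ≡ Φ → ⊥
        contra []      refl = proj₁ irr refl
        contra (α ∷ Γ) refl = root-≢𝟎 {α} (here refl) (Δ⊥⇒𝟎 λ {δ} δ∈ → ⊥-elim (¬p (δ , δ∈)))

      record Eigenvector : Set where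
        field
          μ       : Carrier
          x       : V → Carrier
          μ-pos   : 0# < μ
          μ≤1     : μ ≤ 1#
          x-pos   : ∀ {δ} → δ ∈ Δ → 0# < x δ
          eigenvector : ∀ {ε} → ε ∈ Δ → ∑ Δ (λ δ → x δ * cosine δ ε) ≡ μ * x ε

      private
        -- The supremum exists because 0 belongs to `Below` and a normalized simple root bounds it
        -- by 1. It belongs to `Below` itself because every Rayleigh quotient is an upper bound of
        -- `Below`.
        minimum : ∃ λ μ → Below μ × ∀ ν → Below ν → ν ≤ μ
        minimum = let (μ , ub , least) = complete Below (0# , λ v → 0≤-by (⟨⟩-nonneg v) (solve 2 (λ p g → p := p :- :0 :* g) refl ⟨ v , v ⟩ (G v v)))
                                          (1# , λ ν h → 0≤⇒≤ (0≤-by (h (unit δ₀ · δ₀)) (F-normal ν δ₀∈)))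
                  in μ , (λ v → below μ least v em) , ub
          where
          δ₀ = proj₁ Δ-inhabited
          δ₀∈ = proj₂ Δ-inhabited
          below : ∀ μ → (∀ b → UpperBound Below b → μ ≤ b) → ∀ v → Dec (G v v ≡ 0#) → 0# ≤ F μ v v
          below μ least v (yes e) = 0≤-by (⟨⟩-nonneg v) (trans (solve 2 (λ p m → p := p :- m :* :0) refl ⟨ v , v ⟩ μ) (cong (λ g → ⟨ v , v ⟩ - μ * g) (sym e)))
          below μ least v (no ne) = 0≤-by (0≤* (G-nonneg v) (≤⇒0≤ (least (⟨ v , v ⟩ * G v v ⁻¹) λ ν h → 0≤⇒≤ (0≤-cancel g-pos (0≤-by (h v) (factor ν))))))
              (sym (factor μ))
            where
            g-pos : 0# < G v v
            g-pos = G-nonneg v , ne ∘ sym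
            factor : ∀ ν → F ν v v ≡ G v v * (⟨ v , v ⟩ * G v v ⁻¹ - ν)
            factor ν = combine₁ (- ⟨ v , v ⟩) (⁻¹-inverseˡ ne) (solve 4 (λ p g i n → p :- n :* g :- g :* (p :* i :- n) := :- p :* (i :* g :- :1)) refl ⟨ v , v ⟩ (G v v) (G v v ⁻¹) ν)

        -- If `F μ` were definite, coercivity and boundedness would give `G v v ≤ M K F μ v v`. Then
        -- `μ` could be raised by `1 / (M K + 1)` without leaving `Below`; the summand 1 only
        -- ensures that the denominator is positive.
        null : ∀ {μ} → Below μ → (∀ ν → Below ν → ν ≤ μ) → ∃ λ v → v ≢ 𝟎 × F μ v v ≡ 0#
        null {μ} below greatest with em {∃ λ v → v ≢ 𝟎 × F μ v v ≡ 0#}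
        ... | yes p = p
        ... | no ¬p = ⊥-elim (improve (coercive ℓ (F-form μ) λ v v≢ → below v , λ e → ¬p (v , v≢ , sym e)) G-bound)
          where
          improve : (∃ λ K → 0# ≤ K × ∀ v → ⟨ v , v ⟩ ≤ K * F μ v v) → (∃ λ M → 0# ≤ M × ∀ v → G v v ≤ M * ⟨ v , v ⟩) → ⊥
          improve (K , 0≤K , h) (M , 0≤M , h′) = <-≤-⊥ (0<⇒< (subst (0# <_) (solve 2 (λ m n → n := m :+ n :- m) refl μ ε) (0<⁻¹ L-pos))) (greatest (μ + ε) better)
            where
            L = M * K + 1#
            L-pos : 0# < L
            L-pos = 0≤+0< (0≤* 0≤M 0≤K) 0<1
            ε = L ⁻¹
            better : Below (μ + ε)
            better v = 0≤-cancel L-pos (0≤-by (0≤+ (0≤+ (below v) (0≤* 0≤M (≤⇒0≤ (h v)))) (≤⇒0≤ (h′ v)))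
              (combine₁ (G v v) (⁻¹-inverseˡ (pos⇒≢0 L-pos)) (solve 6 (λ p g m M K e →
                  let f = p :- m :* g in (f :+ M :* (K :* f :- p) :+ (M :* p :- g)) :- (M :* K :+ :1) :* (p :- (m :+ e) :* g) := g :* (e :* (M :* K :+ :1) :- :1)) refl
                ⟨ v , v ⟩ (G v v) μ M K ε)))

        module _ {μ} (below : Below μ) {v} (v≢𝟎 : v ≢ 𝟎) (Fvv : F μ v v ≡ 0#) where
          a x : V → Carrier
          a δ = abs (c δ v)

          -- The null vector with its coordinates replaced by their absolute values. This keeps `G`
          -- and does not increase the length, since distinct simple roots have nonpositive cosines;
          -- so `z` is again a null vector.
          z : V
          z = vsum Δ (λ δ → a δ * unit δ)

          x δ = c δ z

          x≡a : ∀ {δ} → δ ∈ Δ → x δ ≡ a δ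
          x≡a {δ} δ∈ = trans (cong (length-of δ *_) (expansion-unique {c = λ δ → a δ * unit δ} refl δ∈))
            (combine₁ (a δ) (unit-length (Δ-≢𝟎 δ∈)) (solve 3 (λ l a u → l :* (a :* u) :- a := a :* (u :* l :- :1)) refl (length-of δ) (a δ) (unit δ)))

          x-nonneg : ∀ {δ} → δ ∈ Δ → 0# ≤ x δ
          x-nonneg δ∈ = 0≤-by (abs-nonneg _) (sym (x≡a δ∈))

          gram : ∀ w → ⟨ w , w ⟩ ≡ ∑ Δ λ δ → ∑ Δ λ ε → c δ w * c ε w * cosine ε δ
          gram w = trans (c-expansion w w) (∑-ext {xs = Δ} λ δ → trans
            (cong (λ p → c δ w * (unit δ * p)) (trans (⟨⟩-sym δ w) (c-expansion w δ)))
            (trans (cong (c δ w *_) (sym (∑-*ˡ Δ (unit δ) λ ε → c ε w * (unit ε * ⟨ ε , δ ⟩)))) (trans (sym (∑-*ˡ Δ (c δ w) λ ε → unit δ * (c ε w * (unit ε * ⟨ ε , δ ⟩))))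
              (∑-ext {xs = Δ} λ ε → solve 5 (λ c d u w p → c :* (u :* (d :* (w :* p))) := c :* d :* (w :* u :* p)) refl (c δ w) (c ε w) (unit δ) (unit ε) ⟨ ε , δ ⟩))))

          term : ∀ {δ ε} → δ ∈ Δ → ε ∈ Δ → Dec (ε ≡ δ) → 0# ≤ c δ v * c ε v * cosine ε δ - x δ * x ε * cosine ε δ
          term {δ} {ε} δ∈ ε∈ (yes refl) = ≤-reflexive (sym (diff≡0 (cong (_* cosine δ δ) (sym (trans (cong₂ _*_ (x≡a δ∈) (x≡a δ∈)) (abs-sq (c δ v)))))))
          term {δ} {ε} δ∈ ε∈ (no ne) = 0≤-by (0≤* (abs-≥ (c δ v) (c ε v)) (cosine-nonpos ε∈ δ∈ ne))
            (trans (solve 4 (λ a b p g → (a :* b :- p) :* :- g := p :* g :- a :* b :* g) refl (a δ) (a ε) (c δ v * c ε v) (cosine ε δ))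
              (cong₂ (λ p q → c δ v * c ε v * cosine ε δ - p * q * cosine ε δ) (sym (x≡a δ∈)) (sym (x≡a ε∈))))

          shorter : ⟨ z , z ⟩ ≤ ⟨ v , v ⟩
          shorter = ≤-by (∑-nonneg {xs = Δ} λ {δ} δ∈ → ∑-nonneg {xs = Δ} λ {ε} ε∈ → term δ∈ ε∈ em)
            (trans (cong₂ _-_ (gram v) (gram z)) (trans (sym (∑-minus Δ (λ δ → ∑ Δ λ ε → c δ v * c ε v * cosine ε δ) (λ δ → ∑ Δ λ ε → x δ * x ε * cosine ε δ)))
              (∑-ext {xs = Δ} λ δ → sym (∑-minus Δ (λ ε → c δ v * c ε v * cosine ε δ) (λ ε → x δ * x ε * cosine ε δ)))))

          G-same : G z z ≡ G v v
          G-same = ∑-cong {xs = Δ} λ {δ} δ∈ → trans (cong₂ _*_ (x≡a δ∈) (x≡a δ∈)) (abs-sq (c δ v))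

          Fzz : F μ z z ≡ 0#
          Fzz = ≤-antisym (≤-by (≤⇒0≤ shorter) (trans (cong (_- F μ z z) (sym Fvv)) (trans (cong (λ g → F μ v v - (⟨ z , z ⟩ - μ * g)) G-same)
            (solve 4 (λ p q m g → p :- m :* g :- (q :- m :* g) := p :- q) refl ⟨ v , v ⟩ ⟨ z , z ⟩ μ (G v v))))) (below z)

          -- A null vector of a semidefinite form lies in its radical. Pairing with the normalized
          -- simple root of `ε` reads off one row of the eigenvalue equation.
          critical : ∀ {ε} → ε ∈ Δ → ∑ Δ (λ δ → x δ * cosine δ ε) ≡ μ * x ε
          critical {ε} ε∈ = trans (∑-ext {xs = Δ} λ δ → solve 4 (λ x u w p → x :* (u :* w :* p) := w :* (x :* (u :* p))) refl (x δ) (unit δ) (unit ε) ⟨ δ , ε ⟩)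
            (trans (∑-*ˡ Δ (unit ε) λ δ → x δ * (unit δ * ⟨ δ , ε ⟩)) (trans (cong (unit ε *_) (sym (c-expansion z ε))) (trans (sym (⟨,normal⟩ z ε))
              (trans (cancel-diff (IsForm.null-vector (F-form μ) below Fzz (unit ε · ε))) (cong (μ *_) (G-normal z ε∈))))))

          some-pos : ∃ λ δ → δ ∈ Δ × 0# < x δ
          some-pos with em {∃ λ δ → δ ∈ Δ × 0# < x δ}
          ... | yes p = p
          ... | no ¬p = ⊥-elim (v≢𝟎 (⟨⟩-definite (trans (c-expansion v v) (∑-zero {xs = Δ} λ {δ} δ∈ → trans (cong (_* (unit δ * ⟨ δ , v ⟩))
                  (sq≡0 (trans (sym (abs-sq (c δ v))) (trans (cong (λ p → p * p) (trans (sym (x≡a δ∈)) (x≡0 δ∈))) (zeroˡ 0#))))) (zeroˡ _)))))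
            where
            x≡0 : ∀ {δ} → δ ∈ Δ → x δ ≡ 0#
            x≡0 {δ} δ∈ = stable λ ne → ¬p (δ , δ∈ , x-nonneg δ∈ , ne ∘ sym)

          G-pos : 0# < G z z
          G-pos = let (δ , δ∈ , p) = some-pos in ∑-pos {xs = Δ} (λ {δ} _ → 0≤sq (x δ)) δ∈ (0<* p p)

          μ-positive : 0# < μ
          μ-positive = 0<-cancel (proj₁ G-pos) (subst (0# <_) (trans (cancel-diff Fzz) (*-comm _ _)) (⟨⟩-pos z≢𝟎))
            where
            z≢𝟎 : z ≢ 𝟎
            z≢𝟎 e = let (δ , δ∈ , p) = some-pos in pos⇒≢0 p (trans (cong (c δ) e) (trans (cong (length-of δ *_) (⟨⟩-𝟎ʳ (ω δ))) (zeroʳ _)))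

          -- Where a coordinate vanishes, the eigenvalue equation is a vanishing sum of nonpositive
          -- terms, so the coordinates of all neighbours vanish too. By connectedness one positive
          -- coordinate makes all of them positive.
          x-positive : ∀ {δ} → δ ∈ Δ → 0# < x δ
          x-positive = let (δ , δ∈ , p) = some-pos in Δ-connected irr (λ δ → 0# < x δ) δ∈ p orth
            where
            orth : ∀ {δ ε} → δ ∈ Δ → ε ∈ Δ → 0# < x δ → ¬ 0# < x ε → ⟨ δ , ε ⟩ ≡ 0#
            orth {δ} {ε} δ∈ ε∈ p ¬q = [ (λ e → ⊥-elim (pos⇒≢0 p e)) , (λ e → [ (λ e′ → ⊥-elim (*-≢0 (pos⇒≢0 (unit-pos (Δ-≢𝟎 δ∈))) (pos⇒≢0 (unit-pos (Δ-≢𝟎 ε∈))) e′)) , id ]′ (x*y≡0 e)) ]′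
                (x*y≡0 (-x≡0⇒x≡0 (∑-nonneg-zero {xs = Δ} (λ ζ∈ → nonneg ζ∈ em) (trans (∑-neg Δ λ ζ → x ζ * cosine ζ ε) (trans (cong -_ (trans (critical ε∈) (trans (cong (μ *_) xε≡0) (zeroʳ μ)))) -0#≈0#)) δ∈)))
              where
              xε≡0 : x ε ≡ 0#
              xε≡0 = stable λ ne → ¬q (x-nonneg ε∈ , ne ∘ sym)
              nonneg : ∀ {ζ} → ζ ∈ Δ → Dec (ζ ≡ ε) → 0# ≤ - (x ζ * cosine ζ ε)
              nonneg {ζ} ζ∈ (yes refl) = ≤-reflexive (sym (trans (cong (λ p → - (p * cosine ζ ζ)) xε≡0) (solve 1 (λ g → :- (:0 :* g) := :0) refl (cosine ζ ζ))))
              nonneg {ζ} ζ∈ (no ne) = 0≤-by (0≤* (x-nonneg ζ∈) (cosine-nonpos ζ∈ ε∈ ne)) (solve 2 (λ x g → x :* :- g := :- (x :* g)) refl (x ζ) (cosine ζ ε))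

          eigen-data : Eigenvector
          eigen-data = record
            { μ = μ ; x = x ; μ-pos = μ-positive
            ; μ≤1 = 0≤⇒≤ (0≤-by (below (unit δ₀ · δ₀)) (F-normal μ (proj₂ Δ-inhabited)))
            ; x-pos = x-positive ; eigenvector = critical }
            where δ₀ = proj₁ Δ-inhabited

      abstract
        perron-frobenius : Eigenvector
        perron-frobenius = let (μ , below , greatest) = minimum
                               (v , v≢𝟎 , e) = null below greatest
                           in eigen-data below v≢𝟎 e

    -- The plane of a bipartite Coxeter element, and the lower bound for the number of roots.

    module Dihedral where
      open SimpleForest public
      open PerronFrobenius using (unit-length; length-of)
      open PerronFrobenius.Eigenvector PerronFrobenius.perron-frobenius

      Φ-split : Φ ↭ Φ⁺ ++ map neg Φ⁺
      Φ-split = same-set⇒↭ unique (Unique.++⁺ unique⁺ (Unique.map⁺ neg-injective unique⁺) disjoint)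
        (λ {α} α∈ → [ ∈-++⁺ˡ , (λ p → ∈-++⁺ʳ Φ⁺ (subst (_∈ map neg Φ⁺) (neg-involutive α) (∈-map⁺ neg p))) ]′ (root-sign α∈))
        (λ {α} α∈ → [ ⁺⇒root , (λ p → let (β , β∈ , e) = ∈-map⁻ neg p in subst (_∈ Φ) (sym e) (neg-root (⁺⇒root β∈))) ]′ (∈-++⁻ Φ⁺ α∈))
        where
        disjoint : ∀ {α} → ¬ (α ∈ Φ⁺ × α ∈ map neg Φ⁺)
        disjoint (p , q) with ∈-map⁻ neg q
        ... | β , β∈ , refl = ⁺-neg-⊥ β∈ p

      length-Φ : length Φ ≡ length Φ⁺ ℕ.+ length Φ⁺
      length-Φ = trans (↭-length Φ-split) (trans (length-++ Φ⁺) (cong (length Φ⁺ ℕ.+_) (length-map neg Φ⁺)))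

      -- For a bipartition with both sides inhabited, `- k` is the cosine of the angle between the
      -- two halves `U I` and `U J` of the eigenvector, which have equal length.
      k : Carrier
      k = 1# - μ

      record Bipartition (I J : List V) : Set where
        field
          whole        : I ++ J ↭ Δ
          independentˡ : Independent I
          independentʳ : Independent J

        wordˡ : Word I
        wordˡ = ∈-resp-↭ whole ∘ ∈-++⁺ˡ

        wordʳ : Word J
        wordʳ = ∈-resp-↭ whole ∘ ∈-++⁺ʳ I

        uniqueˡ : Unique I
        uniqueˡ = unique-++ (Unique-↭ (↭-sym whole) Δ-unique)
          where
          unique-++ : ∀ {I J : List V} → Unique (I ++ J) → Unique I
          unique-++ {[]}    u = []
          unique-++ {x ∷ I} (x∉ ∷ u) = All.tabulate (λ y∈ → All.lookup x∉ (∈-++⁺ˡ y∈)) ∷ unique-++ u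

      swap-sides : ∀ {I J} → Bipartition I J → Bipartition J I
      swap-sides {I} {J} b = record { whole = ↭-trans (++-comm J I) whole ; independentˡ = independentʳ ; independentʳ = independentˡ }
        where open Bipartition b

      U : List V → V
      U I = vsum I λ δ → x δ * unit δ

      plane : List V → List V → Carrier → Carrier → V
      plane I J s t′ = s · U I ⊕ t′ · U J

      plane-swap : ∀ I J s t′ → plane I J s t′ ≡ plane J I t′ s
      plane-swap I J s t′ = ⊕-comm (s · U I) (t′ · U J)

      module _ {I J} (b : Bipartition I J) where
        open Bipartition b

        ⟨U,⟩ : ∀ K δ → unit δ * ⟨ U K , δ ⟩ ≡ ∑ K (λ ε → x ε * cosine ε δ)
        ⟨U,⟩ K δ = trans (cong (unit δ *_) (⟨vsum,⟩ K (λ δ → x δ * unit δ) δ)) (trans (sym (∑-*ˡ K (unit δ) λ ε → x ε * unit ε * ⟨ ε , δ ⟩))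
          (∑-ext {xs = K} λ ε → solve 4 (λ u x w p → u :* (x :* w :* p) := x :* (w :* u :* p)) refl (unit δ) (x ε) (unit ε) ⟨ ε , δ ⟩))

        ⟨Uˡ,ˡ⟩ : ∀ {i} → i ∈ I → unit i * ⟨ U I , i ⟩ ≡ x i
        ⟨Uˡ,ˡ⟩ {i} i∈ = trans (⟨U,⟩ I i) (trans (∑-single uniqueˡ i∈ (λ {ε} ε∈ ne → trans (cong (λ p → x ε * (unit ε * unit i * p)) (independentˡ ε∈ i∈ ne)) (solve 2 (λ a b → a :* (b :* :0) := :0) refl (x ε) (unit ε * unit i))))
          (trans (cong (x i *_) (unit-spec (Δ-≢𝟎 (wordˡ i∈)))) (*-identityʳ _)))

        -- The row of the eigenvalue equation at `i`, split along `I` and `J`. Within `I` only the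
        -- diagonal term survives, which leaves `μ - 1 = - k` for the other half.
        ⟨Uʳ,ˡ⟩ : ∀ {i} → i ∈ I → unit i * ⟨ U J , i ⟩ ≡ - k * x i
        ⟨Uʳ,ˡ⟩ {i} i∈ = combine₃ (- 1#) 1# 1# (⟨Uˡ,ˡ⟩ i∈) total (⟨U,⟩ I i)
          (solve 5 (λ a b c m x → a :- :- (:1 :- m) :* x := :- :1 :* (b :- x) :+ :1 :* (c :+ a :- m :* x) :+ :1 :* (b :- c)) refl
            (unit i * ⟨ U J , i ⟩) (unit i * ⟨ U I , i ⟩) (∑ I λ ε → x ε * cosine ε i) μ (x i))
          where
          total : ∑ I (λ ε → x ε * cosine ε i) + unit i * ⟨ U J , i ⟩ ≡ μ * x i
          total = trans (cong (∑ I (λ ε → x ε * cosine ε i) +_) (⟨U,⟩ J i)) (trans (sym (∑-++ I (λ ε → x ε * cosine ε i))) (trans (∑-↭ whole (λ ε → x ε * cosine ε i)) (eigenvector (wordˡ i∈))))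

        ⟨plane,ˡ⟩ : ∀ s t′ {i} → i ∈ I → unit i * ⟨ plane I J s t′ , i ⟩ ≡ x i * (s - k * t′)
        ⟨plane,ˡ⟩ s t′ {i} i∈ = trans (cong (unit i *_) (⟨lin₂,⟩ s (U I) t′ (U J) i)) (combine₂ s t′ (⟨Uˡ,ˡ⟩ i∈) (⟨Uʳ,ˡ⟩ i∈)
          (solve 7 (λ u s p t q x k → u :* (s :* p :+ t :* q) :- x :* (s :- k :* t) := s :* (u :* p :- x) :+ t :* (u :* q :- :- k :* x)) refl
            (unit i) s ⟨ U I , i ⟩ t′ ⟨ U J , i ⟩ (x i) k))

        -- At a point of the plane the Cartan numbers of the roots in `I` are proportional to the
        -- coefficients of `U I`. Hence the product of these reflections acts on the plane as the
        -- reflection in `U I`.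
        act-plane : ∀ s t′ → act I (plane I J s t′) ≡ plane I J (k * t′ + k * t′ - s) t′
        act-plane s t′ = ⟨⟩-ext λ z → begin
          ⟨ act I p , z ⟩
            ≡⟨ act-independent {I} independentˡ uniqueˡ p z ⟩
          ⟨ p , z ⟩ - ∑ I (λ δ → cartan δ p * ⟨ δ , z ⟩)
            ≡⟨ cong (λ r → ⟨ p , z ⟩ - r) (trans (∑-cong {xs = I} (λ {δ} δ∈ → trans (cong (_* ⟨ δ , z ⟩) (cartan-p δ∈)) (*-assoc (fromℕ 2 * (s - k * t′)) (x δ * unit δ) ⟨ δ , z ⟩)))
                 (trans (∑-*ˡ I (fromℕ 2 * (s - k * t′)) λ δ → x δ * unit δ * ⟨ δ , z ⟩) (cong (fromℕ 2 * (s - k * t′) *_) (sym (⟨vsum,⟩ I (λ δ → x δ * unit δ) z))))) ⟩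
          ⟨ p , z ⟩ - fromℕ 2 * (s - k * t′) * ⟨ U I , z ⟩
            ≡⟨ cong (λ r → r - fromℕ 2 * (s - k * t′) * ⟨ U I , z ⟩) (⟨lin₂,⟩ s (U I) t′ (U J) z) ⟩
          s * ⟨ U I , z ⟩ + t′ * ⟨ U J , z ⟩ - fromℕ 2 * (s - k * t′) * ⟨ U I , z ⟩
            ≡⟨ solve 5 (λ s a t b k → s :* a :+ t :* b :- :2 :* (s :- k :* t) :* a := (k :* t :+ k :* t :- s) :* a :+ t :* b) refl s ⟨ U I , z ⟩ t′ ⟨ U J , z ⟩ k ⟩
          (k * t′ + k * t′ - s) * ⟨ U I , z ⟩ + t′ * ⟨ U J , z ⟩
            ≡⟨ ⟨lin₂,⟩ (k * t′ + k * t′ - s) (U I) t′ (U J) z ⟨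
          ⟨ plane I J (k * t′ + k * t′ - s) t′ , z ⟩ ∎
          where
          p = plane I J s t′
          cartan-p : ∀ {δ} → δ ∈ I → cartan δ p ≡ fromℕ 2 * (s - k * t′) * (x δ * unit δ)
          cartan-p {δ} δ∈ = trans (cong (fromℕ 2 * ⟨ δ , p ⟩ *_) (sym (unit² (Δ-≢𝟎 (wordˡ δ∈))))) (combine₁ (fromℕ 2 * unit δ) (trans (cong (unit δ *_) (⟨⟩-sym δ p)) (⟨plane,ˡ⟩ s t′ δ∈))
            (solve 5 (λ t p u s x → t :* p :* (u :* u) :- t :* s :* (x :* u) := t :* u :* (u :* p :- x :* s)) refl (fromℕ 2) ⟨ δ , p ⟩ (unit δ) (s - k * t′) (x δ)))

      -- Chebyshev polynomials of the second kind, evaluated at k.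
      S : ℕ → Carrier
      S zero          = 0#
      S (suc zero)    = 1#
      S (suc (suc n)) = (k + k) * S (suc n) - S n

      -- An invariant of the recursion. Next to a zero of `S` it forces the neighbouring values to
      -- be 1 or -1.
      wronskian : ∀ n → S (suc n) * S (suc n) - S (suc (suc n)) * S n ≡ 1#
      wronskian zero    = solve 1 (λ l → :1 :* :1 :- (l :* :1 :- :0) :* :0 := :1) refl (k + k)
      wronskian (suc n) = trans (solve 3 (λ l a b → (l :* a :- b) :* (l :* a :- b) :- (l :* (l :* a :- b) :- a) :* a := a :* a :- (l :* a :- b) :* b) refl (k + k) (S (suc n)) (S n)) (wronskian n)

      -- Only the restriction of a root to the plane matters. The linear forms `s - k t′` and
      -- `t′ - k s` are, up to positive factors, the restrictions of the roots in `I` and in `J`, so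
      -- they cut out the chamber within the plane.
      record AtLevel (I J : List V) (n : ℕ) (ρ : V) : Set where
        field
          factor     : Carrier
          factor-pos : 0# < factor
          values     : ∀ s t′ → ⟨ plane I J s t′ , ρ ⟩ ≡ factor * (S (suc n) * (s - k * t′) + S n * (t′ - k * s))

      level-zero : ∀ {I J} → Bipartition I J → ∀ {i} → i ∈ I → AtLevel I J 0 i
      level-zero {I} {J} b {i} i∈ = record
        { factor = length-of i * x i
        ; factor-pos = 0<* (0<-cancel (proj₁ (unit-pos i≢)) (subst (0# <_) (sym (unit-length i≢)) 0<1)) (x-pos i∈Δ)
        ; values = λ s t′ → combine₂ (- ⟨ plane I J s t′ , i ⟩) (length-of i) (unit-length i≢) (⟨plane,ˡ⟩ b s t′ i∈)
            (solve 6 (λ p u l x s t → p :- l :* x :* (:1 :* s :+ :0 :* t) := :- p :* (u :* l :- :1) :+ l :* (u :* p :- x :* s)) refl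
              ⟨ plane I J s t′ , i ⟩ (unit i) (length-of i) (x i) (s - k * t′) (t′ - k * s))
        }
        where
        i∈Δ = Bipartition.wordˡ b i∈
        i≢ = Δ-≢𝟎 i∈Δ

      -- By self-adjointness the word `I` is moved to the point of the plane, where it substitutes
      -- `2 k t′ - s` for `s`. On the coefficients this substitution is the Chebyshev recursion.
      level-suc : ∀ {I J} → Bipartition I J → ∀ {n ρ} → AtLevel J I n ρ → AtLevel I J (suc n) (act I ρ)
      level-suc {I} {J} b {n} {ρ} lv = record
        { factor = factor
        ; factor-pos = factor-pos
        ; values = λ s t′ → begin
            ⟨ plane I J s t′ , act I ρ ⟩                       ≡⟨ act-adjoint {I} independentˡ uniqueˡ (plane I J s t′) ρ ⟨
            ⟨ act I (plane I J s t′) , ρ ⟩                     ≡⟨ cong ⟨_, ρ ⟩ (trans (act-plane b s t′) (plane-swap I J (k * t′ + k * t′ - s) t′)) ⟩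
            ⟨ plane J I t′ (k * t′ + k * t′ - s) , ρ ⟩         ≡⟨ values t′ (k * t′ + k * t′ - s) ⟩
            _                                                  ≡⟨ solve 6 (λ d a b s t k → d :* (a :* (t :- k :* (k :* t :+ k :* t :- s)) :+ b :* (k :* t :+ k :* t :- s :- k :* t))
                                                                    := d :* (((k :+ k) :* a :- b) :* (s :- k :* t) :+ a :* (t :- k :* s))) refl factor (S (suc n)) (S n) s t′ k ⟩
            factor * (S (suc (suc n)) * (s - k * t′) + S (suc n) * (t′ - k * s)) ∎
        }
        where
        open Bipartition b
        open AtLevel lv

      μ-spec : 1# - k ≡ μ
      μ-spec = solve 1 (λ m → :1 :- (:1 :- m) := m) refl μ

      plane-pos : ∀ {I J} → Bipartition I J → ∀ {s t′} → 0# < s - k * t′ → 0# < t′ - k * s → ∀ {α} → α ∈ Φ⁺ → 0# < ⟨ plane I J s t′ , α ⟩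
      plane-pos {I} {J} b {s} {t′} p q = chamber-pos {plane I J s t′} λ {δ} δ∈ → [ left {δ} , right {δ} ]′ (∈-++⁻ I (∈-resp-↭ (↭-sym (Bipartition.whole b)) δ∈))
        where
        left : ∀ {δ} → δ ∈ I → 0# < ⟨ plane I J s t′ , δ ⟩
        left {δ} δ∈ = let w = Bipartition.wordˡ b δ∈ in 0<-cancel (proj₁ (unit-pos (Δ-≢𝟎 w))) (subst (0# <_) (sym (⟨plane,ˡ⟩ b s t′ δ∈)) (0<* (x-pos w) p))
        right : ∀ {δ} → δ ∈ J → 0# < ⟨ plane I J s t′ , δ ⟩
        right {δ} δ∈ = let w = Bipartition.wordʳ b δ∈ in 0<-cancel (proj₁ (unit-pos (Δ-≢𝟎 w)))
          (subst (0# <_) (sym (trans (cong (λ v → unit δ * ⟨ v , δ ⟩) (plane-swap I J s t′)) (⟨plane,ˡ⟩ (swap-sides b) t′ s δ∈))) (0<* (x-pos w) q))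

      -- Tested at the full eigenvector `plane I J 1 1`, which lies in the open chamber: both
      -- chamber forms equal `μ` there, so the value is a positive multiple of `S (n + 1) + S n`.
      level-positive : ∀ {I J} → Bipartition I J → ∀ {n ρ} → ρ ∈ Φ → AtLevel I J n ρ → 0# < S (suc n) + S n → ρ ∈ Φ⁺
      level-positive {I} {J} b {n} {ρ} ρ∈ lv p with root-sign ρ∈
      ... | inj₁ h = h
      ... | inj₂ h = ⊥-elim (pos-neg-⊥ (plane-pos b one one h) (0≤-by (proj₁ (0<* (0<* factor-pos μ-pos) p))
            (trans (trans (trans (cong (λ m → factor * m * (S (suc n) + S n)) (sym μ-spec)) (solve 4 (λ d a b k → d :* (:1 :- k) :* (a :+ b) := d :* (a :* (:1 :- k :* :1) :+ b :* (:1 :- k :* :1))) refl factor (S (suc n)) (S n) k))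
              (sym (values 1# 1#))) (trans (sym (cong ⟨ plane I J 1# 1# ,_⟩ (neg-involutive ρ))) (⟨⟩-negʳ (plane I J 1# 1#) (neg ρ))))))
        where
        open AtLevel lv
        one : 0# < 1# - k * 1#
        one = subst (0# <_) (trans (sym μ-spec) (solve 1 (λ k → :1 :- k := :1 :- k :* :1) refl k)) μ-pos

      -- The roots of level less than q.
      levels : List V → List V → ℕ → List V
      levels I J zero    = []
      levels I J (suc q) = I ++ map (act I) (levels J I q)

      levels-root : ∀ {I J} → Bipartition I J → ∀ q {ρ} → ρ ∈ levels I J q → ρ ∈ Φ × ∃ λ n → n ℕ.< q × AtLevel I J n ρ
      levels-root {I} {J} b (suc q) {ρ} ρ∈ = [ first , later ]′ (∈-++⁻ I ρ∈)
        where
        open Bipartition b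
        first : ρ ∈ I → ρ ∈ Φ × ∃ λ n → n ℕ.< suc q × AtLevel I J n ρ
        first h = Δ⇒root (wordˡ h) , 0 , ℕ.s≤s ℕ.z≤n , level-zero b h
        later : ρ ∈ map (act I) (levels J I q) → ρ ∈ Φ × ∃ λ n → n ℕ.< suc q × AtLevel I J n ρ
        later h with ∈-map⁻ (act I) h
        ... | σ , σ∈ , refl = let (r , n , n<q , lv) = levels-root (swap-sides b) q σ∈ in act-root wordˡ r , suc n , ℕ.s≤s n<q , level-suc b lv

      levels-positive : ∀ {I J} → Bipartition I J → ∀ q → (∀ {n} → n ℕ.< q → 0# < S (suc n) + S n) → ∀ {ρ} → ρ ∈ levels I J q → ρ ∈ Φ⁺
      levels-positive b q good ρ∈ = let (r , n , n<q , lv) = levels-root b q ρ∈ in level-positive b r lv (good n<q)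

      levels-unique : ∀ {I J} → Bipartition I J → ∀ q → (∀ {n} → n ℕ.< q → 0# < S (suc n) + S n) → Unique (levels I J q)
      levels-unique b zero good = []
      levels-unique {I} {J} b (suc q) good = Unique.++⁺ uniqueˡ (Unique.map⁺ (act-injective (word-≢𝟎 wordˡ)) (levels-unique (swap-sides b) q good′)) disjoint
        where
        open Bipartition b
        good′ : ∀ {n} → n ℕ.< q → 0# < S (suc n) + S n
        good′ n<q = good (ℕ.m<n⇒m<1+n n<q)
        -- The word `I` negates each of its letters, so a common element `v` would be the image of
        -- `neg v`, which is not positive although all roots of lower level are.
        disjoint : ∀ {v} → ¬ (v ∈ I × v ∈ map (act I) (levels J I q))
        disjoint {v} (v∈ , h) with ∈-map⁻ (act I) h
        ... | ρ , ρ∈ , e = ⁺-neg-⊥ (Δ⇒⁺ (wordˡ v∈)) (subst (_∈ Φ⁺) ρ≡ (levels-positive (swap-sides b) q good′ ρ∈))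
          where
          ρ≡ : ρ ≡ neg v
          ρ≡ = act-injective (word-≢𝟎 wordˡ) (trans (sym e) (sym (trans (act-neg I v) (trans (cong neg (act-member {I} independentˡ uniqueˡ v∈ (Δ-≢𝟎 (wordˡ v∈)))) (neg-involutive v)))))

      levels-length : ∀ {I J} → Bipartition I J → ∀ q → length (levels I J q) ℕ.+ length (levels J I q) ≡ q ℕ.* length Δ
      levels-length b zero = refl
      levels-length {I} {J} b (suc q) = begin
        length (I ++ map (act I) (levels J I q)) ℕ.+ length (J ++ map (act J) (levels I J q))
          ≡⟨ cong₂ ℕ._+_ (size I (levels J I q)) (size J (levels I J q)) ⟩
        (length I ℕ.+ length (levels J I q)) ℕ.+ (length J ℕ.+ length (levels I J q))
          ≡⟨ rearrange (length I) (length (levels J I q)) (length J) (length (levels I J q)) ⟩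
        (length I ℕ.+ length J) ℕ.+ (length (levels I J q) ℕ.+ length (levels J I q))
          ≡⟨ cong₂ ℕ._+_ (trans (sym (length-++ I)) (↭-length (Bipartition.whole b))) (levels-length b q) ⟩
        length Δ ℕ.+ q ℕ.* length Δ ∎
        where
        size : ∀ I L → length (I ++ map (act I) L) ≡ length I ℕ.+ length L
        size I L = trans (length-++ I) (cong (length I ℕ.+_) (length-map (act I) L))
        rearrange : ∀ a b c d → (a ℕ.+ b) ℕ.+ (c ℕ.+ d) ≡ (a ℕ.+ c) ℕ.+ (d ℕ.+ b)
        rearrange = solve-∀

      -- The families starting from `I` and from `J` each consist of distinct positive roots. Both
      -- may use the same ones, so together they are bounded by twice the number of positive roots,
      -- which is the number of all roots.
      levels-bound : ∀ {I J} → Bipartition I J → ∀ q → (∀ {n} → n ℕ.< q → 0# < S (suc n) + S n) → q ℕ.* length Δ ℕ.≤ length Φ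
      levels-bound {I} {J} b q good = ℕ.≤-trans (ℕ.≤-reflexive (sym (levels-length b q))) (ℕ.≤-trans
        (ℕ.+-mono-≤ (⊆⇒length≤ {ys = Φ⁺} (levels-unique b q good) (levels-positive b q good))
                    (⊆⇒length≤ {ys = Φ⁺} (levels-unique (swap-sides b) q good) (levels-positive (swap-sides b) q good)))
        (ℕ.≤-reflexive (sym length-Φ)))

      module Order {I J} (b : Bipartition I J) {i₀ j₀} (i₀∈ : i₀ ∈ I) (j₀∈ : j₀ ∈ J) where
        Δ-nonempty : 0 ℕ.< length Δ
        Δ-nonempty = go Δ (Bipartition.wordˡ b i₀∈)
          where
          go : ∀ (xs : List V) → i₀ ∈ xs → 0 ℕ.< length xs
          go (_ ∷ _) _ = ℕ.s≤s ℕ.z≤n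

        PositiveUpTo : ℕ → Set
        PositiveUpTo m = ∀ n → n ℕ.< m → 0# < S (suc n)

        S-nonneg : ∀ {m} → PositiveUpTo m → ∀ {n} → n ℕ.< suc m → 0# ≤ S n
        S-nonneg p {zero}  _ = ≤-refl
        S-nonneg p {suc n} h = proj₁ (p n (ℕ.≤-pred h))

        good : ∀ {m} → PositiveUpTo m → ∀ {n} → n ℕ.< m → 0# < S (suc n) + S n
        good p {n} n<m = 0<+ (p n n<m) (S-nonneg p (ℕ.m<n⇒m<1+n n<m))

        search : ∀ N → PositiveUpTo N ⊎ ∃ λ m → PositiveUpTo m × ¬ 0# < S (suc m)
        search zero    = inj₁ (λ _ ())
        search (suc N) with search N
        ... | inj₂ found = inj₂ found
        ... | inj₁ p with em {0# < S (suc N)}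
        ...   | no ¬q = inj₂ (N , p , ¬q)
        ...   | yes q = inj₁ λ n h → [ p n , (λ { refl → q }) ]′ (ℕ.m≤n⇒m<n∨m≡n (ℕ.≤-pred h))

        -- If `S` were positive for `|Φ| + 1` steps, `levels-bound` would produce more roots than
        -- there are.
        first-nonpositive : ∃ λ m → PositiveUpTo m × ¬ 0# < S (suc m)
        first-nonpositive = [ (λ p → ⊥-elim (ℕ.1+n≰n (ℕ.≤-trans (ℕ.≤-trans (ℕ.≤-reflexive (sym (ℕ.*-identityʳ (suc (length Φ))))) (ℕ.*-monoʳ-≤ (suc (length Φ)) Δ-nonempty)) (levels-bound b (suc (length Φ)) (good p))))) , id ]′
          (search (suc (length Φ)))

        level-root : ∀ {I J i j} → Bipartition I J → i ∈ I → j ∈ J → ∀ n → ∃ λ ρ → ρ ∈ Φ × AtLevel I J n ρ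
        level-root b i∈ j∈ zero    = _ , Δ⇒root (Bipartition.wordˡ b i∈) , level-zero b i∈
        level-root b i∈ j∈ (suc n) = let (ρ , ρ∈ , lv) = level-root (swap-sides b) j∈ i∈ n in _ , act-root (Bipartition.wordˡ b) ρ∈ , level-suc b lv

        0<1-k² : 0# < 1# - k * k
        0<1-k² = subst (0# <_) (solve 1 (λ m → m :* (:1 :+ (:1 :- m)) := :1 :- (:1 :- m) :* (:1 :- m)) refl μ) (0<* μ-pos (0<+ 0<1 (≤⇒0≤ μ≤1)))

        -- If S (m + 1) were negative, a root of level m would vanish at a point of
        -- the plane inside the chamber.
        S-vanishes : ∀ {m} → PositiveUpTo (suc m) → ¬ 0# < S (suc (suc m)) → S (suc (suc m)) ≡ 0#
        S-vanishes {m} p ¬q with sign (S (suc (suc m)))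
        ... | inj₁ e = e
        ... | inj₂ (inj₁ h) = ⊥-elim (¬q h)
        ... | inj₂ (inj₂ h) = ⊥-elim (contradict (level-root b i₀∈ j₀∈ (suc m)))
          where
          A B s t′ : Carrier
          A = S (suc m)
          B = S (suc (suc m))
          -- Solves `s - k t′ = A (1 - k²)` and `t′ - k s = - B (1 - k²)`. Both are positive, yet
          -- the form with coefficients `B` and `A` vanishes there.
          s = A + k * - B
          t′ = - B + k * A
          ps₁ : 0# < s - k * t′
          ps₁ = subst (0# <_) (solve 3 (λ a b k → a :* (:1 :- k :* k) := (a :+ k :* :- b) :- k :* (:- b :+ k :* a)) refl A B k) (0<* (p m (ℕ.n<1+n m)) 0<1-k²)
          ps₂ : 0# < t′ - k * s
          ps₂ = subst (0# <_) (solve 3 (λ a b k → :- b :* (:1 :- k :* k) := (:- b :+ k :* a) :- k :* (a :+ k :* :- b)) refl A B k) (0<* h 0<1-k²)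
          contradict : (∃ λ ρ → ρ ∈ Φ × AtLevel I J (suc m) ρ) → ⊥
          contradict (ρ , ρ∈ , lv) = [ (λ r → pos⇒≢0 (plane-pos b ps₁ ps₂ r) zero-value) , (λ r → pos⇒≢0 (plane-pos b ps₁ ps₂ r) (trans (⟨⟩-negʳ (plane I J s t′) ρ) (trans (cong -_ zero-value) -0#≈0#))) ]′ (root-sign ρ∈)
            where
            zero-value : ⟨ plane I J s t′ , ρ ⟩ ≡ 0#
            zero-value = trans (AtLevel.values lv s t′) (solve 4 (λ d a b k → d :* (b :* (a :+ k :* :- b :- k :* (:- b :+ k :* a)) :+ a :* (:- b :+ k :* a :- k :* (a :+ k :* :- b))) := :0) refl (AtLevel.factor lv) A B k)

        module Rotation (m : ℕ) (p : PositiveUpTo (suc m)) (Sm : S (suc (suc m)) ≡ 0#) where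
          M : ℕ
          M = suc (suc m)

          -- The last level `M - 1` is still admissible: `S M` is zero, but its predecessor in
          -- `S (n + 1) + S n` is positive.
          M-bound : M ℕ.* length Δ ℕ.≤ length Φ
          M-bound = levels-bound b M λ {n} h → [ (λ h′ → good p h′) , (λ { refl → subst (0# <_) (sym (trans (cong (_+ S (suc m)) Sm) (+-identityˡ _))) (p m (ℕ.n<1+n m)) }) ]′ (ℕ.m≤n⇒m<n∨m≡n (ℕ.≤-pred h))

          S-before : S (suc m) ≡ 1#
          S-before = cancel-diff ([ id , (λ e → ⊥-elim (pos⇒≢0 (0<+ (p m (ℕ.n<1+n m)) 0≤1) e)) ]′ (x*y≡0 {S (suc m) - 1#} {S (suc m) + 1#}
            (combine₂ 1# ((k + k) * S (suc m) - S M) (wronskian (suc m)) Sm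
              (solve 3 (λ a b l → (a :- :1) :* (a :+ :1) :- :0 := :1 :* (b :* b :- (l :* b :- a) :* a :- :1) :+ (l :* a :- b) :* (b :- :0)) refl (S (suc m)) (S M) (k + k)))))

          -- The half turn: `M` steps of the recursion change the sign, because `S M = 0` and the
          -- value before it is 1.
          S-shift : ∀ n → S (n ℕ.+ M) ≡ - S n
          S-shift zero          = trans Sm (solve 0 (:0 := :- :0) refl)
          S-shift (suc zero)    = combine₂ (k + k) (- 1#) Sm S-before (solve 3 (λ l a b → l :* a :- b :- :- :1 := l :* (a :- :0) :+ :- :1 :* (b :- :1)) refl (k + k) (S M) (S (suc m)))
          S-shift (suc (suc n)) = trans (cong₂ (λ p q → (k + k) * p - q) (S-shift (suc n)) (S-shift n)) (solve 3 (λ l a b → l :* :- a :- :- b := :- (l :* a :- b)) refl (k + k) (S (suc n)) (S n))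

          -- The solution of the Chebyshev recursion with `R 0 = R 1 = 1`. Two consecutive values
          -- are the coordinates of a point in the orbit of the eigenvector, and each of the two
          -- involutions advances the index by one.
          R : ℕ → Carrier
          R n = S (suc n) + (1# - (k + k)) * S n

          R-suc : ∀ n → R (suc (suc n)) ≡ k * R (suc n) + k * R (suc n) - R n
          R-suc n = solve 3 (λ k a b → (((k :+ k) :* ((k :+ k) :* a :- b) :- a) :+ (:1 :- (k :+ k)) :* ((k :+ k) :* a :- b))
            := k :* (((k :+ k) :* a :- b) :+ (:1 :- (k :+ k)) :* a) :+ k :* (((k :+ k) :* a :- b) :+ (:1 :- (k :+ k)) :* a) :- (a :+ (:1 :- (k :+ k)) :* b)) refl k (S (suc n)) (S n)

          R-periodic : ∀ n → R (n ℕ.+ M ℕ.+ M) ≡ R n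
          R-periodic n = cong₂ (λ p q → p + (1# - (k + k)) * q) (twice (suc n)) (twice n)
            where
            twice : ∀ n → S (n ℕ.+ M ℕ.+ M) ≡ S n
            twice n = trans (S-shift (n ℕ.+ M)) (trans (cong -_ (S-shift n)) (-‿involutive (S n)))

          point : ℕ → V
          point n = plane I J (R (suc n)) (R n)

          point-suc : ∀ n → act (I ++ J) (point n) ≡ point (suc (suc n))
          point-suc n = begin
            act (I ++ J) (point n)                                   ≡⟨ act-++ I J (point n) ⟩
            act I (act J (point n))                                  ≡⟨ cong (act I) (begin
              act J (plane I J (R (suc n)) (R n))                      ≡⟨ cong (act J) (plane-swap I J (R (suc n)) (R n)) ⟩
              act J (plane J I (R n) (R (suc n)))                      ≡⟨ act-plane (swap-sides b) (R n) (R (suc n)) ⟩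
              plane J I (k * R (suc n) + k * R (suc n) - R n) (R (suc n)) ≡⟨ cong (λ r → plane J I r (R (suc n))) (R-suc n) ⟨
              plane J I (R (suc (suc n))) (R (suc n))                  ≡⟨ plane-swap J I (R (suc (suc n))) (R (suc n)) ⟩
              plane I J (R (suc n)) (R (suc (suc n)))                  ∎) ⟩
            act I (plane I J (R (suc n)) (R (suc (suc n))))          ≡⟨ act-plane b (R (suc n)) (R (suc (suc n))) ⟩
            plane I J (k * R (suc (suc n)) + k * R (suc (suc n)) - R (suc n)) (R (suc (suc n))) ≡⟨ cong (λ r → plane I J r (R (suc (suc n)))) (R-suc (suc n)) ⟨
            point (suc (suc n))                                      ∎

          iterate-point : ∀ q n → iterate (act (I ++ J)) (point n) q ≡ point (n ℕ.+ q ℕ.+ q)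
          iterate-point zero    n = cong point (sym (trans (ℕ.+-identityʳ (n ℕ.+ 0)) (ℕ.+-identityʳ n)))
          iterate-point (suc q) n = trans (cong (λ v → iterate (act (I ++ J)) v q) (point-suc n)) (trans (iterate-point q (suc (suc n)))
            (cong point (sym (trans (cong (ℕ._+ suc q) (ℕ.+-suc n q)) (ℕ.+-suc (suc (n ℕ.+ q)) q)))))

          power : ℕ → List V
          power zero    = []
          power (suc q) = power q ++ (I ++ J)

          act-power : ∀ q v → act (power q) v ≡ iterate (act (I ++ J)) v q
          act-power zero    v = refl
          act-power (suc q) v = trans (act-++ (power q) (I ++ J) v) (act-power q (act (I ++ J) v))

          power-word : ∀ q → Word (power q)
          power-word (suc q) h = [ power-word q , ∈-resp-↭ (Bipartition.whole b) ]′ (∈-++⁻ (power q) h)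

          -- The point `point 0` lies in the open chamber. The `M`-th power moves its index by
          -- `2 M`, a period of `R`, and so fixes it; the stabilizer of a chamber point acts
          -- trivially.
          period : Period (I ++ J) M
          period v = trans (sym (act-power M v)) (stabilizer-trivial {point 0} (plane-pos b (subst (0# <_) first μ-pos) (subst (0# <_) second μ-pos)) (power-word M)
            (trans (act-power M (point 0)) (trans (iterate-point M 0) (cong₂ (plane I J) (R-periodic 1) (R-periodic 0)))) v)
            where
            R₀ : R 0 ≡ 1#
            R₀ = solve 1 (λ k → :1 :+ (:1 :- (k :+ k)) :* :0 := :1) refl k
            R₁ : R 1 ≡ 1#
            R₁ = solve 1 (λ k → (k :+ k) :* :1 :- :0 :+ (:1 :- (k :+ k)) :* :1 := :1) refl k
            first : μ ≡ R 1 - k * R 0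
            first = trans (sym μ-spec) (trans (solve 1 (λ k → :1 :- k := :1 :- k :* :1) refl k) (sym (cong₂ (λ p q → p - k * q) R₁ R₀)))
            second : μ ≡ R 0 - k * R 1
            second = trans (sym μ-spec) (trans (solve 1 (λ k → :1 :- k := :1 :- k :* :1) refl k) (sym (cong₂ (λ p q → p - k * q) R₀ R₁)))

        rotation : ∃ λ M → 0 ℕ.< M × M ℕ.* length Δ ℕ.≤ length Φ × Period (I ++ J) M
        rotation = let (m , p , ¬q) = first-nonpositive in rotate m p ¬q
          where
          rotate : ∀ m → PositiveUpTo m → ¬ 0# < S (suc m) → ∃ λ M → 0 ℕ.< M × M ℕ.* length Δ ℕ.≤ length Φ × Period (I ++ J) M
          rotate zero    p ¬q = ⊥-elim (¬q 0<1)
          rotate (suc m) p ¬q = let e = S-vanishes p ¬q in suc (suc m) , ℕ.s≤s ℕ.z≤n , Rotation.M-bound m p e , Rotation.period m p e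

      bipartition : ∃₂ Bipartition
      bipartition = let (I , J , whole , indI , indJ) = forest-bipartite Δ-forest Δ-unique
                    in I , J , record { whole = whole ; independentˡ = λ {a} {b} → indI {a} {b} ; independentʳ = λ {a} {b} → indJ {a} {b} }

      -- With two or more simple roots the connected diagram has an edge. Both sides of a
      -- bipartition are then inhabited, so that roots of every level exist.
      Δ-dependent : 2 ℕ.≤ ℓ → ¬ Independent Δ
      Δ-dependent 2≤ℓ ind = distinct Δ-unique id (ℕ.≤-trans 2≤ℓ (ℕ.≤-reflexive (sym length-Δ)))
        where
        distinct : ∀ {xs : List V} → Unique xs → (∀ {δ} → δ ∈ xs → δ ∈ Δ) → 2 ℕ.≤ length xs → ⊥
        distinct {_ ∷ []} _ _ (ℕ.s≤s ())
        distinct {a ∷ c ∷ _} ((a≢c ∷ _) ∷ _) sub _ = a≢c (sym (Δ-connected irr (_≡ a) (sub (here refl)) refl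
          (λ δ∈ ε∈ δ≡a ε≢a → ind δ∈ ε∈ λ δ≡ε → ε≢a (trans (sym δ≡ε) δ≡a)) (sub (there (here refl)))))

      side-inhabited : 2 ℕ.≤ ℓ → ∀ {I J} → Bipartition I J → ∃ (_∈ I)
      side-inhabited 2≤ℓ {[]}    b = ⊥-elim (Δ-dependent 2≤ℓ λ p q → Bipartition.independentʳ b (∈-resp-↭ (↭-sym (Bipartition.whole b)) p) (∈-resp-↭ (↭-sym (Bipartition.whole b)) q))
      side-inhabited 2≤ℓ {i ∷ _} b = i , here refl

      coxeter-number : 2 ℕ.≤ ℓ → ∀ {h} → IsCoxeterNumber Φ⁺ h → length Φ ≡ h ℕ.* ℓ
      coxeter-number 2≤ℓ {h} (σ , σ↭Δ , h>0 , period-h , minimal) =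
        let (I , J , b) = bipartition
            (_ , i∈) = side-inhabited 2≤ℓ b
            (_ , j∈) = side-inhabited 2≤ℓ (swap-sides b)
            (M , M>0 , bound , period) = Order.rotation b i∈ j∈
        in ℕ.≤-antisym
            (ℕ.≤-trans (length-Φ≤ σ↭Δ h>0 period-h) (ℕ.≤-reflexive (trans (ℕ.*-comm (length Δ) h) (cong (h ℕ.*_) length-Δ))))
            (ℕ.≤-trans (ℕ.*-monoˡ-≤ ℓ (h≤ M M>0 (proj₁ (~-period M (forest-words Δ-forest Δ-≢𝟎 Δ-unique (Bipartition.whole b) σ↭Δ)) period)))
              (ℕ.≤-trans (ℕ.≤-reflexive (cong (M ℕ.*_) (sym length-Δ))) bound))
        where
        h≤ : ∀ M → 0 ℕ.< M → Period σ M → h ℕ.≤ M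
        h≤ M M>0 p with h ℕ.≤? M
        ... | yes q = q
        ... | no ¬q = ⊥-elim (minimal M M>0 (ℕ.≰⇒> ¬q) p)

    -- Hyperplanes of a restriction as flats, and traces on a flat.

    module Counting where
      open Dihedral hiding (k; U; S) public

      ∑-even : ∀ f → (∀ α → f (neg α) ≡ f α) → ∑ Φ f ≡ fromℕ 2 * ∑ Φ⁺ f
      ∑-even f even = trans (∑-↭ Φ-split f) (trans (∑-++ Φ⁺ f) (trans (cong (∑ Φ⁺ f +_) (trans (∑-map neg Φ⁺ f) (∑-ext {xs = Φ⁺} even)))
        (solve 1 (λ a → a :+ a := :2 :* a) refl (∑ Φ⁺ f))))

      same-ray : ∀ {α β} → α ∈ Φ⁺ → β ∈ Φ⁺ → ⟨ α , β ⟩ * ⟨ α , β ⟩ ≡ ⟨ α , α ⟩ * ⟨ β , β ⟩ → α ≡ β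
      same-ray α∈ β∈ e = [ id , (λ α≡-β → ⊥-elim (⁺-neg-⊥ β∈ (subst (_∈ Φ⁺) α≡-β α∈))) ]′ (parallel-roots (⁺⇒root α∈) (⁺⇒root β∈) e)

      -- B consists of pairwise orthogonal positive roots and contains all
      -- positive roots in its span; X is its orthogonal complement.
      module Flat (B : List V) (B-unique : Unique B) (B-orthogonal : Independent B) (B⊆Φ⁺ : ∀ {b} → b ∈ B → b ∈ Φ⁺)
                  (B-closed : ∀ {α} → α ∈ Φ⁺ → residual B α ≡ 𝟎 → α ∈ B)
                  (X : Pred V 0ℓ) (X⇒⊥ : ∀ {x} → X x → ∀ {b} → b ∈ B → ⟨ b , x ⟩ ≡ 0#) (⊥⇒X : ∀ {x} → (∀ {b} → b ∈ B → ⟨ b , x ⟩ ≡ 0#) → X x) where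
        p : V → V
        p = residual B

        B-≢𝟎 : ∀ {b} → b ∈ B → b ≢ 𝟎
        B-≢𝟎 b∈ = root-≢𝟎 (⁺⇒root (B⊆Φ⁺ b∈))

        ⟨p,⟩ : ∀ v w → ⟨ p v , w ⟩ ≡ ⟨ v , w ⟩ - ∑ B (λ b → ⟨ v , b ⟩ * ⟨ b , b ⟩ ⁻¹ * ⟨ b , w ⟩)
        ⟨p,⟩ v w = residual-linear B (λ u → ⟨ u , w ⟩) (λ x k y → ⟨⟩-⊕·ˡ x k y w) v

        p-adjoint : ∀ v w → ⟨ p v , w ⟩ ≡ ⟨ v , p w ⟩
        p-adjoint v w = trans (⟨p,⟩ v w) (trans (cong₂ _-_ (⟨⟩-sym v w) (∑-ext {xs = B} λ b → trans (cong₂ (λ x y → x * ⟨ b , b ⟩ ⁻¹ * y) (⟨⟩-sym v b) (⟨⟩-sym b w))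
          (solve 3 (λ x i y → x :* i :* y := y :* i :* x) refl ⟨ b , v ⟩ (⟨ b , b ⟩ ⁻¹) ⟨ w , b ⟩))) (trans (sym (⟨p,⟩ w v)) (⟨⟩-sym (p w) v)))

        p-⊕· : ∀ x k y → p (x ⊕ k · y) ≡ p x ⊕ k · p y
        p-⊕· x k y = ⟨⟩-ext λ z → trans (p-adjoint (x ⊕ k · y) z) (trans (⟨⟩-⊕·ˡ x k y (p z)) (trans (sym (cong₂ (λ a b → a + k * b) (p-adjoint x z) (p-adjoint y z))) (sym (⟨⟩-⊕·ˡ (p x) k (p y) z))))

        p-𝟎 : p 𝟎 ≡ 𝟎
        p-𝟎 = ⟨⟩-ext λ z → trans (p-adjoint 𝟎 z) (trans (⟨⟩-𝟎ˡ (p z)) (sym (⟨⟩-𝟎ˡ z)))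

        p-⊥ : ∀ {v} → (∀ {b} → b ∈ B → ⟨ b , v ⟩ ≡ 0#) → p v ≡ v
        p-⊥ {v} h = ⟨⟩-ext λ z → trans (⟨p,⟩ v z) (trans (cong (λ s → ⟨ v , z ⟩ - s) (∑-zero {xs = B} λ {b} b∈ →
          trans (cong (λ x → x * ⟨ b , b ⟩ ⁻¹ * ⟨ b , z ⟩) (trans (⟨⟩-sym v b) (h b∈))) (solve 2 (λ i y → :0 :* i :* y := :0) refl (⟨ b , b ⟩ ⁻¹) ⟨ b , z ⟩)))
          (solve 1 (λ a → a :- :0 := a) refl ⟨ v , z ⟩))

        ⟨b,p⟩ : ∀ {b} → b ∈ B → ∀ v → ⟨ b , p v ⟩ ≡ 0#
        ⟨b,p⟩ {b} b∈ v = trans (⟨⟩-sym b (p v)) (trans (⟨p,⟩ v b) (trans (cong (λ s → ⟨ v , b ⟩ - s)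
            (∑-single B-unique b∈ (λ {c} c∈ ne → trans (cong (⟨ v , c ⟩ * ⟨ c , c ⟩ ⁻¹ *_) (B-orthogonal c∈ b∈ ne)) (zeroʳ _))))
          (combine₁ (- ⟨ v , b ⟩) (⁻¹-inverseˡ (pos⇒≢0 (⟨⟩-pos (B-≢𝟎 b∈)))) (solve 3 (λ v i b → v :- v :* i :* b :- :0 := :- v :* (i :* b :- :1)) refl ⟨ v , b ⟩ (⟨ b , b ⟩ ⁻¹) ⟨ b , b ⟩))))

        p-X : ∀ v → X (p v)
        p-X v = ⊥⇒X λ b∈ → ⟨b,p⟩ b∈ v

        p-fixed : ∀ {x} → X x → p x ≡ x
        p-fixed Xx = p-⊥ (X⇒⊥ Xx)

        p-idem : ∀ v → p (p v) ≡ p v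
        p-idem v = p-fixed (p-X v)

        p-b : ∀ {b} → b ∈ B → p b ≡ 𝟎
        p-b {b} b∈ = ⟨⟩-definite (trans (p-adjoint b (p b)) (trans (cong ⟨ b ,_⟩ (p-idem b)) (⟨b,p⟩ b∈ b)))

        H-X : ∀ {x} α → X x → ⟨ p α , x ⟩ ≡ ⟨ α , x ⟩
        H-X {x} α Xx = trans (p-adjoint α x) (cong ⟨ α ,_⟩ (p-fixed Xx))

        X⊈H⇒ : ∀ {α} → X ⊈ H α → p α ≢ 𝟎
        X⊈H⇒ {α} h e = h λ {x} Xx → trans (sym (H-X α Xx)) (trans (cong ⟨_, x ⟩ e) (⟨⟩-𝟎ˡ x))

        ⇒X⊈H : ∀ {α} → p α ≢ 𝟎 → X ⊈ H α
        ⇒X⊈H {α} ne h = ne (⟨⟩-definite (trans (H-X α (p-X α)) (h (p-X α))))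

        -- Equivalently, `B` together with `α` spans the same flat as `B` together with `d`.
        _∼_ : V → V → Set
        α ∼ d = ∃ λ k → k ≢ 0# × p α ≡ k · p d

        trace : V → Pred V 0ℓ
        trace α = H α ∩ X

        ∼⇒≐ : ∀ {α d} → α ∼ d → trace α ≐ trace d
        ∼⇒≐ {α} {d} (k , k≢0 , e) =
          (λ {x} (hx , Xx) → *-≡0ʳ k ⟨ d , x ⟩ (trans (sym (scaled Xx)) hx) k≢0 , Xx) , (λ {x} (hx , Xx) → trans (scaled Xx) (trans (cong (k *_) hx) (zeroʳ k)) , Xx)
          where
          scaled : ∀ {x} → X x → ⟨ α , x ⟩ ≡ k * ⟨ d , x ⟩
          scaled {x} Xx = trans (sym (H-X α Xx)) (trans (cong ⟨_, x ⟩ e) (trans (⟨⟩-·ˡ k (p d) x) (cong (k *_) (H-X d Xx))))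

        -- The component of p α orthogonal to p d lies in X and in H d, hence in H α.
        ≐⇒∼ : ∀ {α d} → p α ≢ 𝟎 → p d ≢ 𝟎 → trace α ≐ trace d → α ∼ d
        ≐⇒∼ {α} {d} pα≢ pd≢ (_ , ⊇) = k , (λ k≡0 → pα≢ (trans pα≡ (trans (cong (_· p d) k≡0) (0· p d)))) , pα≡
          where
          k = ⟨ p α , p d ⟩ * ⟨ p d , p d ⟩ ⁻¹
          ν = p α ⊕ (- k) · p d
          Xν : X ν
          Xν = subst X (p-⊕· α (- k) d) (p-X (α ⊕ (- k) · d))
          dν : ⟨ p d , ν ⟩ ≡ 0#
          dν = trans (⟨⟩-⊕·ʳ (p d) (p α) (- k) (p d)) (trans (cong (_+ - k * ⟨ p d , p d ⟩) (⟨⟩-sym (p d) (p α)))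
            (combine₁ (- ⟨ p α , p d ⟩) (⁻¹-inverseˡ (pos⇒≢0 (⟨⟩-pos pd≢))) (solve 3 (λ q i r → q :+ :- (q :* i) :* r :- :0 := :- q :* (i :* r :- :1)) refl ⟨ p α , p d ⟩ (⟨ p d , p d ⟩ ⁻¹) ⟨ p d , p d ⟩)))
          αν : ⟨ p α , ν ⟩ ≡ 0#
          αν = trans (H-X α Xν) (proj₁ (⊇ (trans (sym (H-X d Xν)) dν , Xν)))
          ν≡𝟎 : ν ≡ 𝟎
          ν≡𝟎 = ⟨⟩-definite (trans (⟨⟩-⊕·ˡ (p α) (- k) (p d) ν) (trans (cong₂ (λ a b → a + - k * b) αν dν) (trans (+-identityˡ _) (zeroʳ (- k)))))
          pα≡ : p α ≡ k · p d
          pα≡ = ⟨⟩-ext λ z → combine₁ 1# (trans (sym (⟨⟩-⊕·ˡ (p α) (- k) (p d) z)) (trans (cong ⟨_, z ⟩ ν≡𝟎) (⟨⟩-𝟎ˡ z)))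
            (trans (cong (λ r → ⟨ p α , z ⟩ - r) (⟨⟩-·ˡ k (p d) z)) (solve 3 (λ a k b → a :- k :* b := :1 :* (a :+ :- k :* b :- :0)) refl ⟨ p α , z ⟩ k ⟨ p d , z ⟩))

        ∼-refl : ∀ α → α ∼ α
        ∼-refl α = 1# , (0≢1 ∘ sym) , sym (1· p α)

        ∼-≢𝟎 : ∀ {α d} → α ∼ d → p d ≢ 𝟎 → p α ≢ 𝟎
        ∼-≢𝟎 {α} {d} (k , k≢0 , e) pd≢ pα≡𝟎 = pd≢ (⟨⟩-ext λ z → trans (*-≡0ʳ k ⟨ p d , z ⟩ (trans (sym (⟨⟩-·ˡ k (p d) z)) (trans (cong ⟨_, z ⟩ (trans (sym e) pα≡𝟎)) (⟨⟩-𝟎ˡ z))) k≢0) (sym (⟨⟩-𝟎ˡ z)))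

        ∼-sym : ∀ {α d} → α ∼ d → d ∼ α
        ∼-sym {α} {d} (k , k≢0 , e) = k ⁻¹ , (λ i≡0 → 0≢1 (trans (sym (trans (cong (k *_) i≡0) (zeroʳ k))) (*-inverse k k≢0))) ,
          sym (trans (cong (k ⁻¹ ·_) e) (trans (·-assoc (k ⁻¹) k (p d)) (trans (cong (_· p d) (⁻¹-inverseˡ k≢0)) (1· p d))))

        ∼-trans : ∀ {α d e} → α ∼ d → d ∼ e → α ∼ e
        ∼-trans {α} {d} {e} (k , k≢0 , h) (l , l≢0 , h′) = k * l , *-≢0 k≢0 l≢0 , trans h (trans (cong (k ·_) h′) (·-assoc k l (p e)))

        p-neg : ∀ α → p (neg α) ≡ (- 1#) · p α
        p-neg α = ⟨⟩-ext λ z → trans (p-adjoint (neg α) z) (trans (⟨⟩-negˡ α (p z)) (trans (cong -_ (sym (p-adjoint α z))) (trans (solve 1 (λ a → :- a := :- :1 :* a) refl ⟨ p α , z ⟩) (sym (⟨⟩-·ˡ (- 1#) (p α) z)))))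

        class-sum : V → (V → Carrier) → Carrier
        class-sum d f = ∑ Φ⁺ λ α → χ (α ∼ d) * f α

        class-sum-+ : ∀ d f g → class-sum d (λ α → f α + g α) ≡ class-sum d f + class-sum d g
        class-sum-+ d f g = trans (∑-ext {xs = Φ⁺} λ α → distribˡ (χ (α ∼ d)) (f α) (g α)) (∑-+ Φ⁺ (λ α → χ (α ∼ d) * f α) (λ α → χ (α ∼ d) * g α))

        class-sum-* : ∀ d k f → class-sum d (λ α → k * f α) ≡ k * class-sum d f
        class-sum-* d k f = trans (∑-ext {xs = Φ⁺} λ α → solve 3 (λ c k f → c :* (k :* f) := k :* (c :* f)) refl (χ (α ∼ d)) k (f α)) (∑-*ˡ Φ⁺ k λ α → χ (α ∼ d) * f α)

        outside : List V
        outside = Φ⁺ ∣ λ α → X ⊈ H α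

        reps : List V
        reps = deduplicate (λ α d → em {trace α ≐ trace d}) outside

        ≐-refl : ∀ α → trace α ≐ trace α
        ≐-refl α = id , id

        ≐-sym : ∀ {α d} → trace α ≐ trace d → trace d ≐ trace α
        ≐-sym (f , g) = g , f

        ≐-trans : ∀ {α d e} → trace α ≐ trace d → trace d ≐ trace e → trace α ≐ trace e
        ≐-trans (f , g) (f′ , g′) = f′ ∘ f , g ∘ g′

        reps-∈ : ∀ {d} → d ∈ reps → d ∈ Φ⁺ × p d ≢ 𝟎
        reps-∈ d∈ = let (d∈⁺ , h) = ∈-∣⁻ Φ⁺ (λ α → X ⊈ H α) (∈-deduplicate⁻ (λ α d → em {trace α ≐ trace d}) outside d∈) in d∈⁺ , X⊈H⇒ h

        -- Filtering and removing duplicates are pulled back from hyperplanes to the positive roots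
        -- defining them.
        length-restriction : length (restriction (weylArrangement Φ⁺) X) ≡ length reps
        length-restriction = trans (cong (λ 𝓐 → length (deduplicate (λ K L → em {K ≐ L}) (map (_∩ X) 𝓐))) (filter-map H _≐_ (X ⊈_) Φ⁺))
          (trans (cong (λ 𝓐 → length (deduplicate (λ K L → em {K ≐ L}) 𝓐)) (sym (map-∘ {g = _∩ X} {f = H} outside)))
          (trans (cong length (deduplicate-map trace _≐_ outside)) (length-map trace reps)))

        ∑-zero-set : ∀ f → ∑ Φ⁺ (λ α → χ (p α ≡ 𝟎) * f α) ≡ ∑ B f
        ∑-zero-set f = trans (sym (∑-filter (λ α → p α ≡ 𝟎) Φ⁺ f)) (∑-↭ (same-set⇒↭ (∣-unique unique⁺) B-unique
          (λ {α} α∈ → let (h , e) = ∈-∣⁻ Φ⁺ (λ α → p α ≡ 𝟎) α∈ in B-closed h e)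
          (λ {b} b∈ → ∈-∣⁺ (λ α → p α ≡ 𝟎) (B⊆Φ⁺ b∈) (p-b b∈))) f)

        -- The flats partition the positive roots with nonzero projection, and the positive roots
        -- with zero projection are exactly `B`.
        ∑-reps : ∀ f → ∑ reps (λ d → class-sum d f) ≡ ∑ Φ⁺ f - ∑ B f
        ∑-reps f = sym (begin
          ∑ Φ⁺ f - ∑ B f                                        ≡⟨ cong (λ s → ∑ Φ⁺ f - s) (∑-zero-set f) ⟨
          ∑ Φ⁺ f - ∑ Φ⁺ (λ α → χ (p α ≡ 𝟎) * f α)               ≡⟨ ∑-minus Φ⁺ f (λ α → χ (p α ≡ 𝟎) * f α) ⟨
          ∑ Φ⁺ (λ α → f α - χ (p α ≡ 𝟎) * f α)                  ≡⟨ ∑-ext {xs = Φ⁺} (λ α → trans (solve 2 (λ f c → f :- c :* f := (:1 :- c) :* f) refl (f α) (χ (p α ≡ 𝟎)))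
                                                                   (cong (_* f α) (trans (sym (χ-¬ (p α ≡ 𝟎))) (χ-⇔ ⇒X⊈H X⊈H⇒)))) ⟩
          ∑ Φ⁺ (λ α → χ (X ⊈ H α) * f α)                        ≡⟨ ∑-filter (λ α → X ⊈ H α) Φ⁺ f ⟨
          ∑ outside f                                           ≡⟨ ∑-classes (λ α d → trace α ≐ trace d) ≐-refl (λ {α} {d} → ≐-sym {α} {d}) (λ {α} {d} {e} → ≐-trans {α} {d} {e}) outside f ⟩
          ∑ reps (λ d → ∑ outside λ α → χ (trace α ≐ trace d) * f α) ≡⟨ ∑-cong {xs = reps} (λ {d} d∈ → trans (∑-filter (λ α → X ⊈ H α) Φ⁺ (λ α → χ (trace α ≐ trace d) * f α))
                                                                   (∑-ext {xs = Φ⁺} λ α → trans (sym (*-assoc (χ (X ⊈ H α)) (χ (trace α ≐ trace d)) (f α))) (cong (_* f α) (trans (sym (χ-× (X ⊈ H α) (trace α ≐ trace d)))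
                                                                     (χ-⇔ (λ (h , e) → ≐⇒∼ (X⊈H⇒ h) (proj₂ (reps-∈ d∈)) e) (λ s → ⇒X⊈H (∼-≢𝟎 s (proj₂ (reps-∈ d∈))) , ∼⇒≐ s)))))) ⟩
          ∑ reps (λ d → class-sum d f)                          ∎)

        -- The subsystem of the roots in the span of B and d.
        module Local {d} (d∈ : d ∈ Φ⁺) (pd≢𝟎 : p d ≢ 𝟎) where
          On : Pred V 0ℓ
          On α = ∃ λ k → p α ≡ k · p d

          On-subspace : Subspace On
          On-subspace = record
            { has-𝟎  = 0# , trans p-𝟎 (sym (0· p d))
            ; has-⊕· = λ x k y (a , e) (b , e′) → a + k * b , trans (p-⊕· x k y) (⟨⟩-ext λ z → trans (⟨⟩-⊕·ˡ (p x) k (p y) z)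
                (trans (cong₂ (λ u v → u + k * v) (trans (cong ⟨_, z ⟩ e) (⟨⟩-·ˡ a (p d) z)) (trans (cong ⟨_, z ⟩ e′) (⟨⟩-·ˡ b (p d) z)))
                (trans (solve 4 (λ a k b q → a :* q :+ k :* (b :* q) := (a :+ k :* b) :* q) refl a k b ⟨ p d , z ⟩) (sym (⟨⟩-·ˡ (a + k * b) (p d) z)))))
            }

          Γ : List V
          Γ = Φ ∣ On

          module Γ = RootSystem (restrict On (Subspace.has-reflect On-subspace))

          b∈Γ : ∀ {b} → b ∈ B → b ∈ Γ
          b∈Γ b∈ = ∈-∣⁺ On (⁺⇒root (B⊆Φ⁺ b∈)) (0# , trans (p-b b∈) (sym (0· p d)))

          ∼∈Γ : ∀ {α} → α ∈ Φ → α ∼ d → α ∈ Γ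
          ∼∈Γ α∈ (k , _ , e) = ∈-∣⁺ On α∈ (k , e)

          χ-On : ∀ α → χ (On α) ≡ χ (p α ≡ 𝟎) + χ (α ∼ d)
          χ-On α = by em
            where
            by : Dec (p α ≡ 𝟎) → χ (On α) ≡ χ (p α ≡ 𝟎) + χ (α ∼ d)
            by (yes e) = trans (χ-yes (0# , trans e (sym (0· p d)))) (sym (trans (cong₂ _+_ (χ-yes e) (χ-no λ s → ∼-≢𝟎 s pd≢𝟎 e)) (+-identityʳ 1#)))
            by (no ne) = trans (χ-⇔ (λ (k , e) → k , (λ k≡0 → ne (trans e (trans (cong (_· p d) k≡0) (0· p d)))) , e) (λ (k , _ , e) → k , e))
              (sym (trans (cong (_+ χ (α ∼ d)) (χ-no ne)) (+-identityˡ _)))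

          ∑-Γ : ∀ f → (∀ α → f (neg α) ≡ f α) → ∑ Γ f ≡ fromℕ 2 * (∑ B f + class-sum d f)
          ∑-Γ f even = begin
            ∑ Γ f                                                         ≡⟨ ∑-filter On Φ f ⟩
            ∑ Φ (λ α → χ (On α) * f α)                                    ≡⟨ ∑-even (λ α → χ (On α) * f α) (λ α → cong₂ _*_ (χ-⇔ (λ o → subst On (neg-involutive α) (Subspace.has-neg On-subspace (neg α) o)) (Subspace.has-neg On-subspace α)) (even α)) ⟩
            fromℕ 2 * ∑ Φ⁺ (λ α → χ (On α) * f α)                         ≡⟨ cong (fromℕ 2 *_) (trans (∑-ext {xs = Φ⁺} λ α → trans (cong (_* f α) (χ-On α)) (distribʳ (f α) (χ (p α ≡ 𝟎)) (χ (α ∼ d)))) (∑-+ Φ⁺ (λ α → χ (p α ≡ 𝟎) * f α) (λ α → χ (α ∼ d) * f α))) ⟩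
            fromℕ 2 * (∑ Φ⁺ (λ α → χ (p α ≡ 𝟎) * f α) + class-sum d f)    ≡⟨ cong (λ s → fromℕ 2 * (s + class-sum d f)) (∑-zero-set f) ⟩
            fromℕ 2 * (∑ B f + class-sum d f)                             ∎

          ⟨,pd⟩ : ∀ {α k} → p α ≡ k · p d → ⟨ α , p d ⟩ ≡ k * ⟨ p d , p d ⟩
          ⟨,pd⟩ {α} {k} e = trans (cong ⟨ α ,_⟩ (sym (p-idem d))) (trans (sym (p-adjoint α (p d))) (trans (cong ⟨_, p d ⟩ e) (⟨⟩-·ˡ k (p d) (p d))))

          -- Pythagoras with respect to the orthogonal basis of the flat formed by `B` and `p d`.
          κ-total : ∀ {α} → α ∈ Γ → ∑ B (λ b → κ α b) + κ α (p d) ≡ 1#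
          κ-total {α} α∈ = let (α∈Φ , k , e) = ∈-∣⁻ Φ On α∈ in go α∈Φ k e
            where
            go : α ∈ Φ → ∀ k → p α ≡ k · p d → ∑ B (λ b → κ α b) + κ α (p d) ≡ 1#
            go α∈Φ k e = trans (cong (_+ κ α (p d)) (trans (∑-ext {xs = B} λ b → trans (cong (λ y → ⟨ α , b ⟩ * y * (i * ⟨ b , b ⟩ ⁻¹)) (⟨⟩-sym α b))
                  (solve 4 (λ x y i j → x :* y :* (i :* j) := i :* (x :* j :* y)) refl ⟨ α , b ⟩ ⟨ b , α ⟩ i (⟨ b , b ⟩ ⁻¹))) (∑-*ˡ B i λ b → ⟨ α , b ⟩ * ⟨ b , b ⟩ ⁻¹ * ⟨ b , α ⟩)))
                (combine₃ 1# (- i) (i * q) (⁻¹-inverseˡ (pos⇒≢0 (⟨⟩-pos (root-≢𝟎 α∈Φ)))) length-p qj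
                  (solve 6 (λ a i s q j k → i :* s :+ q :* q :* (i :* j) :- :1 := :1 :* (i :* a :- :1) :+ :- i :* (a :- s :- k :* q) :+ i :* q :* (q :* j :- k)) refl ⟨ α , α ⟩ i s q j k))
              where
              i = ⟨ α , α ⟩ ⁻¹
              s = ∑ B (λ b → ⟨ α , b ⟩ * ⟨ b , b ⟩ ⁻¹ * ⟨ b , α ⟩)
              q = ⟨ α , p d ⟩
              j = ⟨ p d , p d ⟩ ⁻¹
              length-p : ⟨ α , α ⟩ - s ≡ k * q
              length-p = trans (sym (⟨p,⟩ α α)) (trans (cong ⟨_, α ⟩ e) (trans (⟨⟩-·ˡ k (p d) α) (cong (k *_) (⟨⟩-sym (p d) α))))
              qj : q * j ≡ k
              qj = combine₂ j k (⟨,pd⟩ e) (⁻¹-inverseˡ (pos⇒≢0 (⟨⟩-pos pd≢𝟎)))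
                (solve 4 (λ q j k r → q :* j :- k := j :* (q :- k :* r) :+ k :* (j :* r :- :1)) refl q j k ⟨ p d , p d ⟩)

          -- The Rayleigh quotient of the form at `p d`, that is, the one eigenvalue of the flat not
          -- belonging to `B`.
          transversal : Carrier
          transversal = ∑ Γ (λ α → κ α (p d))

          length-Γ : fromℕ (length Γ) ≡ ∑ B Γ.eigenvalue + transversal
          length-Γ = begin
            fromℕ (length Γ)                                       ≡⟨ ∑-length Γ ⟨
            ∑ Γ (λ _ → 1#)                                         ≡⟨ ∑-cong {xs = Γ} (λ α∈ → sym (κ-total α∈)) ⟩
            ∑ Γ (λ α → ∑ B (λ b → κ α b) + κ α (p d))              ≡⟨ ∑-+ Γ (λ α → ∑ B (λ b → κ α b)) (λ α → κ α (p d)) ⟩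
            ∑ Γ (λ α → ∑ B (λ b → κ α b)) + transversal            ≡⟨ cong (_+ transversal) (trans (∑-swap Γ B κ) (∑-ext {xs = B} λ b → sym (Γ.eigenvalue≡∑κ b))) ⟩
            ∑ B Γ.eigenvalue + transversal                         ∎

          -- The elements of `B` are eigenvectors orthogonal to `p d` and drop out of the form at
          -- `α` and `p d`. The remaining component of `α` along `p d` is nonzero, which forces the
          -- eigenvalue of `α` on `p d`.
          transversal≡ : ∀ {α} → α ∈ Φ → α ∼ d → transversal ≡ Γ.eigenvalue α
          transversal≡ {α} α∈ (k , k≢0 , e) = trans (∑-κ Γ (p d)) (combine₂ ⟨ε,ε⟩⁻¹ (Γ.eigenvalue α)
              (*-cancelˡ k≢0 (trans (sym scaled) (trans (Γ.eigen (∼∈Γ α∈ (k , k≢0 , e)) (p d)) (trans (cong (Γ.eigenvalue α *_) (⟨,pd⟩ e)) (solve 3 (λ a k r → a :* (k :* r) := k :* (a :* r)) refl (Γ.eigenvalue α) k ⟨ p d , p d ⟩)))))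
              (⁻¹-inverseˡ (pos⇒≢0 (⟨⟩-pos pd≢𝟎)))
              (solve 4 (λ f j b r → f :* j :- b := j :* (f :- b :* r) :+ b :* (j :* r :- :1)) refl (form Γ (p d) (p d)) ⟨ε,ε⟩⁻¹ (Γ.eigenvalue α) ⟨ p d , p d ⟩))
            where
            ⟨ε,ε⟩⁻¹ = ⟨ p d , p d ⟩ ⁻¹
            scaled : form Γ α (p d) ≡ k * form Γ (p d) (p d)
            scaled = begin
              form Γ α (p d)                  ≡⟨ solve 1 (λ a → a := a :- :0) refl (form Γ α (p d)) ⟩
              form Γ α (p d) - 0#             ≡⟨ cong (λ x → form Γ α (p d) - x) (∑-zero {xs = B} λ {b} b∈ → trans (cong (⟨ α , b ⟩ * ⟨ b , b ⟩ ⁻¹ *_) (trans (Γ.eigen (b∈Γ b∈) (p d)) (trans (cong (Γ.eigenvalue b *_) (⟨b,p⟩ b∈ d)) (zeroʳ _)))) (zeroʳ _)) ⟨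
              form Γ α (p d) - ∑ B (λ b → ⟨ α , b ⟩ * ⟨ b , b ⟩ ⁻¹ * form Γ b (p d)) ≡⟨ residual-linear B (λ u → form Γ u (p d)) (λ x k y → form-⊕·ˡ Γ x k y (p d)) α ⟨
              form Γ (p α) (p d)              ≡⟨ cong (λ u → form Γ u (p d)) (trans e (sym (⊕-identityˡ (k · p d)))) ⟩
              form Γ (𝟎 ⊕ k · p d) (p d)      ≡⟨ form-⊕·ˡ Γ 𝟎 k (p d) (p d) ⟩
              form Γ 𝟎 (p d) + k * form Γ (p d) (p d) ≡⟨ trans (cong (_+ k * form Γ (p d) (p d)) (form-𝟎ˡ Γ (p d))) (+-identityˡ _) ⟩
              k * form Γ (p d) (p d)          ∎

          size : fromℕ (length Γ) ≡ fromℕ 2 * (∑ B (λ _ → 1#) + class-sum d (λ _ → 1#))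
          size = trans (sym (∑-length Γ)) (∑-Γ (λ _ → 1#) (λ _ → refl))

          eigenvalue-Γ : ∀ b → Γ.eigenvalue b ≡ fromℕ 2 * (∑ B (λ a → κ a b) + class-sum d (λ α → κ α b))
          eigenvalue-Γ b = trans (Γ.eigenvalue≡∑κ b) (∑-Γ (λ α → κ α b) (λ α → κ-negˡ α b))

    -- Counting hyperplanes through rank two and rank three flats.

    module PairCount where
      open Counting public

      multiple-root : ∀ {α β} k → α ∈ Φ⁺ → β ∈ Φ⁺ → α ≡ k · β → α ≡ β
      multiple-root {α} {β} k α∈ β∈ e = same-ray α∈ β∈ (trans (cong₂ _*_ αβ αβ) (trans
          (solve 2 (λ k b → (k :* b) :* (k :* b) := k :* (k :* b) :* b) refl k ⟨ β , β ⟩) (cong (_* ⟨ β , β ⟩) (sym αα))))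
        where
        αβ : ⟨ α , β ⟩ ≡ k * ⟨ β , β ⟩
        αβ = trans (cong ⟨_, β ⟩ e) (⟨⟩-·ˡ k β β)
        αα : ⟨ α , α ⟩ ≡ k * (k * ⟨ β , β ⟩)
        αα = trans (cong ⟨ α ,_⟩ e) (trans (⟨⟩-·ʳ k α β) (cong (k *_) αβ))

      line-subspace : ∀ β → Subspace (λ v → ∃ λ k → v ≡ k · β)
      line-subspace β = record
        { has-𝟎  = 0# , sym (0· β)
        ; has-⊕· = λ { x k y (a , refl) (b , refl) → a + k * b , ⟨⟩-ext λ z → trans (⟨⟩-⊕·ˡ (a · β) k (b · β) z)
            (trans (cong₂ (λ u v → u + k * v) (⟨⟩-·ˡ a β z) (⟨⟩-·ˡ b β z)) (trans (solve 4 (λ a k b q → a :* q :+ k :* (b :* q) := (a :+ k :* b) :* q) refl a k b ⟨ β , z ⟩) (sym (⟨⟩-·ˡ (a + k * b) β z)))) }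
        }

      -- Rank two flats through a root
      module Line {β} (β∈ : β ∈ Φ⁺) where
        line-closed : ∀ {α} → α ∈ Φ⁺ → residual (β ∷ []) α ≡ 𝟎 → α ∈ β ∷ []
        line-closed {α} α∈ e = let (k , e′) = residual-⇐ (line-subspace β) (β ∷ []) (λ { (here refl) → 1# , sym (1· β) }) {α} (subst (λ v → ∃ λ k → v ≡ k · β) (sym e) (0# , sym (0· β)))
                               in here (multiple-root k α∈ β∈ e′)

        private
          independent₁ : Independent (β ∷ [])
          independent₁ (here refl) (here refl) ne = ⊥-elim (ne refl)

          positive₁ : ∀ {b} → b ∈ β ∷ [] → b ∈ Φ⁺
          positive₁ (here refl) = β∈

          ⊥₁ : ∀ {x} → H β x → ∀ {b} → b ∈ β ∷ [] → ⟨ b , x ⟩ ≡ 0#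
          ⊥₁ h (here refl) = h

        open Flat (β ∷ []) ([] ∷ []) independent₁ positive₁ line-closed (H β) ⊥₁ (λ h → h (here refl)) public

        private
          β-self : κ β β ≡ 1#
          β-self = κ-self (root-≢𝟎 (⁺⇒root β∈))

        -- If some root of the class is not orthogonal to `β`, both eigenvalues of the plane agree,
        -- and comparing the trace with the number of roots gives `2 (1 + s₁) = 4 (1 + sκ)`.
        -- Otherwise every root of the class is parallel to `d`, so `d` is alone and `sκ` vanishes.
        class-size : ∀ {d} → d ∈ Φ⁺ → p d ≢ 𝟎 → class-sum d (λ _ → 1#) ≡ 1# + fromℕ 2 * class-sum d (λ α → κ α β)
        class-size {d} d∈ pd≢𝟎 = by em
          where
          open Local d∈ pd≢𝟎
          s₁ = class-sum d (λ _ → 1#)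
          sκ = class-sum d (λ α → κ α β)
          by : Dec (∃ λ α → α ∈ Φ × α ∼ d × ⟨ α , β ⟩ ≢ 0#) → s₁ ≡ 1# + fromℕ 2 * sκ
          by (yes (α , α∈ , α∼d , ne)) = *-cancelˡ (pos⇒≢0 0<2) (combine₃ 1# (fromℕ 2) (fromℕ 2 * fromℕ 2)
              (trans (sym size) (trans length-Γ (cong (Γ.eigenvalue β + 0# +_) (trans (transversal≡ α∈ α∼d) (Γ.eigenvalue-cong (∼∈Γ α∈ α∼d) (b∈Γ (here refl)) ne)))))
              (eigenvalue-Γ β) β-self
              (solve 4 (λ s k b q → :2 :* s :- :2 :* (:1 :+ :2 :* q) := :1 :* (:2 :* ((:1 :+ :0) :+ s) :- ((b :+ :0) :+ b)) :+ :2 :* (b :- :2 :* ((k :+ :0) :+ q)) :+ :2 :* :2 :* (k :- :1)) refl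
                s₁ (κ β β) (Γ.eigenvalue β) sκ))
          by (no none) = trans (trans (∑-single unique⁺ d∈ other) (trans (*-identityʳ _) (χ-yes (∼-refl d)))) (sym (trans (cong (λ s → 1# + fromℕ 2 * s) (∑-zero {xs = Φ⁺} vanish)) (solve 0 (:1 :+ :2 :* :0 := :1) refl)))
            where
            orth : ∀ {α} → α ∈ Φ → α ∼ d → ⟨ α , β ⟩ ≡ 0#
            orth {α} α∈ s = stable λ ne → none (α , α∈ , s , ne)
            p-id : ∀ {α} → α ∈ Φ → α ∼ d → p α ≡ α
            p-id {α} α∈ s = p-⊥ λ { (here refl) → trans (⟨⟩-sym β α) (orth α∈ s) }
            χ∼ : ∀ {α} → α ∈ Φ⁺ → α ≢ d → ¬ α ∼ d
            χ∼ {α} α∈ ne s@(k , _ , e) = ne (multiple-root k α∈ d∈ (trans (sym (p-id (⁺⇒root α∈) s)) (trans e (cong (k ·_) (p-id (⁺⇒root d∈) (∼-refl d))))))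
            other : ∀ {α} → α ∈ Φ⁺ → α ≢ d → χ (α ∼ d) * 1# ≡ 0#
            other {α} α∈ ne = trans (*-identityʳ _) (χ-no (χ∼ α∈ ne))
            vanish : ∀ {α} → α ∈ Φ⁺ → χ (α ∼ d) * κ α β ≡ 0#
            vanish {α} α∈ = cases em
              where
              cases : Dec (α ∼ d) → χ (α ∼ d) * κ α β ≡ 0#
              cases (yes s) = trans (cong (χ (α ∼ d) *_) (κ-⊥ {α} {β} (orth (⁺⇒root α∈) s))) (zeroʳ (χ (α ∼ d)))
              cases (no ¬s) = trans (cong (_* κ α β) (χ-no ¬s)) (zeroˡ (κ α β))

        -- The weight `1 - 2 κ` sums to 1 over each flat and equals -1 at `β`. Its sum over all
        -- positive roots other than `β` therefore counts the flats.
        length-restriction₁ : fromℕ (length (restriction (weylArrangement Φ⁺) (H β))) ≡ fromℕ (length Φ⁺) - fromℕ 2 * ∑ Φ⁺ (λ α → κ α β) + 1#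
        length-restriction₁ = begin
          fromℕ (length (restriction (weylArrangement Φ⁺) (H β)))         ≡⟨ cong fromℕ length-restriction ⟩
          fromℕ (length reps)                                             ≡⟨ ∑-length reps ⟨
          ∑ reps (λ _ → 1#)                                               ≡⟨ ∑-cong {xs = reps} (λ {d} d∈ → one (reps-∈ d∈)) ⟩
          ∑ reps (λ d → class-sum d f)                                    ≡⟨ ∑-reps f ⟩
          ∑ Φ⁺ f - ∑ (β ∷ []) f                                           ≡⟨ cong₂ (λ a b → a - (1# + - fromℕ 2 * b + 0#)) total β-self ⟩
          fromℕ (length Φ⁺) + - fromℕ 2 * ∑ Φ⁺ (λ α → κ α β) - (1# + - fromℕ 2 * 1# + 0#) ≡⟨ solve 2 (λ n c → n :+ :- :2 :* c :- (:1 :+ :- :2 :* :1 :+ :0) := n :- :2 :* c :+ :1) refl (fromℕ (length Φ⁺)) (∑ Φ⁺ (λ α → κ α β)) ⟩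
          fromℕ (length Φ⁺) - fromℕ 2 * ∑ Φ⁺ (λ α → κ α β) + 1#           ∎
          where
          f : V → Carrier
          f α = 1# + - fromℕ 2 * κ α β
          total : ∑ Φ⁺ f ≡ fromℕ (length Φ⁺) + - fromℕ 2 * ∑ Φ⁺ (λ α → κ α β)
          total = trans (∑-+ Φ⁺ (λ _ → 1#) (λ α → - fromℕ 2 * κ α β)) (cong₂ _+_ (∑-length Φ⁺) (∑-*ˡ Φ⁺ (- fromℕ 2) (λ α → κ α β)))
          one : ∀ {d} → d ∈ Φ⁺ × p d ≢ 𝟎 → 1# ≡ class-sum d f
          one {d} (d∈ , ne) = sym (trans (class-sum-+ d (λ _ → 1#) (λ α → - fromℕ 2 * κ α β)) (trans (cong (class-sum d (λ _ → 1#) +_) (class-sum-* d (- fromℕ 2) (λ α → κ α β)))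
            (combine₁ 1# (class-size d∈ ne) (solve 2 (λ s k → s :+ :- :2 :* k :- :1 := :1 :* (s :- (:1 :+ :2 :* k))) refl (class-sum d (λ _ → 1#)) (class-sum d (λ α → κ α β))))))

      -- Rank three flats through an orthogonal pair of roots
      module Pair {β γ} (β∈ : β ∈ Φ⁺) (γ∈ : γ ∈ Φ⁺) (β⊥γ : ⟨ β , γ ⟩ ≡ 0#) (X : Pred V 0ℓ)
                  (X⇒ : ∀ {x} → X x → ⟨ β , x ⟩ ≡ 0# × ⟨ γ , x ⟩ ≡ 0#) (⇒X : ∀ {x} → ⟨ β , x ⟩ ≡ 0# → ⟨ γ , x ⟩ ≡ 0# → X x)
                  (pair-closed : ∀ {α} → α ∈ Φ⁺ → residual (β ∷ γ ∷ []) α ≡ 𝟎 → α ∈ β ∷ γ ∷ []) where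
        β≢𝟎 : β ≢ 𝟎
        β≢𝟎 = root-≢𝟎 (⁺⇒root β∈)

        γ≢𝟎 : γ ≢ 𝟎
        γ≢𝟎 = root-≢𝟎 (⁺⇒root γ∈)

        β≢γ : β ≢ γ
        β≢γ refl = β≢𝟎 (⟨⟩-definite β⊥γ)

        private
          independent₂ : Independent (β ∷ γ ∷ [])
          independent₂ (here refl)         (here refl)         ne = ⊥-elim (ne refl)
          independent₂ (here refl)         (there (here refl)) ne = β⊥γ
          independent₂ (there (here refl)) (here refl)         ne = trans (⟨⟩-sym γ β) β⊥γ
          independent₂ (there (here refl)) (there (here refl)) ne = ⊥-elim (ne refl)

          positive₂ : ∀ {b} → b ∈ β ∷ γ ∷ [] → b ∈ Φ⁺
          positive₂ (here refl)         = β∈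
          positive₂ (there (here refl)) = γ∈

          ⊥₂ : ∀ {x} → X x → ∀ {b} → b ∈ β ∷ γ ∷ [] → ⟨ b , x ⟩ ≡ 0#
          ⊥₂ h (here refl)         = proj₁ (X⇒ h)
          ⊥₂ h (there (here refl)) = proj₂ (X⇒ h)

        open Flat (β ∷ γ ∷ []) ((β≢γ ∷ []) ∷ [] ∷ []) independent₂ positive₂ pair-closed X ⊥₂ (λ h → ⇒X (h (here refl)) (h (there (here refl)))) public

        private module L = Line β∈

        -- The line through γ is a component of the root system on the flat of α.
        Isolated : V → Set
        Isolated α = ∀ ρ → ρ ∈ Φ → ρ ∼ α → ⟨ ρ , γ ⟩ ≡ 0#

        private
          κββ : κ β β ≡ 1#
          κββ = κ-self β≢𝟎
          κγγ : κ γ γ ≡ 1#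
          κγγ = κ-self γ≢𝟎
          κβγ : κ β γ ≡ 0#
          κβγ = κ-⊥ {β} {γ} β⊥γ
          κγβ : κ γ β ≡ 0#
          κγβ = κ-⊥ {γ} {β} (trans (⟨⟩-sym γ β) β⊥γ)

        p≡p₁ : ∀ {α} → ⟨ α , γ ⟩ ≡ 0# → p α ≡ L.p α
        p≡p₁ {α} e = cong (_⊕ (- (⟨ α , β ⟩ * ⟨ β , β ⟩ ⁻¹)) · β) (trans (cong (λ c → α ⊕ (- (c * ⟨ γ , γ ⟩ ⁻¹)) · γ) e)
          (trans (cong (λ c → α ⊕ c · γ) (solve 1 (λ i → :- (:0 :* i) := :0) refl (⟨ γ , γ ⟩ ⁻¹))) (trans (cong (α ⊕_) (0· γ)) (⊕-identityʳ α))))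

        ⟨p₁,γ⟩ : ∀ α → ⟨ L.p α , γ ⟩ ≡ ⟨ α , γ ⟩
        ⟨p₁,γ⟩ α = trans (⟨⟩-⊕·ˡ α (- (⟨ α , β ⟩ * ⟨ β , β ⟩ ⁻¹)) β γ) (trans (cong (λ x → ⟨ α , γ ⟩ + - (⟨ α , β ⟩ * ⟨ β , β ⟩ ⁻¹) * x) β⊥γ)
          (solve 2 (λ a c → a :+ :- c :* :0 := a) refl ⟨ α , γ ⟩ (⟨ α , β ⟩ * ⟨ β , β ⟩ ⁻¹)))

        -- If a root of the class meets `γ`, the third eigenvalue is that of `γ`, and the trace
        -- gives `2 (2 + s₁) = 2 (1 + sβ) + 4 (1 + sγ)`. In the isolated case the class is that of a
        -- rank two flat through `β`, so `s₁ = 1 + 2 sβ` and `sγ = 0`; the last summand supplies the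
        -- second `sβ`.
        class-size₂ : ∀ {d} → d ∈ Φ⁺ → p d ≢ 𝟎 →
          class-sum d (λ _ → 1#) ≡ 1# + class-sum d (λ α → κ α β) + fromℕ 2 * class-sum d (λ α → κ α γ) + χ (Isolated d) * class-sum d (λ α → κ α β)
        class-size₂ {d} d∈ pd≢𝟎 = by em
          where
          open Local d∈ pd≢𝟎
          s₁ = class-sum d (λ _ → 1#)
          sβ = class-sum d (λ α → κ α β)
          sγ = class-sum d (λ α → κ α γ)
          by : Dec (∃ λ ρ → ρ ∈ Φ × ρ ∼ d × ⟨ ρ , γ ⟩ ≢ 0#) → s₁ ≡ 1# + sβ + fromℕ 2 * sγ + χ (Isolated d) * sβ
          by (yes (ρ , ρ∈ , s , ne)) = trans (*-cancelˡ (pos⇒≢0 0<2)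
              (combine₃ 1# 1# (fromℕ 2)
                (trans (sym size) (trans length-Γ (cong (Γ.eigenvalue β + (Γ.eigenvalue γ + 0#) +_) (trans (transversal≡ ρ∈ s) (Γ.eigenvalue-cong (∼∈Γ ρ∈ s) (b∈Γ (there (here refl))) ne)))))
                eigβ eigγ
                (solve 5 (λ s b c q r → :2 :* s :- :2 :* (:1 :+ q :+ :2 :* r) := :1 :* (:2 :* ((:1 :+ (:1 :+ :0)) :+ s) :- ((b :+ (c :+ :0)) :+ c)) :+ :1 :* (b :- :2 :* (:1 :+ q)) :+ :2 :* (c :- :2 :* (:1 :+ r))) refl
                  s₁ (Γ.eigenvalue β) (Γ.eigenvalue γ) sβ sγ)))
              (sym (trans (cong (λ x → 1# + sβ + fromℕ 2 * sγ + x * sβ) (χ-no λ iso → ne (iso ρ ρ∈ s))) (solve 2 (λ a b → a :+ :0 :* b := a) refl (1# + sβ + fromℕ 2 * sγ) sβ)))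
            where
            eigβ : Γ.eigenvalue β ≡ fromℕ 2 * (1# + sβ)
            eigβ = trans (eigenvalue-Γ β) (cong (λ x → fromℕ 2 * (x + sβ)) (trans (cong₂ (λ x y → x + (y + 0#)) κββ κγβ) (solve 0 (:1 :+ (:0 :+ :0) := :1) refl)))
            eigγ : Γ.eigenvalue γ ≡ fromℕ 2 * (1# + sγ)
            eigγ = trans (eigenvalue-Γ γ) (cong (λ x → fromℕ 2 * (x + sγ)) (trans (cong₂ (λ x y → x + (y + 0#)) κβγ κγγ) (solve 0 (:0 :+ (:1 :+ :0) := :1) refl)))
          by (no none) = begin
            s₁                                                     ≡⟨ same (λ _ → 1#) ⟩
            L.class-sum d (λ _ → 1#)                               ≡⟨ L.class-size d∈ (λ e → pd≢𝟎 (trans (p≡p₁ d⊥γ) e)) ⟩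
            1# + fromℕ 2 * L.class-sum d (λ α → κ α β)             ≡⟨ cong (λ x → 1# + fromℕ 2 * x) (same (λ α → κ α β)) ⟨
            1# + fromℕ 2 * sβ                                      ≡⟨ solve 1 (λ b → :1 :+ :2 :* b := :1 :+ b :+ :2 :* :0 :+ :1 :* b) refl sβ ⟩
            1# + sβ + fromℕ 2 * 0# + 1# * sβ                       ≡⟨ cong₂ (λ x y → 1# + sβ + fromℕ 2 * x + y * sβ) (∑-zero {xs = Φ⁺} (λ {α} α∈ → vanish α∈ em)) (χ-yes iso) ⟨
            1# + sβ + fromℕ 2 * sγ + χ (Isolated d) * sβ           ∎
            where
            iso : Isolated d
            iso ρ ρ∈ s = stable λ ne → none (ρ , ρ∈ , s , ne)
            d⊥γ : ⟨ d , γ ⟩ ≡ 0#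
            d⊥γ = iso d (⁺⇒root d∈) (∼-refl d)
            vanish : ∀ {α} → α ∈ Φ⁺ → Dec (α ∼ d) → χ (α ∼ d) * κ α γ ≡ 0#
            vanish {α} α∈ (yes s) = trans (cong (χ (α ∼ d) *_) (κ-⊥ {α} {γ} (iso α (⁺⇒root α∈) s))) (zeroʳ (χ (α ∼ d)))
            vanish {α} α∈ (no ¬s) = trans (cong (_* κ α γ) (χ-no ¬s)) (zeroˡ (κ α γ))
            same : ∀ f → class-sum d f ≡ L.class-sum d f
            same f = ∑-cong {xs = Φ⁺} λ {α} α∈ → cong (_* f α) (χ-⇔ (to α∈) (from α∈))
              where
              to : ∀ {α} → α ∈ Φ⁺ → α ∼ d → α L.∼ d
              to {α} α∈ s@(k , k≢0 , e) = k , k≢0 , trans (sym (p≡p₁ (iso α (⁺⇒root α∈) s))) (trans e (cong (k ·_) (p≡p₁ d⊥γ)))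
              from : ∀ {α} → α ∈ Φ⁺ → α L.∼ d → α ∼ d
              from {α} α∈ (k , k≢0 , e) = k , k≢0 , trans (p≡p₁ α⊥γ) (trans e (cong (k ·_) (sym (p≡p₁ d⊥γ))))
                where
                α⊥γ : ⟨ α , γ ⟩ ≡ 0#
                α⊥γ = trans (sym (⟨p₁,γ⟩ α)) (trans (cong ⟨_, γ ⟩ e) (trans (⟨⟩-·ˡ k (L.p d) γ) (trans (cong (k *_) (trans (⟨p₁,γ⟩ d) d⊥γ)) (zeroʳ k))))

        isolated-∼ : ∀ {α d} → α ∼ d → χ (Isolated α) ≡ χ (Isolated d)
        isolated-∼ s = χ-⇔ (λ iso ρ ρ∈ r → iso ρ ρ∈ (∼-trans r (∼-sym s))) (λ iso ρ ρ∈ r → iso ρ ρ∈ (∼-trans r s))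

        -- Both `β` and `γ` project to zero, so `γ ∼ β`, and `γ` is not orthogonal to itself.
        ¬isolated-β : ¬ Isolated β
        ¬isolated-β iso = γ≢𝟎 (⟨⟩-definite (iso γ (⁺⇒root γ∈) (1# , 0≢1 ∘ sym , trans (p-b (there (here refl))) (sym (trans (1· p β) (p-b (here refl)))))))

        correction : Carrier
        correction = ∑ Φ⁺ λ α → χ (Isolated α) * κ α β

        module _ {c} (cβ : ∑ Φ⁺ (λ α → κ α β) ≡ c) (cγ : ∑ Φ⁺ (λ α → κ α γ) ≡ c) where
          private
            N = fromℕ (length Φ⁺)
            -- The weight `f` is chosen to sum to 1 over every rank three flat; it takes the values
            -- 0 at `β` and -1 at `γ`, which accounts for the final summand 1.
            g f : V → Carrier
            g α = χ (Isolated α) * κ α β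
            f α = 1# + - 1# * κ α β + (- fromℕ 2 * κ α γ + - 1# * g α)

            f-sum : ∀ (sum : (V → Carrier) → Carrier) → (∀ f g → sum (λ α → f α + g α) ≡ sum f + sum g) → (∀ k f → sum (λ α → k * f α) ≡ k * sum f) →
                    sum f ≡ sum (λ _ → 1#) + - 1# * sum (λ α → κ α β) + (- fromℕ 2 * sum (λ α → κ α γ) + - 1# * sum g)
            f-sum sum add scale = trans (add (λ α → 1# + - 1# * κ α β) (λ α → - fromℕ 2 * κ α γ + - 1# * g α)) (cong₂ _+_
              (trans (add (λ _ → 1#) (λ α → - 1# * κ α β)) (cong (sum (λ _ → 1#) +_) (scale (- 1#) (λ α → κ α β))))
              (trans (add (λ α → - fromℕ 2 * κ α γ) (λ α → - 1# * g α)) (cong₂ _+_ (scale (- fromℕ 2) (λ α → κ α γ)) (scale (- 1#) g))))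

            class-g : ∀ d → class-sum d g ≡ χ (Isolated d) * class-sum d (λ α → κ α β)
            class-g d = trans (∑-ext {xs = Φ⁺} λ α → term α em) (∑-*ˡ Φ⁺ (χ (Isolated d)) λ α → χ (α ∼ d) * κ α β)
              where
              term : ∀ α → Dec (α ∼ d) → χ (α ∼ d) * g α ≡ χ (Isolated d) * (χ (α ∼ d) * κ α β)
              term α (yes s) = trans (cong (λ x → χ (α ∼ d) * (x * κ α β)) (isolated-∼ s)) (solve 3 (λ a b c → a :* (b :* c) := b :* (a :* c)) refl (χ (α ∼ d)) (χ (Isolated d)) (κ α β))
              term α (no ¬s) = trans (cong (_* g α) (χ-no ¬s)) (trans (zeroˡ (g α)) (sym (trans (cong (λ x → χ (Isolated d) * (x * κ α β)) (χ-no ¬s)) (solve 2 (λ a c → a :* (:0 :* c) := :0) refl (χ (Isolated d)) (κ α β)))))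

            one : ∀ {d} → d ∈ Φ⁺ × p d ≢ 𝟎 → 1# ≡ class-sum d f
            one {d} (d∈ , ne) = sym (trans (f-sum (class-sum d) (class-sum-+ d) (class-sum-* d)) (combine₂ 1# (- 1#) (class-size₂ d∈ ne) (class-g d)
              (solve 5 (λ s b c i g → s :+ :- :1 :* b :+ (:- :2 :* c :+ :- :1 :* g) :- :1 := :1 :* (s :- (:1 :+ b :+ :2 :* c :+ i :* b)) :+ :- :1 :* (g :- i :* b)) refl
                (class-sum d (λ _ → 1#)) (class-sum d (λ α → κ α β)) (class-sum d (λ α → κ α γ)) (χ (Isolated d)) (class-sum d g))))

            fβ : f β ≡ 0#
            fβ = trans (cong₂ (λ x y → 1# + - 1# * x + (- fromℕ 2 * y + - 1# * (χ (Isolated β) * x))) κββ κβγ) (trans (cong (λ i → 1# + - 1# * 1# + (- fromℕ 2 * 0# + - 1# * (i * 1#))) (χ-no ¬isolated-β))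
              (solve 0 (:1 :+ :- :1 :* :1 :+ (:- :2 :* :0 :+ :- :1 :* (:0 :* :1)) := :0) refl))

            fγ : f γ ≡ - 1#
            fγ = trans (cong₂ (λ x y → 1# + - 1# * x + (- fromℕ 2 * y + - 1# * (χ (Isolated γ) * x))) κγβ κγγ) (solve 1 (λ i → :1 :+ :- :1 :* :0 :+ (:- :2 :* :1 :+ :- :1 :* (i :* :0)) := :- :1) refl (χ (Isolated γ)))

          length-restriction₂ : fromℕ (length (restriction (weylArrangement Φ⁺) X)) ≡ N - (c + c + c) - correction + 1#
          length-restriction₂ = begin
            fromℕ (length (restriction (weylArrangement Φ⁺) X))     ≡⟨ cong fromℕ length-restriction ⟩
            fromℕ (length reps)                                     ≡⟨ ∑-length reps ⟨
            ∑ reps (λ _ → 1#)                                       ≡⟨ ∑-cong {xs = reps} (λ {d} d∈ → one (reps-∈ d∈)) ⟩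
            ∑ reps (λ d → class-sum d f)                            ≡⟨ ∑-reps f ⟩
            ∑ Φ⁺ f - (f β + (f γ + 0#))                             ≡⟨ cong₂ (λ a b → a - b) (trans (f-sum (∑ Φ⁺) (∑-+ Φ⁺) (λ k h → ∑-*ˡ Φ⁺ k h)) (cong₂ _+_ (cong₂ (λ a b → a + - 1# * b) (∑-length Φ⁺) cβ) (cong (λ b → - fromℕ 2 * b + - 1# * correction) cγ)))
                                                                         (cong₂ (λ a b → a + (b + 0#)) fβ fγ) ⟩
            N + - 1# * c + (- fromℕ 2 * c + - 1# * correction) - (0# + (- 1# + 0#))
              ≡⟨ solve 3 (λ n c k → n :+ :- :1 :* c :+ (:- :2 :* c :+ :- :1 :* k) :- (:0 :+ (:- :1 :+ :0)) := n :- (c :+ c :+ c) :- k :+ :1) refl N c correction ⟩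
            N - (c + c + c) - correction + 1# ∎

          difference : fromℕ (length (restriction (weylArrangement Φ⁺) (H β))) - fromℕ (length (restriction (weylArrangement Φ⁺) X)) ≡ c + correction
          difference = trans (cong₂ _-_ (trans L.length-restriction₁ (cong (λ s → N - fromℕ 2 * s + 1#) cβ)) length-restriction₂)
            (solve 3 (λ n c k → n :- :2 :* c :+ :1 :- (n :- (c :+ c :+ c) :- k :+ :1) := c :+ k) refl N c correction)

    -- Planes of type G₂ are orthogonal to all other roots.

    module TripleLink where
      open RootSystem rs
      open Crystal rs crystallographic

      private
        two : IsInteger (fromℕ 2)
        two = pos 2 , refl
        three : IsInteger (fromℕ 3)
        three = pos 3 , refl

      -- Here `a` and `b` are the short and the long simple root of a system of type G₂, and `v` is
      -- a root outside their plane with a nonzero projection to it. The Cartan numbers of the three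
      -- short positive roots with `v` must then be larger than the length of the projection
      -- permits.
      module Core {P : Pred V 0ℓ} (S : Subspace P) {a b v} (a∈ : a ∈ Φ) (b∈ : b ∈ Φ) (v∈ : v ∈ Φ) (Pa : P a) (Pb : P b) (¬Pv : ¬ P v)
                  (linked : ¬ (⟨ a , v ⟩ ≡ 0# × ⟨ b , v ⟩ ≡ 0#))
                  (ab : fromℕ 2 * ⟨ a , b ⟩ ≡ - fromℕ 3 * ⟨ a , a ⟩) (bb : ⟨ b , b ⟩ ≡ fromℕ 3 * ⟨ a , a ⟩) where
        open Subspace S
        private
          A W p q n : Carrier
          A = ⟨ a , a ⟩
          W = ⟨ v , v ⟩
          p = cartan a v
          q = cartan b v
          -- The squared length of the projection of `v` to the plane, measured in units of `A`; it
          -- is an integer.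
          n = p * p + fromℕ 3 * (p * q) + fromℕ 3 * (q * q)

          a≢ = root-≢𝟎 a∈
          b≢ = root-≢𝟎 b∈
          v≢ = root-≢𝟎 v∈

          p-spec : p * A ≡ fromℕ 2 * ⟨ v , a ⟩
          p-spec = trans (cartan-spec v a≢) (cong (fromℕ 2 *_) (⟨⟩-sym a v))

          q-spec : fromℕ 3 * q * A ≡ fromℕ 2 * ⟨ v , b ⟩
          q-spec = trans (trans (solve 3 (λ t q a → t :* q :* a := q :* (t :* a)) refl (fromℕ 3) q A) (cong (q *_) (sym bb))) (trans (cartan-spec v b≢) (cong (fromℕ 2 *_) (⟨⟩-sym b v)))

          pW : p * A ≡ cartan v a * W
          pW = trans p-spec (sym (cartan-spec a v≢))

          qW : fromℕ 3 * q * A ≡ cartan v b * W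
          qW = trans q-spec (sym (cartan-spec b v≢))

          p-int : IsInteger p
          p-int = cartan-integer a∈ v∈
          q-int : IsInteger q
          q-int = cartan-integer b∈ v∈
          n-int : IsInteger n
          n-int = integer-+ (integer-+ (integer-* p-int p-int) (integer-* three (integer-* p-int q-int))) (integer-* three (integer-* q-int q-int))

          -- The vector 2 v - p a - (p + 2 q) (3 a + 2 b), twice the component of v
          -- orthogonal to a and b.
          x y : Carrier
          x = - (fromℕ 2 * fromℕ 2) * p + - (fromℕ 2 * fromℕ 3) * q
          y = - fromℕ 2 * p + - (fromℕ 2 * fromℕ 2) * q

          w : V
          w = x · a ⊕ y · b

          ⟨u,u⟩ : ⟨ fromℕ 2 · v ⊕ 1# · w , fromℕ 2 · v ⊕ 1# · w ⟩ ≡ fromℕ 2 * fromℕ 2 * (W - A * n)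
          ⟨u,u⟩ = trans (⟨lin₂,lin₂⟩ (fromℕ 2) v 1# w) (trans
            (cong₂ (λ s r → fromℕ 2 * fromℕ 2 * W + fromℕ 2 * (fromℕ 2 * 1# * s) + 1# * 1# * r) (⟨,lin₂⟩ x a y b v)
              (trans (⟨lin₂,lin₂⟩ x a y b) (cong (λ B → x * x * A + fromℕ 2 * (x * y * ⟨ a , b ⟩) + y * y * B) bb)))
            (combine₃ (- (fromℕ 2 * x)) (- (fromℕ 2 * y)) (x * y) p-spec q-spec ab
              (solve 7 (λ p q A W α β m →
                  let three = :1 :+ :2
                      x = :- (:2 :* :2) :* p :+ :- (:2 :* three) :* q
                      y = :- :2 :* p :+ :- (:2 :* :2) :* q
                      n = p :* p :+ three :* (p :* q) :+ three :* (q :* q)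
                  in :2 :* :2 :* W :+ :2 :* (:2 :* :1 :* (x :* α :+ y :* β)) :+ :1 :* :1 :* (x :* x :* A :+ :2 :* (x :* y :* m) :+ y :* y :* (three :* A)) :- :2 :* :2 :* (W :- A :* n)
                     := :- (:2 :* x) :* (p :* A :- :2 :* α) :+ :- (:2 :* y) :* (three :* q :* A :- :2 :* β) :+ x :* y :* (:2 :* m :- :- three :* A)) refl
                p q A W ⟨ v , a ⟩ ⟨ v , b ⟩ ⟨ a , b ⟩)))

          n-nonneg : 0# ≤ n
          n-nonneg = 0≤-cancel (0<* 0<2 0<2) (0≤-by (0≤+ (0≤sq (fromℕ 2 * p + fromℕ 3 * q)) (0≤* (0≤fromℕ 3) (0≤sq q)))
            (solve 2 (λ p q → let three = :1 :+ :2 in (:2 :* p :+ three :* q) :* (:2 :* p :+ three :* q) :+ three :* (q :* q) := :2 :* :2 :* (p :* p :+ three :* (p :* q) :+ three :* (q :* q))) refl p q))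

          strict : 0# < W - A * n
          strict = 0<-cancel (0≤* 0≤2 0≤2) (subst (0# <_) ⟨u,u⟩ (⟨⟩-pos λ u≡𝟎 → ¬Pv (subst P halve (has-· (fromℕ 2 ⁻¹) (u ⊕ (- 1#) · w) (has-⊕· u (- 1#) w (subst P (sym u≡𝟎) has-𝟎) Pw)))))
            where
            u : V
            u = fromℕ 2 · v ⊕ 1# · w
            Pw : P w
            Pw = has-⊕· (x · a) y b (has-· x a Pa) Pb
            halve : fromℕ 2 ⁻¹ · (u ⊕ (- 1#) · w) ≡ v
            halve = ⟨⟩-ext λ z → trans (⟨⟩-·ˡ (fromℕ 2 ⁻¹) (u ⊕ (- 1#) · w) z) (trans (cong (fromℕ 2 ⁻¹ *_) (trans (⟨⟩-⊕·ˡ u (- 1#) w z) (cong (_+ - 1# * ⟨ w , z ⟩) (⟨lin₂,⟩ (fromℕ 2) v 1# w z))))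
              (combine₁ ⟨ v , z ⟩ (⁻¹-inverseˡ (pos⇒≢0 0<2)) (solve 4 (λ i t v w → i :* (t :* v :+ :1 :* w :+ :- :1 :* w) :- v := v :* (i :* t :- :1)) refl (fromℕ 2 ⁻¹) (fromℕ 2) ⟨ v , z ⟩ ⟨ w , z ⟩)))

          -- Here `u` is the Cartan number of `v` relative to a short root, and `i` the one with the
          -- roles exchanged. As `i ≥ 1`, `u A ≥ W > A n`, hence `u > n`, and integrality gives
          -- `u ≥ n + 1`.
          big-pos : ∀ {u i} → IsInteger u → IsInteger i → u * A ≡ i * W → 0# < u → (n + 1#) * (n + 1#) ≤ u * u
          big-pos {u} {i} u-int i-int e u>0 = ≤-by (0≤* u≥n+1 (0≤+ (proj₁ u>0) (0≤+ n-nonneg 0≤1))) (solve 2 (λ u n → u :* u :- (n :+ :1) :* (n :+ :1) := (u :- n :- :1) :* (u :+ (n :+ :1))) refl u n)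
            where
            i>0 : 0# < i
            i>0 = 0<-cancel (⟨⟩-nonneg v) (subst (0# <_) (trans e (*-comm i W)) (0<* u>0 (⟨⟩-pos a≢)))
            u-n>0 : 0# < u - n
            u-n>0 = 0<-cancel (⟨⟩-nonneg a) (subst (0# <_) (combine₁ (- 1#) e (solve 5 (λ w a n i u → (w :- a :* n) :+ (i :- :1) :* w :- a :* (u :- n) := :- :1 :* (u :* a :- i :* w)) refl W A n i u))
              (0<+ strict (0≤* (≤⇒0≤ (integer-pos i-int i>0)) (⟨⟩-nonneg v))))
            u≥n+1 : 0# ≤ u - n - 1#
            u≥n+1 = ≤⇒0≤ (integer-pos (integer-+ u-int (integer-neg n-int)) u-n>0)

          big : ∀ {u i} → IsInteger u → IsInteger i → u * A ≡ i * W → u ≢ 0# → (n + 1#) * (n + 1#) ≤ u * u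
          big {u} {i} u-int i-int e u≢0 with sign u
          ... | inj₁ u≡0 = ⊥-elim (u≢0 u≡0)
          ... | inj₂ (inj₁ h) = big-pos u-int i-int e h
          ... | inj₂ (inj₂ h) = subst ((n + 1#) * (n + 1#) ≤_) (solve 1 (λ u → :- u :* :- u := u :* u) refl u)
                  (big-pos (integer-neg u-int) (integer-neg i-int) (trans (solve 2 (λ u a → :- u :* a := :- (u :* a)) refl u A) (trans (cong -_ e) (solve 2 (λ i w → :- (i :* w) := :- i :* w) refl i W))) h)

          -- The case of a short root orthogonal to `v`: the other two short roots have Cartan
          -- numbers `3 r` up to sign and `n = 3 r²`. But `(3 r² + 1)²` exceeds `9 r²` once
          -- `r² ≥ 1`.
          degenerate : ∀ {r} → IsInteger r → r ≢ 0# → n ≡ fromℕ 3 * (r * r) → ¬ (n + 1#) * (n + 1#) ≤ fromℕ 3 * fromℕ 3 * (r * r)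
          degenerate {r} r-int r≢0 n≡ h = <-≤-⊥ (0<⇒< (subst (0# <_)
              (solve 1 (λ s → :1 :+ ((:1 :+ :2) :* (:1 :+ :2) :* (s :* (s :- :1)) :+ :2 :* (:1 :+ :2) :* s) := ((:1 :+ :2) :* s :+ :1) :* ((:1 :+ :2) :* s :+ :1) :- (:1 :+ :2) :* (:1 :+ :2) :* s) refl (r * r))
              (0<+ 0<1 (0≤+ (0≤* (0≤* (0≤fromℕ 3) (0≤fromℕ 3)) (0≤* (0≤sq r) (≤⇒0≤ (integer-pos (integer-* r-int r-int) (0<sq r≢0))))) (0≤* (0≤* 0≤2 (0≤fromℕ 3)) (0≤sq r))))))
            (subst (λ n → (n + 1#) * (n + 1#) ≤ fromℕ 3 * fromℕ 3 * (r * r)) n≡ h)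

          not-both : ¬ (p ≡ 0# × q ≡ 0#)
          not-both (p≡0 , q≡0) = linked (vanish a≢ p≡0 , vanish b≢ q≡0)
            where
            vanish : ∀ {c} → c ≢ 𝟎 → cartan c v ≡ 0# → ⟨ c , v ⟩ ≡ 0#
            vanish {c} c≢ e = *-cancelˡ (pos⇒≢0 0<2) (trans (sym (cartan-spec v c≢)) (trans (cong (_* ⟨ c , c ⟩) e) (trans (zeroˡ ⟨ c , c ⟩) (sym (zeroʳ (fromℕ 2))))))

          -- The Cartan numbers of `v` relative to the short roots `a ⊕ b` and `2 a ⊕ b`; for `a`
          -- itself it is `p`.
          p+3q 2p+3q : Carrier
          p+3q = p + fromℕ 3 * q
          2p+3q = fromℕ 2 * p + fromℕ 3 * q

          i-int = cartan-integer v∈ a∈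
          l-int = cartan-integer v∈ b∈

          big₁ : p ≢ 0# → (n + 1#) * (n + 1#) ≤ p * p
          big₁ = big p-int i-int pW

          big₂ : p+3q ≢ 0# → (n + 1#) * (n + 1#) ≤ p+3q * p+3q
          big₂ = big (integer-+ p-int (integer-* three q-int)) (integer-+ i-int l-int) (combine₂ 1# 1# pW qW
            (solve 6 (λ p q a i l w → (p :+ q) :* a :- (i :+ l) :* w := :1 :* (p :* a :- i :* w) :+ :1 :* (q :* a :- l :* w)) refl p (fromℕ 3 * q) A (cartan v a) (cartan v b) W))

          big₃ : 2p+3q ≢ 0# → (n + 1#) * (n + 1#) ≤ 2p+3q * 2p+3q
          big₃ = big (integer-+ (integer-* two p-int) (integer-* three q-int)) (integer-+ (integer-* two i-int) l-int) (combine₂ (fromℕ 2) 1# pW qW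
            (solve 6 (λ p q a i l w → (:2 :* p :+ q) :* a :- (:2 :* i :+ l) :* w := :2 :* (p :* a :- i :* w) :+ :1 :* (q :* a :- l :* w)) refl p (fromℕ 3 * q) A (cartan v a) (cartan v b) W))

        contradiction : ⊥
        contradiction with em {p ≡ 0#} | em {p+3q ≡ 0#} | em {2p+3q ≡ 0#}
        ... | yes e | _ | _ = degenerate q-int q≢0
              (combine₁ (p + fromℕ 3 * q) e (solve 2 (λ p q → let t = :1 :+ :2 in p :* p :+ t :* (p :* q) :+ t :* (q :* q) :- t :* (q :* q) := (p :+ t :* q) :* (p :- :0)) refl p q))
              (subst ((n + 1#) * (n + 1#) ≤_) (combine₁ (p + fromℕ 2 * (fromℕ 3 * q)) e (solve 2 (λ p q → let t = :1 :+ :2 in (p :+ t :* q) :* (p :+ t :* q) :- t :* t :* (q :* q) := (p :+ :2 :* (t :* q)) :* (p :- :0)) refl p q))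
                (big₂ λ e′ → q≢0 (*-cancelˡ (pos⇒≢0 (0<fromℕ 2)) (combine₂ 1# (- 1#) e′ e (solve 2 (λ p q → let t = :1 :+ :2 in t :* q :- t :* :0 := :1 :* (p :+ t :* q :- :0) :+ :- :1 :* (p :- :0)) refl p q)))))
          where
          q≢0 : q ≢ 0#
          q≢0 e′ = not-both (e , e′)
        ... | no p≢0 | yes e | _ = degenerate q-int q≢0
              (combine₁ p e (solve 2 (λ p q → let t = :1 :+ :2 in p :* p :+ t :* (p :* q) :+ t :* (q :* q) :- t :* (q :* q) := p :* (p :+ t :* q :- :0)) refl p q))
              (subst ((n + 1#) * (n + 1#) ≤_) (combine₁ (p - fromℕ 3 * q) e (solve 2 (λ p q → let t = :1 :+ :2 in p :* p :- t :* t :* (q :* q) := (p :- t :* q) :* (p :+ t :* q :- :0)) refl p q)) (big₁ p≢0))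
          where
          q≢0 : q ≢ 0#
          q≢0 e′ = p≢0 (combine₂ 1# (- fromℕ 3) e e′ (solve 2 (λ p q → let t = :1 :+ :2 in p :- :0 := :1 :* (p :+ t :* q :- :0) :+ :- t :* (q :- :0)) refl p q))
        ... | no p≢0 | no _ | yes e = degenerate (integer-+ p-int q-int) r≢0
              (combine₁ (- p) e (solve 2 (λ p q → let t = :1 :+ :2 in p :* p :+ t :* (p :* q) :+ t :* (q :* q) :- t :* ((p :+ q) :* (p :+ q)) := :- p :* (:2 :* p :+ t :* q :- :0)) refl p q))
              (subst ((n + 1#) * (n + 1#) ≤_) (combine₁ (- (fromℕ 2 * fromℕ 2 * p) + - (fromℕ 3 * q)) e (solve 2 (λ p q → let t = :1 :+ :2 in p :* p :- t :* t :* ((p :+ q) :* (p :+ q)) := (:- (:2 :* :2 :* p) :+ :- (t :* q)) :* (:2 :* p :+ t :* q :- :0)) refl p q)) (big₁ p≢0))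
          where
          r≢0 : p + q ≢ 0#
          r≢0 e′ = p≢0 (combine₂ (- 1#) (fromℕ 3) e e′ (solve 2 (λ p q → let t = :1 :+ :2 in p :- :0 := :- :1 :* (:2 :* p :+ t :* q :- :0) :+ t :* (p :+ q :- :0)) refl p q))
        -- The squares of the three Cartan numbers add up to `6 n`, whereas each is at least
        -- `(n + 1)²`; this would mean `3 + 3 n² ≤ 0`.
        ... | no p≢0 | no h₂ | no h₃ = pos-neg-⊥ (0<+ (0<fromℕ 2) (0≤* (0≤fromℕ 3) (0≤sq n)))
              (0≤-by (0≤+ (0≤+ (≤⇒0≤ (big₁ p≢0)) (≤⇒0≤ (big₂ h₂))) (≤⇒0≤ (big₃ h₃)))
                (solve 2 (λ p q → let t = :1 :+ :2
                                      n = p :* p :+ t :* (p :* q) :+ t :* (q :* q)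
                                      m = (n :+ :1) :* (n :+ :1)
                                  in (p :* p :- m) :+ ((p :+ t :* q) :* (p :+ t :* q) :- m) :+ ((:2 :* p :+ t :* q) :* (:2 :* p :+ t :* q) :- m) := :- (t :+ t :* (n :* n))) refl p q))

      -- A pair of roots spanning a subsystem of type G₂ is not joined to any
      -- further root.
      no-triple-link : ∀ {P : Pred V 0ℓ} → Subspace P → ∀ {a b v} → a ∈ Φ → b ∈ Φ → v ∈ Φ → P a → P b → ¬ P v →
                       ¬ (⟨ a , v ⟩ ≡ 0# × ⟨ b , v ⟩ ≡ 0#) → cartan a b * cartan b a ≢ fromℕ 3
      no-triple-link {P} S {a} {b} {v} a∈ b∈ v∈ Pa Pb ¬Pv linked e = [ zero-case , [ positive-case a∈ b∈ Pa Pb linked e , negative-case ]′ ]′ (sign ⟨ a , b ⟩)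
        where
        -- With b replaced by - b, the pair has an obtuse angle as in Core.
        oriented : ∀ {a b} → a ∈ Φ → b ∈ Φ → P a → P b → ¬ (⟨ a , v ⟩ ≡ 0# × ⟨ b , v ⟩ ≡ 0#) → cartan a b ≡ fromℕ 3 → cartan b a ≡ 1# → ⊥
        oriented {a} {b} a∈ b∈ Pa Pb linked e₃ e₁ = Core.contradiction S a∈ (neg-root b∈) v∈ Pa (Subspace.has-neg S b Pb) ¬Pv
          (λ (x , y) → linked (x , trans (solve 1 (λ a → a := :- (:- a)) refl ⟨ b , v ⟩) (trans (cong -_ (trans (sym (⟨⟩-negˡ b v)) y)) -0#≈0#)))
          (trans (cong (fromℕ 2 *_) (⟨⟩-negʳ a b)) (trans (solve 2 (λ t p → t :* :- p := :- (t :* p)) refl (fromℕ 2) ⟨ a , b ⟩) (trans (cong -_ ab) (solve 2 (λ t a → :- (t :* a) := :- t :* a) refl (fromℕ 3) ⟨ a , a ⟩))))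
          (trans (⟨neg,neg⟩ b b) (trans (sym (*-identityˡ ⟨ b , b ⟩)) (trans (cong (_* ⟨ b , b ⟩) (sym e₁)) (trans (cartan-spec a (root-≢𝟎 b∈)) (trans (cong (fromℕ 2 *_) (⟨⟩-sym b a)) ab)))))
          where
          ab : fromℕ 2 * ⟨ a , b ⟩ ≡ fromℕ 3 * ⟨ a , a ⟩
          ab = trans (sym (cartan-spec b (root-≢𝟎 a∈))) (cong (_* ⟨ a , a ⟩) e₃)
        positive-case : ∀ {a b} → a ∈ Φ → b ∈ Φ → P a → P b → ¬ (⟨ a , v ⟩ ≡ 0# × ⟨ b , v ⟩ ≡ 0#) → cartan a b * cartan b a ≡ fromℕ 3 → 0# < ⟨ a , b ⟩ → ⊥
        positive-case {a} {b} a∈ b∈ Pa Pb linked e ab>0 = cases (integer≡1⊎≥2 (cartan-integer a∈ b∈) (cartan-pos a∈ ab>0)) (integer≡1⊎≥2 (cartan-integer b∈ a∈) (cartan-pos b∈ (subst (0# <_) (⟨⟩-sym a b) ab>0)))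
          where
          m = cartan a b
          m′ = cartan b a
          cases : m ≡ 1# ⊎ fromℕ 2 ≤ m → m′ ≡ 1# ⊎ fromℕ 2 ≤ m′ → ⊥
          cases (inj₁ m≡1) _ = oriented b∈ a∈ Pb Pa (λ (x , y) → linked (y , x)) (trans (sym (trans (cong (_* m′) m≡1) (*-identityˡ m′))) e) m≡1
          cases (inj₂ _) (inj₁ m′≡1) = oriented a∈ b∈ Pa Pb linked (trans (sym (trans (cong (m *_) m′≡1) (*-identityʳ m))) e) m′≡1
          cases (inj₂ h) (inj₂ h′) = pos-neg-⊥ 0<1 (0≤-by (0≤+ (0≤* (≤⇒0≤ h) (≤⇒0≤ h′)) (0≤+ (0≤* 0≤2 (≤⇒0≤ h)) (0≤* 0≤2 (≤⇒0≤ h′))))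
            (combine₁ 1# e (solve 2 (λ m n → (m :- :2) :* (n :- :2) :+ (:2 :* (m :- :2) :+ :2 :* (n :- :2)) :- :- :1 := :1 :* (m :* n :- (:1 :+ :2))) refl m m′)))
        zero-case : ⟨ a , b ⟩ ≡ 0# → ⊥
        zero-case ab≡0 = pos⇒≢0 (0<fromℕ 2) (trans (sym e) (trans (cong (_* cartan b a) (trans (cong (λ x → fromℕ 2 * x / ⟨ a , a ⟩) ab≡0) (solve 2 (λ t i → t :* :0 :* i := :0) refl (fromℕ 2) (⟨ a , a ⟩ ⁻¹)))) (zeroˡ (cartan b a))))
        negative-case : 0# < - ⟨ a , b ⟩ → ⊥
        negative-case h = positive-case a∈ (neg-root b∈) Pa (Subspace.has-neg S b Pb)
          (λ (x , y) → linked (x , trans (solve 1 (λ a → a := :- (:- a)) refl ⟨ b , v ⟩) (trans (cong -_ (trans (sym (⟨⟩-negˡ b v)) y)) -0#≈0#)))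
          (trans (cong₂ (λ p q → (fromℕ 2 * p / ⟨ a , a ⟩) * q) (⟨⟩-negʳ a b) (cong₂ (λ p q → fromℕ 2 * p / q) (⟨⟩-negˡ b a) (⟨neg,neg⟩ b b)))
            (trans (solve 5 (λ t p i q j → (t :* :- p :* i) :* (t :* :- q :* j) := (t :* p :* i) :* (t :* q :* j)) refl (fromℕ 2) ⟨ a , b ⟩ (⟨ a , a ⟩ ⁻¹) ⟨ b , a ⟩ (⟨ b , b ⟩ ⁻¹)) e))
          (subst (0# <_) (sym (⟨⟩-negʳ a b)) h)

    -- A root ρ of the plane of Λ that is not in Λ satisfies cos² ≤ 1/2 with every
    -- root of Λ, and the sum of 1 - 2 cos² over Λ vanishes.  So ρ bisects any two
    -- roots of Λ, which are then orthogonal or parallel.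
    module Saturation where
      open PairCount
      open TripleLink

      module _ {α β γ} (α∈ : α ∈ Φ⁺) (β∈ : β ∈ Φ⁺) (α≢β : α ≢ β) (β⊥̸α : ⟨ β , α ⟩ ≢ 0#) (γ∈ : γ ∈ Φ) (γ∉ : ¬ Span (β ∷ α ∷ []) γ)
               {Λ : List V} (rsΛ : IsRootSystem Λ) (irrΛ : Irreducible Λ) (Λ⊆Φ : ∀ {v} → v ∈ Λ → v ∈ Φ) (Λ⊆P : ∀ {v} → v ∈ Λ → Span (β ∷ α ∷ []) v)
               (α∈Λ : α ∈ Λ) (β∈Λ : β ∈ Λ) where
        private
          module Λ = RootSystem rsΛ
          module L = Line β∈

          P : Pred V 0ℓ
          P = Span (β ∷ α ∷ [])

          P-subspace : Subspace P
          P-subspace = span-subspace (β ∷ α ∷ [])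

          Pα : P α
          Pα = ∈⇒Span (there (here refl))

          Pβ : P β
          Pβ = ∈⇒Span (here refl)

          -- Irreducibility of `Φ` together with a root outside the plane supplies the link that
          -- excludes type G₂.
          joined : ∃₂ λ u v → u ∈ Φ × v ∈ Φ × P u × ¬ P v × ⟨ u , v ⟩ ≢ 0#
          joined with em {∃₂ λ u v → u ∈ Φ × v ∈ Φ × P u × ¬ P v × ⟨ u , v ⟩ ≢ 0#}
          ... | yes p = p
          ... | no ¬p = ⊥-elim (γ∉ (irreducible-connected P irr (⁺⇒root β∈) Pβ (λ {u} {v} u∈ v∈ Pu ¬Pv → stable λ ne → ¬p (u , v , u∈ , v∈ , Pu , ¬Pv , ne)) γ∈))

          pα≢𝟎 : L.p α ≢ 𝟎
          pα≢𝟎 e = single (L.line-closed α∈ e)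
            where
            single : α ∈ β ∷ [] → ⊥
            single (here α≡β) = α≢β α≡β

          b : Carrier
          b = Λ.eigenvalue β

          -- The vectors `α` and `β` are eigenvectors spanning the plane, and irreducibility of `Λ`
          -- makes their eigenvalues equal.
          scalar : ∀ {w} → P w → ∀ z → form Λ w z ≡ b * ⟨ w , z ⟩
          scalar Pw z = cancel-diff (Span-least {P = λ w → form Λ w z - b * ⟨ w , z ⟩ ≡ 0#}
            (linear-subspace
              (λ x k y → trans (cong₂ (λ a c → a - b * c) (form-⊕·ˡ Λ x k y z) (⟨⟩-⊕·ˡ x k y z))
                (solve 6 (λ a k c e p q → (a :+ k :* c) :- e :* (p :+ k :* q) := (a :- e :* p) :+ k :* (c :- e :* q)) refl (form Λ x z) k (form Λ y z) b ⟨ x , z ⟩ ⟨ y , z ⟩))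
              (trans (cong₂ (λ a c → a - b * c) (form-𝟎ˡ Λ z) (⟨⟩-𝟎ˡ z)) (solve 1 (λ e → :0 :- e :* :0 := :0) refl b)))
            (λ { (here refl) → diff≡0 (Λ.eigen β∈Λ z)
               ; (there (here refl)) → diff≡0 (trans (Λ.eigen α∈Λ z) (cong (_* ⟨ α , z ⟩) (Λ.eigenvalue-const irrΛ α∈Λ β∈Λ))) }) Pw)

          ∑κ : ∀ {w} → P w → w ≢ 𝟎 → ∑ Λ (λ v → κ v w) ≡ b
          ∑κ {w} Pw w≢ = trans (∑-κ Λ w) (combine₂ (⟨ w , w ⟩ ⁻¹) b (scalar Pw w) (⁻¹-inverseˡ (pos⇒≢0 (⟨⟩-pos w≢)))
            (solve 4 (λ f i b w → f :* i :- b := i :* (f :- b :* w) :+ b :* (i :* w :- :1)) refl (form Λ w w) (⟨ w , w ⟩ ⁻¹) b ⟨ w , w ⟩))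

          length-Λ : fromℕ (length Λ) ≡ b + b
          length-Λ = begin
            fromℕ (length Λ)                                    ≡⟨ ∑-length Λ ⟨
            ∑ Λ (λ _ → 1#)                                      ≡⟨ ∑-cong {xs = Λ} (λ {v} v∈ → trans (sym (κ-total (∈-∣⁺ On (Λ⊆Φ v∈) (Span-least On-subspace on (Λ⊆P v∈))))) (cong (_+ κ v (L.p α)) (+-identityʳ (κ v β)))) ⟩
            ∑ Λ (λ v → κ v β + κ v (L.p α))                     ≡⟨ ∑-+ Λ (λ v → κ v β) (λ v → κ v (L.p α)) ⟩
            ∑ Λ (λ v → κ v β) + ∑ Λ (λ v → κ v (L.p α))         ≡⟨ cong₂ _+_ (∑κ Pβ (root-≢𝟎 (⁺⇒root β∈))) (∑κ (residual-⇒ P-subspace (β ∷ []) (λ { (here refl) → Pβ }) Pα) pα≢𝟎) ⟩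
            b + b                                               ∎
            where
            open L.Local α∈ pα≢𝟎
            on : ∀ {v} → v ∈ β ∷ α ∷ [] → On v
            on (here refl)         = 0# , trans (L.p-b (here refl)) (sym (0· L.p α))
            on (there (here refl)) = 1# , sym (1· L.p α)

        saturated : ∀ {ρ} → ρ ∈ Φ → P ρ → ρ ∈ Λ
        saturated {ρ} ρ∈ Pρ with em {ρ ∈ Λ}
        ... | yes h = h
        -- The halves `A R = 2 r²` and `B R = 2 s²`, together with `R g = 2 r s`, give `g² = A B`,
        -- making `α` and `β` parallel.
        ... | no ρ∉ = ⊥-elim (AB≢gg (*-cancelˡ (*-≢0 (pos⇒≢0 R-pos) (pos⇒≢0 R-pos)) (combine₃ (R * g + fromℕ 2 * (r * s)) (- (fromℕ 2 * (s * s))) (- (A * R)) Rg (half² α∈Λ) (half² β∈Λ)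
                (solve 6 (λ A B R g r s → R :* R :* (g :* g) :- R :* R :* (B :* A) :=
                   (R :* g :+ :2 :* (r :* s)) :* (R :* g :- :2 :* (r :* s)) :+ :- (:2 :* (s :* s)) :* (A :* R :- :2 :* (r :* r)) :+ :- (A :* R) :* (B :* R :- :2 :* (s :* s))) refl A B R g r s))))
          where
          ρ≢𝟎 = root-≢𝟎 ρ∈
          nonparallel : ∀ {v} → v ∈ Λ → ⟨ v , ρ ⟩ * ⟨ v , ρ ⟩ ≢ ⟨ v , v ⟩ * ⟨ ρ , ρ ⟩
          nonparallel v∈ e = [ (λ { refl → ρ∉ v∈ }) , (λ { refl → ρ∉ (subst (_∈ Λ) (neg-involutive ρ) (Λ.neg-root v∈)) }) ]′ (parallel-roots (Λ⊆Φ v∈) ρ∈ e)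
          -- The product of the two Cartan integers is `4 cos²`. It is less than 4 because `v` and
          -- `ρ` are not parallel, and it is not 3 by `no-triple-link`, so it is at most 2.
          at-most-half : ∀ {v} → v ∈ Λ → 0# ≤ 1# + - fromℕ 2 * κ v ρ
          at-most-half {v} v∈ = 0≤-cancel 0<2 (0≤-by (≤⇒0≤ (integer-4 (integer-* (cartan-integer (Λ⊆Φ v∈) ρ∈) (cartan-integer ρ∈ (Λ⊆Φ v∈))) m<4 m≢3))
              (trans (cong (λ m → fromℕ 2 - m) (cartan-product v≢ ρ≢𝟎)) (solve 1 (λ k → :2 :- :2 :* :2 :* k := :2 :* (:1 :+ :- :2 :* k)) refl (κ v ρ))))
            where
            v≢ = Λ.root-≢𝟎 v∈
            m<4 : cartan v ρ * cartan ρ v < fromℕ 4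
            m<4 = 0<⇒< (subst (0# <_) (trans (solve 1 (λ k → :2 :* :2 :* (:1 :- k) := :1 :+ (:1 :+ :2) :- :2 :* :2 :* k) refl (κ v ρ)) (cong (λ m → fromℕ 4 - m) (sym (cartan-product v≢ ρ≢𝟎))))
              (0<* (0<* 0<2 0<2) (0<-cancel (0≤* (⟨⟩-nonneg v) (⟨⟩-nonneg ρ)) (subst (0# <_) (trans (cong (λ x → ⟨ v , v ⟩ * ⟨ ρ , ρ ⟩ - x) (sym (κ-spec v≢ ρ≢𝟎))) (solve 3 (λ a b k → a :* b :- k :* (a :* b) := a :* b :* (:1 :- k)) refl ⟨ v , v ⟩ ⟨ ρ , ρ ⟩ (κ v ρ)))
                (<⇒0< (cauchy-schwarz v ρ , nonparallel v∈))))))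
            m≢3 : cartan v ρ * cartan ρ v ≢ fromℕ 3
            m≢3 = let (u , w , u∈ , w∈ , Pu , ¬Pw , ne) = joined in no-triple-link P-subspace (Λ⊆Φ v∈) ρ∈ w∈ (Λ⊆P v∈) Pρ ¬Pw
              (λ (e , e′) → ne (trans (⟨⟩-sym u w) (Span-least (⊥-subspace w) (λ { (here refl) → trans (⟨⟩-sym w v) e ; (there (here refl)) → trans (⟨⟩-sym w ρ) e′ }) (exchange (Λ⊆P v∈) Pρ (nonparallel v∈) Pu))))
          total : ∑ Λ (λ v → 1# + - fromℕ 2 * κ v ρ) ≡ 0#
          total = trans (∑-+ Λ (λ _ → 1#) (λ v → - fromℕ 2 * κ v ρ)) (trans (cong₂ _+_ (trans (∑-length Λ) length-Λ) (trans (∑-*ˡ Λ (- fromℕ 2) (λ v → κ v ρ)) (cong (- fromℕ 2 *_) (∑κ Pρ ρ≢𝟎))))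
            (solve 1 (λ b → b :+ b :+ :- :2 :* b := :0) refl b))
          R A B g r s : Carrier
          R = ⟨ ρ , ρ ⟩
          A = ⟨ α , α ⟩
          B = ⟨ β , β ⟩
          g = ⟨ β , α ⟩
          r = ⟨ α , ρ ⟩
          s = ⟨ β , ρ ⟩
          R-pos : 0# < R
          R-pos = ⟨⟩-pos ρ≢𝟎
          AB≢gg : g * g ≢ B * A
          AB≢gg e = α≢β (sym (same-ray β∈ α∈ e))
          half² : ∀ {v} → v ∈ Λ → ⟨ v , v ⟩ * R ≡ fromℕ 2 * (⟨ v , ρ ⟩ * ⟨ v , ρ ⟩)
          half² {v} v∈ = combine₂ (fromℕ 2) (⟨ v , v ⟩ * R) (κ-spec (Λ.root-≢𝟎 v∈) ρ≢𝟎) (∑-nonneg-zero {xs = Λ} at-most-half total v∈)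
            (solve 3 (λ x k p → x :- :2 :* p := :2 :* (k :* x :- p) :+ x :* (:1 :+ :- :2 :* k :- :0)) refl (⟨ v , v ⟩ * R) (κ v ρ) (⟨ v , ρ ⟩ * ⟨ v , ρ ⟩))
          -- The Gram determinant of α, β, ρ vanishes.
          gram : R * (A * B - g * g) ≡ A * (s * s) + B * (r * r) - fromℕ 2 * (g * (r * s))
          gram = let (x , y , e) = plane-elim Pρ in go x y e
            where
            go : ∀ x y → ρ ≡ x · β ⊕ y · α → R * (A * B - g * g) ≡ A * (s * s) + B * (r * r) - fromℕ 2 * (g * (r * s))
            go x y e = trans (cong (_* (A * B - g * g)) R≡) (trans (solve 5 (λ A B g x y →
                  (x :* x :* B :+ :2 :* (x :* y :* g) :+ y :* y :* A) :* (A :* B :- g :* g) :=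
                  A :* ((x :* B :+ y :* g) :* (x :* B :+ y :* g)) :+ B :* ((x :* g :+ y :* A) :* (x :* g :+ y :* A)) :- :2 :* (g :* ((x :* g :+ y :* A) :* (x :* B :+ y :* g)))) refl A B g x y)
                (sym (cong₂ (λ r s → A * (s * s) + B * (r * r) - fromℕ 2 * (g * (r * s))) r≡ s≡)))
              where
              R≡ : R ≡ x * x * B + fromℕ 2 * (x * y * g) + y * y * A
              R≡ = trans (cong (λ v → ⟨ v , v ⟩) e) (⟨lin₂,lin₂⟩ x β y α)
              r≡ : r ≡ x * g + y * A
              r≡ = trans (cong ⟨ α ,_⟩ e) (trans (⟨,lin₂⟩ x β y α α) (cong (λ m → x * m + y * A) (⟨⟩-sym α β)))
              s≡ : s ≡ x * B + y * g
              s≡ = trans (cong ⟨ β ,_⟩ e) (⟨,lin₂⟩ x β y α β)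
          Rg : R * g ≡ fromℕ 2 * (r * s)
          Rg = *-cancelˡ β⊥̸α (*-cancelˡ (pos⇒≢0 0<2) (combine₃ (- fromℕ 2) B A gram (half² α∈Λ) (half² β∈Λ)
            (solve 6 (λ A B R g r s → :2 :* (g :* (R :* g)) :- :2 :* (g :* (:2 :* (r :* s))) :=
              :- :2 :* (R :* (A :* B :- g :* g) :- (A :* (s :* s) :+ B :* (r :* r) :- :2 :* (g :* (r :* s)))) :+ B :* (A :* R :- :2 :* (r :* r)) :+ A :* (B :* R :- :2 :* (s :* s))) refl A B R g r s)))

    -- Elements of `𝓜` correspond to exceptional flats.

    module Components {β γ : V} (β∈ : β ∈ Φ⁺) (γ∈ : γ ∈ Φ⁺) (β⊥γ : ⟨ β , γ ⟩ ≡ 0#) (X : Pred V 0ℓ)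
                      (X⇒ : ∀ {x} → X x → ⟨ β , x ⟩ ≡ 0# × ⟨ γ , x ⟩ ≡ 0#) (⇒X : ∀ {x} → ⟨ β , x ⟩ ≡ 0# → ⟨ γ , x ⟩ ≡ 0# → X x)
                      (pair-closed : ∀ {α} → α ∈ Φ⁺ → residual (β ∷ γ ∷ []) α ≡ 𝟎 → α ∈ β ∷ γ ∷ []) where
      open PairCount
      open Pair β∈ γ∈ β⊥γ X X⇒ ⇒X pair-closed

      private
        Perp : Pred V 0ℓ
        Perp v = ⟨ v , γ ⟩ ≡ 0#

        perp-⊆ : ∀ {v} → v ∈ perp Φ γ → v ∈ Φ × ⟨ v , γ ⟩ ≡ 0#
        perp-⊆ = ∈-∣⁻ Φ Perp

      module _ {α} (α∈ : α ∈ Φ⁺) (α≢β : α ≢ β) (β⊥̸α : ⟨ β , α ⟩ ≢ 0#) where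
        private
          P : Pred V 0ℓ
          P = Span (β ∷ α ∷ [])

          P-subspace : Subspace P
          P-subspace = span-subspace (β ∷ α ∷ [])

          Λ₀ : List V
          Λ₀ = perp Φ γ ∣ P

          α≢γ : α ≢ γ
          α≢γ refl = β⊥̸α β⊥γ

          pα≢𝟎 : p α ≢ 𝟎
          pα≢𝟎 e = outside-pair (pair-closed α∈ e)
            where
            outside-pair : α ∈ β ∷ γ ∷ [] → ⊥
            outside-pair (here e)         = α≢β e
            outside-pair (there (here e)) = α≢γ e

        -- Rank two places `Λ` in the plane of `β` and `α`, and saturation makes it the full
        -- section. The reducible decomposition separates `γ` from the part containing `β` and `α`;
        -- a root of the flat with nonzero projection cannot join `γ`, for then it would be
        -- orthogonal to `p α`.
        component⇒isolated : ∀ {Λ} → Λ ∈ sublists (perp Φ γ) → InM Φ γ β Λ → α ∈ Λ → Isolated α × Λ ≡ Λ₀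
        component⇒isolated {Λ} Λ∈ m α∈Λ = isolated , sublist-select P (∣-unique unique) Λ∈ (λ _ → Λ⊆P) (λ {ρ} ρ∈ Pρ →
            Saturation.saturated α∈ β∈ α≢β β⊥̸α (⁺⇒root γ∈) γ∉P M.isRootSystem M.irreducible Λ⊆Φ Λ⊆P α∈Λ M.contains (proj₁ (perp-⊆ ρ∈)) Pρ)
          where
          module M = InM m
          Γ : List V
          Γ = Φ ∣ Span (γ ∷ Λ)
          Γ-subspace : Subspace (Span (γ ∷ Λ))
          Γ-subspace = span-subspace (γ ∷ Λ)
          Λ⊆Φ : ∀ {v} → v ∈ Λ → v ∈ Φ
          Λ⊆Φ v∈ = proj₁ (perp-⊆ (∈-sublist Λ∈ v∈))
          Λ⊥γ : ∀ {v} → v ∈ Λ → ⟨ v , γ ⟩ ≡ 0#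
          Λ⊥γ v∈ = proj₂ (perp-⊆ (∈-sublist Λ∈ v∈))
          Λ⊆P : ∀ {v} → v ∈ Λ → P v
          Λ⊆P v∈ = in-basis M.rank-two
            where
            in-basis : HasRank Λ 2 → P _
            in-basis (b₁ ∷ b₂ ∷ [] , _ , _ , ⊇) = exchange (⊇ (∈⇒Span M.contains)) (⊇ (∈⇒Span α∈Λ)) (λ e → α≢β (sym (same-ray β∈ α∈ e))) (⊇ (∈⇒Span v∈))
          γ∉P : ¬ P γ
          γ∉P h = γ≢𝟎 (Span-⊥⇒𝟎 h λ { (here refl) → trans (⟨⟩-sym γ β) β⊥γ ; (there (here refl)) → trans (⟨⟩-sym γ α) (Λ⊥γ α∈Λ) })
          in-Γ : ∀ {v} → v ∈ Λ → v ∈ Γ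
          in-Γ v∈ = ∈-∣⁺ (Span (γ ∷ Λ)) (Λ⊆Φ v∈) (∈⇒Span (there v∈))
          γ∈Γ : γ ∈ Γ
          γ∈Γ = ∈-∣⁺ (Span (γ ∷ Λ)) (⁺⇒root γ∈) (∈⇒Span (here refl))
          Splits : List V → List V → Set
          Splits Γ₁ Γ₂ = (∀ {v} → v ∈ Γ → v ∈ Γ₁ ⊎ v ∈ Γ₂) × (∀ {v} → v ∈ Γ₂ → v ∈ Γ) × (∃ (_∈ Γ₂)) × (∀ {u v} → u ∈ Γ₁ → v ∈ Γ₂ → ⟨ u , v ⟩ ≡ 0#)
          -- The irreducible part containing β and α cannot contain γ as well.
          separate : ∀ {Γ₁ Γ₂} → Splits Γ₁ Γ₂ → β ∈ Γ₁ → Isolated α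
          separate {Γ₁} {Γ₂} (split , sub , (z , z∈) , orth) β∈₁ ρ ρ∈ (k , k≢0 , e) = [ (λ h → orth h γ∈₂) , (λ h → ⊥-elim (contradiction h)) ]′ (split ρ∈Γ)
            where
            α∈₁ : α ∈ Γ₁
            α∈₁ = [ id , (λ h → ⊥-elim (β⊥̸α (orth β∈₁ h))) ]′ (split (in-Γ α∈Λ))
            γ∈₂ : γ ∈ Γ₂
            -- If `γ` lay on the side of `β`, a root `z` of the other side would be orthogonal to
            -- `γ` and to the whole plane, hence to its own span.
            γ∈₂ = [ (λ h → ⊥-elim (root-≢𝟎 (proj₁ z∈Γ) (Span-⊥⇒𝟎 (proj₂ z∈Γ) (z⊥ h)))) , id ]′ (split γ∈Γ)
              where
              z∈Γ = ∈-∣⁻ Φ (Span (γ ∷ Λ)) (sub z∈)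
              z⊥ : γ ∈ Γ₁ → ∀ {v} → v ∈ γ ∷ Λ → ⟨ z , v ⟩ ≡ 0#
              z⊥ h (here refl) = trans (⟨⟩-sym z γ) (orth h z∈)
              z⊥ h (there v∈)  = Span-least (⊥-subspace z) (λ { (here refl) → trans (⟨⟩-sym z β) (orth β∈₁ z∈) ; (there (here refl)) → trans (⟨⟩-sym z α) (orth α∈₁ z∈) }) (Λ⊆P v∈)
            ρ∈Γ : ρ ∈ Γ
            ρ∈Γ = ∈-∣⁺ (Span (γ ∷ Λ)) ρ∈ (residual-⇐ Γ-subspace (β ∷ γ ∷ []) pair⊆ (subst (Span (γ ∷ Λ)) (sym e) (Subspace.has-· Γ-subspace k (p α) (residual-⇒ Γ-subspace (β ∷ γ ∷ []) pair⊆ (∈⇒Span (there α∈Λ))))))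
              where
              pair⊆ : ∀ {b} → b ∈ β ∷ γ ∷ [] → Span (γ ∷ Λ) b
              pair⊆ (here refl)         = ∈⇒Span (there M.contains)
              pair⊆ (there (here refl)) = ∈⇒Span (here refl)
            contradiction : ρ ∈ Γ₂ → ⊥
            contradiction h = *-≢0 k≢0 (pos⇒≢0 (⟨⟩-pos pα≢𝟎)) (trans (sym (⟨⟩-·ˡ k (p α) (p α))) (trans (cong (λ v → ⟨ v , p α ⟩) (sym e)) (trans (p-adjoint ρ (p α)) (trans (cong (λ v → ⟨ ρ , v ⟩) (p-idem α)) (trans (⟨⟩-sym ρ (p α)) pα⊥ρ)))))
              where
              pα⊥ρ : ⟨ p α , ρ ⟩ ≡ 0#
              pα⊥ρ = trans (⟨p,⟩ α ρ) (trans
                (cong₂ (λ x y → x - (⟨ α , β ⟩ * ⟨ β , β ⟩ ⁻¹ * y + (⟨ α , γ ⟩ * ⟨ γ , γ ⟩ ⁻¹ * ⟨ γ , ρ ⟩ + 0#))) (orth α∈₁ h) (orth β∈₁ h)) (trans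
                (cong (λ x → 0# - (⟨ α , β ⟩ * ⟨ β , β ⟩ ⁻¹ * 0# + (x * ⟨ γ , γ ⟩ ⁻¹ * ⟨ γ , ρ ⟩ + 0#))) (Λ⊥γ α∈Λ))
                (solve 3 (λ a i g → :0 :- (a :* :0 :+ (:0 :* i :* g :+ :0)) := :0) refl (⟨ α , β ⟩ * ⟨ β , β ⟩ ⁻¹) (⟨ γ , γ ⟩ ⁻¹) ⟨ γ , ρ ⟩)))
          isolated : Isolated α
          isolated = from M.span-reducible
            where
            from : Reducible Γ → Isolated α
            from (Γ₁ , Γ₂ , ne₁ , ne₂ , perm , orth) = [ separate splits₁ , separate splits₂ ]′ (proj₁ splits₁ (in-Γ M.contains))
              where
              splits₁ : Splits Γ₁ Γ₂
              splits₁ = (λ v∈ → ∈-++⁻ Γ₁ (∈-resp-↭ perm v∈)) , (λ v∈ → ∈-resp-↭ (↭-sym perm) (∈-++⁺ʳ Γ₁ v∈)) , inhabitant ne₂ , (λ u∈ v∈ → orth _ _ u∈ v∈)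
              splits₂ : Splits Γ₂ Γ₁
              splits₂ = (λ v∈ → [ inj₂ , inj₁ ]′ (proj₁ splits₁ v∈)) , (λ v∈ → ∈-resp-↭ (↭-sym perm) (∈-++⁺ˡ v∈)) , inhabitant ne₁ , (λ {u} {v} u∈ v∈ → trans (⟨⟩-sym u v) (orth _ _ v∈ u∈))

        α∈Λ₀ : ⟨ α , γ ⟩ ≡ 0# → α ∈ Λ₀
        α∈Λ₀ α⊥γ = ∈-∣⁺ P (∈-∣⁺ Perp (⁺⇒root α∈) α⊥γ) (∈⇒Span (there (here refl)))

        module _ (iso : Isolated α) where
          private
            α⊥γ : ⟨ α , γ ⟩ ≡ 0#
            α⊥γ = iso α (⁺⇒root α∈) (∼-refl α)

            β∈Λ₀ : β ∈ Λ₀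
            β∈Λ₀ = ∈-∣⁺ P (∈-∣⁺ Perp (⁺⇒root β∈) β⊥γ) (∈⇒Span (here refl))

            perp-rs : IsRootSystem (perp Φ γ)
            perp-rs = restrict Perp λ a b a⊥ b⊥ → trans (⟨reflect,⟩ a b γ) (trans (cong₂ (λ x y → x - cartan a b * y) b⊥ a⊥) (solve 1 (λ c → :0 :- c :* :0 := :0) refl (cartan a b)))

            Λ₀-rs : IsRootSystem Λ₀
            Λ₀-rs = RootSystem.restrict perp-rs P (Subspace.has-reflect P-subspace)

            Λ₀⊆P : ∀ {v} → v ∈ Λ₀ → P v
            Λ₀⊆P v∈ = proj₂ (∈-∣⁻ (perp Φ γ) P v∈)

            Λ₀⊆perp : ∀ {v} → v ∈ Λ₀ → v ∈ Φ × ⟨ v , γ ⟩ ≡ 0#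
            Λ₀⊆perp v∈ = perp-⊆ (proj₁ (∈-∣⁻ (perp Φ γ) P v∈))

            irreducible₀ : Irreducible Λ₀
            irreducible₀ = nonempty β∈Λ₀ , λ (Γ₁ , Γ₂ , ne₁ , ne₂ , perm , orth) → [
                (λ h → separated (λ v∈ → ∈-++⁻ Γ₁ (∈-resp-↭ perm v∈)) (λ v∈ → ∈-resp-↭ (↭-sym perm) (∈-++⁺ʳ Γ₁ v∈)) (inhabitant ne₂) (λ u∈ v∈ → orth _ _ u∈ v∈) h) ,
                (λ h → separated (λ v∈ → [ inj₂ , inj₁ ]′ (∈-++⁻ Γ₁ (∈-resp-↭ perm v∈))) (λ v∈ → ∈-resp-↭ (↭-sym perm) (∈-++⁺ˡ v∈)) (inhabitant ne₁) (λ {u} {v} u∈ v∈ → trans (⟨⟩-sym u v) (orth _ _ v∈ u∈)) h) ]′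
                (∈-++⁻ Γ₁ (∈-resp-↭ perm β∈Λ₀))
              where
              separated : ∀ {Γ₁ Γ₂} → (∀ {v} → v ∈ Λ₀ → v ∈ Γ₁ ⊎ v ∈ Γ₂) → (∀ {v} → v ∈ Γ₂ → v ∈ Λ₀) → ∃ (_∈ Γ₂) → (∀ {u v} → u ∈ Γ₁ → v ∈ Γ₂ → ⟨ u , v ⟩ ≡ 0#) → β ∈ Γ₁ → ⊥
              separated {Γ₁} {Γ₂} split sub (z , z∈) orth β∈₁ = root-≢𝟎 (proj₁ (Λ₀⊆perp (sub z∈))) (Span-⊥⇒𝟎 (Λ₀⊆P (sub z∈))
                λ { (here refl) → trans (⟨⟩-sym z β) (orth β∈₁ z∈) ; (there (here refl)) → trans (⟨⟩-sym z α) (orth α∈₁ z∈) })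
                where
                α∈₁ : α ∈ Γ₁
                α∈₁ = [ id , (λ h → ⊥-elim (β⊥̸α (orth β∈₁ h))) ]′ (split (α∈Λ₀ α⊥γ))

            independent : ∀ x y → x · β ⊕ y · α ≡ 𝟎 → x ≡ 0# × y ≡ 0#
            independent x y e = x≡0 , y≡0
              where
              y≡0 : y ≡ 0#
              y≡0 = *-≡0ʳ ⟨ p α , p α ⟩ y (trans (sym (trans (cong₂ (λ u w → x * u + y * w) (⟨b,p⟩ (here refl) α) (trans (cong ⟨ α ,_⟩ (sym (p-idem α))) (sym (p-adjoint α (p α)))))
                  (solve 3 (λ x y q → x :* :0 :+ y :* q := q :* y) refl x y ⟨ p α , p α ⟩)))
                (trans (sym (⟨lin₂,⟩ x β y α (p α))) (trans (cong ⟨_, p α ⟩ e) (⟨⟩-𝟎ˡ (p α))))) (pos⇒≢0 (⟨⟩-pos pα≢𝟎))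
              x≡0 : x ≡ 0#
              x≡0 = *-≡0ʳ ⟨ β , β ⟩ x (trans (sym (trans (cong (λ y → x * ⟨ β , β ⟩ + y * ⟨ α , β ⟩) y≡0) (solve 3 (λ x b a → x :* b :+ :0 :* a := b :* x) refl x ⟨ β , β ⟩ ⟨ α , β ⟩)))
                (trans (sym (⟨lin₂,⟩ x β y α β)) (trans (cong ⟨_, β ⟩ e) (⟨⟩-𝟎ˡ β)))) (pos⇒≢0 (⟨⟩-pos β≢𝟎))

            rank₂ : HasRank Λ₀ 2
            rank₂ = β ∷ α ∷ [] , li , Span-least (span-subspace Λ₀) (λ { (here refl) → ∈⇒Span β∈Λ₀ ; (there (here refl)) → ∈⇒Span (α∈Λ₀ α⊥γ) }) , Span-least P-subspace Λ₀⊆P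
              where
              li : LinearlyIndependent (β ∷ α ∷ [])
              li (x ∷ y ∷ []) e = let (x≡0 , y≡0) = independent x y (trans (cong (x · β ⊕_) (sym (⊕-identityʳ (y · α)))) e) in cong₂ (λ x y → x ∷ y ∷ []) x≡0 y≡0

            T : Pred V 0ℓ
            T = Span (γ ∷ Λ₀)

            T-subspace : Subspace T
            T-subspace = span-subspace (γ ∷ Λ₀)

            Γ : List V
            Γ = Φ ∣ T

            γ∈Γ : γ ∈ Γ
            γ∈Γ = ∈-∣⁺ T (⁺⇒root γ∈) (∈⇒Span (here refl))

            Λ₀⊆Γ : ∀ {v} → v ∈ Λ₀ → v ∈ Γ
            Λ₀⊆Γ v∈ = ∈-∣⁺ T (proj₁ (Λ₀⊆perp v∈)) (∈⇒Span (there v∈))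

            Triple : Pred V 0ℓ
            Triple = Span (γ ∷ β ∷ α ∷ [])

            T⇒Triple : ∀ {v} → T v → Triple v
            T⇒Triple = Span-least (span-subspace (γ ∷ β ∷ α ∷ [])) λ { (here refl) → ∈⇒Span (here refl) ; (there v∈) → Span-least (span-subspace (γ ∷ β ∷ α ∷ []))
              (λ { (here refl) → ∈⇒Span (there (here refl)) ; (there (here refl)) → ∈⇒Span (there (there (here refl))) }) (Λ₀⊆P v∈) }

            open Local α∈ pα≢𝟎 using (On; On-subspace)

            T⇒On : ∀ {v} → T v → On v
            T⇒On h = Span-least On-subspace (λ { (here refl) → 0# , trans (p-b (there (here refl))) (sym (0· p α)) ; (there (here refl)) → 0# , trans (p-b (here refl)) (sym (0· p α)) ; (there (there (here refl))) → 1# , sym (1· p α) }) (T⇒Triple h)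

            -- Isolation makes every root of the flat with nonzero projection orthogonal to `γ`. A
            -- root that is not orthogonal to `γ` thus projects to zero, and `pair-closed`
            -- identifies it as `γ` or its negative.
            reducible-Γ : Reducible Γ
            reducible-Γ = Γ ∣ Perp , Γ ∣ (λ v → ¬ Perp v) , nonempty (∈-∣⁺ Perp (Λ₀⊆Γ β∈Λ₀) β⊥γ) , nonempty (∈-∣⁺ (λ v → ¬ Perp v) γ∈Γ (λ e → γ≢𝟎 (⟨⟩-definite e))) , ∣-partition Γ Perp ,
              λ u v u∈ v∈ → orth {u} {v} (proj₂ (∈-∣⁻ Γ Perp u∈)) (proj₁ (∈-∣⁻ Γ (λ v → ¬ Perp v) v∈)) (proj₂ (∈-∣⁻ Γ (λ v → ¬ Perp v) v∈))
              where
              ±γ : ∀ {v} → v ∈ Φ → p v ≡ 𝟎 → ¬ Perp v → v ≡ γ ⊎ v ≡ neg γ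
              ±γ {v} v∈ e ¬⊥ = [ (λ h → member (pair-closed h e)) , (λ h → negated (pair-closed h (trans (p-neg v) (trans (cong ((- 1#) ·_) e) (⟨⟩-ext λ z → trans (⟨⟩-·ˡ (- 1#) 𝟎 z) (trans (cong (- 1# *_) (⟨⟩-𝟎ˡ z)) (trans (zeroʳ (- 1#)) (sym (⟨⟩-𝟎ˡ z))))))))) ]′ (root-sign v∈)
                where
                member : v ∈ β ∷ γ ∷ [] → v ≡ γ ⊎ v ≡ neg γ
                member (here refl)      = ⊥-elim (¬⊥ β⊥γ)
                member (there (here h)) = inj₁ h
                negated : neg v ∈ β ∷ γ ∷ [] → v ≡ γ ⊎ v ≡ neg γ
                negated (here h)         = ⊥-elim (¬⊥ (trans (cong ⟨_, γ ⟩ (trans (sym (neg-involutive v)) (cong neg h))) (trans (⟨⟩-negˡ β γ) (trans (cong -_ β⊥γ) -0#≈0#))))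
                negated (there (here h)) = inj₂ (trans (sym (neg-involutive v)) (cong neg h))
              orth : ∀ {u v} → ⟨ u , γ ⟩ ≡ 0# → v ∈ Γ → ¬ Perp v → ⟨ u , v ⟩ ≡ 0#
              orth {u} {v} u⊥ v∈ ¬⊥ = let (v∈Φ , Tv) = ∈-∣⁻ Φ T v∈ in by v∈Φ (T⇒On Tv) em
                where
                by : v ∈ Φ → On v → Dec (p v ≡ 𝟎) → ⟨ u , v ⟩ ≡ 0#
                by v∈Φ _ (yes e) = [ (λ { refl → u⊥ }) , (λ { refl → trans (⟨⟩-negʳ u γ) (trans (cong -_ u⊥) -0#≈0#) }) ]′ (±γ v∈Φ e ¬⊥)
                by v∈Φ (k , e) (no ne) = ⊥-elim (¬⊥ (iso v v∈Φ (k , (λ k≡0 → ne (trans e (trans (cong (_· p α) k≡0) (0· p α)))) , e)))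

            rank₃ : HasRank Γ 3
            rank₃ = γ ∷ β ∷ α ∷ [] , li , Span-least (span-subspace Γ) (λ { (here refl) → ∈⇒Span γ∈Γ ; (there (here refl)) → ∈⇒Span (Λ₀⊆Γ β∈Λ₀) ; (there (there (here refl))) → ∈⇒Span (Λ₀⊆Γ (α∈Λ₀ α⊥γ)) }) ,
              Span-least (span-subspace (γ ∷ β ∷ α ∷ [])) (λ v∈ → T⇒Triple (proj₂ (∈-∣⁻ Φ T v∈)))
              where
              li : LinearlyIndependent (γ ∷ β ∷ α ∷ [])
              li (w ∷ x ∷ y ∷ []) e = let (x≡0 , y≡0) = independent x y rest in cong₂ (λ w (x , y) → w ∷ x ∷ y ∷ []) w≡0 (cong₂ _,_ x≡0 y≡0)
                where
                r : V
                r = x · β ⊕ y · α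
                e′ : w · γ ⊕ r ≡ 𝟎
                e′ = trans (cong (λ v → w · γ ⊕ (x · β ⊕ v)) (sym (⊕-identityʳ (y · α)))) e
                ⟨r,γ⟩ : ⟨ r , γ ⟩ ≡ 0#
                ⟨r,γ⟩ = trans (⟨lin₂,⟩ x β y α γ) (trans (cong₂ (λ a b → x * a + y * b) β⊥γ α⊥γ) (solve 2 (λ x y → x :* :0 :+ y :* :0 := :0) refl x y))
                w≡0 : w ≡ 0#
                w≡0 = *-≡0ʳ ⟨ γ , γ ⟩ w (trans (sym (trans (⟨⟩-⊕ˡ (w · γ) r γ) (trans (cong₂ _+_ (⟨⟩-·ˡ w γ γ) ⟨r,γ⟩) (solve 2 (λ w g → w :* g :+ :0 := g :* w) refl w ⟨ γ , γ ⟩)))) (trans (cong ⟨_, γ ⟩ e′) (⟨⟩-𝟎ˡ γ))) (pos⇒≢0 (⟨⟩-pos γ≢𝟎))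
                rest : r ≡ 𝟎
                rest = trans (sym (⊕-identityˡ r)) (trans (cong (_⊕ r) (sym (trans (cong (_· γ) w≡0) (0· γ)))) e′)

          isolated⇒component : InM Φ γ β Λ₀
          isolated⇒component = record
            { isRootSystem      = Λ₀-rs
            ; irreducible       = irreducible₀
            ; rank-two          = rank₂
            ; contains          = β∈Λ₀
            ; span-isRootSystem = restrict T (Subspace.has-reflect T-subspace)
            ; span-reducible    = reducible-Γ
            ; span-rank-three   = rank₃
            }

        private
          f : List V → Carrier
          f Λ = χ (InM Φ γ β Λ) * χ (α ∈ Λ × α ≢ β)

        -- The only candidate containing `α` is the full section `Λ₀`, and it qualifies precisely
        -- when `α` is isolated. So the number of elements of `𝓜` through `α` is 0 or 1.
        count-components : ∑ (sublists (perp Φ γ)) (λ Λ → χ (InM Φ γ β Λ) * χ (α ∈ Λ × α ≢ β)) ≡ χ (Isolated α)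
        count-components = trans (∑-sublists P f (∣-unique unique) (λ Λ∈ ne → vanish λ m h → ne (proj₂ (component⇒isolated Λ∈ m h)))) (by em)
          where
          vanish : ∀ {Λ} → (InM Φ γ β Λ → α ∈ Λ → ⊥) → f Λ ≡ 0#
          vanish {Λ} h = trans (sym (χ-× (InM Φ γ β Λ) (α ∈ Λ × α ≢ β))) (χ-no λ (m , a , _) → h m a)
          by : Dec (Isolated α) → f Λ₀ ≡ χ (Isolated α)
          by (yes iso) = trans (cong₂ _*_ (χ-yes (isolated⇒component iso)) (χ-yes (α∈Λ₀ (iso α (⁺⇒root α∈) (∼-refl α)) , α≢β))) (trans (*-identityˡ 1#) (sym (χ-yes iso)))
          by (no ¬iso) = trans (vanish λ m h → ¬iso (proj₁ (component⇒isolated′ m h))) (sym (χ-no ¬iso))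
            where
            component⇒isolated′ : InM Φ γ β Λ₀ → α ∈ Λ₀ → Isolated α × Λ₀ ≡ Λ₀
            component⇒isolated′ = component⇒isolated (select-sublist P (perp Φ γ))

      -- Exchanging the sums weights each `κ δ β` by the number of elements of `𝓜` containing `δ`.
      -- For `δ` orthogonal to `β` the factor `κ` vanishes, so that number is needed only where
      -- `count-components` determines it; `β` itself contributes to neither side.
      𝓚≡correction : 𝓚 Φ Φ⁺ γ β ≡ correction
      𝓚≡correction = begin
        𝓚 Φ Φ⁺ γ β
          ≡⟨ ∑-ext {xs = 𝓜 Φ γ β} (λ Λ → ∑-filter (λ δ → δ ∈ Λ × δ ≢ β) Φ⁺ (λ δ → ⟨ normalize β , normalize δ ⟩ * ⟨ normalize β , normalize δ ⟩)) ⟩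
        ∑ (𝓜 Φ γ β) (λ Λ → ∑ Φ⁺ λ δ → χ (δ ∈ Λ × δ ≢ β) * (⟨ normalize β , normalize δ ⟩ * ⟨ normalize β , normalize δ ⟩))
          ≡⟨ ∑-swap (𝓜 Φ γ β) Φ⁺ (λ Λ δ → χ (δ ∈ Λ × δ ≢ β) * (⟨ normalize β , normalize δ ⟩ * ⟨ normalize β , normalize δ ⟩)) ⟩
        ∑ Φ⁺ (λ δ → ∑ (𝓜 Φ γ β) λ Λ → χ (δ ∈ Λ × δ ≢ β) * (⟨ normalize β , normalize δ ⟩ * ⟨ normalize β , normalize δ ⟩))
          ≡⟨ ∑-cong {xs = Φ⁺} (λ {δ} δ∈ → trans (∑-*ʳ (𝓜 Φ γ β) (⟨ normalize β , normalize δ ⟩ * ⟨ normalize β , normalize δ ⟩) (λ Λ → χ (δ ∈ Λ × δ ≢ β)))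
                (trans (cong₂ _*_ (∑-filter (InM Φ γ β) (sublists (perp Φ γ)) (λ Λ → χ (δ ∈ Λ × δ ≢ β))) (trans (⟨normalize,normalize⟩²≡κ β≢𝟎 (root-≢𝟎 (⁺⇒root δ∈))) (κ-sym β δ))) (term δ∈ em em))) ⟩
        correction ∎
        where
        sum : V → Carrier
        sum δ = ∑ (sublists (perp Φ γ)) λ Λ → χ (InM Φ γ β Λ) * χ (δ ∈ Λ × δ ≢ β)
        term : ∀ {δ} → δ ∈ Φ⁺ → Dec (δ ≡ β) → Dec (⟨ β , δ ⟩ ≡ 0#) → sum δ * κ δ β ≡ χ (Isolated δ) * κ δ β
        term δ∈ (yes refl) _ = cong (_* κ β β) (trans (∑-zero {xs = sublists (perp Φ γ)} λ {Λ} _ → trans (cong (χ (InM Φ γ β Λ) *_) (χ-no λ (_ , ne) → ne refl)) (zeroʳ (χ (InM Φ γ β Λ)))) (sym (χ-no ¬isolated-β)))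
        term {δ} δ∈ (no _) (yes e) = let z = κ-⊥ {δ} {β} (trans (⟨⟩-sym δ β) e) in trans (cong (sum δ *_) z) (trans (zeroʳ (sum δ)) (sym (trans (cong (χ (Isolated δ) *_) z) (zeroʳ (χ (Isolated δ))))))
        term {δ} δ∈ (no ne) (no ne′) = cong (_* κ δ β) (count-components δ∈ ne ne′)

    -- From the Coxeter number to the difference of the two restrictions.

    module Differences where
      open PairCount

      ∑κ≡h/2 : 2 ℕ.≤ ℓ → ∀ {h} → IsCoxeterNumber Φ⁺ h → ∀ {β} → β ∈ Φ⁺ → ∑ Φ⁺ (λ α → κ α β) ≡ fromℕ h / fromℕ 2
      ∑κ≡h/2 2≤ℓ {h} cox {β} β∈ = *-cancelˡ (pos⇒≢0 0<2) (trans (sym (∑-even (λ α → κ α β) (λ α → κ-negˡ α β))) (trans (sym (eigenvalue≡∑κ β)) (trans eigenvalue≡h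
          (sym (combine₁ (fromℕ h) (*-inverse (fromℕ 2) (pos⇒≢0 0<2)) (solve 3 (λ t h i → t :* (h :* i) :- h := h :* (t :* i :- :1)) refl (fromℕ 2) (fromℕ h) (fromℕ 2 ⁻¹)))))))
        where
        ℓ≢0 : fromℕ ℓ ≢ 0#
        ℓ≢0 = pos⇒≢0 (<-≤-trans 0<2 (fromℕ-mono 2≤ℓ))
        eigenvalue≡h : eigenvalue β ≡ fromℕ h
        eigenvalue≡h = *-cancelˡ ℓ≢0 (trans (*-comm (fromℕ ℓ) (eigenvalue β)) (trans (sym (length≡eigenvalue*ℓ irr spanning (⁺⇒root β∈)))
          (trans (cong fromℕ (coxeter-number 2≤ℓ cox)) (trans (fromℕ-* h ℓ) (*-comm (fromℕ h) (fromℕ ℓ))))))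

      -- The predicate `X` enters through two implications only, so the same intersection serves for
      -- either order of the two roots.
      module OrthogonalPair {β γ : V} (β∈ : β ∈ Φ⁺) (γ∈ : γ ∈ Φ⁺)
        (X : Pred V 0ℓ) (X⇒ : ∀ {x} → X x → ⟨ β , x ⟩ ≡ 0# × ⟨ γ , x ⟩ ≡ 0#) (⇒X : ∀ {x} → ⟨ β , x ⟩ ≡ 0# → ⟨ γ , x ⟩ ≡ 0# → X x)
        (type : IsTypeA₁×A₁ (Φ ∣ X ᗮ))
        (pair : ∀ {α} → α ∈ Φ → Span (β ∷ γ ∷ []) α → α ∈ β ∷ neg β ∷ γ ∷ neg γ ∷ []) where

        private
          β≢𝟎 : β ≢ 𝟎
          β≢𝟎 = root-≢𝟎 (⁺⇒root β∈)

          γ≢𝟎 : γ ≢ 𝟎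
          γ≢𝟎 = root-≢𝟎 (⁺⇒root γ∈)

          -- Otherwise X ᗮ is a line, which contains no two orthogonal roots.
          β≢γ : β ≢ γ
          β≢γ refl = from type
            where
            on-line : ∀ v → (X ᗮ) v → v ≡ (⟨ v , β ⟩ * ⟨ β , β ⟩ ⁻¹) · β
            on-line v h = ⟨⟩-ext λ z → combine₁ 1# (trans (sym (⟨⟩-⊕·ˡ v (- c) β z)) (trans (cong ⟨_, z ⟩ r≡𝟎) (⟨⟩-𝟎ˡ z)))
              (trans (cong (λ y → ⟨ v , z ⟩ - y) (⟨⟩-·ˡ c β z)) (solve 3 (λ v c b → v :- c :* b := :1 :* (v :+ :- c :* b :- :0)) refl ⟨ v , z ⟩ c ⟨ β , z ⟩))
              where
              c = ⟨ v , β ⟩ * ⟨ β , β ⟩ ⁻¹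
              r = v ⊕ (- c) · β
              r⊥β : ⟨ β , r ⟩ ≡ 0#
              r⊥β = trans (⟨⟩-⊕·ʳ β v (- c) β) (trans (cong (_+ - c * ⟨ β , β ⟩) (⟨⟩-sym β v)) (combine₁ (- ⟨ v , β ⟩) (⁻¹-inverseˡ (pos⇒≢0 (⟨⟩-pos β≢𝟎)))
                (solve 3 (λ v i b → v :+ :- (v :* i) :* b :- :0 := :- v :* (i :* b :- :1)) refl ⟨ v , β ⟩ (⟨ β , β ⟩ ⁻¹) ⟨ β , β ⟩)))
              r≡𝟎 : r ≡ 𝟎
              r≡𝟎 = ⟨⟩-definite (trans (⟨⟩-⊕·ˡ v (- c) β r) (trans (cong₂ (λ x y → x + - c * y) (h r (⇒X r⊥β r⊥β)) r⊥β) (solve 1 (λ c → :0 :+ :- c :* :0 := :0) refl c)))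
            from : IsTypeA₁×A₁ (Φ ∣ X ᗮ) → ⊥
            from (Γ₁ , Γ₂ , (a , a≢ , p₁) , (b , b≢ , p₂) , perm , orth) = *-≢0 (*-≢0 (nonzero-coefficient a≢ a∈) (nonzero-coefficient b≢ b∈)) (pos⇒≢0 (⟨⟩-pos β≢𝟎))
                (trans (sym ab) (orth a b (∈-resp-↭ (↭-sym p₁) (here refl)) (∈-resp-↭ (↭-sym p₂) (here refl))))
              where
              a∈ : (X ᗮ) a
              a∈ = proj₂ (∈-∣⁻ Φ (X ᗮ) (∈-resp-↭ (↭-sym perm) (∈-++⁺ˡ (∈-resp-↭ (↭-sym p₁) (here refl)))))
              b∈ : (X ᗮ) b
              b∈ = proj₂ (∈-∣⁻ Φ (X ᗮ) (∈-resp-↭ (↭-sym perm) (∈-++⁺ʳ Γ₁ (∈-resp-↭ (↭-sym p₂) (here refl)))))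
              nonzero-coefficient : ∀ {v} → v ≢ 𝟎 → (X ᗮ) v → ⟨ v , β ⟩ * ⟨ β , β ⟩ ⁻¹ ≢ 0#
              nonzero-coefficient {v} v≢ h e = v≢ (trans (on-line v h) (trans (cong (_· β) e) (0· β)))
              ab : ⟨ a , b ⟩ ≡ (⟨ a , β ⟩ * ⟨ β , β ⟩ ⁻¹) * (⟨ b , β ⟩ * ⟨ β , β ⟩ ⁻¹) * ⟨ β , β ⟩
              ab = trans (cong₂ ⟨_,_⟩ (on-line a a∈) (on-line b b∈)) (trans (⟨⟩-·ˡ ka β (kb · β)) (trans (cong (ka *_) (⟨⟩-·ʳ kb β β)) (sym (*-assoc ka kb ⟨ β , β ⟩))))
                where
                ka = ⟨ a , β ⟩ * ⟨ β , β ⟩ ⁻¹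
                kb = ⟨ b , β ⟩ * ⟨ β , β ⟩ ⁻¹

        -- The reflection of γ in β is again one of ±β, ±γ.
        orthogonal : ⟨ β , γ ⟩ ≡ 0#
        orthogonal = from (pair (closed β γ (⁺⇒root β∈) (⁺⇒root γ∈)) (Subspace.has-reflect (span-subspace (β ∷ γ ∷ [])) β γ (∈⇒Span (here refl)) (∈⇒Span (there (here refl)))))
          where
          back : ∀ {v} → reflect β γ ≡ v → γ ≡ reflect β v
          back e = trans (sym (reflect-involutive γ β≢𝟎)) (cong (reflect β) e)
          from : reflect β γ ∈ β ∷ neg β ∷ γ ∷ neg γ ∷ [] → ⟨ β , γ ⟩ ≡ 0#
          from (here e)                         = ⊥-elim (⁺-neg-⊥ β∈ (subst (_∈ Φ⁺) (trans (back e) (reflect-self β≢𝟎)) γ∈))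
          from (there (here e))                 = ⊥-elim (β≢γ (sym (trans (back e) (trans (reflect-neg β β) (trans (cong neg (reflect-self β≢𝟎)) (neg-involutive β))))))
          from (there (there (here e)))         = [ (λ c≡0 → zero-from c≡0) , (λ β≡𝟎 → ⊥-elim (pos⇒≢0 (⟨⟩-pos β≢𝟎) β≡𝟎)) ]′ (x*y≡0 moved)
            where
            moved : cartan β γ * ⟨ β , β ⟩ ≡ 0#
            moved = combine₁ (- 1#) (trans (sym (⟨,reflect⟩ β γ β)) (cong ⟨ β ,_⟩ e)) (solve 2 (λ g c → c :- :0 := :- :1 :* (g :- c :- g)) refl ⟨ β , γ ⟩ (cartan β γ * ⟨ β , β ⟩))
            zero-from : cartan β γ ≡ 0# → ⟨ β , γ ⟩ ≡ 0#
            zero-from c≡0 = *-cancelˡ (pos⇒≢0 0<2) (trans (sym (cartan-spec γ β≢𝟎)) (trans moved (sym (zeroʳ (fromℕ 2)))))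
          from (there (there (there (here e)))) = ⊥-elim ([ β≢γ ∘ sym , β≢-γ′ ]′ (parallel-roots (⁺⇒root γ∈) (⁺⇒root β∈) square))
            where
            β≢-γ′ : γ ≢ neg β
            β≢-γ′ e′ = ⁺-neg-⊥ β∈ (subst (_∈ Φ⁺) e′ γ∈)
            -- Here 2 γ is a multiple of β.
            twice : ∀ z → fromℕ 2 * ⟨ γ , z ⟩ ≡ cartan β γ * ⟨ β , z ⟩
            twice z = combine₁ 1# (trans (sym (⟨reflect,⟩ β γ z)) (trans (cong ⟨_, z ⟩ e) (⟨⟩-negˡ γ z))) (solve 2 (λ g c → :2 :* g :- c := :1 :* (g :- c :- :- g)) refl ⟨ γ , z ⟩ (cartan β γ * ⟨ β , z ⟩))
            square : ⟨ γ , β ⟩ * ⟨ γ , β ⟩ ≡ ⟨ γ , γ ⟩ * ⟨ β , β ⟩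
            square = *-cancelˡ (pos⇒≢0 0<2) (combine₂ ⟨ γ , β ⟩ (- ⟨ β , β ⟩) (twice β) (trans (twice γ) (cong (cartan β γ *_) (⟨⟩-sym β γ)))
              (solve 4 (λ g q c b → :2 :* (g :* g) :- :2 :* (q :* b) := g :* (:2 :* g :- c :* b) :+ :- b :* (:2 :* q :- c :* g)) refl ⟨ γ , β ⟩ ⟨ γ , γ ⟩ (cartan β γ) ⟨ β , β ⟩))

        pair-closed : ∀ {α} → α ∈ Φ⁺ → residual (β ∷ γ ∷ []) α ≡ 𝟎 → α ∈ β ∷ γ ∷ []
        pair-closed {α} α∈ e = from (pair (⁺⇒root α∈) (residual-⇐ S (β ∷ γ ∷ []) ∈⇒Span (subst (Span (β ∷ γ ∷ [])) (sym e) (Subspace.has-𝟎 S))))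
          where
          S = span-subspace (β ∷ γ ∷ [])
          from : α ∈ β ∷ neg β ∷ γ ∷ neg γ ∷ [] → α ∈ β ∷ γ ∷ []
          from (here e)                         = here e
          from (there (here refl))              = ⊥-elim (⁺-neg-⊥ β∈ α∈)
          from (there (there (here e)))         = there (here e)
          from (there (there (there (here refl)))) = ⊥-elim (⁺-neg-⊥ γ∈ α∈)

        -- The number `ℓ - 2` is the trace of the projection orthogonal to `β` and `γ`, hence a sum
        -- of squared lengths over the standard basis.
        2≤ℓ : 2 ℕ.≤ ℓ
        2≤ℓ = fromℕ-cancel-≤ (≤-by (∑-nonneg {xs = basis} λ {e} _ → ⟨⟩-nonneg (F.p e)) (begin
            fromℕ ℓ - fromℕ 2
              ≡⟨ cong₂ _-_ (trans (cong fromℕ (sym basis-length)) (trans (sym (∑-length basis)) (∑-cong {xs = basis} λ e∈ → sym (basis-unit e∈))))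
                   (sym (trans (cong₂ _+_ (part β≢𝟎) (part γ≢𝟎)) (solve 0 (:1 :+ :1 := :2) refl))) ⟩
            ∑ basis (λ e → ⟨ e , e ⟩) - (∑ basis (term β) + ∑ basis (term γ))
              ≡⟨ cong (λ s → ∑ basis (λ e → ⟨ e , e ⟩) - s) (∑-+ basis (term β) (term γ)) ⟨
            ∑ basis (λ e → ⟨ e , e ⟩) - ∑ basis (λ e → term β e + term γ e)
              ≡⟨ ∑-minus basis (λ e → ⟨ e , e ⟩) (λ e → term β e + term γ e) ⟨
            ∑ basis (λ e → ⟨ e , e ⟩ - (term β e + term γ e))
              ≡⟨ ∑-ext {xs = basis} (λ e → trans (cong (λ s → ⟨ e , e ⟩ - (term β e + s)) (sym (+-identityʳ (term γ e)))) (trans (sym (F.⟨p,⟩ e e)) (trans (F.p-adjoint e e) (trans (cong ⟨ e ,_⟩ (sym (F.p-idem e))) (sym (F.p-adjoint e (F.p e))))))) ⟩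
            ∑ basis (λ e → ⟨ F.p e , F.p e ⟩) ∎))
          where
          module F = Pair β∈ γ∈ orthogonal X X⇒ ⇒X pair-closed
          term : V → V → Carrier
          term b e = ⟨ e , b ⟩ * ⟨ b , b ⟩ ⁻¹ * ⟨ b , e ⟩
          part : ∀ {b} → b ≢ 𝟎 → ∑ basis (term b) ≡ 1#
          part {b} b≢ = trans (∑-ext {xs = basis} λ e → trans (cong (λ x → x * ⟨ b , b ⟩ ⁻¹ * ⟨ b , e ⟩) (⟨⟩-sym e b)) (solve 2 (λ x i → x :* i :* x := i :* (x :* x)) refl ⟨ b , e ⟩ (⟨ b , b ⟩ ⁻¹)))
            (trans (∑-*ˡ basis (⟨ b , b ⟩ ⁻¹) (λ e → ⟨ b , e ⟩ * ⟨ b , e ⟩)) (trans (cong (⟨ b , b ⟩ ⁻¹ *_) (parseval b b)) (⁻¹-inverseˡ (pos⇒≢0 (⟨⟩-pos b≢)))))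

        restriction-difference : ∀ {h} → IsCoxeterNumber Φ⁺ h →
          fromℕ (length (restriction (weylArrangement Φ⁺) (H β))) - fromℕ (length (restriction (weylArrangement Φ⁺) X)) ≡ fromℕ h / fromℕ 2 + 𝓚 Φ Φ⁺ γ β
        restriction-difference {h} cox = trans (Pair.difference β∈ γ∈ orthogonal X X⇒ ⇒X pair-closed (∑κ≡h/2 2≤ℓ cox β∈) (∑κ≡h/2 2≤ℓ cox γ∈))
          (cong (fromℕ h / fromℕ 2 +_) (sym (Components.𝓚≡correction β∈ γ∈ orthogonal X X⇒ ⇒X pair-closed)))

proposition3p13 :
  (em : ExcludedMiddle 0ℓ) (ℝ : RealNumbers) (ℓ : ℕ) →
  let open RealNumbers ℝ
      open Geometry em ℝ ℓ
  in
  (Φ Φ⁺ : List V) (h : ℕ) (β : Fin 2 → V) →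
  IsRootSystem Φ →
  Crystallographic Φ →
  Irreducible Φ →
  Spanning Φ →
  IsPositiveSystem Φ Φ⁺ →
  IsCoxeterNumber Φ⁺ h →
  (∀ i → β i ∈ Φ⁺) →
  let X = H (β 0F) ∩ H (β 1F)
      𝓐 = weylArrangement Φ⁺
  in
  IsTypeA₁×A₁ (Φ ∣ X ᗮ) →
  (∀ α → α ∈ Φ ∣ Span (β 0F ∷ β 1F ∷ []) ⇔ α ∈ (β 0F ∷ neg (β 0F) ∷ β 1F ∷ neg (β 1F) ∷ [])) →
  ∀ (i : Fin 2) →
  fromℕ (length (restriction 𝓐 (H (β i)))) - fromℕ (length (restriction 𝓐 X))
    ≡ fromℕ h / fromℕ 2 + 𝓚 Φ Φ⁺ (β (opposite i)) (β i)
proposition3p13 em ℝ ℓ Φ Φ⁺ h β rs crystallographic irr spanning ps cox β∈ type pair = λ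
  { 0F → P.restriction-difference (β∈ 0F) (β∈ 1F) X id _,_ type
           (λ {α} α∈ s → to α (E.∈-∣⁺ _ α∈ s)) cox
  ; 1F → P.restriction-difference (β∈ 1F) (β∈ 0F) X (λ (p , q) → q , p) (λ p q → q , p) type
           (λ {α} α∈ s → rotate (to α (E.∈-∣⁺ _ α∈ (swap-span s)))) cox
  }
  where
  module G = Geometry em ℝ ℓ
  module E = Theory em ℝ ℓ
  module P = E.Main.Differences.OrthogonalPair rs crystallographic spanning ps irr
  X : Pred G.V 0ℓ
  X = G.H (β 0F) ∩ G.H (β 1F)
  to = λ α → Equivalence.to (pair α)
  swap-span : ∀ {v} → G.Span (β 1F ∷ β 0F ∷ []) v → G.Span (β 0F ∷ β 1F ∷ []) v
  swap-span = E.Span-least (E.span-subspace _) λ { (here refl) → E.∈⇒Span (there (here refl)) ; (there (here refl)) → E.∈⇒Span (here refl) }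
  rotate : ∀ {v} → v ∈ (β 0F ∷ G.neg (β 0F) ∷ β 1F ∷ G.neg (β 1F) ∷ []) → v ∈ (β 1F ∷ G.neg (β 1F) ∷ β 0F ∷ G.neg (β 0F) ∷ [])
  rotate (here e)                         = there (there (here e))
  rotate (there (here e))                 = there (there (there (here e)))
  rotate (there (there (here e)))         = here e
  rotate (there (there (there (here e)))) = there (here e)
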